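{- Let $n\ge 1$, let $f\in\mathbb{Z}[x_1,\dots,x_n]$ be a polynomial of degree $d>1$, let $f_d$ be its homogeneous part of degree $d$, and let $s$ be the dimension of the critical locus of $f_d$ in $\mathbb{C}^n$. Suppose that for every $\varepsilon>0$ there is a constant $c=c(f,\varepsilon)$ such that $E_f(N,\xi)\le c\,N^{ -\frac{n-s}{d}+\varepsilon}$ for all integers $N\ge 1$ and all complex primitive $N$-th roots of unity $\xi$. Let $p$ be a prime number, let $T_0\in\mathbb{C}$ be a pole of the rational function $P_{f,p}(T)$, and let $t_0$ be the real part of a complex number $s_0$ with $p^{ -s_0}=T_0$. If $t_0>-(n-s)/d$, then $t_0=-1$, and hence $t_0$ is a zero of the Bernstein-Sato polynomial of $f$.
   Context: For an integer $N\ge 1$ and a complex primitive $N$-th root of unity $\xi$, put $$E_f(N,\xi):=\left|\frac{1}{N^n}\sum_{x\in(\mathbb{Z}/N\mathbb{Z})^n}\xi^{f(x)}\right|.$$ The critical locus of $f_d$ is the set of $x\in\mathbb{C}^n$ at which all partial derivatives $\partial f_d/\partial x_i$ vanish. For a prime $p$ and an integer $m\ge 0$ let $a_{p,m}$ be the number of solutions in $(\mathbb{Z}/p^m\mathbb{Z})^n$ of $f(x)\equiv 0\bmod p^m$, and put $$P_{f,p}(T):=\sum_{m\ge 0}\frac{a_{p,m}}{p^{mn}}T^m\in\mathbb{Q}[[T]].$$ By a theorem of Igusa, $P_{f,p}(T)$ is a rational function of $T$; its poles are those of this rational function. The Bernstein-Sato polynomial $b_f$ of $f$ is the monic polynomial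 $b(\sigma)\in\mathbb{C}[\sigma]$ of least degree for which there is a differential operator $D\in \mathbb{C}[x_1,\dots,x_n,\sigma]\langle\partial_{x_1},\dots,\partial_{x_n}\rangle$ with $D\cdot f^{\sigma+1}=b(\sigma)f^{\sigma}$. -}

module Defs where

open import Algebra.Bundles.Raw using (RawRing)
import Algebra.Definitions.RawSemiring as RawSemiringDefs
open import Data.Bool using (if_then_else_)
open import Data.Fin using (Fin; zero; suc; toℕ; inject₁)
open import Data.Integer as ℤ using (ℤ; +_; _%ℕ_)
import Data.Integer.Divisibility.Signed as ℤ
open import Data.List as List using (List; []; _∷_; _∷ʳ_; _++_; length; upTo; allFin)
open import Data.List.Relation.Unary.All using (All)
open import Data.Nat as ℕ using (ℕ; zero; suc; _!; NonZero; NonTrivial)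
open import Data.Nat.GeneralisedArithmetic using (fold)
import Data.Nat.Properties as ℕ
open import Data.Product using (∃-syntax; _×_; _,_; proj₁; proj₂)
open import Data.Rational as ℚ using (ℚ; 0ℚ; 1ℚ)
import Data.Rational.Properties as ℚ
open import Data.Rational.Solver using (module +-*-Solver)
open import Data.Sum using (_⊎_)
open import Data.Vec as Vec using (Vec; []; _∷_; lookup; replicate; updateAt)
import Data.Vec.Properties as Vec
open import Function using (_∘_)
open import Level using (0ℓ)
open import Relation.Binary.PropositionalEquality
  using (_≡_; _≢_; refl; sym; cong; trans; subst; module ≡-Reasoning)
open import Relation.Nullary using (¬_; does)

-- A real number is a Cauchy sequence of rationals; equality of reals is _≈ᵣ_.
IsCauchy : (ℕ → ℚ) → Set
IsCauchy x = ∀ ε → 0ℚ ℚ.< ε →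
  ∃[ N ] (∀ m n → N ℕ.≤ m → N ℕ.≤ n → ℚ.∣ x m ℚ.- x n ∣ ℚ.< ε)

record ℝ : Set where
  constructor mkℝ
  field
    seq    : ℕ → ℚ
    cauchy : IsCauchy seq

open ℝ

infix 4 _≈ᵣ_ _<ᵣ_ _≤ᵣ_

_≈ᵣ_ : ℝ → ℝ → Set
x ≈ᵣ y = ∀ ε → 0ℚ ℚ.< ε →
  ∃[ N ] (∀ n → N ℕ.≤ n → ℚ.∣ seq x n ℚ.- seq y n ∣ ℚ.< ε)

_<ᵣ_ : ℝ → ℝ → Set
x <ᵣ y = ∃[ ε ] 0ℚ ℚ.< ε × ∃[ N ] (∀ n → N ℕ.≤ n → seq x n ℚ.+ ε ℚ.< seq y n)

_≤ᵣ_ : ℝ → ℝ → Set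
x ≤ᵣ y = ¬ (y <ᵣ x)

private
  variable
    p q r s : ℚ

abstract
  ½ε : ℚ → ℚ
  ½ε ε = ε ℚ.* ℚ.½

  0<½ε : 0ℚ ℚ.< p → 0ℚ ℚ.< ½ε p
  0<½ε {p} 0<p = subst (ℚ._< ½ε p) (ℚ.*-zeroˡ ℚ.½) (ℚ.*-monoˡ-<-pos ℚ.½ 0<p)

  ½ε+½ε : ∀ ε → ½ε ε ℚ.+ ½ε ε ≡ ε
  ½ε+½ε ε = trans (sym (ℚ.*-distribˡ-+ ε ℚ.½ ℚ.½)) (ℚ.*-identityʳ ε)

  max-≤ : ∀ M N {m} → M ℕ.⊔ N ℕ.≤ m → M ℕ.≤ m × N ℕ.≤ m
  max-≤ M N le =
    ℕ.≤-trans (ℕ.m≤m⊔n M N) le , ℕ.≤-trans (ℕ.m≤n⊔m M N) le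

  cauchy-const : ∀ q → IsCauchy (λ _ → q)
  cauchy-const q ε 0<ε =
    0 , λ _ _ _ _ → subst (λ d → ℚ.∣ d ∣ ℚ.< ε) (sym (ℚ.+-inverseʳ q)) 0<ε

  cauchy-neg : ∀ {x} → IsCauchy x → IsCauchy (λ n → ℚ.- x n)
  cauchy-neg {x} cx ε 0<ε with cx ε 0<ε
  ... | N , h = N , λ m n le le′ →
    subst (ℚ._< ε)
      (trans (sym (ℚ.∣-p∣≡∣p∣ (x m ℚ.- x n))) (cong ℚ.∣_∣ (eq (x m) (x n))))
      (h m n le le′)
    where
    open +-*-Solver
    eq : ∀ a b → ℚ.- (a ℚ.- b) ≡ ℚ.- a ℚ.- ℚ.- b
    eq = solve 2 (λ a b → :- (a :- b) := :- a :- :- b) refl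

  cauchy-+ : ∀ {x y} → IsCauchy x → IsCauchy y → IsCauchy (λ n → x n ℚ.+ y n)
  cauchy-+ {x} {y} cx cy ε 0<ε with cx (½ε ε) (0<½ε 0<ε) | cy (½ε ε) (0<½ε 0<ε)
  ... | M , hx | N , hy = M ℕ.⊔ N , λ m n le le′ → begin-strict
    ℚ.∣ (x m ℚ.+ y m) ℚ.- (x n ℚ.+ y n) ∣
      ≡⟨ cong ℚ.∣_∣ (eq (x m) (y m) (x n) (y n)) ⟩
    ℚ.∣ (x m ℚ.- x n) ℚ.+ (y m ℚ.- y n) ∣
      ≤⟨ ℚ.∣p+q∣≤∣p∣+∣q∣ (x m ℚ.- x n) (y m ℚ.- y n) ⟩
    ℚ.∣ x m ℚ.- x n ∣ ℚ.+ ℚ.∣ y m ℚ.- y n ∣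
      <⟨ ℚ.+-mono-< (hx m n (proj₁ (max-≤ M N le)) (proj₁ (max-≤ M N le′)))
                    (hy m n (proj₂ (max-≤ M N le)) (proj₂ (max-≤ M N le′))) ⟩
    ½ε ε ℚ.+ ½ε ε
      ≡⟨ ½ε+½ε ε ⟩
    ε ∎
    where
    open ℚ.≤-Reasoning
    open +-*-Solver
    eq : ∀ a b c d → (a ℚ.+ b) ℚ.- (c ℚ.+ d) ≡ (a ℚ.- c) ℚ.+ (b ℚ.- d)
    eq = solve 4 (λ a b c d → (a :+ b) :- (c :+ d) := (a :- c) :+ (b :- d)) refl

  cauchy-bounded : ∀ {x} → IsCauchy x →
    ∃[ N ] ∃[ B ] 0ℚ ℚ.< B × (∀ n → N ℕ.≤ n → ℚ.∣ x n ∣ ℚ.< B)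
  cauchy-bounded {x} cx with cx 1ℚ (ℚ.positive⁻¹ 1ℚ)
  ... | N , h = N , 1ℚ ℚ.+ ℚ.∣ x N ∣
    , ℚ.+-mono-<-≤ (ℚ.positive⁻¹ 1ℚ) (ℚ.0≤∣p∣ (x N))
    , λ n le → begin-strict
    ℚ.∣ x n ∣
      ≡⟨ cong ℚ.∣_∣ (eq (x n) (x N)) ⟩
    ℚ.∣ (x n ℚ.- x N) ℚ.+ x N ∣
      ≤⟨ ℚ.∣p+q∣≤∣p∣+∣q∣ (x n ℚ.- x N) (x N) ⟩
    ℚ.∣ x n ℚ.- x N ∣ ℚ.+ ℚ.∣ x N ∣
      <⟨ ℚ.+-monoˡ-< ℚ.∣ x N ∣ (h n N le ℕ.≤-refl) ⟩
    1ℚ ℚ.+ ℚ.∣ x N ∣ ∎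
    where
    open ℚ.≤-Reasoning
    open +-*-Solver
    eq : ∀ a b → a ≡ (a ℚ.- b) ℚ.+ b
    eq = solve 2 (λ a b → a := (a :- b) :+ b) refl

  ∣∣*-< : 0ℚ ℚ.< p → ℚ.∣ q ∣ ℚ.< p → ℚ.∣ r ∣ ℚ.< s → ℚ.∣ q ℚ.* r ∣ ℚ.< p ℚ.* s
  ∣∣*-< {p} {q} {r} {s} 0<p q<p r<s = begin-strict
    ℚ.∣ q ℚ.* r ∣         ≡⟨ ℚ.∣p*q∣≡∣p∣*∣q∣ q r ⟩
    ℚ.∣ q ∣ ℚ.* ℚ.∣ r ∣   ≤⟨ ℚ.*-monoʳ-≤-nonNeg ℚ.∣ r ∣ {{ℚ.∣-∣-nonNeg r}} (ℚ.<⇒≤ q<p) ⟩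
    p ℚ.* ℚ.∣ r ∣         <⟨ ℚ.*-monoʳ-<-pos p {{ℚ.positive 0<p}} r<s ⟩
    p ℚ.* s               ∎
    where open ℚ.≤-Reasoning

  split-bound : ∀ {B C ε} → 0ℚ ℚ.< B → 0ℚ ℚ.< C → 0ℚ ℚ.< ε →
    ∃[ δ ] 0ℚ ℚ.< δ × B ℚ.* δ ℚ.+ C ℚ.* δ ≡ ε
  split-bound {B} {C} {ε} 0<B 0<C 0<ε =
    go (B ℚ.+ C) refl (ℚ.positive (ℚ.+-mono-< 0<B 0<C))
    where
    go : ∀ S → S ≡ B ℚ.+ C → ℚ.Positive S →
      ∃[ δ ] 0ℚ ℚ.< δ × B ℚ.* δ ℚ.+ C ℚ.* δ ≡ ε
    go S S≡B+C S-pos = ε ℚ.* i , 0<δ , (begin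
      B ℚ.* (ε ℚ.* i) ℚ.+ C ℚ.* (ε ℚ.* i) ≡⟨ ℚ.*-distribʳ-+ (ε ℚ.* i) B C ⟨
      (B ℚ.+ C) ℚ.* (ε ℚ.* i)             ≡⟨ cong (ℚ._* (ε ℚ.* i)) S≡B+C ⟨
      S ℚ.* (ε ℚ.* i)                     ≡⟨ cong (S ℚ.*_) (ℚ.*-comm ε i) ⟩
      S ℚ.* (i ℚ.* ε)                     ≡⟨ ℚ.*-assoc S i ε ⟨
      (S ℚ.* i) ℚ.* ε                     ≡⟨ cong (ℚ._* ε) (ℚ.*-inverseʳ S {{S≢0}}) ⟩
      1ℚ ℚ.* ε                            ≡⟨ ℚ.*-identityˡ ε ⟩
      ε                                   ∎)
      where
      open ≡-Reasoning
      S≢0 : ℚ.NonZero S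
      S≢0 = ℚ.pos⇒nonZero S {{S-pos}}
      i : ℚ
      i = ℚ.1/_ S {{S≢0}}
      0<δ : 0ℚ ℚ.< ε ℚ.* i
      0<δ = subst (ℚ._< ε ℚ.* i) (ℚ.*-zeroˡ i)
        (ℚ.*-monoˡ-<-pos i {{ℚ.1/pos⇒pos S {{S-pos}}}} 0<ε)

  ∣ab-cd∣-< : ∀ {B C δ ε} a b c d → B ℚ.* δ ℚ.+ C ℚ.* δ ≡ ε →
    0ℚ ℚ.< B → 0ℚ ℚ.< C →
    ℚ.∣ a ∣ ℚ.< B → ℚ.∣ b ℚ.- d ∣ ℚ.< δ → ℚ.∣ d ∣ ℚ.< C → ℚ.∣ a ℚ.- c ∣ ℚ.< δ →
    ℚ.∣ a ℚ.* b ℚ.- c ℚ.* d ∣ ℚ.< ε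
  ∣ab-cd∣-< {B} {C} {δ} {ε} a b c d Bδ+Cδ≡ε 0<B 0<C a<B b-d<δ d<C a-c<δ = begin-strict
    ℚ.∣ a ℚ.* b ℚ.- c ℚ.* d ∣
      ≡⟨ cong ℚ.∣_∣ (eq a b c d) ⟩
    ℚ.∣ a ℚ.* (b ℚ.- d) ℚ.+ d ℚ.* (a ℚ.- c) ∣
      ≤⟨ ℚ.∣p+q∣≤∣p∣+∣q∣ (a ℚ.* (b ℚ.- d)) (d ℚ.* (a ℚ.- c)) ⟩
    ℚ.∣ a ℚ.* (b ℚ.- d) ∣ ℚ.+ ℚ.∣ d ℚ.* (a ℚ.- c) ∣
      <⟨ ℚ.+-mono-< (∣∣*-< {q = a} {r = b ℚ.- d} 0<B a<B b-d<δ)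
                    (∣∣*-< {q = d} {r = a ℚ.- c} 0<C d<C a-c<δ) ⟩
    B ℚ.* δ ℚ.+ C ℚ.* δ
      ≡⟨ Bδ+Cδ≡ε ⟩
    ε ∎
    where
    open ℚ.≤-Reasoning
    open +-*-Solver
    eq : ∀ a b c d → a ℚ.* b ℚ.- c ℚ.* d ≡ a ℚ.* (b ℚ.- d) ℚ.+ d ℚ.* (a ℚ.- c)
    eq = solve 4 (λ a b c d → a :* b :- c :* d
                                := a :* (b :- d) :+ d :* (a :- c)) refl

  cauchy-* : ∀ {x y} → IsCauchy x → IsCauchy y → IsCauchy (λ n → x n ℚ.* y n)
  cauchy-* {x} {y} cx cy ε 0<ε =
    let K , B , 0<B , x<B = cauchy-bounded {x} cx
        L , C , 0<C , y<C = cauchy-bounded {y} cy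
        δ , 0<δ , Bδ+Cδ≡ε = split-bound {B} {C} {ε} 0<B 0<C 0<ε
        M , hx            = cx δ 0<δ
        N , hy            = cy δ 0<δ
    in (K ℕ.⊔ L) ℕ.⊔ (M ℕ.⊔ N) , λ m n le le′ →
      let KL≤m , MN≤m = max-≤ (K ℕ.⊔ L) (M ℕ.⊔ N) le
          KL≤n , MN≤n = max-≤ (K ℕ.⊔ L) (M ℕ.⊔ N) le′
          M≤m , N≤m   = max-≤ M N MN≤m
          M≤n , N≤n   = max-≤ M N MN≤n
      in ∣ab-cd∣-< {B} {C} {δ} {ε} (x m) (y m) (x n) (y n) Bδ+Cδ≡ε 0<B 0<C
           (x<B m (proj₁ (max-≤ K L KL≤m))) (hy m n N≤m N≤n)
           (y<C n (proj₂ (max-≤ K L KL≤n))) (hx m n M≤m M≤n)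

infixl 6 _+ᵣ_
infixl 7 _*ᵣ_
infix  8 -ᵣ_

_+ᵣ_ _*ᵣ_ : ℝ → ℝ → ℝ
x +ᵣ y = mkℝ (λ n → seq x n ℚ.+ seq y n)
             (cauchy-+ {seq x} {seq y} (cauchy x) (cauchy y))
x *ᵣ y = mkℝ (λ n → seq x n ℚ.* seq y n)
             (cauchy-* {seq x} {seq y} (cauchy x) (cauchy y))

-ᵣ_ : ℝ → ℝ
-ᵣ x = mkℝ (λ n → ℚ.- seq x n) (cauchy-neg {seq x} (cauchy x))

ℚ⇒ℝ : ℚ → ℝ
ℚ⇒ℝ q = mkℝ (λ _ → q) (cauchy-const q)

0ᵣ 1ᵣ : ℝ
0ᵣ = ℚ⇒ℝ 0ℚ
1ᵣ = ℚ⇒ℝ 1ℚ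

record ℂ : Set where
  constructor _+i_
  field
    re : ℝ
    im : ℝ

open ℂ public

infix 4 _≈_
_≈_ : ℂ → ℂ → Set
z ≈ w = re z ≈ᵣ re w × im z ≈ᵣ im w

ℝ⇒ℂ : ℝ → ℂ
ℝ⇒ℂ x = x +i 0ᵣ

ℚ⇒ℂ : ℚ → ℂ
ℚ⇒ℂ q = ℝ⇒ℂ (ℚ⇒ℝ q)

ℤ⇒ℂ : ℤ → ℂ
ℤ⇒ℂ k = ℚ⇒ℂ (k ℚ./ 1)

ℕ⇒ℂ : ℕ → ℂ
ℕ⇒ℂ k = ℤ⇒ℂ (+ k)

ℂ-rawRing : RawRing 0ℓ 0ℓ
ℂ-rawRing = record
  { Carrier = ℂ
  ; _≈_     = _≈_
  ; _+_     = λ z w → (re z +ᵣ re w) +i (im z +ᵣ im w)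
  ; _*_     = λ z w → (re z *ᵣ re w +ᵣ -ᵣ (im z *ᵣ im w))
                      +i (re z *ᵣ im w +ᵣ im z *ᵣ re w)
  ; -_      = λ z → (-ᵣ re z) +i (-ᵣ im z)
  ; 0#      = ℚ⇒ℂ 0ℚ
  ; 1#      = ℚ⇒ℂ 1ℚ
  }

open RawRing ℂ-rawRing public using (_+_; _*_; -_)
  renaming (0# to 0ℂ; 1# to 1ℂ)
open RawSemiringDefs (RawRing.rawSemiring ℂ-rawRing) public using (_^_)

∣_∣² : ℂ → ℝ
∣ z ∣² = re z *ᵣ re z +ᵣ im z *ᵣ im z

-- The graph of the modulus z ↦ |z|.
∣_∣≈_ : ℂ → ℝ → Set
∣ z ∣≈ r = 0ᵣ ≤ᵣ r × r *ᵣ r ≈ᵣ ∣ z ∣²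

∑ : List ℂ → ℂ
∑ = List.foldr _+_ 0ℂ

infix 4 _⟶_
_⟶_ : (ℕ → ℂ) → ℂ → Set
u ⟶ z = ∀ ε → 0ᵣ <ᵣ ε →
  ∃[ M ] (∀ m → M ℕ.≤ m → ∣ u m + - z ∣² <ᵣ ε *ᵣ ε)

expTerm : ℂ → ℕ → ℂ
expTerm z k = z ^ k * ℚ⇒ℂ (ℚ._/_ (+ 1) (k !) {{k ℕ.!≢0}})

-- The graph of the complex exponential function.
exp_≈_ : ℂ → ℂ → Set
exp z ≈ w = (λ m → ∑ (List.map (expTerm z) (upTo m))) ⟶ w

-- The graph of z ↦ a^z = exp (z log a) for a natural number a ≥ 1, where log a
-- is the real logarithm ℓ.
_^ℂ_≈_ : ℕ → ℂ → ℂ → Set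
a ^ℂ z ≈ w = ∃[ ℓ ] (exp ℝ⇒ℂ ℓ ≈ ℕ⇒ℂ a) × (exp (z * ℝ⇒ℂ ℓ) ≈ w)

-- The graph of the real power function r ↦ a^r.
_^ℝ_≈_ : ℕ → ℝ → ℝ → Set
a ^ℝ r ≈ y = a ^ℂ ℝ⇒ℂ r ≈ ℝ⇒ℂ y

IsPrimitiveRoot : ℕ → ℂ → Set
IsPrimitiveRoot N ξ =
  ξ ^ N ≈ 1ℂ × (∀ k → 0 ℕ.< k → k ℕ.< N → ¬ (ξ ^ k ≈ 1ℂ))

module Polynomial (R : RawRing 0ℓ 0ℓ) where
  private
    module R = RawRing R
    module P = RawSemiringDefs R.rawSemiring
    C = R.Carrier

  -- A finite sum of terms c x^α.  Exponents may be repeated and coefficients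
  -- may vanish, so polynomials are compared by _≋_ and inspected by coeff.
  Poly : ℕ → Set
  Poly n = List (C × Vec ℕ n)

  coeff : ∀ {n} → Poly n → Vec ℕ n → C
  coeff f α = List.foldr
    (λ (c , β) a → if does (Vec.≡-dec ℕ._≟_ β α) then c R.+ a else a) R.0# f

  infix 4 _≋_
  _≋_ : ∀ {n} → Poly n → Poly n → Set
  f ≋ g = ∀ α → coeff f α R.≈ coeff g α

  const : ∀ {n} → C → Poly n
  const c = (c , replicate _ 0) ∷ []

  var : ∀ {n} → Fin n → Poly n
  var i = (R.1# , updateAt (replicate _ 0) i (λ _ → 1)) ∷ []

  infixl 6 _⊕_
  infixl 7 _⊗_
  infixr 8 _↑_

  _⊕_ _⊗_ : ∀ {n} → Poly n → Poly n → Poly n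
  _⊕_ = _++_
  _⊗_ = List.cartesianProductWith
          (λ (c , α) (d , β) → c R.* d , Vec.zipWith ℕ._+_ α β)

  _↑_ : ∀ {n} → Poly n → ℕ → Poly n
  f ↑ zero  = const R.1#
  f ↑ suc k = f ⊗ f ↑ k

  ∂ : ∀ {n} → Fin n → Poly n → Poly n
  ∂ i = List.map (λ (c , α) → lookup α i P.× c , updateAt α i ℕ.pred)

  eval : ∀ {n} → Poly n → Vec C n → C
  eval f x = List.foldr (λ (c , α) a → c R.* monomial α R.+ a) R.0# f
    where
    monomial : Vec ℕ _ → C
    monomial α = Vec.foldr _ R._*_ R.1# (Vec.zipWith P._^_ x α)

module ℤX = Polynomial ℤ.+-*-rawRing
module ℂX = Polynomial ℂ-rawRing

totalDegree : ∀ {n} → Vec ℕ n → ℕ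
totalDegree = Vec.sum

HasDegree : ∀ {n} → ℤX.Poly n → ℕ → Set
HasDegree f d =
  (∃[ α ] totalDegree α ≡ d × ℤX.coeff f α ≢ + 0)
  × (∀ α → ℤX.coeff f α ≢ + 0 → totalDegree α ℕ.≤ d)

homogeneousPart : ∀ {n} → ℕ → ℤX.Poly n → ℤX.Poly n
homogeneousPart d = List.filter (λ (_ , α) → totalDegree α ℕ.≟ d)

toℂX : ∀ {n} → ℤX.Poly n → ℂX.Poly n
toℂX = List.map (λ (c , α) → ℤ⇒ℂ c , α)

-- A Zariski closed subset of ℂⁿ, given by a list of polynomials of which it is
-- the set of common zeros.
ClosedSet : ℕ → Set
ClosedSet n = List (ℂX.Poly n)

infix 4 _∈V_ _⊆V_
_∈V_ : ∀ {n} → Vec ℂ n → ClosedSet n → Set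
x ∈V Z = All (λ g → ℂX.eval g x ≈ 0ℂ) Z

_⊆V_ : ∀ {n} → ClosedSet n → ClosedSet n → Set
Y ⊆V Z = ∀ x → x ∈V Y → x ∈V Z

IsIrreducible : ∀ {n} → ClosedSet n → Set
IsIrreducible Z =
  (∃[ x ] x ∈V Z)
  × ¬ (∃[ A ] ∃[ B ] ¬ (Z ⊆V A) × ¬ (Z ⊆V B) × (∀ x → x ∈V Z → x ∈V A ⊎ x ∈V B))

record Chain {n} (Z : ClosedSet n) (k : ℕ) : Set where
  field
    link        : Fin (suc k) → ClosedSet n
    irreducible : ∀ i → IsIrreducible (link i)
    inside      : ∀ i → link i ⊆V Z
    increasing  : ∀ (i : Fin k) → link (inject₁ i) ⊆V link (suc i)
    strictly    : ∀ (i : Fin k) → ¬ (link (suc i) ⊆V link (inject₁ i))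

-- The Krull dimension: the greatest length of a strictly increasing chain of
-- irreducible closed subsets.
HasDimension : ∀ {n} → ClosedSet n → ℕ → Set
HasDimension Z s = Chain Z s × (∀ k → Chain Z k → k ℕ.≤ s)

criticalLocus : ∀ {n} → ℂX.Poly n → ClosedSet n
criticalLocus {n} g = List.map (λ i → ℂX.∂ i g) (allFin n)

-- (ℤ/N)ⁿ, a residue class being given by its representative in {0, …, N - 1}.
points : ∀ N n → List (Vec (Fin N) n)
points N zero    = [] ∷ []
points N (suc n) = List.cartesianProductWith _∷_ (allFin N) (points N n)

evalAt : ∀ {n N} → ℤX.Poly n → Vec (Fin N) n → ℤ
evalAt f x = ℤX.eval f (Vec.map (+_ ∘ toℕ) x)

1/[_^_] : (N n : ℕ) .{{_ : NonZero N}} → ℚ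
1/[ N ^ n ] = ℚ._/_ (+ 1) (N ℕ.^ n) {{ℕ.m^n≢0 N n}}

-- N⁻ⁿ Σₓ ξ^f(x); the exponent only matters modulo N when ξ^N = 1.
normalisedSum : ∀ {n} → ℤX.Poly n → (N : ℕ) .{{_ : NonZero N}} → ℂ → ℂ
normalisedSum {n} f N ξ =
  ℚ⇒ℂ 1/[ N ^ n ] * ∑ (List.map (λ x → ξ ^ (evalAt f x %ℕ N)) (points N n))

E[_,_,_]≈_ : ∀ {n} → ℤX.Poly n → (N : ℕ) .{{_ : NonZero N}} → ℂ → ℝ → Set
E[ f , N , ξ ]≈ e = ∣ normalisedSum f N ξ ∣≈ e

-- - (n - s) / d; the difference is taken in ℤ.
exponent : (n s d : ℕ) .{{_ : NonTrivial d}} → ℝ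
exponent n s d =
  ℚ⇒ℝ (ℚ._/_ (+ s ℤ.- + n) d {{ℕ.nonTrivial⇒nonZero d}})

solutionCount : ∀ {n} → ℤX.Poly n → (p m : ℕ) → ℕ
solutionCount {n} f p m =
  length (List.filter (λ x → + (p ℕ.^ m) ℤ.∣? evalAt f x) (points (p ℕ.^ m) n))

-- In what follows a list of complex numbers is a polynomial in one variable,
-- given by its coefficients from the constant term on.

PowerSeries : Set
PowerSeries = ℕ → ℂ

series : List ℂ → PowerSeries
series []       _       = 0ℂ
series (a ∷ as) zero    = a
series (a ∷ as) (suc m) = series as m

infixl 7 _·_
_·_ : List ℂ → PowerSeries → PowerSeries
([]       · P) _       = 0ℂ
((a ∷ as) · P) zero    = a * P zero
((a ∷ as) · P) (suc m) = a * P (suc m) + (as · P) m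

evalAtℂ : List ℂ → ℂ → ℂ
evalAtℂ as z = List.foldr (λ a b → a + z * b) 0ℂ as

-- P is a rational function B / A, with A vanishing at T₀ and B not; this is the
-- case for a fraction in lowest terms when T₀ is a zero of its denominator.
IsPole : PowerSeries → ℂ → Set
IsPole P T₀ = ∃[ A ] ∃[ B ]
  (∀ m → (A · P) m ≈ series B m)
  × evalAtℂ A T₀ ≈ 0ℂ
  × ¬ (evalAtℂ B T₀ ≈ 0ℂ)

poincaré : ∀ {n} → ℤX.Poly n → (p : ℕ) .{{_ : NonZero p}} → PowerSeries
poincaré {n} f p m =
  ℚ⇒ℂ ((+ solutionCount f p m ℚ./ 1) ℚ.* 1/[ p ^ m ℕ.* n ])

-- The variables of ℂX.Poly (suc n) are σ = x₀ and x₁, …, xₙ.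
module BernsteinSato {n : ℕ} (f : ℤX.Poly n) where
  open ℂX

  σ : Poly (suc n)
  σ = var zero

  fσ : Poly (suc n)
  fσ = List.map (λ (c , α) → c , 0 ∷ α) (toℂX f)

  inσ : List ℂ → Poly (suc n)
  inσ b = List.zipWith (λ c k → c , k ∷ replicate n 0) b (upTo (length b))

  -- g / f^k represents the element (g f⁻ᵏ) f^σ of ℂ[x, σ, f⁻¹] f^σ.
  record Element : Set where
    constructor _/f^_
    field
      numerator : Poly (suc n)
      power     : ℕ

  infix 4 _≅_
  _≅_ : Element → Element → Set
  (g /f^ k) ≅ (h /f^ l) = g ⊗ fσ ↑ l ≋ h ⊗ fσ ↑ k

  _+ₑ_ : Element → Element → Element
  (g /f^ k) +ₑ (h /f^ l) = (g ⊗ fσ ↑ l ⊕ h ⊗ fσ ↑ k) /f^ (k ℕ.+ l)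

  _*ₑ_ : Poly (suc n) → Element → Element
  h *ₑ (g /f^ k) = (h ⊗ g) /f^ k

  -- ∂ᵢ (g f^(σ-k)) = (f ∂ᵢg + (σ - k) g ∂ᵢf) f^(σ-k-1)
  ∂ₑ : Fin n → Element → Element
  ∂ₑ i (g /f^ k) =
    (fσ ⊗ ∂ (suc i) g ⊕ (σ ⊕ const (- ℕ⇒ℂ k)) ⊗ (g ⊗ ∂ (suc i) fσ)) /f^ suc k

  ∂ₑ^ : Vec ℕ n → Element → Element
  ∂ₑ^ β u = List.foldr (λ i v → fold v (∂ₑ i) (lookup β i)) u (allFin n)

  -- Σ h ∂^β: every element of ℂ[x, σ]⟨∂⟩ can be written with its coefficients on
  -- the left.
  DiffOp : Set
  DiffOp = List (Poly (suc n) × Vec ℕ n)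

  apply : DiffOp → Element → Element
  apply D u = List.foldr (λ (h , β) v → (h *ₑ ∂ₑ^ β u) +ₑ v) ([] /f^ 0) D

  -- D · f^(σ+1) = b(σ) f^σ for some D, where f^(σ+1) is the element f · f^σ.
  FunctionalEquation : List ℂ → Set
  FunctionalEquation b = ∃[ D ] apply D (fσ /f^ 0) ≅ (inσ b /f^ 0)

  IsMonic : List ℂ → Set
  IsMonic b = ∃[ as ] ∃[ a ] b ≡ as ∷ʳ a × a ≈ 1ℂ

  record IsBernsteinSato (b : List ℂ) : Set where
    field
      monic    : IsMonic b
      equation : FunctionalEquation b
      minimal  : ∀ b′ → IsMonic b′ → FunctionalEquation b′ → length b ℕ.≤ length b′

open BernsteinSato public using (IsBernsteinSato)

{-# OPTIONS --safe #-}
module Submission where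

{- Let r = -(n - s)/d and let Nₘ be the coefficient of Tᵐ in P(T).  By orthogonality of characters
   Nₘ - Nₘ₋₁/p is p⁻ᵐ times the sum of the normalised exponential sums over all primitive pᵐ-th roots
   of unity, so the hypothesis bounds it by c exp((r + ε) m log p).  If t₀ > r, take ε = (t₀ - r)/2:
   then (Nₘ - Nₘ₋₁/p) T₀ᵐ tends to 0.  Writing P = B/A, the partial sums at T₀ of A times (1 - T/p) P
   are eventually (1 - T₀/p) B(T₀), and they differ from A(T₀) = 0 times the partial sums of
   (1 - T/p) P by a null sequence.  So T₀ = p and t₀ = -1.

   At σ = -1 the functional equation reads D · 1 = b(-1) f⁻¹, so b(-1) = h f for a polynomial h, and
   b(-1) = 0 because f is not constant.

   Equality of Cauchy reals is stable under double negation, which admits classical case distinctions;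
   primitive roots of unity come from the zero of the cosine in (0, 2), found by trisection. -}

open import Defs
open import Algebra.Bundles using (CommutativeRing; RawRing)
import Algebra.Definitions.RawSemiring as RawSemiringDefs
import Algebra.Properties.Semiring.Exp as SemiringExp
import Algebra.Solver.Ring as RingSolver
import Algebra.Solver.Ring.AlmostCommutativeRing as ACR
open import Data.Bool using (if_then_else_; true; false)
open import Data.Empty using (⊥; ⊥-elim)
open import Data.Fin using (Fin; zero; suc; toℕ)
open import Data.Integer as ℤ using (ℤ; +_)
import Data.Integer.DivMod as ℤ
import Data.Integer.Divisibility.Signed as ℤ∣
import Data.Integer.Properties as ℤ
import Data.Integer.Solver as ℤSolver
open import Data.List as List using (List; []; _∷_; _++_; length; applyUpTo; upTo; allFin)
import Data.List.Properties as List
open import Data.Maybe using (Maybe; just; nothing)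
open import Data.Nat as ℕ using (ℕ; zero; suc; _≤_; _!; NonZero; NonTrivial)
import Data.Nat.DivMod as ℕ
import Data.Nat.Divisibility as ℕ∣
open import Data.Nat.GeneralisedArithmetic using (fold)
import Data.Nat.Primality as ℕ
open import Data.Nat.Primality using (Prime; prime⇒nonZero)
import Data.Nat.Properties as ℕ
open import Data.Product using (∃-syntax; Σ; _×_; _,_; proj₁; proj₂)
open import Data.Rational as ℚ using (ℚ; 0ℚ; 1ℚ)
import Data.Rational.Properties as ℚ
open import Data.Rational.Solver using (module +-*-Solver)
import Data.Rational.Unnormalised as ℚᵘ
import Data.Rational.Unnormalised.Properties as ℚᵘ
open import Data.Sum using (_⊎_; inj₁; inj₂; [_,_]′)
open import Data.Vec as Vec using (Vec; []; _∷_; lookup; replicate; updateAt; zipWith)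
import Data.Vec.Properties as Vec
open import Data.Vec.Relation.Binary.Pointwise.Inductive using (Pointwise; []; _∷_)
open import Level using (0ℓ)
open import Relation.Binary.Definitions using (Tri; tri<; tri≈; tri>)
open import Relation.Binary.PropositionalEquality
  using (_≡_; refl; sym; cong; cong₂; trans; subst; subst₂)
import Relation.Binary.Reasoning.Base.Triple as TripleReasoning
import Relation.Binary.Reasoning.Setoid as SetoidReasoning
open import Relation.Binary.Structures using (IsPreorder)
open import Relation.Nullary using (¬_; Dec; yes; no; does)
open import Relation.Unary using (Pred; Decidable)

-- Real numbers

-- The hypothesis brings a logarithm of N of its own for each N and ξ, and the pole brings a
-- logarithm of p. Injectivity of the real exponential makes them agree, log pᵐ = m log p. As T₀
-- fixes s₀ only up to a period, T₀ = p becomes t₀ = -1 by comparing moduli.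
--
-- Orthogonality is summed over the powers of one fixed primitive root, so such roots have to be
-- constructed. The sign of a real number cannot be decided, so cotransitivity of the order (x < y
-- gives x < z or z < y) replaces trichotomy, and moduli enter only as upper bounds.
--
-- Elements of the Bernstein-Sato module are fractions g/fᵏ compared by cross-multiplication, so σ =
-- -1 yields b(-1) f^K = h f^(K+1) for some K. Cancelling f^K needs a leading coefficient. Vanishing
-- of complex numbers is undecidable, so one is found only up to double negation, which suffices for
-- the stable goal b(-1) = 0; Kronecker's substitution reduces several variables to one, where the
-- leading coefficient is a single number.

module ℚLinear where

  diff>0 : ∀ {a b} → a ℚ.< b → 0ℚ ℚ.< b ℚ.- a
  diff>0 {a} {b} a<b = subst (ℚ._< b ℚ.- a) (ℚ.+-inverseʳ a) (ℚ.+-monoˡ-< (ℚ.- a) a<b)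

  -- Linear arithmetic by certificate: b - a is written as a sum of quantities known to be positive,
  -- and the ring solver checks the identity.
  from-diff : ∀ {a b u} → 0ℚ ℚ.< u → u ≡ b ℚ.- a → a ℚ.< b
  from-diff {a} {b} 0<u refl = subst₂ ℚ._<_ (ℚ.+-identityˡ a) (eq a b) (ℚ.+-monoˡ-< a 0<u)
    where
    open +-*-Solver
    eq : ∀ a b → b ℚ.- a ℚ.+ a ≡ b
    eq = solve 2 (λ a b → b :- a :+ a := b) refl

  infixl 6 _⊹_
  _⊹_ : ∀ {a b} → 0ℚ ℚ.< a → 0ℚ ℚ.< b → 0ℚ ℚ.< a ℚ.+ b
  _⊹_ = ℚ.+-mono-<

  diff≥0 : ∀ {a b} → a ℚ.≤ b → 0ℚ ℚ.≤ b ℚ.- a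
  diff≥0 {a} {b} a≤b = subst (ℚ._≤ b ℚ.- a) (ℚ.+-inverseʳ a) (ℚ.+-monoˡ-≤ (ℚ.- a) a≤b)

  infixl 6 _⊹≤_
  _⊹≤_ : ∀ {a b} → 0ℚ ℚ.< a → 0ℚ ℚ.≤ b → 0ℚ ℚ.< a ℚ.+ b
  _⊹≤_ = ℚ.+-mono-<-≤

  *-pos : ∀ {a b} → 0ℚ ℚ.< a → 0ℚ ℚ.< b → 0ℚ ℚ.< a ℚ.* b
  *-pos {a} {b} 0<a 0<b = subst (ℚ._< a ℚ.* b) (ℚ.*-zeroˡ b) (ℚ.*-monoˡ-<-pos b {{ℚ.positive 0<b}} 0<a)

  p≤∣p∣ : ∀ p → p ℚ.≤ ℚ.∣ p ∣
  p≤∣p∣ p with ℚ.∣p∣≡p∨∣p∣≡-p p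
  ... | inj₁ e = ℚ.≤-reflexive (sym e)
  ... | inj₂ e = ℚ.≤-trans
    (subst (ℚ._≤ 0ℚ) (solve 1 (λ p → :- (:- p) := p) refl p) (ℚ.neg-antimono-≤ (subst (0ℚ ℚ.≤_) e (ℚ.0≤∣p∣ p))))
    (ℚ.0≤∣p∣ p)
    where open +-*-Solver

  <∣∣⇒< : ∀ {a b ε} → ℚ.∣ a ℚ.- b ∣ ℚ.< ε → a ℚ.< b ℚ.+ ε
  <∣∣⇒< {a} {b} {ε} h = from-diff (diff>0 (ℚ.≤-<-trans (p≤∣p∣ (a ℚ.- b)) h)) (eq a b ε)
    where
    open +-*-Solver
    eq : ∀ a b ε → ε ℚ.- (a ℚ.- b) ≡ (b ℚ.+ ε) ℚ.- a
    eq = solve 3 (λ a b ε → ε :- (a :- b) := (b :+ ε) :- a) refl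

  <⇒<∣∣ : ∀ {a b ε} → a ℚ.< b ℚ.+ ε → b ℚ.< a ℚ.+ ε → ℚ.∣ a ℚ.- b ∣ ℚ.< ε
  <⇒<∣∣ {a} {b} {ε} h k with ℚ.∣p∣≡p∨∣p∣≡-p (a ℚ.- b)
  ... | inj₁ e = subst (ℚ._< ε) (sym e) (from-diff (diff>0 h) (eq a b ε))
    where
    open +-*-Solver
    eq : ∀ a b ε → (b ℚ.+ ε) ℚ.- a ≡ ε ℚ.- (a ℚ.- b)
    eq = solve 3 (λ a b ε → (b :+ ε) :- a := ε :- (a :- b)) refl
  ... | inj₂ e = subst (ℚ._< ε) (sym e) (from-diff (diff>0 k) (eq a b ε))
    where
    open +-*-Solver
    eq : ∀ a b ε → (a ℚ.+ ε) ℚ.- b ≡ ε ℚ.- (ℚ.- (a ℚ.- b))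
    eq = solve 3 (λ a b ε → (a :+ ε) :- b := ε :- (:- (a :- b))) refl

  ∣∣-sym : ∀ a b {ε} → ℚ.∣ a ℚ.- b ∣ ℚ.< ε → ℚ.∣ b ℚ.- a ∣ ℚ.< ε
  ∣∣-sym a b {ε} = subst (ℚ._< ε) (trans (sym (ℚ.∣-p∣≡∣p∣ (a ℚ.- b))) (cong ℚ.∣_∣ (eq a b)))
    where
    open +-*-Solver
    eq : ∀ a b → ℚ.- (a ℚ.- b) ≡ b ℚ.- a
    eq = solve 2 (λ a b → :- (a :- b) := b :- a) refl

  -- Below, six parts δ of ε pay for two Cauchy errors, a comparison threshold of 3δ and one δ of
  -- margin.
  sixth : ℚ
  sixth = + 1 ℚ./ 6

  0<sixth : ∀ {ε} → 0ℚ ℚ.< ε → 0ℚ ℚ.< ε ℚ.* sixth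
  0<sixth 0<ε = *-pos 0<ε (ℚ.positive⁻¹ sixth)

open ℚLinear

open ℝ

infix  4 _≃ʳ_ _<ʳ_ _≤ʳ_
infixl 6 _+ʳ_
infixl 7 _*ʳ_
infix  8 -ʳ_

-- Opaque, so that terms do not unfold to sequences of rationals.
opaque
  _≃ʳ_ _<ʳ_ _≤ʳ_ : ℝ → ℝ → Set
  _≃ʳ_ = _≈ᵣ_
  _<ʳ_ = _<ᵣ_
  _≤ʳ_ = _≤ᵣ_

  _+ʳ_ _*ʳ_ : ℝ → ℝ → ℝ
  _+ʳ_ = _+ᵣ_
  _*ʳ_ = _*ᵣ_

  -ʳ_ : ℝ → ℝ
  -ʳ_ = -ᵣ_

  ⟨_⟩ : ℚ → ℝ
  ⟨_⟩ = ℚ⇒ℝ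

0ʳ 1ʳ : ℝ
0ʳ = ⟨ 0ℚ ⟩
1ʳ = ⟨ 1ℚ ⟩

opaque
  unfolding _≃ʳ_

  approx : ∀ (x : ℝ) ε → 0ℚ ℚ.< ε →
    ∃[ N ] (∀ m n → N ℕ.≤ m → N ℕ.≤ n → seq x m ℚ.< seq x n ℚ.+ ε)
  approx x ε 0<ε = let N , h = cauchy x ε 0<ε in
    N , λ m n N≤m N≤n → <∣∣⇒< (h m n N≤m N≤n)

  pointwise : ∀ {x y} → (∀ n → seq x n ≡ seq y n) → x ≃ʳ y
  pointwise {x} {y} h ε 0<ε = 0 , λ n _ →
    subst (λ d → ℚ.∣ d ∣ ℚ.< ε) (sym (trans (cong (ℚ._- seq y n) (h n)) (ℚ.+-inverseʳ (seq y n)))) 0<ε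

  ≃ʳ-refl : ∀ {x} → x ≃ʳ x
  ≃ʳ-refl {x} = pointwise {x} {x} λ _ → refl

  ≃ʳ-sym : ∀ {x y} → x ≃ʳ y → y ≃ʳ x
  ≃ʳ-sym {x} {y} h ε 0<ε = let N , k = h ε 0<ε in
    N , λ n N≤n → ∣∣-sym (seq x n) (seq y n) (k n N≤n)

  <ʳ-asym : ∀ {x y} → x <ʳ y → y <ʳ x → ⊥
  <ʳ-asym {x} {y} (ε , 0<ε , M , h) (δ , 0<δ , N , k) =
    ℚ.<-asym (lem 0<ε (h n (ℕ.m≤m⊔n M N))) (lem 0<δ (k n (ℕ.m≤n⊔m M N)))
    where
    n : ℕ
    n = M ℕ.⊔ N
    lem : ∀ {ε a b} → 0ℚ ℚ.< ε → a ℚ.+ ε ℚ.< b → a ℚ.< b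
    lem {ε} {a} {b} 0<ε h = from-diff (diff>0 h ⊹ 0<ε) (eq a b ε)
      where
      open +-*-Solver
      eq : ∀ a b ε → b ℚ.- (a ℚ.+ ε) ℚ.+ ε ≡ b ℚ.- a
      eq = solve 3 (λ a b ε → b :- (a :+ ε) :+ ε := b :- a) refl

  ≃ʳ⇒≮ : ∀ {x y} → x ≃ʳ y → ¬ x <ʳ y
  ≃ʳ⇒≮ {x} {y} h (ε , 0<ε , M , k) = let N , h′ = h ε 0<ε ; n = M ℕ.⊔ N in
    ℚ.<-asym (<∣∣⇒< (∣∣-sym (seq x n) (seq y n) (h′ n (ℕ.m≤n⊔m M N)))) (k n (ℕ.m≤m⊔n M N))

  -- The constructive substitute for trichotomy: at an index K beyond all moduli of convergence,
  -- comparing the rationals z_K and x_K + 3δ is decidable, and either outcome persists with margin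
  -- δ.
  <ʳ-cotrans : ∀ {x y} → x <ʳ y → ∀ z → x <ʳ z ⊎ z <ʳ y
  <ʳ-cotrans {x} {y} (ε , 0<ε , M , h) z = go (seq x K ℚ.+ (δ ℚ.+ δ ℚ.+ δ) ℚ.≤? seq z K)
    where
    δ : ℚ
    δ = ε ℚ.* sixth
    0<δ : 0ℚ ℚ.< δ
    0<δ = 0<sixth 0<ε
    X : ∃[ N ] (∀ m n → N ℕ.≤ m → N ℕ.≤ n → seq x m ℚ.< seq x n ℚ.+ δ)
    X = approx x δ 0<δ
    Y : ∃[ N ] (∀ m n → N ℕ.≤ m → N ℕ.≤ n → seq y m ℚ.< seq y n ℚ.+ δ)
    Y = approx y δ 0<δ
    Z : ∃[ N ] (∀ m n → N ℕ.≤ m → N ℕ.≤ n → seq z m ℚ.< seq z n ℚ.+ δ)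
    Z = approx z δ 0<δ
    K : ℕ
    K = (M ℕ.⊔ proj₁ X) ℕ.⊔ (proj₁ Y ℕ.⊔ proj₁ Z)
    kM : M ℕ.≤ K
    kM = ℕ.≤-trans (ℕ.m≤m⊔n M _) (ℕ.m≤m⊔n _ _)
    kX : proj₁ X ℕ.≤ K
    kX = ℕ.≤-trans (ℕ.m≤n⊔m M _) (ℕ.m≤m⊔n _ _)
    kY : proj₁ Y ℕ.≤ K
    kY = ℕ.≤-trans (ℕ.m≤m⊔n _ (proj₁ Z)) (ℕ.m≤n⊔m (M ℕ.⊔ proj₁ X) _)
    kZ : proj₁ Z ℕ.≤ K
    kZ = ℕ.≤-trans (ℕ.m≤n⊔m (proj₁ Y) (proj₁ Z)) (ℕ.m≤n⊔m (M ℕ.⊔ proj₁ X) _)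
    open +-*-Solver
    eq₁ : ∀ xn xK zn zK δ →
      ((xK ℚ.+ δ ℚ.- xn) ℚ.+ (zn ℚ.+ δ ℚ.- zK)) ℚ.+ (zK ℚ.- (xK ℚ.+ (δ ℚ.+ δ ℚ.+ δ))) ≡ zn ℚ.- (xn ℚ.+ δ)
    eq₁ = solve 5 (λ xn xK zn zK δ →
      ((xK :+ δ :- xn) :+ (zn :+ δ :- zK)) :+ (zK :- (xK :+ (δ :+ δ :+ δ))) := zn :- (xn :+ δ)) refl
    eq₂ : ∀ zn zK xK yK yn ε → (let δ = ε ℚ.* sixth in
      (zK ℚ.+ δ ℚ.- zn) ℚ.+ (yn ℚ.+ δ ℚ.- yK) ℚ.+ (yK ℚ.- (xK ℚ.+ ε)) ℚ.+ (xK ℚ.+ (δ ℚ.+ δ ℚ.+ δ) ℚ.- zK)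
        ≡ yn ℚ.- (zn ℚ.+ δ))
    eq₂ = solve 6 (λ zn zK xK yK yn ε → (let δ = ε :* con sixth in
      (zK :+ δ :- zn) :+ (yn :+ δ :- yK) :+ (yK :- (xK :+ ε)) :+ (xK :+ (δ :+ δ :+ δ) :- zK)
        := yn :- (zn :+ δ))) refl
    go : Dec (seq x K ℚ.+ (δ ℚ.+ δ ℚ.+ δ) ℚ.≤ seq z K) → x <ᵣ z ⊎ z <ᵣ y
    go (yes p) = inj₁ (δ , 0<δ , K , λ n K≤n → from-diff
      ((diff>0 (proj₂ X n K (ℕ.≤-trans kX K≤n) kX) ⊹ diff>0 (proj₂ Z K n kZ (ℕ.≤-trans kZ K≤n))) ⊹≤ diff≥0 p)
      (eq₁ (seq x n) (seq x K) (seq z n) (seq z K) δ))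
    go (no p) = inj₂ (δ , 0<δ , K , λ n K≤n → from-diff
      (diff>0 (proj₂ Z n K (ℕ.≤-trans kZ K≤n) kZ) ⊹ diff>0 (proj₂ Y K n kY (ℕ.≤-trans kY K≤n))
        ⊹ diff>0 (h K kM) ⊹ diff>0 (ℚ.≰⇒> p))
      (eq₂ (seq z n) (seq z K) (seq x K) (seq y K) (seq y n) ε))

  -- If x and y differed by 3δ or more at the late index K, the gap would persist and give a strict
  -- inequality. Equality thereby amounts to two negations, which is why it is stable under double
  -- negation.
  <ʳ-tight : ∀ {x y} → ¬ x <ʳ y → ¬ y <ʳ x → x ≃ʳ y
  <ʳ-tight {x} {y} x≮y y≮x ε 0<ε = K , λ n K≤n →
      <⇒<∣∣ (half x y kx′ ky′ y≮x n K≤n (kx′ n K≤n) (ky′ n K≤n)) (half y x ky′ kx′ x≮y n K≤n (ky′ n K≤n) (kx′ n K≤n))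
    where
    δ : ℚ
    δ = ε ℚ.* sixth
    0<δ : 0ℚ ℚ.< δ
    0<δ = 0<sixth 0<ε
    X : ∃[ N ] (∀ m n → N ℕ.≤ m → N ℕ.≤ n → seq x m ℚ.< seq x n ℚ.+ δ)
    X = approx x δ 0<δ
    Y : ∃[ N ] (∀ m n → N ℕ.≤ m → N ℕ.≤ n → seq y m ℚ.< seq y n ℚ.+ δ)
    Y = approx y δ 0<δ
    K : ℕ
    K = proj₁ X ℕ.⊔ proj₁ Y
    Near : ℝ → ℕ → Set
    Near x n = seq x n ℚ.< seq x K ℚ.+ δ × seq x K ℚ.< seq x n ℚ.+ δ
    kx′ : ∀ n → K ℕ.≤ n → Near x n
    kx′ n K≤n = let k = ℕ.m≤m⊔n (proj₁ X) (proj₁ Y) ; k′ = ℕ.≤-trans k K≤n in proj₂ X n K k′ k , proj₂ X K n k k′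
    ky′ : ∀ n → K ℕ.≤ n → Near y n
    ky′ n K≤n = let k = ℕ.m≤n⊔m (proj₁ X) (proj₁ Y) ; k′ = ℕ.≤-trans k K≤n in proj₂ Y n K k′ k , proj₂ Y K n k k′
    open +-*-Solver
    eq₁ : ∀ xn xK yn yK δ →
      ((xn ℚ.+ δ ℚ.- xK) ℚ.+ (yK ℚ.+ δ ℚ.- yn)) ℚ.+ (xK ℚ.- (yK ℚ.+ (δ ℚ.+ δ ℚ.+ δ))) ≡ xn ℚ.- (yn ℚ.+ δ)
    eq₁ = solve 5 (λ xn xK yn yK δ →
      ((xn :+ δ :- xK) :+ (yK :+ δ :- yn)) :+ (xK :- (yK :+ (δ :+ δ :+ δ))) := xn :- (yn :+ δ)) refl
    eq₂ : ∀ xn xK yn yK ε → (let δ = ε ℚ.* sixth in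
      (xK ℚ.+ δ ℚ.- xn) ℚ.+ (yn ℚ.+ δ ℚ.- yK) ℚ.+ (yK ℚ.+ (δ ℚ.+ δ ℚ.+ δ) ℚ.- xK) ℚ.+ δ ≡ yn ℚ.+ ε ℚ.- xn)
    eq₂ = solve 5 (λ xn xK yn yK ε → (let δ = ε :* con sixth in
      (xK :+ δ :- xn) :+ (yn :+ δ :- yK) :+ (yK :+ (δ :+ δ :+ δ) :- xK) :+ δ := yn :+ ε :- xn)) refl
    half : ∀ x y → (∀ n → K ℕ.≤ n → Near x n) → (∀ n → K ℕ.≤ n → Near y n) → ¬ y <ᵣ x →
      ∀ n → K ℕ.≤ n → Near x n → Near y n → seq x n ℚ.< seq y n ℚ.+ ε
    half x y kx′ ky′ y≮x n K≤n (xn , _) (_ , yn) with seq y K ℚ.+ (δ ℚ.+ δ ℚ.+ δ) ℚ.≤? seq x K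
    ... | yes p = ⊥-elim (y≮x (δ , 0<δ , K , λ m K≤m → from-diff
      ((diff>0 (proj₂ (kx′ m K≤m)) ⊹ diff>0 (proj₁ (ky′ m K≤m))) ⊹≤ diff≥0 p)
      (eq₁ (seq x m) (seq x K) (seq y m) (seq y K) δ)))
    ... | no p = from-diff (diff>0 xn ⊹ diff>0 yn ⊹ diff>0 (ℚ.≰⇒> p) ⊹ 0<δ)
      (eq₂ (seq x n) (seq x K) (seq y n) (seq y K) ε)

  +ʳ-monoˡ-< : ∀ {x y} z → x <ʳ y → x +ʳ z <ʳ y +ʳ z
  +ʳ-monoˡ-< {x} {y} z (ε , 0<ε , M , h) = ε , 0<ε , M , λ n M≤n →
    from-diff (diff>0 (h n M≤n)) (eq (seq x n) (seq y n) (seq z n) ε)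
    where
    open +-*-Solver
    eq : ∀ x y z ε → y ℚ.- (x ℚ.+ ε) ≡ y ℚ.+ z ℚ.- (x ℚ.+ z ℚ.+ ε)
    eq = solve 4 (λ x y z ε → y :- (x :+ ε) := y :+ z :- (x :+ z :+ ε)) refl

  *ʳ-pos : ∀ {x y} → 0ʳ <ʳ x → 0ʳ <ʳ y → 0ʳ <ʳ x *ʳ y
  *ʳ-pos {x} {y} (ε , 0<ε , M , h) (δ , 0<δ , N , k) =
    ε ℚ.* δ , *-pos 0<ε 0<δ , M ℕ.⊔ N , λ n le →
      let 0<a = diff>0 (h n (ℕ.≤-trans (ℕ.m≤m⊔n M N) le))
          0<b = diff>0 (k n (ℕ.≤-trans (ℕ.m≤n⊔m M N) le))
      in from-diff (*-pos 0<a 0<b ⊹ *-pos 0<a 0<δ ⊹ *-pos 0<ε 0<b) (eq (seq x n) (seq y n) ε δ)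
    where
    open +-*-Solver
    eq : ∀ x y ε δ → (let a = x ℚ.- (0ℚ ℚ.+ ε) ; b = y ℚ.- (0ℚ ℚ.+ δ) in
      a ℚ.* b ℚ.+ a ℚ.* δ ℚ.+ ε ℚ.* b ≡ x ℚ.* y ℚ.- (0ℚ ℚ.+ ε ℚ.* δ))
    eq = solve 4 (λ x y ε δ → (let a = x :- (con 0ℚ :+ ε) ; b = y :- (con 0ℚ :+ δ) in
      a :* b :+ a :* δ :+ ε :* b := x :* y :- (con 0ℚ :+ ε :* δ))) refl

  ⟨⟩-mono-< : ∀ {p q} → p ℚ.< q → ⟨ p ⟩ <ʳ ⟨ q ⟩
  ⟨⟩-mono-< {p} {q} p<q = (q ℚ.- p) ℚ.* ℚ.½ , 0<h , 0 , λ _ _ → from-diff 0<h (eq p q)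
    where
    0<h : 0ℚ ℚ.< (q ℚ.- p) ℚ.* ℚ.½
    0<h = *-pos (diff>0 p<q) (ℚ.positive⁻¹ ℚ.½)
    open +-*-Solver
    eq : ∀ p q → (q ℚ.- p) ℚ.* ℚ.½ ≡ q ℚ.- (p ℚ.+ (q ℚ.- p) ℚ.* ℚ.½)
    eq = solve 2 (λ p q → (q :- p) :* con ℚ.½ := q :- (p :+ (q :- p) :* con ℚ.½)) refl

  ⟨⟩-cancel-< : ∀ {p q} → ⟨ p ⟩ <ʳ ⟨ q ⟩ → p ℚ.< q
  ⟨⟩-cancel-< {p} {q} (ε , 0<ε , M , h) = from-diff (diff>0 (h M ℕ.≤-refl) ⊹ 0<ε) (eq p q ε)
    where
    open +-*-Solver
    eq : ∀ p q ε → q ℚ.- (p ℚ.+ ε) ℚ.+ ε ≡ q ℚ.- p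
    eq = solve 3 (λ p q ε → q :- (p :+ ε) :+ ε := q :- p) refl

  rational-above : ∀ x → ∃[ q ] x <ʳ ⟨ q ⟩
  rational-above x = let N , h = approx x 1ℚ (ℚ.positive⁻¹ 1ℚ) in
    seq x N ℚ.+ 1ℚ ℚ.+ 1ℚ , 1ℚ , ℚ.positive⁻¹ 1ℚ , N , λ n N≤n →
      ℚ.+-monoˡ-< 1ℚ (h n N N≤n ℕ.≤-refl)

  rational-below : ∀ {x} → 0ʳ <ʳ x → ∃[ q ] 0ℚ ℚ.< q × ⟨ q ⟩ <ʳ x
  rational-below {x} (ε , 0<ε , M , h) = ε ℚ.* ℚ.½ , 0<h , ε ℚ.* ℚ.½ , 0<h , M , λ n M≤n →
    lem ε (seq x n) (h n M≤n)
    where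
    0<h : 0ℚ ℚ.< ε ℚ.* ℚ.½
    0<h = *-pos 0<ε (ℚ.positive⁻¹ ℚ.½)
    lem : ∀ ε x → 0ℚ ℚ.+ ε ℚ.< x → ε ℚ.* ℚ.½ ℚ.+ ε ℚ.* ℚ.½ ℚ.< x
    lem ε x = subst (ℚ._< x) (eq ε)
      where
      open +-*-Solver
      eq : ∀ ε → 0ℚ ℚ.+ ε ≡ ε ℚ.* ℚ.½ ℚ.+ ε ℚ.* ℚ.½
      eq = solve 1 (λ ε → con 0ℚ :+ ε := ε :* con ℚ.½ :+ ε :* con ℚ.½) refl

  eventually-< : ∀ {x} q → (∃[ N ] (∀ n → N ℕ.≤ n → seq x n ℚ.< q)) → ¬ ⟨ q ⟩ <ʳ x
  eventually-< {x} q (N , h) (ε , 0<ε , M , k) =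
    ℚ.<-asym (h (M ℕ.⊔ N) (ℕ.m≤n⊔m M N))
      (from-diff (diff>0 (k (M ℕ.⊔ N) (ℕ.m≤m⊔n M N)) ⊹ 0<ε) (eq q (seq x (M ℕ.⊔ N)) ε))
    where
    open +-*-Solver
    eq : ∀ p q ε → q ℚ.- (p ℚ.+ ε) ℚ.+ ε ≡ q ℚ.- p
    eq = solve 3 (λ p q ε → q :- (p :+ ε) :+ ε := q :- p) refl

  eventually-> : ∀ {x} q → (∃[ N ] (∀ n → N ℕ.≤ n → q ℚ.< seq x n)) → ¬ x <ʳ ⟨ q ⟩
  eventually-> {x} q (N , h) (ε , 0<ε , M , k) =
    ℚ.<-asym (h (M ℕ.⊔ N) (ℕ.m≤n⊔m M N))
      (from-diff (diff>0 (k (M ℕ.⊔ N) (ℕ.m≤m⊔n M N)) ⊹ 0<ε) (eq (seq x (M ℕ.⊔ N)) q ε))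
    where
    open +-*-Solver
    eq : ∀ p q ε → q ℚ.- (p ℚ.+ ε) ℚ.+ ε ≡ q ℚ.- p
    eq = solve 3 (λ p q ε → q :- (p :+ ε) :+ ε := q :- p) refl

  ⟨⟩-+ : ∀ p q → ⟨ p ℚ.+ q ⟩ ≃ʳ ⟨ p ⟩ +ʳ ⟨ q ⟩
  ⟨⟩-+ p q = pointwise {⟨ p ℚ.+ q ⟩} {⟨ p ⟩ +ʳ ⟨ q ⟩} λ _ → refl

  ⟨⟩-* : ∀ p q → ⟨ p ℚ.* q ⟩ ≃ʳ ⟨ p ⟩ *ʳ ⟨ q ⟩
  ⟨⟩-* p q = pointwise {⟨ p ℚ.* q ⟩} {⟨ p ⟩ *ʳ ⟨ q ⟩} λ _ → refl

  ⟨⟩-neg : ∀ p → ⟨ ℚ.- p ⟩ ≃ʳ -ʳ ⟨ p ⟩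
  ⟨⟩-neg p = pointwise {⟨ ℚ.- p ⟩} { -ʳ ⟨ p ⟩} λ _ → refl

  ≮⇒≥ : ∀ {x y} → ¬ x <ʳ y → y ≤ʳ x
  ≮⇒≥ h = h

  ≤⇒≯ : ∀ {x y} → x ≤ʳ y → ¬ y <ʳ x
  ≤⇒≯ h = h

  *ʳ-cong : ∀ {x x′ y y′} → x ≃ʳ x′ → y ≃ʳ y′ → x *ʳ y ≃ʳ x′ *ʳ y′
  *ʳ-cong {x} {x′} {y} {y′} x≃x′ y≃y′ ε 0<ε =
    let K , B , 0<B , x<B = cauchy-bounded {seq x} (cauchy x)
        L , C , 0<C , y<C = cauchy-bounded {seq y′} (cauchy y′)
        δ , 0<δ , Bδ+Cδ≡ε = split-bound {B} {C} {ε} 0<B 0<C 0<ε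
        M , hx            = x≃x′ δ 0<δ
        N , hy            = y≃y′ δ 0<δ
    in (K ℕ.⊔ L) ℕ.⊔ (M ℕ.⊔ N) , λ n le →
      let KL≤n , MN≤n = max-≤ (K ℕ.⊔ L) (M ℕ.⊔ N) le
          K≤n , L≤n   = max-≤ K L KL≤n
          M≤n , N≤n   = max-≤ M N MN≤n
      in ∣ab-cd∣-< {B} {C} {δ} {ε} (seq x n) (seq y n) (seq x′ n) (seq y′ n) Bδ+Cδ≡ε 0<B 0<C
           (x<B n K≤n) (hy n N≤n) (y<C n L≤n) (hx n M≤n)

  +ʳ-comm : ∀ x y → x +ʳ y ≃ʳ y +ʳ x
  +ʳ-comm x y = pointwise {x +ʳ y} {y +ʳ x} λ n → ℚ.+-comm (seq x n) (seq y n)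

  +ʳ-assoc : ∀ x y z → x +ʳ y +ʳ z ≃ʳ x +ʳ (y +ʳ z)
  +ʳ-assoc x y z = pointwise {x +ʳ y +ʳ z} {x +ʳ (y +ʳ z)} λ n → ℚ.+-assoc (seq x n) (seq y n) (seq z n)

  +ʳ-identityˡ : ∀ x → 0ʳ +ʳ x ≃ʳ x
  +ʳ-identityˡ x = pointwise {0ʳ +ʳ x} {x} λ n → ℚ.+-identityˡ (seq x n)

  -ʳ-inverseˡ : ∀ x → -ʳ x +ʳ x ≃ʳ 0ʳ
  -ʳ-inverseˡ x = pointwise { -ʳ x +ʳ x} {0ʳ} λ n → ℚ.+-inverseˡ (seq x n)

  *ʳ-comm : ∀ x y → x *ʳ y ≃ʳ y *ʳ x
  *ʳ-comm x y = pointwise {x *ʳ y} {y *ʳ x} λ n → ℚ.*-comm (seq x n) (seq y n)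

  *ʳ-assoc : ∀ x y z → x *ʳ y *ʳ z ≃ʳ x *ʳ (y *ʳ z)
  *ʳ-assoc x y z = pointwise {x *ʳ y *ʳ z} {x *ʳ (y *ʳ z)} λ n → ℚ.*-assoc (seq x n) (seq y n) (seq z n)

  *ʳ-identityˡ : ∀ x → 1ʳ *ʳ x ≃ʳ x
  *ʳ-identityˡ x = pointwise {1ʳ *ʳ x} {x} λ n → ℚ.*-identityˡ (seq x n)

  *ʳ-distribˡ-+ʳ : ∀ x y z → x *ʳ (y +ʳ z) ≃ʳ x *ʳ y +ʳ x *ʳ z
  *ʳ-distribˡ-+ʳ x y z = pointwise {x *ʳ (y +ʳ z)} {x *ʳ y +ʳ x *ʳ z} λ n →
    ℚ.*-distribˡ-+ (seq x n) (seq y n) (seq z n)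

  +ʳ-cancel : ∀ x z → x +ʳ z +ʳ -ʳ z ≃ʳ x
  +ʳ-cancel x z = pointwise {x +ʳ z +ʳ -ʳ z} {x} λ n →
    solve 2 (λ x z → x :+ z :- z := x) refl (seq x n) (seq z n)
    where open +-*-Solver

-- Splitting x < y at x′ leaves one branch that contradicts the hypothesis. The later transitivity
-- lemmas reuse this pattern in place of epsilons.
<ʳ-respˡ : ∀ {x x′ y} → x ≃ʳ x′ → x <ʳ y → x′ <ʳ y
<ʳ-respˡ {x′ = x′} x≃x′ x<y with <ʳ-cotrans x<y x′
... | inj₁ x<x′ = ⊥-elim (≃ʳ⇒≮ x≃x′ x<x′)
... | inj₂ x′<y = x′<y

<ʳ-respʳ : ∀ {x y y′} → y ≃ʳ y′ → x <ʳ y → x <ʳ y′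
<ʳ-respʳ {y′ = y′} y≃y′ x<y with <ʳ-cotrans x<y y′
... | inj₁ x<y′ = x<y′
... | inj₂ y′<y = ⊥-elim (≃ʳ⇒≮ (≃ʳ-sym y≃y′) y′<y)

≃ʳ-trans : ∀ {x y z} → x ≃ʳ y → y ≃ʳ z → x ≃ʳ z
≃ʳ-trans {x} {y} {z} x≃y y≃z = <ʳ-tight
  (λ x<z → [ ≃ʳ⇒≮ x≃y , ≃ʳ⇒≮ y≃z ]′ (<ʳ-cotrans x<z y))
  (λ z<x → [ ≃ʳ⇒≮ (≃ʳ-sym y≃z) , ≃ʳ⇒≮ (≃ʳ-sym x≃y) ]′ (<ʳ-cotrans z<x y))

≃ʳ-stable : ∀ {x y} → ¬ ¬ x ≃ʳ y → x ≃ʳ y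
≃ʳ-stable h = <ʳ-tight (λ x<y → h λ x≃y → ≃ʳ⇒≮ x≃y x<y) (λ y<x → h λ x≃y → ≃ʳ⇒≮ (≃ʳ-sym x≃y) y<x)

+ʳ-congʳ : ∀ {x y} z → x ≃ʳ y → x +ʳ z ≃ʳ y +ʳ z
+ʳ-congʳ {x} {y} z x≃y = <ʳ-tight (reflect x≃y) (reflect (≃ʳ-sym x≃y))
  where
  reflect : ∀ {x y} → x ≃ʳ y → ¬ (x +ʳ z <ʳ y +ʳ z)
  reflect {x} {y} x≃y h = ≃ʳ⇒≮ x≃y
    (<ʳ-respˡ (+ʳ-cancel x z) (<ʳ-respʳ (+ʳ-cancel y z) (+ʳ-monoˡ-< (-ʳ z) h)))

+ʳ-cong : ∀ {x x′ y y′} → x ≃ʳ x′ → y ≃ʳ y′ → x +ʳ y ≃ʳ x′ +ʳ y′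
+ʳ-cong {x} {x′} {y} {y′} x≃x′ y≃y′ = ≃ʳ-trans (+ʳ-congʳ y x≃x′)
  (≃ʳ-trans (+ʳ-comm x′ y) (≃ʳ-trans (+ʳ-congʳ x′ y≃y′) (+ʳ-comm y′ x′)))

-ʳ-cong : ∀ {x y} → x ≃ʳ y → -ʳ x ≃ʳ -ʳ y
-ʳ-cong {x} {y} x≃y = ≃ʳ-trans (≃ʳ-sym (identityʳ (-ʳ x)))
  (≃ʳ-trans (+ʳ-cong ≃ʳ-refl (≃ʳ-sym (≃ʳ-trans (+ʳ-congʳ (-ʳ y) x≃y) (inverseʳ y))))
  (≃ʳ-trans (≃ʳ-sym (+ʳ-assoc (-ʳ x) x (-ʳ y)))
  (≃ʳ-trans (+ʳ-congʳ (-ʳ y) (-ʳ-inverseˡ x)) (+ʳ-identityˡ (-ʳ y)))))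
  where
  identityʳ : ∀ x → x +ʳ 0ʳ ≃ʳ x
  identityʳ x = ≃ʳ-trans (+ʳ-comm x 0ʳ) (+ʳ-identityˡ x)
  inverseʳ : ∀ x → x +ʳ -ʳ x ≃ʳ 0ʳ
  inverseʳ x = ≃ʳ-trans (+ʳ-comm x (-ʳ x)) (-ʳ-inverseˡ x)

ℝ-commutativeRing : CommutativeRing 0ℓ 0ℓ
ℝ-commutativeRing = record
  { Carrier = ℝ ; _≈_ = _≃ʳ_ ; _+_ = _+ʳ_ ; _*_ = _*ʳ_ ; -_ = -ʳ_ ; 0# = 0ʳ ; 1# = 1ʳ
  ; isCommutativeRing = record
    { isRing = record
      { +-isAbelianGroup = record
        { isGroup = record
          { isMonoid = record
            { isSemigroup = record
              { isMagma = record
                { isEquivalence = record { refl = ≃ʳ-refl ; sym = ≃ʳ-sym ; trans = ≃ʳ-trans }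
                ; ∙-cong = +ʳ-cong }
              ; assoc = +ʳ-assoc }
            ; identity = comm∧idˡ⇒id +ʳ-comm +ʳ-identityˡ }
          ; inverse = -ʳ-inverseˡ , λ x → ≃ʳ-trans (+ʳ-comm x (-ʳ x)) (-ʳ-inverseˡ x)
          ; ⁻¹-cong = -ʳ-cong }
        ; comm = +ʳ-comm }
      ; *-cong = *ʳ-cong
      ; *-assoc = *ʳ-assoc
      ; *-identity = comm∧idˡ⇒id *ʳ-comm *ʳ-identityˡ
      ; distrib = *ʳ-distribˡ-+ʳ , λ x y z → ≃ʳ-trans (*ʳ-comm (y +ʳ z) x)
          (≃ʳ-trans (*ʳ-distribˡ-+ʳ x y z) (+ʳ-cong (*ʳ-comm x y) (*ʳ-comm x z))) }
    ; *-comm = *ʳ-comm } }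
  where
  comm∧idˡ⇒id : ∀ {_∙_ : ℝ → ℝ → ℝ} {e} → (∀ x y → (x ∙ y) ≃ʳ (y ∙ x)) → (∀ x → (e ∙ x) ≃ʳ x) →
    (∀ x → (e ∙ x) ≃ʳ x) × (∀ x → (x ∙ e) ≃ʳ x)
  comm∧idˡ⇒id {e = e} comm idˡ = idˡ , λ x → ≃ʳ-trans (comm x e) (idˡ x)

open CommutativeRing ℝ-commutativeRing public using ()
  renaming (-‿inverseʳ to -ʳ-inverseʳ; +-identityʳ to +ʳ-identityʳ)

ℚ-rawRing : RawRing 0ℓ 0ℓ
ℚ-rawRing = ℚ.+-*-rawRing

ℚ⟶ℝ : ℚ-rawRing ACR.-Raw-AlmostCommutative⟶ ACR.fromCommutativeRing ℝ-commutativeRing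
ℚ⟶ℝ = record
  { ⟦_⟧ = ⟨_⟩ ; +-homo = ⟨⟩-+ ; *-homo = ⟨⟩-* ; -‿homo = ⟨⟩-neg ; 0-homo = ≃ʳ-refl ; 1-homo = ≃ʳ-refl }

⟨⟩-cong : ∀ {p q} → p ≡ q → ⟨ p ⟩ ≃ʳ ⟨ q ⟩
⟨⟩-cong refl = ≃ʳ-refl

≟-coeff : ∀ {A : ℚ → ℚ → Set} → (∀ {p q} → p ≡ q → A p q) → ∀ p q → Maybe (A p q)
≟-coeff f p q with p ℚ.≟ q
... | yes p≡q = just (f p≡q)
... | no _    = nothing

module ℝ-Solver = RingSolver ℚ-rawRing (ACR.fromCommutativeRing ℝ-commutativeRing) ℚ⟶ℝ (≟-coeff ⟨⟩-cong)

open SemiringExp (CommutativeRing.semiring ℝ-commutativeRing) using ()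
  renaming (_^_ to _^ʳ_; ^-homo-* to ^ʳ-homo-*)

≤ʳ-refl : ∀ {x} → x ≤ʳ x
≤ʳ-refl = ≮⇒≥ λ x<x → <ʳ-asym x<x x<x

≤ʳ-reflexive : ∀ {x y} → x ≃ʳ y → x ≤ʳ y
≤ʳ-reflexive x≃y = ≮⇒≥ (≃ʳ⇒≮ (≃ʳ-sym x≃y))

<⇒≤ʳ : ∀ {x y} → x <ʳ y → x ≤ʳ y
<⇒≤ʳ x<y = ≮⇒≥ (<ʳ-asym x<y)

≤ʳ-antisym : ∀ {x y} → x ≤ʳ y → y ≤ʳ x → x ≃ʳ y
≤ʳ-antisym x≤y y≤x = <ʳ-tight (≤⇒≯ y≤x) (≤⇒≯ x≤y)

<-≤ʳ-trans : ∀ {x y z} → x <ʳ y → y ≤ʳ z → x <ʳ z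
<-≤ʳ-trans {z = z} x<y y≤z with <ʳ-cotrans x<y z
... | inj₁ x<z = x<z
... | inj₂ z<y = ⊥-elim (≤⇒≯ y≤z z<y)

≤-<ʳ-trans : ∀ {x y z} → x ≤ʳ y → y <ʳ z → x <ʳ z
≤-<ʳ-trans {x = x} x≤y y<z with <ʳ-cotrans y<z x
... | inj₁ y<x = ⊥-elim (≤⇒≯ x≤y y<x)
... | inj₂ x<z = x<z

<ʳ-trans : ∀ {x y z} → x <ʳ y → y <ʳ z → x <ʳ z
<ʳ-trans x<y y<z = <-≤ʳ-trans x<y (<⇒≤ʳ y<z)

≤ʳ-trans : ∀ {x y z} → x ≤ʳ y → y ≤ʳ z → x ≤ʳ z
≤ʳ-trans x≤y y≤z = ≮⇒≥ λ z<x → ≤⇒≯ x≤y (≤-<ʳ-trans y≤z z<x)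

≤ʳ-isPreorder : IsPreorder _≃ʳ_ _≤ʳ_
≤ʳ-isPreorder = record
  { isEquivalence = CommutativeRing.isEquivalence ℝ-commutativeRing
  ; reflexive = ≤ʳ-reflexive
  ; trans = ≤ʳ-trans }

module ≤ʳ-Reasoning = TripleReasoning {_≈_ = _≃ʳ_} {_≤_ = _≤ʳ_} {_<_ = _<ʳ_}
  ≤ʳ-isPreorder <ʳ-asym <ʳ-trans (<ʳ-respʳ , <ʳ-respˡ) <⇒≤ʳ <-≤ʳ-trans ≤-<ʳ-trans

module ≃ʳ-Reasoning = SetoidReasoning (CommutativeRing.setoid ℝ-commutativeRing)

+ʳ-mono-< : ∀ {x y u v} → x <ʳ y → u <ʳ v → x +ʳ u <ʳ y +ʳ v
+ʳ-mono-< {x} {y} {u} {v} x<y u<v = <ʳ-trans (+ʳ-monoˡ-< u x<y)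
  (<ʳ-respˡ (+ʳ-comm u y) (<ʳ-respʳ (+ʳ-comm v y) (+ʳ-monoˡ-< y u<v)))

+ʳ-cancelˡ-< : ∀ {x y} z → x +ʳ z <ʳ y +ʳ z → x <ʳ y
+ʳ-cancelˡ-< {x} {y} z h = <ʳ-respˡ (+ʳ-cancel x z) (<ʳ-respʳ (+ʳ-cancel y z) (+ʳ-monoˡ-< (-ʳ z) h))

+ʳ-monoˡ-≤ : ∀ {x y} z → x ≤ʳ y → x +ʳ z ≤ʳ y +ʳ z
+ʳ-monoˡ-≤ z x≤y = ≮⇒≥ λ h → ≤⇒≯ x≤y (+ʳ-cancelˡ-< z h)

+ʳ-monoʳ-≤ : ∀ {x y} z → x ≤ʳ y → z +ʳ x ≤ʳ z +ʳ y
+ʳ-monoʳ-≤ {x} {y} z x≤y =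
  ≤ʳ-trans (≤ʳ-reflexive (+ʳ-comm z x)) (≤ʳ-trans (+ʳ-monoˡ-≤ z x≤y) (≤ʳ-reflexive (+ʳ-comm y z)))

+ʳ-mono-≤ : ∀ {x y u v} → x ≤ʳ y → u ≤ʳ v → x +ʳ u ≤ʳ y +ʳ v
+ʳ-mono-≤ {y = y} {u} x≤y u≤v = ≤ʳ-trans (+ʳ-monoˡ-≤ u x≤y) (+ʳ-monoʳ-≤ y u≤v)

+ʳ-nonNeg : ∀ {x y} → 0ʳ ≤ʳ x → 0ʳ ≤ʳ y → 0ʳ ≤ʳ x +ʳ y
+ʳ-nonNeg p q = ≤ʳ-trans (≤ʳ-reflexive (≃ʳ-sym (+ʳ-identityˡ 0ʳ))) (+ʳ-mono-≤ p q)

module _ where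
  open ℝ-Solver

  diff-posʳ : ∀ {x y} → x <ʳ y → 0ʳ <ʳ y +ʳ -ʳ x
  diff-posʳ {x} {y} x<y =
    <ʳ-respˡ (solve 1 (λ x → x :- x := con 0ℚ) ≃ʳ-refl x) (+ʳ-monoˡ-< (-ʳ x) x<y)

  diff-nonNegʳ : ∀ {x y} → x ≤ʳ y → 0ʳ ≤ʳ y +ʳ -ʳ x
  diff-nonNegʳ {x} {y} x≤y =
    ≤ʳ-trans (≤ʳ-reflexive (solve 1 (λ x → con 0ℚ := x :- x) ≃ʳ-refl x)) (+ʳ-monoˡ-≤ (-ʳ x) x≤y)

  -- The counterpart of `from-diff` over the reals: the difference is supplied as a positive
  -- expression and the solver verifies it.
  <-by : ∀ {x y u} → 0ʳ <ʳ u → x +ʳ u ≃ʳ y → x <ʳ y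
  <-by {x} {u = u} 0<u e = <ʳ-respʳ e (<ʳ-respˡ (+ʳ-identityˡ x) (<ʳ-respʳ (+ʳ-comm u x) (+ʳ-monoˡ-< x 0<u)))

  ≤-by : ∀ {x y u} → 0ʳ ≤ʳ u → x +ʳ u ≃ʳ y → x ≤ʳ y
  ≤-by {x} {u = u} 0≤u e = ≤ʳ-trans (≤ʳ-reflexive (solve 1 (λ x → x := x :+ con 0ℚ) ≃ʳ-refl x))
    (≤ʳ-trans (+ʳ-monoʳ-≤ x 0≤u) (≤ʳ-reflexive e))

  neg-pos : ∀ {x} → x <ʳ 0ʳ → 0ʳ <ʳ -ʳ x
  neg-pos {x} x<0 = <ʳ-respʳ (+ʳ-identityˡ (-ʳ x)) (diff-posʳ x<0)

  *ʳ-zeroʳ : ∀ x → x *ʳ 0ʳ ≃ʳ 0ʳ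
  *ʳ-zeroʳ = CommutativeRing.zeroʳ ℝ-commutativeRing

  *ʳ-zeroˡ : ∀ x → 0ʳ *ʳ x ≃ʳ 0ʳ
  *ʳ-zeroˡ = CommutativeRing.zeroˡ ℝ-commutativeRing

  -- Since `≤ʳ` is a negation, a negative product may be assumed. Positivity of both factors is then
  -- refuted in turn, and a nonnegative factor that is not positive is zero.
  *ʳ-nonNeg : ∀ {x y} → 0ʳ ≤ʳ x → 0ʳ ≤ʳ y → 0ʳ ≤ʳ x *ʳ y
  *ʳ-nonNeg {x} {y} 0≤x 0≤y = ≮⇒≥ λ xy<0 →
    let x≮0 : ¬ 0ʳ <ʳ x
        x≮0 0<x = let y≮0 : ¬ 0ʳ <ʳ y
                      y≮0 0<y = <ʳ-asym xy<0 (*ʳ-pos 0<x 0<y)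
                  in ≃ʳ⇒≮ (≃ʳ-trans (*ʳ-cong ≃ʳ-refl (≤ʳ-antisym (≮⇒≥ y≮0) 0≤y)) (*ʳ-zeroʳ x)) xy<0
    in ≃ʳ⇒≮ (≃ʳ-trans (*ʳ-cong (≤ʳ-antisym (≮⇒≥ x≮0) 0≤x) ≃ʳ-refl) (*ʳ-zeroˡ y)) xy<0

  square-nonNeg : ∀ x → 0ʳ ≤ʳ x *ʳ x
  square-nonNeg x = ≮⇒≥ λ xx<0 →
    let x≤0 : ¬ 0ʳ <ʳ x
        x≤0 0<x = <ʳ-asym xx<0 (*ʳ-pos 0<x 0<x)
        0≤x : ¬ x <ʳ 0ʳ
        0≤x x<0 = <ʳ-asym xx<0 (<ʳ-respʳ (solve 1 (λ x → (:- x) :* (:- x) := x :* x) ≃ʳ-refl x)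
                                 (*ʳ-pos (neg-pos x<0) (neg-pos x<0)))
    in ≃ʳ⇒≮ (≃ʳ-trans (*ʳ-cong (<ʳ-tight 0≤x x≤0) ≃ʳ-refl) (*ʳ-zeroˡ x)) xx<0

  *ʳ-monoʳ-≤ : ∀ {x y} z → 0ʳ ≤ʳ z → x ≤ʳ y → z *ʳ x ≤ʳ z *ʳ y
  *ʳ-monoʳ-≤ {x} {y} z 0≤z x≤y = ≤-by (*ʳ-nonNeg 0≤z (diff-nonNegʳ x≤y))
    (solve 3 (λ x y z → z :* x :+ z :* (y :- x) := z :* y) ≃ʳ-refl x y z)

  *ʳ-monoˡ-≤ : ∀ {x y} z → 0ʳ ≤ʳ z → x ≤ʳ y → x *ʳ z ≤ʳ y *ʳ z
  *ʳ-monoˡ-≤ {x} {y} z 0≤z x≤y = ≤-by (*ʳ-nonNeg 0≤z (diff-nonNegʳ x≤y))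
    (solve 3 (λ x y z → x :* z :+ z :* (y :- x) := y :* z) ≃ʳ-refl x y z)

  *ʳ-mono-≤ : ∀ {x y u v} → 0ʳ ≤ʳ x → 0ʳ ≤ʳ v → x ≤ʳ y → u ≤ʳ v → x *ʳ u ≤ʳ y *ʳ v
  *ʳ-mono-≤ {x} {y} {u} {v} 0≤x 0≤v x≤y u≤v = ≤ʳ-trans (*ʳ-monoʳ-≤ x 0≤x u≤v) (*ʳ-monoˡ-≤ v 0≤v x≤y)

  *ʳ-monoʳ-< : ∀ {x y} z → 0ʳ <ʳ z → x <ʳ y → z *ʳ x <ʳ z *ʳ y
  *ʳ-monoʳ-< {x} {y} z 0<z x<y = <-by (*ʳ-pos 0<z (diff-posʳ x<y))
    (solve 3 (λ x y z → z :* x :+ z :* (y :- x) := z :* y) ≃ʳ-refl x y z)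

  square-cancel-≤ : ∀ {a b} → 0ʳ ≤ʳ b → a *ʳ a ≤ʳ b *ʳ b → a ≤ʳ b
  square-cancel-≤ {a} {b} 0≤b aa≤bb = ≮⇒≥ λ b<a → ≤⇒≯ aa≤bb
    (<-by (*ʳ-pos (diff-posʳ b<a) (<-≤ʳ-trans (≤-<ʳ-trans 0≤b b<a)
             (≤-by 0≤b (+ʳ-comm a b))))
      (solve 2 (λ a b → b :* b :+ (a :- b) :* (b :+ a) := a :* a) ≃ʳ-refl a b))

  *ʳ-cancel-0 : ∀ {x y} → x *ʳ y ≃ʳ 0ʳ → 0ʳ <ʳ y → x ≃ʳ 0ʳ
  *ʳ-cancel-0 {x} {y} xy≃0 0<y = <ʳ-tight
    (λ x<0 → ≃ʳ⇒≮ xy≃0 (<-by (*ʳ-pos (neg-pos x<0) 0<y)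
      (solve 2 (λ x y → x :* y :+ (:- x) :* y := con 0ℚ) ≃ʳ-refl x y)))
    (λ 0<x → ≃ʳ⇒≮ (≃ʳ-sym xy≃0) (*ʳ-pos 0<x 0<y))

⟨⟩-mono-≤ : ∀ {p q} → p ℚ.≤ q → ⟨ p ⟩ ≤ʳ ⟨ q ⟩
⟨⟩-mono-≤ p≤q = ≮⇒≥ λ h → ℚ.<-irrefl refl (ℚ.<-≤-trans (⟨⟩-cancel-< h) p≤q)

0<1ʳ : 0ʳ <ʳ 1ʳ
0<1ʳ = ⟨⟩-mono-< (ℚ.positive⁻¹ 1ℚ)

-- The Archimedean property and geometric decay

nat : ℕ → ℚ
nat k = + k ℚ./ 1

private
  toℚᵘ-nat : ∀ k → ℚ.toℚᵘ (nat k) ℚᵘ.≃ ℚᵘ.mkℚᵘ (+ k) 0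
  toℚᵘ-nat k = ℚ.toℚᵘ-fromℚᵘ (ℚᵘ.mkℚᵘ (+ k) 0)

nat-+ : ∀ j k → nat (j ℕ.+ k) ≡ nat j ℚ.+ nat k
nat-+ j k = ℚ.toℚᵘ-injective (begin
  ℚ.toℚᵘ (nat (j ℕ.+ k))             ≈⟨ toℚᵘ-nat (j ℕ.+ k) ⟩
  ℚᵘ.mkℚᵘ (+ (j ℕ.+ k)) 0            ≈⟨ ℚᵘ.*≡* (cong (ℤ._* + 1) (trans (ℤ.pos-+ j k)
                                          (sym (cong₂ ℤ._+_ (ℤ.*-identityʳ (+ j)) (ℤ.*-identityʳ (+ k)))))) ⟩
  ℚᵘ.mkℚᵘ (+ j) 0 ℚᵘ.+ ℚᵘ.mkℚᵘ (+ k) 0 ≈⟨ ℚᵘ.+-cong (toℚᵘ-nat j) (toℚᵘ-nat k) ⟨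
  ℚ.toℚᵘ (nat j) ℚᵘ.+ ℚ.toℚᵘ (nat k) ≈⟨ ℚ.toℚᵘ-homo-+ (nat j) (nat k) ⟨
  ℚ.toℚᵘ (nat j ℚ.+ nat k)           ∎)
  where open ℚᵘ.≃-Reasoning

nat-* : ∀ j k → nat (j ℕ.* k) ≡ nat j ℚ.* nat k
nat-* j k = ℚ.toℚᵘ-injective (begin
  ℚ.toℚᵘ (nat (j ℕ.* k))             ≈⟨ toℚᵘ-nat (j ℕ.* k) ⟩
  ℚᵘ.mkℚᵘ (+ (j ℕ.* k)) 0            ≈⟨ ℚᵘ.*≡* (cong (ℤ._* + 1) (ℤ.pos-* j k)) ⟩
  ℚᵘ.mkℚᵘ (+ j) 0 ℚᵘ.* ℚᵘ.mkℚᵘ (+ k) 0 ≈⟨ ℚᵘ.*-cong (toℚᵘ-nat j) (toℚᵘ-nat k) ⟨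
  ℚ.toℚᵘ (nat j) ℚᵘ.* ℚ.toℚᵘ (nat k) ≈⟨ ℚ.toℚᵘ-homo-* (nat j) (nat k) ⟨
  ℚ.toℚᵘ (nat j ℚ.* nat k)           ∎)
  where open ℚᵘ.≃-Reasoning

nat-mono-≤ : ∀ {j k} → j ℕ.≤ k → nat j ℚ.≤ nat k
nat-mono-≤ {j} {k} j≤k = ℚ.toℚᵘ-cancel-≤ (begin
  ℚ.toℚᵘ (nat j)  ≃⟨ toℚᵘ-nat j ⟩
  ℚᵘ.mkℚᵘ (+ j) 0 ≤⟨ ℚᵘ.*≤* (ℤ.*-monoʳ-≤-nonNeg (+ 1) (ℤ.+≤+ j≤k)) ⟩
  ℚᵘ.mkℚᵘ (+ k) 0 ≃⟨ toℚᵘ-nat k ⟨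
  ℚ.toℚᵘ (nat k)  ∎)
  where open ℚᵘ.≤-Reasoning

nat-mono-< : ∀ {j k} → j ℕ.< k → nat j ℚ.< nat k
nat-mono-< {j} {k} j<k = ℚ.toℚᵘ-cancel-< (begin-strict
  ℚ.toℚᵘ (nat j)  ≃⟨ toℚᵘ-nat j ⟩
  ℚᵘ.mkℚᵘ (+ j) 0 <⟨ ℚᵘ.*<* (ℤ.*-monoʳ-<-pos (+ 1) (ℤ.+<+ j<k)) ⟩
  ℚᵘ.mkℚᵘ (+ k) 0 ≃⟨ toℚᵘ-nat k ⟨
  ℚ.toℚᵘ (nat k)  ∎)
  where open ℚᵘ.≤-Reasoning

nat-nonNeg : ∀ k → 0ℚ ℚ.≤ nat k
nat-nonNeg k = nat-mono-≤ {0} {k} ℕ.z≤n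

ℚ-archimedean : ∀ q → ∃[ k ] q ℚ.< nat k
ℚ-archimedean q@(ℚ.mkℚ n d-1 _) = k , ℚ.toℚᵘ-cancel-< (begin-strict
  ℚ.toℚᵘ q        <⟨ ℚᵘ.*<* (ℤ.<-≤-trans (ℤ.≤-<-trans (ℤ.≤-reflexive (ℤ.*-identityʳ n)) (i<1+∣i∣ n))
                       (ℤ.≤-trans (ℤ.≤-reflexive (sym (ℤ.*-identityʳ (+ k))))
                          (ℤ.*-monoˡ-≤-nonNeg (+ k) (ℤ.+≤+ (ℕ.s≤s ℕ.z≤n))))) ⟩
  ℚᵘ.mkℚᵘ (+ k) 0 ≃⟨ toℚᵘ-nat k ⟨
  ℚ.toℚᵘ (nat k)  ∎)
  where
  k = suc ℤ.∣ n ∣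
  i<1+∣i∣ : ∀ i → i ℤ.< + suc ℤ.∣ i ∣
  i<1+∣i∣ (+ _)      = ℤ.+<+ (ℕ.n<1+n _)
  i<1+∣i∣ ℤ.-[1+ _ ] = ℤ.-<+
  open ℚᵘ.≤-Reasoning

multiple-above : ∀ {a} b → 0ℚ ℚ.< a → ∃[ M ] b ℚ.< nat M ℚ.* a
multiple-above {a} b 0<a = let M , h = ℚ-archimedean (b ℚ.* a⁻¹) in
  M , subst (ℚ._< nat M ℚ.* a) eq (ℚ.*-monoˡ-<-pos a h)
  where
  instance
    a-pos : ℚ.Positive a
    a-pos = ℚ.positive 0<a
    a≢0 : ℚ.NonZero a
    a≢0 = ℚ.pos⇒nonZero a
  a⁻¹ = ℚ.1/ a
  eq : b ℚ.* a⁻¹ ℚ.* a ≡ b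
  eq = trans (ℚ.*-assoc b a⁻¹ a) (trans (cong (b ℚ.*_) (ℚ.*-inverseˡ a)) (ℚ.*-identityʳ b))

ℝ-archimedean : ∀ x {y} → 0ʳ <ʳ y → ∃[ M ] x <ʳ ⟨ nat M ⟩ *ʳ y
ℝ-archimedean x {y} 0<y =
  let b , x<b       = rational-above x
      a , 0<a , a<y = rational-below 0<y
      M , b<Ma      = multiple-above b 0<a
  in M , <-≤ʳ-trans (<ʳ-trans x<b (<ʳ-respʳ (⟨⟩-* (nat M) a) (⟨⟩-mono-< b<Ma)))
           (*ʳ-monoʳ-≤ ⟨ nat M ⟩ (⟨⟩-mono-≤ (nat-nonNeg M)) (<⇒≤ʳ a<y))

*ʳ-identityʳ : ∀ x → x *ʳ 1ʳ ≃ʳ x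
*ʳ-identityʳ = CommutativeRing.*-identityʳ ℝ-commutativeRing

^ʳ-nonNeg : ∀ {θ} → 0ʳ ≤ʳ θ → ∀ m → 0ʳ ≤ʳ θ ^ʳ m
^ʳ-nonNeg 0≤θ zero    = <⇒≤ʳ 0<1ʳ
^ʳ-nonNeg 0≤θ (suc m) = *ʳ-nonNeg 0≤θ (^ʳ-nonNeg 0≤θ m)

module _ {θ x} (0≤θ : 0ʳ ≤ʳ θ) (0<x : 0ʳ <ʳ x) (θ[1+x]≤1 : θ *ʳ (1ʳ +ʳ x) ≤ʳ 1ʳ) where

  -- Bernoulli's inequality (1 + x)ᵐ ≥ 1 + m x in a form without division: θ plays a number at most
  -- 1/(1 + x). Hence θᵐ decays at least like 1/(m x).
  bernoulli : ∀ m → θ ^ʳ m *ʳ (1ʳ +ʳ ⟨ nat m ⟩ *ʳ x) ≤ʳ 1ʳ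
  bernoulli zero = ≤ʳ-reflexive (solve 1 (λ x → con 1ℚ :* (con 1ℚ :+ con 0ℚ :* x) := con 1ℚ) ≃ʳ-refl x)
    where open ℝ-Solver
  bernoulli (suc m) = begin
    θ *ʳ θ ^ʳ m *ʳ (1ʳ +ʳ ⟨ nat (suc m) ⟩ *ʳ x)
      ≈⟨ *ʳ-cong ≃ʳ-refl (+ʳ-cong ≃ʳ-refl (*ʳ-cong (≃ʳ-trans (⟨⟩-cong (nat-+ 1 m)) (⟨⟩-+ 1ℚ (nat m))) ≃ʳ-refl)) ⟩
    θ *ʳ θ ^ʳ m *ʳ (1ʳ +ʳ (1ʳ +ʳ k) *ʳ x)
      ≤⟨ ≤-by (*ʳ-nonNeg (*ʳ-nonNeg 0≤θ (^ʳ-nonNeg 0≤θ m)) (*ʳ-nonNeg 0≤k (*ʳ-nonNeg 0≤x 0≤x)))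
           (solve 4 (λ θ t k x → θ :* t :* (con 1ℚ :+ (con 1ℚ :+ k) :* x) :+ θ :* t :* (k :* (x :* x))
             := t :* (con 1ℚ :+ k :* x) :* (θ :* (con 1ℚ :+ x))) ≃ʳ-refl θ (θ ^ʳ m) k x) ⟩
    θ ^ʳ m *ʳ (1ʳ +ʳ k *ʳ x) *ʳ (θ *ʳ (1ʳ +ʳ x))
      ≤⟨ *ʳ-mono-≤ (*ʳ-nonNeg (^ʳ-nonNeg 0≤θ m) (≤ʳ-trans (*ʳ-nonNeg 0≤k 0≤x) (≤-by (<⇒≤ʳ 0<1ʳ) (+ʳ-comm _ 1ʳ))))
           (<⇒≤ʳ 0<1ʳ) (bernoulli m) θ[1+x]≤1 ⟩
    1ʳ *ʳ 1ʳ
      ≈⟨ *ʳ-identityˡ 1ʳ ⟩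
    1ʳ ∎
    where
    open ≤ʳ-Reasoning
    open ℝ-Solver
    k = ⟨ nat m ⟩
    0≤k = ⟨⟩-mono-≤ (nat-nonNeg m)
    0≤x = <⇒≤ʳ 0<x

  power→0 : ∀ K {q} → 0ʳ <ʳ q → ∃[ M ] (∀ m → M ℕ.≤ m → K *ʳ θ ^ʳ m ≤ʳ q)
  power→0 K {q} 0<q = let M , K<Mxq = ℝ-archimedean K (*ʳ-pos 0<x 0<q) in M , λ m M≤m → (begin
    K *ʳ θ ^ʳ m
      ≤⟨ *ʳ-monoˡ-≤ (θ ^ʳ m) (^ʳ-nonNeg 0≤θ m) (≤ʳ-trans (<⇒≤ʳ K<Mxq)
           (*ʳ-monoˡ-≤ (x *ʳ q) (<⇒≤ʳ (*ʳ-pos 0<x 0<q)) (⟨⟩-mono-≤ (nat-mono-≤ M≤m)))) ⟩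
    ⟨ nat m ⟩ *ʳ (x *ʳ q) *ʳ θ ^ʳ m
      ≤⟨ ≤-by (*ʳ-nonNeg (^ʳ-nonNeg 0≤θ m) (<⇒≤ʳ 0<q))
           (solve 4 (λ k x q t → k :* (x :* q) :* t :+ t :* q := t :* (con 1ℚ :+ k :* x) :* q)
             ≃ʳ-refl ⟨ nat m ⟩ x q (θ ^ʳ m)) ⟩
    θ ^ʳ m *ʳ (1ʳ +ʳ ⟨ nat m ⟩ *ʳ x) *ʳ q
      ≤⟨ *ʳ-monoˡ-≤ q (<⇒≤ʳ 0<q) (bernoulli m) ⟩
    1ʳ *ʳ q
      ≈⟨ *ʳ-identityˡ q ⟩
    q ∎)
    where
    open ≤ʳ-Reasoning
    open ℝ-Solver

-- Completeness of the real numbers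

opaque
  unfolding _≃ʳ_

  rational-near : ∀ x {q} → 0ℚ ℚ.< q → ∃[ a ] ⟨ a ⟩ ≤ʳ x +ʳ ⟨ q ⟩ × x ≤ʳ ⟨ a ℚ.+ q ⟩
  rational-near x {q} 0<q = let N , h = approx x q 0<q in ℝ.seq x N
    , eventually-> {x +ʳ ⟨ q ⟩} (ℝ.seq x N) (N , λ n N≤n → h N n ℕ.≤-refl N≤n)
    , eventually-< {x} (ℝ.seq x N ℚ.+ q) (N , λ n N≤n → h n N N≤n ℕ.≤-refl)

nat-suc-positive : ∀ n → ℚ.Positive (nat (suc n))
nat-suc-positive n = ℚ.positive (nat-mono-< {0} {suc n} (ℕ.s≤s ℕ.z≤n))

nat-suc-nonZero : ∀ n → ℚ.NonZero (nat (suc n))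
nat-suc-nonZero n = ℚ.pos⇒nonZero (nat (suc n)) {{nat-suc-positive n}}

-- 1/(n + 1), so that no nonzero condition has to be carried along.
reciprocal : ℕ → ℚ
reciprocal n = (ℚ.1/ nat (suc n)) {{nat-suc-nonZero n}}

reciprocal-inverse : ∀ n → nat (suc n) ℚ.* reciprocal n ≡ 1ℚ
reciprocal-inverse n = ℚ.*-inverseʳ (nat (suc n)) {{nat-suc-nonZero n}}

reciprocal-pos : ∀ n → 0ℚ ℚ.< reciprocal n
reciprocal-pos n = ℚ.positive⁻¹ (reciprocal n)
  {{ℚ.1/pos⇒pos (nat (suc n)) {{nat-suc-positive n}}}}

reciprocal-small : ∀ {q} → 0ℚ ℚ.< q → ∃[ N ] (∀ n → N ℕ.≤ n → reciprocal n ℚ.< q)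
reciprocal-small {q} 0<q = let M , 1<Mq = multiple-above 1ℚ 0<q in M , λ n M≤n →
  ℚ.*-cancelˡ-<-nonNeg (nat (suc n)) {{ℚ.nonNegative (nat-nonNeg (suc n))}}
    (subst (ℚ._< nat (suc n) ℚ.* q) (sym (reciprocal-inverse n))
      (ℚ.<-≤-trans 1<Mq (ℚ.*-monoʳ-≤-nonNeg q {{ℚ.nonNegative (ℚ.<⇒≤ 0<q)}}
        (nat-mono-≤ (ℕ.≤-trans M≤n (ℕ.n≤1+n n))))))

reciprocal≤1 : ∀ n → reciprocal n ℚ.≤ 1ℚ
reciprocal≤1 n = subst (ℚ._≤ 1ℚ) (ℚ.*-identityˡ (reciprocal n)) (subst (1ℚ ℚ.* reciprocal n ℚ.≤_) (reciprocal-inverse n)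
  (ℚ.*-monoʳ-≤-nonNeg (reciprocal n) {{ℚ.nonNegative (ℚ.<⇒≤ (reciprocal-pos n))}} (nat-mono-≤ {1} {suc n} (ℕ.s≤s ℕ.z≤n))))

scaled-reciprocal : ∀ q j → nat (suc j) ℚ.* (q ℚ.* reciprocal j) ≡ q
scaled-reciprocal q j = trans (swap (nat (suc j)) q (reciprocal j)) (trans (cong (q ℚ.*_) (reciprocal-inverse j)) (ℚ.*-identityʳ q))
  where
  swap : ∀ a b c → a ℚ.* (b ℚ.* c) ≡ b ℚ.* (a ℚ.* c)
  swap a b c = trans (sym (ℚ.*-assoc a b c)) (trans (cong (ℚ._* c) (ℚ.*-comm a b)) (ℚ.*-assoc b a c))

module _ (u : ℕ → ℝ) (u-cauchy : ∀ q → 0ℚ ℚ.< q → ∃[ N ] (∀ m n → N ℕ.≤ m → N ℕ.≤ n → u m ≤ʳ u n +ʳ ⟨ q ⟩)) where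

  private
    near : ∀ n → ∃[ a ] ⟨ a ⟩ ≤ʳ u n +ʳ ⟨ reciprocal n ⟩ × u n ≤ʳ ⟨ a ℚ.+ reciprocal n ⟩
    near n = rational-near (u n) (reciprocal-pos n)

    a : ℕ → ℚ
    a n = proj₁ (near n)

    0<δ : ∀ {ε} → 0ℚ ℚ.< ε → 0ℚ ℚ.< ε ℚ.* sixth
    0<δ = 0<sixth

    a-close : ∀ ε → 0ℚ ℚ.< ε → ∃[ N ] (∀ m n → N ℕ.≤ m → N ℕ.≤ n → a m ℚ.< a n ℚ.+ ε)
    a-close ε 0<ε = K ℕ.⊔ L , λ m n m≥ n≥ →
      let km = ℕ.≤-trans (ℕ.m≤m⊔n K L) m≥
          kn = ℕ.≤-trans (ℕ.m≤m⊔n K L) n≥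
          lm = ℕ.≤-trans (ℕ.m≤n⊔m K L) m≥
          ln = ℕ.≤-trans (ℕ.m≤n⊔m K L) n≥
      in ⟨⟩-cancel-< (begin-strict
        ⟨ a m ⟩                                     ≤⟨ proj₁ (proj₂ (near m)) ⟩
        u m +ʳ ⟨ reciprocal m ⟩                     ≤⟨ +ʳ-mono-≤ (proj₂ U m n km kn) (⟨⟩-mono-≤ (ℚ.<⇒≤ (proj₂ R m lm))) ⟩
        u n +ʳ ⟨ δ ⟩ +ʳ ⟨ δ ⟩                       ≤⟨ +ʳ-monoˡ-≤ _ (+ʳ-monoˡ-≤ _ (proj₂ (proj₂ (near n)))) ⟩
        ⟨ a n ℚ.+ reciprocal n ⟩ +ʳ ⟨ δ ⟩ +ʳ ⟨ δ ⟩ ≤⟨ +ʳ-monoˡ-≤ _ (+ʳ-monoˡ-≤ _ (⟨⟩-mono-≤ (ℚ.+-monoʳ-≤ (a n) (ℚ.<⇒≤ (proj₂ R n ln))))) ⟩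
        ⟨ a n ℚ.+ δ ⟩ +ʳ ⟨ δ ⟩ +ʳ ⟨ δ ⟩            ≈⟨ ≃ʳ-trans (⟨⟩-+ _ _) (+ʳ-cong (⟨⟩-+ _ _) ≃ʳ-refl) ⟨
        ⟨ a n ℚ.+ δ ℚ.+ δ ℚ.+ δ ⟩                   <⟨ ⟨⟩-mono-< (from-diff (0<δ 0<ε ⊹ 0<δ 0<ε ⊹ 0<δ 0<ε) (eq (a n) ε)) ⟩
        ⟨ a n ℚ.+ ε ⟩                               ∎)
      where
      δ = ε ℚ.* sixth
      U = u-cauchy δ (0<δ 0<ε)
      R = reciprocal-small (0<δ 0<ε)
      K = proj₁ U
      L = proj₁ R
      open ≤ʳ-Reasoning
      open +-*-Solver
      eq : ∀ a ε → (let δ = ε ℚ.* sixth in δ ℚ.+ δ ℚ.+ δ ≡ a ℚ.+ ε ℚ.- (a ℚ.+ δ ℚ.+ δ ℚ.+ δ))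
      eq = solve 2 (λ a ε → (let δ = ε :* con sixth in δ :+ δ :+ δ := a :+ ε :- (a :+ δ :+ δ :+ δ))) refl

    a-cauchy : IsCauchy a
    a-cauchy ε 0<ε = let N , h = a-close ε 0<ε in
      N , λ m n N≤m N≤n → <⇒<∣∣ (h m n N≤m N≤n) (h n m N≤n N≤m)

  -- A real is itself a Cauchy sequence of rationals, so the limit is a diagonal sequence: its n-th
  -- entry is a rational within 1/(n + 1) of `u n`.
  limit : ℝ
  limit = mkℝ a a-cauchy

  limit-close : ∀ q → 0ℚ ℚ.< q → ∃[ N ] (∀ n → N ℕ.≤ n → u n ≤ʳ limit +ʳ ⟨ q ⟩ × limit ≤ʳ u n +ʳ ⟨ q ⟩)
  limit-close q 0<q = K ℕ.⊔ L , λ n n≥ → close n (ℕ.≤-trans (ℕ.m≤m⊔n K L) n≥) (ℕ.≤-trans (ℕ.m≤n⊔m K L) n≥)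
    where
    δ = q ℚ.* ℚ.½
    0<½q : 0ℚ ℚ.< δ
    0<½q = *-pos 0<q (ℚ.positive⁻¹ ℚ.½)
    A = a-close δ 0<½q
    R = reciprocal-small 0<½q
    K = proj₁ A
    L = proj₁ R
    opaque
      unfolding _≃ʳ_
      above : ∀ n → K ℕ.≤ n → limit ≤ʳ ⟨ a n ℚ.+ δ ⟩
      above n K≤n = eventually-< {limit} (a n ℚ.+ δ) (K , λ m K≤m → proj₂ A m n K≤m K≤n)
      below : ∀ n → K ℕ.≤ n → ⟨ a n ⟩ ≤ʳ limit +ʳ ⟨ δ ⟩
      below n K≤n = eventually-> {limit +ʳ ⟨ δ ⟩} (a n) (K , λ m K≤m → proj₂ A n m K≤n K≤m)
    halves : ∀ x → x +ʳ ⟨ δ ⟩ +ʳ ⟨ δ ⟩ ≃ʳ x +ʳ ⟨ q ⟩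
    halves x = ≃ʳ-trans (+ʳ-assoc x ⟨ δ ⟩ ⟨ δ ⟩) (+ʳ-cong ≃ʳ-refl (≃ʳ-trans (≃ʳ-sym (⟨⟩-+ δ δ))
      (⟨⟩-cong (solve 1 (λ q → q :* con ℚ.½ :+ q :* con ℚ.½ := q) refl q))))
      where open +-*-Solver
    close : ∀ n → K ℕ.≤ n → L ℕ.≤ n → u n ≤ʳ limit +ʳ ⟨ q ⟩ × limit ≤ʳ u n +ʳ ⟨ q ⟩
    close n K≤n L≤n =
      (begin
        u n                         ≤⟨ proj₂ (proj₂ (near n)) ⟩
        ⟨ a n ℚ.+ reciprocal n ⟩    ≤⟨ ⟨⟩-mono-≤ (ℚ.+-monoʳ-≤ (a n) (ℚ.<⇒≤ (proj₂ R n L≤n))) ⟩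
        ⟨ a n ℚ.+ δ ⟩               ≈⟨ ⟨⟩-+ (a n) δ ⟩
        ⟨ a n ⟩ +ʳ ⟨ δ ⟩            ≤⟨ +ʳ-monoˡ-≤ ⟨ δ ⟩ (below n K≤n) ⟩
        limit +ʳ ⟨ δ ⟩ +ʳ ⟨ δ ⟩     ≈⟨ halves limit ⟩
        limit +ʳ ⟨ q ⟩              ∎)
      , (begin
        limit                       ≤⟨ above n K≤n ⟩
        ⟨ a n ℚ.+ δ ⟩               ≈⟨ ⟨⟩-+ (a n) δ ⟩
        ⟨ a n ⟩ +ʳ ⟨ δ ⟩            ≤⟨ +ʳ-monoˡ-≤ ⟨ δ ⟩ (proj₁ (proj₂ (near n))) ⟩
        u n +ʳ ⟨ reciprocal n ⟩ +ʳ ⟨ δ ⟩ ≤⟨ +ʳ-monoˡ-≤ ⟨ δ ⟩ (+ʳ-monoʳ-≤ (u n) (⟨⟩-mono-≤ (ℚ.<⇒≤ (proj₂ R n L≤n)))) ⟩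
        u n +ʳ ⟨ δ ⟩ +ʳ ⟨ δ ⟩       ≈⟨ halves (u n) ⟩
        u n +ʳ ⟨ q ⟩                ∎)
      where open ≤ʳ-Reasoning

≤ʳ-limit : ∀ {x y} → (∀ q → 0ℚ ℚ.< q → x ≤ʳ y +ʳ ⟨ q ⟩) → x ≤ʳ y
≤ʳ-limit {x} {y} h = ≮⇒≥ λ y<x →
  let q , 0<q , q<x-y = rational-below (diff-posʳ y<x)
  in ≤⇒≯ (h q 0<q) (<ʳ-respˡ (+ʳ-comm ⟨ q ⟩ y) (<ʳ-respʳ
       (solve 2 (λ x y → x :- y :+ y := x) ≃ʳ-refl x y) (+ʳ-monoˡ-< y q<x-y)))
  where open ℝ-Solver

-- Complex numbers

open ℝ-Solver using () renaming (solve to solveʳ)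

infix  4 _≃_
infixl 6 _+ᶜ_
infixl 7 _*ᶜ_
infix  8 -ᶜ_

opaque
  _≃_ : ℂ → ℂ → Set
  z ≃ w = re z ≃ʳ re w × im z ≃ʳ im w

  _+ᶜ_ _*ᶜ_ : ℂ → ℂ → ℂ
  z +ᶜ w = (re z +ʳ re w) +i (im z +ʳ im w)
  z *ᶜ w = (re z *ʳ re w +ʳ -ʳ (im z *ʳ im w)) +i (re z *ʳ im w +ʳ im z *ʳ re w)

  -ᶜ_ : ℂ → ℂ
  -ᶜ z = (-ʳ re z) +i (-ʳ im z)

  fromℝ : ℝ → ℂ
  fromℝ x = x +i 0ʳ

  i : ℂ
  i = 0ʳ +i 1ʳ

⟪_⟫ : ℚ → ℂ
⟪ q ⟫ = fromℝ ⟨ q ⟩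

0ᶜ 1ᶜ : ℂ
0ᶜ = ⟪ 0ℚ ⟫
1ᶜ = ⟪ 1ℚ ⟫

opaque
  unfolding _≃_

  ≃-intro : ∀ {z w} → re z ≃ʳ re w → im z ≃ʳ im w → z ≃ w
  ≃-intro = _,_

  re-cong : ∀ {z w} → z ≃ w → re z ≃ʳ re w
  re-cong = proj₁

  im-cong : ∀ {z w} → z ≃ w → im z ≃ʳ im w
  im-cong = proj₂

  re-+ : ∀ z w → re (z +ᶜ w) ≃ʳ re z +ʳ re w
  re-+ z w = ≃ʳ-refl

  im-+ : ∀ z w → im (z +ᶜ w) ≃ʳ im z +ʳ im w
  im-+ z w = ≃ʳ-refl

  re-* : ∀ z w → re (z *ᶜ w) ≃ʳ re z *ʳ re w +ʳ -ʳ (im z *ʳ im w)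
  re-* z w = ≃ʳ-refl

  im-* : ∀ z w → im (z *ᶜ w) ≃ʳ re z *ʳ im w +ʳ im z *ʳ re w
  im-* z w = ≃ʳ-refl

  re-neg : ∀ z → re (-ᶜ z) ≃ʳ -ʳ re z
  re-neg z = ≃ʳ-refl

  im-neg : ∀ z → im (-ᶜ z) ≃ʳ -ʳ im z
  im-neg z = ≃ʳ-refl

  re-fromℝ : ∀ x → re (fromℝ x) ≃ʳ x
  re-fromℝ x = ≃ʳ-refl

  im-fromℝ : ∀ x → im (fromℝ x) ≃ʳ 0ʳ
  im-fromℝ x = ≃ʳ-refl

  re-i : re i ≃ʳ 0ʳ
  re-i = ≃ʳ-refl

  im-i : im i ≃ʳ 1ʳ
  im-i = ≃ʳ-refl

≃-refl : ∀ {z} → z ≃ z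
≃-refl = ≃-intro ≃ʳ-refl ≃ʳ-refl

≡⇒≃ : ∀ {z w} → z ≡ w → z ≃ w
≡⇒≃ refl = ≃-refl

≃-sym : ∀ {z w} → z ≃ w → w ≃ z
≃-sym e = ≃-intro (≃ʳ-sym (re-cong e)) (≃ʳ-sym (im-cong e))

≃-trans : ∀ {z w v} → z ≃ w → w ≃ v → z ≃ v
≃-trans e f = ≃-intro (≃ʳ-trans (re-cong e) (re-cong f)) (≃ʳ-trans (im-cong e) (im-cong f))

≃-stable : ∀ {z w} → ¬ ¬ z ≃ w → z ≃ w
≃-stable h = ≃-intro (≃ʳ-stable λ k → h λ e → k (re-cong e)) (≃ʳ-stable λ k → h λ e → k (im-cong e))

opaque
  unfolding _≃_

  +ᶜ-cong : ∀ {z z′ w w′} → z ≃ z′ → w ≃ w′ → z +ᶜ w ≃ z′ +ᶜ w′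
  +ᶜ-cong (a , b) (c , d) = +ʳ-cong a c , +ʳ-cong b d

  *ᶜ-cong : ∀ {z z′ w w′} → z ≃ z′ → w ≃ w′ → z *ᶜ w ≃ z′ *ᶜ w′
  *ᶜ-cong (a , b) (c , d) =
    +ʳ-cong (*ʳ-cong a c) (-ʳ-cong (*ʳ-cong b d)) , +ʳ-cong (*ʳ-cong a d) (*ʳ-cong b c)

  -ᶜ-cong : ∀ {z w} → z ≃ w → -ᶜ z ≃ -ᶜ w
  -ᶜ-cong (a , b) = -ʳ-cong a , -ʳ-cong b

  fromℝ-cong : ∀ {x y} → x ≃ʳ y → fromℝ x ≃ fromℝ y
  fromℝ-cong e = e , ≃ʳ-refl

  +ᶜ-assoc : ∀ z w v → z +ᶜ w +ᶜ v ≃ z +ᶜ (w +ᶜ v)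
  +ᶜ-assoc z w v = +ʳ-assoc (re z) (re w) (re v) , +ʳ-assoc (im z) (im w) (im v)

  +ᶜ-comm : ∀ z w → z +ᶜ w ≃ w +ᶜ z
  +ᶜ-comm z w = +ʳ-comm (re z) (re w) , +ʳ-comm (im z) (im w)

  +ᶜ-identityˡ : ∀ z → 0ᶜ +ᶜ z ≃ z
  +ᶜ-identityˡ z = +ʳ-identityˡ (re z) , +ʳ-identityˡ (im z)

  -ᶜ-inverseˡ : ∀ z → -ᶜ z +ᶜ z ≃ 0ᶜ
  -ᶜ-inverseˡ z = -ʳ-inverseˡ (re z) , -ʳ-inverseˡ (im z)

  *ᶜ-assoc : ∀ z w v → z *ᶜ w *ᶜ v ≃ z *ᶜ (w *ᶜ v)
  *ᶜ-assoc (a +i b) (c +i d) (e +i f) =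
      solve 6 (λ a b c d e f → (a :* c :- b :* d) :* e :- (a :* d :+ b :* c) :* f
        := a :* (c :* e :- d :* f) :- b :* (c :* f :+ d :* e)) ≃ʳ-refl a b c d e f
    , solve 6 (λ a b c d e f → (a :* c :- b :* d) :* f :+ (a :* d :+ b :* c) :* e
        := a :* (c :* f :+ d :* e) :+ b :* (c :* e :- d :* f)) ≃ʳ-refl a b c d e f
    where open ℝ-Solver

  *ᶜ-comm : ∀ z w → z *ᶜ w ≃ w *ᶜ z
  *ᶜ-comm (a +i b) (c +i d) =
      solve 4 (λ a b c d → a :* c :- b :* d := c :* a :- d :* b) ≃ʳ-refl a b c d
    , solve 4 (λ a b c d → a :* d :+ b :* c := c :* b :+ d :* a) ≃ʳ-refl a b c d
    where open ℝ-Solver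

  *ᶜ-identityˡ : ∀ z → 1ᶜ *ᶜ z ≃ z
  *ᶜ-identityˡ (a +i b) =
      solve 2 (λ a b → con 1ℚ :* a :- con 0ℚ :* b := a) ≃ʳ-refl a b
    , solve 2 (λ a b → con 1ℚ :* b :+ con 0ℚ :* a := b) ≃ʳ-refl a b
    where open ℝ-Solver

  *ᶜ-distribˡ-+ᶜ : ∀ z w v → z *ᶜ (w +ᶜ v) ≃ z *ᶜ w +ᶜ z *ᶜ v
  *ᶜ-distribˡ-+ᶜ (a +i b) (c +i d) (e +i f) =
      solve 6 (λ a b c d e f → a :* (c :+ e) :- b :* (d :+ f)
        := (a :* c :- b :* d) :+ (a :* e :- b :* f)) ≃ʳ-refl a b c d e f
    , solve 6 (λ a b c d e f → a :* (d :+ f) :+ b :* (c :+ e)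
        := (a :* d :+ b :* c) :+ (a :* f :+ b :* e)) ≃ʳ-refl a b c d e f
    where open ℝ-Solver

  fromℝ-+ : ∀ x y → fromℝ (x +ʳ y) ≃ fromℝ x +ᶜ fromℝ y
  fromℝ-+ x y = ≃ʳ-refl , solveʳ 0 (con 0ℚ := con 0ℚ :+ con 0ℚ) ≃ʳ-refl
    where open ℝ-Solver

  fromℝ-* : ∀ x y → fromℝ (x *ʳ y) ≃ fromℝ x *ᶜ fromℝ y
  fromℝ-* x y = solve 2 (λ x y → x :* y := x :* y :- con 0ℚ :* con 0ℚ) ≃ʳ-refl x y
    , solve 2 (λ x y → con 0ℚ := x :* con 0ℚ :+ con 0ℚ :* y) ≃ʳ-refl x y
    where open ℝ-Solver

  fromℝ-neg : ∀ x → fromℝ (-ʳ x) ≃ -ᶜ fromℝ x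
  fromℝ-neg x = ≃ʳ-refl , solve 1 (λ x → con 0ℚ := :- con 0ℚ) ≃ʳ-refl x
    where open ℝ-Solver

ℂ-commutativeRing : CommutativeRing 0ℓ 0ℓ
ℂ-commutativeRing = record
  { Carrier = ℂ ; _≈_ = _≃_ ; _+_ = _+ᶜ_ ; _*_ = _*ᶜ_ ; -_ = -ᶜ_ ; 0# = 0ᶜ ; 1# = 1ᶜ
  ; isCommutativeRing = record
    { isRing = record
      { +-isAbelianGroup = record
        { isGroup = record
          { isMonoid = record
            { isSemigroup = record
              { isMagma = record
                { isEquivalence = record { refl = ≃-refl ; sym = ≃-sym ; trans = ≃-trans }
                ; ∙-cong = +ᶜ-cong }
              ; assoc = +ᶜ-assoc }
            ; identity = comm∧idˡ⇒id +ᶜ-comm +ᶜ-identityˡ }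
          ; inverse = -ᶜ-inverseˡ , λ z → ≃-trans (+ᶜ-comm z (-ᶜ z)) (-ᶜ-inverseˡ z)
          ; ⁻¹-cong = -ᶜ-cong }
        ; comm = +ᶜ-comm }
      ; *-cong = *ᶜ-cong
      ; *-assoc = *ᶜ-assoc
      ; *-identity = comm∧idˡ⇒id *ᶜ-comm *ᶜ-identityˡ
      ; distrib = *ᶜ-distribˡ-+ᶜ , λ z w v → ≃-trans (*ᶜ-comm (w +ᶜ v) z)
          (≃-trans (*ᶜ-distribˡ-+ᶜ z w v) (+ᶜ-cong (*ᶜ-comm z w) (*ᶜ-comm z v))) }
    ; *-comm = *ᶜ-comm } }
  where
  comm∧idˡ⇒id : ∀ {_∙_ : ℂ → ℂ → ℂ} {e} → (∀ x y → (x ∙ y) ≃ (y ∙ x)) → (∀ x → (e ∙ x) ≃ x) →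
    (∀ x → (e ∙ x) ≃ x) × (∀ x → (x ∙ e) ≃ x)
  comm∧idˡ⇒id {e = e} comm idˡ = idˡ , λ x → ≃-trans (comm x e) (idˡ x)

open CommutativeRing ℂ-commutativeRing public using () renaming
  ( zeroˡ to *ᶜ-zeroˡ; zeroʳ to *ᶜ-zeroʳ; *-identityʳ to *ᶜ-identityʳ; +-identityʳ to +ᶜ-identityʳ
  ; -‿inverseʳ to -ᶜ-inverseʳ; distribʳ to *ᶜ-distribʳ-+ᶜ )

⟪⟫-cong : ∀ {p q} → p ≡ q → ⟪ p ⟫ ≃ ⟪ q ⟫
⟪⟫-cong refl = ≃-refl

⟪⟫-+ : ∀ p q → ⟪ p ℚ.+ q ⟫ ≃ ⟪ p ⟫ +ᶜ ⟪ q ⟫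
⟪⟫-+ p q = ≃-trans (fromℝ-cong (⟨⟩-+ p q)) (fromℝ-+ _ _)

⟪⟫-* : ∀ p q → ⟪ p ℚ.* q ⟫ ≃ ⟪ p ⟫ *ᶜ ⟪ q ⟫
⟪⟫-* p q = ≃-trans (fromℝ-cong (⟨⟩-* p q)) (fromℝ-* _ _)

⟪⟫-neg : ∀ p → ⟪ ℚ.- p ⟫ ≃ -ᶜ ⟪ p ⟫
⟪⟫-neg p = ≃-trans (fromℝ-cong (⟨⟩-neg p)) (fromℝ-neg _)

ℚ⟶ℂ : ℚ-rawRing ACR.-Raw-AlmostCommutative⟶ ACR.fromCommutativeRing ℂ-commutativeRing
ℚ⟶ℂ = record
  { ⟦_⟧ = ⟪_⟫ ; +-homo = ⟪⟫-+ ; *-homo = ⟪⟫-* ; -‿homo = ⟪⟫-neg ; 0-homo = ≃-refl ; 1-homo = ≃-refl }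

module ℂ-Solver = RingSolver ℚ-rawRing (ACR.fromCommutativeRing ℂ-commutativeRing) ℚ⟶ℂ (≟-coeff ⟪⟫-cong)

module ≃-Reasoning = SetoidReasoning (CommutativeRing.setoid ℂ-commutativeRing)

-- Upper bounds for the modulus

normSq : ℂ → ℝ
normSq z = re z *ʳ re z +ʳ im z *ʳ im z

normSq-cong : ∀ {z w} → z ≃ w → normSq z ≃ʳ normSq w
normSq-cong e = +ʳ-cong (*ʳ-cong (re-cong e) (re-cong e)) (*ʳ-cong (im-cong e) (im-cong e))

normSq-nonNeg : ∀ z → 0ʳ ≤ʳ normSq z
normSq-nonNeg z = +ʳ-nonNeg (square-nonNeg (re z)) (square-nonNeg (im z))

opaque
  unfolding _≃_

  normSq-* : ∀ z w → normSq (z *ᶜ w) ≃ʳ normSq z *ʳ normSq w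
  normSq-* (a +i b) (c +i d) =
    solve 4 (λ a b c d → (a :* c :- b :* d) :* (a :* c :- b :* d) :+ (a :* d :+ b :* c) :* (a :* d :+ b :* c)
      := (a :* a :+ b :* b) :* (c :* c :+ d :* d)) ≃ʳ-refl a b c d
    where open ℝ-Solver

  normSq-neg : ∀ z → normSq (-ᶜ z) ≃ʳ normSq z
  normSq-neg (a +i b) =
    solve 2 (λ a b → (:- a) :* (:- a) :+ (:- b) :* (:- b) := a :* a :+ b :* b) ≃ʳ-refl a b
    where open ℝ-Solver

  normSq-fromℝ : ∀ x → normSq (fromℝ x) ≃ʳ x *ʳ x
  normSq-fromℝ x = solve 1 (λ x → x :* x :+ con 0ℚ :* con 0ℚ := x :* x) ≃ʳ-refl x
    where open ℝ-Solver

  normSq-+ : ∀ z w → normSq (z +ᶜ w) ≃ʳ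
    normSq z +ʳ normSq w +ʳ ⟨ nat 2 ⟩ *ʳ (re z *ʳ re w +ʳ im z *ʳ im w)
  normSq-+ (a +i b) (c +i d) =
    solve 4 (λ a b c d → (a :+ c) :* (a :+ c) :+ (b :+ d) :* (b :+ d)
      := a :* a :+ b :* b :+ (c :* c :+ d :* d) :+ con (nat 2) :* (a :* c :+ b :* d)) ≃ʳ-refl a b c d
    where open ℝ-Solver

-- The modulus enters only through bounds |z|² ≤ a² with a ≥ 0, so no square root has to be
-- constructed.
record ∥_∥≤_ (z : ℂ) (a : ℝ) : Set where
  constructor bound
  field
    bound-nonNeg : 0ʳ ≤ʳ a
    bound-square : normSq z ≤ʳ a *ʳ a

open ∥_∥≤_ public

norm-resp : ∀ {z w a} → z ≃ w → ∥ z ∥≤ a → ∥ w ∥≤ a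
norm-resp z≃w (bound p q) = bound p (≤ʳ-trans (≤ʳ-reflexive (normSq-cong (≃-sym z≃w))) q)

norm-weaken : ∀ {z a b} → a ≤ʳ b → ∥ z ∥≤ a → ∥ z ∥≤ b
norm-weaken a≤b (bound p q) = let 0≤b = ≤ʳ-trans p a≤b in bound 0≤b (≤ʳ-trans q (*ʳ-mono-≤ p 0≤b a≤b a≤b))

norm-* : ∀ {z w a b} → ∥ z ∥≤ a → ∥ w ∥≤ b → ∥ z *ᶜ w ∥≤ (a *ʳ b)
norm-* {z} {w} {a} {b} (bound p q) (bound r s) = bound (*ʳ-nonNeg p r) (begin
  normSq (z *ᶜ w)         ≈⟨ normSq-* z w ⟩
  normSq z *ʳ normSq w    ≤⟨ *ʳ-mono-≤ (normSq-nonNeg z) (square-nonNeg b) q s ⟩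
  a *ʳ a *ʳ (b *ʳ b)      ≈⟨ solve 2 (λ a b → a :* a :* (b :* b) := a :* b :* (a :* b)) ≃ʳ-refl a b ⟩
  a *ʳ b *ʳ (a *ʳ b)      ∎)
  where
  open ≤ʳ-Reasoning
  open ℝ-Solver

norm-+ : ∀ {z w a b} → ∥ z ∥≤ a → ∥ w ∥≤ b → ∥ z +ᶜ w ∥≤ (a +ʳ b)
norm-+ {z} {w} {a} {b} (bound p q) (bound r s) = bound 0≤a+b (begin
  normSq (z +ᶜ w)                                ≈⟨ normSq-+ z w ⟩
  normSq z +ʳ normSq w +ʳ ⟨ nat 2 ⟩ *ʳ dot       ≤⟨ +ʳ-mono-≤ (+ʳ-mono-≤ q s) (*ʳ-monoʳ-≤ _ (⟨⟩-mono-≤ (nat-nonNeg 2)) dot≤ab) ⟩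
  a *ʳ a +ʳ b *ʳ b +ʳ ⟨ nat 2 ⟩ *ʳ (a *ʳ b)      ≈⟨ solve 2 (λ a b → a :* a :+ b :* b :+ con (nat 2) :* (a :* b)
                                                      := (a :+ b) :* (a :+ b)) ≃ʳ-refl a b ⟩
  (a +ʳ b) *ʳ (a +ʳ b)                           ∎)
  where
  open ≤ʳ-Reasoning
  open ℝ-Solver
  0≤a+b = +ʳ-nonNeg p r
  dot cross : ℝ
  dot = re z *ʳ re w +ʳ im z *ʳ im w
  cross = re z *ʳ im w +ʳ -ʳ (im z *ʳ re w)
  -- Cauchy-Schwarz by Lagrange's identity dot² + cross² = |z|²|w|².
  dot≤ab : dot ≤ʳ a *ʳ b
  dot≤ab = square-cancel-≤ (*ʳ-nonNeg p r) (begin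
    dot *ʳ dot            ≤⟨ ≤-by (square-nonNeg cross) (solve 4 (λ a b c d →
                               (a :* c :+ b :* d) :* (a :* c :+ b :* d) :+ (a :* d :- b :* c) :* (a :* d :- b :* c)
                                 := (a :* a :+ b :* b) :* (c :* c :+ d :* d)) ≃ʳ-refl (re z) (im z) (re w) (im w)) ⟩
    normSq z *ʳ normSq w  ≤⟨ *ʳ-mono-≤ (normSq-nonNeg z) (square-nonNeg b) q s ⟩
    a *ʳ a *ʳ (b *ʳ b)    ≈⟨ solve 2 (λ a b → a :* a :* (b :* b) := a :* b :* (a :* b)) ≃ʳ-refl a b ⟩
    a *ʳ b *ʳ (a *ʳ b)    ∎)

norm-neg : ∀ {z a} → ∥ z ∥≤ a → ∥ -ᶜ z ∥≤ a
norm-neg {z} (bound p q) = bound p (≤ʳ-trans (≤ʳ-reflexive (normSq-neg z)) q)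

norm-fromℝ : ∀ {x} → 0ʳ ≤ʳ x → ∥ fromℝ x ∥≤ x
norm-fromℝ {x} 0≤x = bound 0≤x (≤ʳ-reflexive (normSq-fromℝ x))

norm-0 : ∀ {a} → 0ʳ ≤ʳ a → ∥ 0ᶜ ∥≤ a
norm-0 0≤a = norm-weaken 0≤a (norm-fromℝ ≤ʳ-refl)

norm-diff-sym : ∀ {z w a} → ∥ z +ᶜ -ᶜ w ∥≤ a → ∥ w +ᶜ -ᶜ z ∥≤ a
norm-diff-sym {z} {w} h = norm-resp (solve 2 (λ z w → :- (z :- w) := w :- z) ≃-refl z w) (norm-neg h)
  where open ℂ-Solver

norm-triangle : ∀ {z w v a b} → ∥ z +ᶜ -ᶜ w ∥≤ a → ∥ w +ᶜ -ᶜ v ∥≤ b → ∥ z +ᶜ -ᶜ v ∥≤ (a +ʳ b)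
norm-triangle {z} {w} {v} h k = norm-resp (solve 3 (λ z w v → (z :- w) :+ (w :- v) := z :- v) ≃-refl z w v) (norm-+ h k)
  where open ℂ-Solver

norm-exists : ∀ z → ∃[ K ] ∥ z ∥≤ ⟨ nat K ⟩
norm-exists z = let M , h = ℝ-archimedean (normSq z) 0<1ʳ
                    h′ = <⇒≤ʳ (<ʳ-respʳ (*ʳ-identityʳ ⟨ nat M ⟩) h)
                in suc M , bound (⟨⟩-mono-≤ (nat-nonNeg (suc M)))
                     (≤ʳ-trans h′ (≤ʳ-trans (⟨⟩-mono-≤ (nat-mono-≤ {M} {suc M ℕ.* suc M} (M≤[1+M]² M)))
                       (≤ʳ-reflexive (≃ʳ-trans (⟨⟩-cong (nat-* (suc M) (suc M))) (⟨⟩-* _ _)))))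
  where
  M≤[1+M]² : ∀ M → M ℕ.≤ suc M ℕ.* suc M
  M≤[1+M]² M = ℕ.≤-trans (ℕ.n≤1+n M) (ℕ.m≤m*n (suc M) (suc M))

re-bound : ∀ {z a} → ∥ z ∥≤ a → re z ≤ʳ a
re-bound {z} (bound p q) = square-cancel-≤ p (≤ʳ-trans (≤-by (square-nonNeg (im z)) ≃ʳ-refl) q)

im-bound : ∀ {z a} → ∥ z ∥≤ a → im z ≤ʳ a
im-bound {z} (bound p q) = square-cancel-≤ p (≤ʳ-trans (≤-by (square-nonNeg (re z)) (+ʳ-comm _ _)) q)

norm-i : ∥ i ∥≤ 1ʳ
norm-i = bound (<⇒≤ʳ 0<1ʳ) (≤ʳ-reflexive (≃ʳ-trans (+ʳ-cong (*ʳ-cong re-i re-i) (*ʳ-cong im-i im-i))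
  (solve 0 (con 0ℚ :* con 0ℚ :+ con 1ℚ :* con 1ℚ := con 1ℚ :* con 1ℚ) ≃ʳ-refl)))
  where open ℝ-Solver

abs-bound : ∀ {x a} → x ≤ʳ a → -ʳ x ≤ʳ a → ∥ fromℝ x ∥≤ a
abs-bound {x} {a} x≤a -x≤a = bound 0≤a (≤ʳ-trans (≤ʳ-reflexive (normSq-fromℝ x))
  (≤-by (*ʳ-nonNeg (diff-nonNegʳ x≤a) (diff-nonNegʳ -x≤a))
    (solve 2 (λ x a → x :* x :+ (a :- x) :* (a :- (:- x)) := a :* a) ≃ʳ-refl x a)))
  where
  open ℝ-Solver
  0≤a : 0ʳ ≤ʳ a
  0≤a = ≮⇒≥ λ a<0 → ≤⇒≯ -x≤a (<ʳ-trans a<0 (neg-pos (≤-<ʳ-trans x≤a a<0)))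

opaque
  unfolding _≃_

  cartesian : ∀ z → z ≃ fromℝ (re z) +ᶜ i *ᶜ fromℝ (im z)
  cartesian (a +i b) =
      solve 2 (λ a b → a := a :+ (con 0ℚ :* b :- con 1ℚ :* con 0ℚ)) ≃ʳ-refl a b
    , solve 2 (λ a b → b := con 0ℚ :+ (con 0ℚ :* con 0ℚ :+ con 1ℚ :* b)) ≃ʳ-refl a b
    where open ℝ-Solver

norm-cartesian : ∀ {z a} → ∥ fromℝ (re z) ∥≤ a → ∥ fromℝ (im z) ∥≤ a → ∥ z ∥≤ (a +ʳ a)
norm-cartesian {z} {a} h k = norm-resp (≃-sym (cartesian z))
  (norm-+ h (norm-weaken (≤ʳ-reflexive (*ʳ-identityˡ a)) (norm-* norm-i k)))

norm-infinitesimal : ∀ {z} → (∀ q → 0ℚ ℚ.< q → ∥ z ∥≤ ⟨ q ⟩) → z ≃ 0ᶜ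
norm-infinitesimal {z} h = ≃-intro
  (≃ʳ-trans (small⇒0 (λ q 0<q → re-bound (h q 0<q)) λ q 0<q → ≤ʳ-trans (≤ʳ-reflexive (≃ʳ-sym (re-neg z))) (re-bound (norm-neg (h q 0<q))))
    (≃ʳ-sym (re-fromℝ 0ʳ)))
  (≃ʳ-trans (small⇒0 (λ q 0<q → im-bound (h q 0<q)) λ q 0<q → ≤ʳ-trans (≤ʳ-reflexive (≃ʳ-sym (im-neg z))) (im-bound (norm-neg (h q 0<q))))
    (≃ʳ-sym (im-fromℝ 0ʳ)))
  where
  open ℝ-Solver
  small⇒0 : ∀ {x} → (∀ q → 0ℚ ℚ.< q → x ≤ʳ ⟨ q ⟩) → (∀ q → 0ℚ ℚ.< q → -ʳ x ≤ʳ ⟨ q ⟩) → x ≃ʳ 0ʳ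
  small⇒0 {x} h k = ≤ʳ-antisym
    (≤ʳ-limit λ q 0<q → ≤ʳ-trans (h q 0<q) (≤ʳ-reflexive (≃ʳ-sym (+ʳ-identityˡ _))))
    (≤ʳ-limit λ q 0<q → ≤ʳ-trans (≤ʳ-reflexive (solve 1 (λ x → con 0ℚ := x :+ (:- x)) ≃ʳ-refl x)) (+ʳ-monoʳ-≤ x (k q 0<q)))

normSq-zero : ∀ {z} → normSq z ≃ʳ 0ʳ → z ≃ 0ᶜ
normSq-zero {z} e = norm-infinitesimal λ q 0<q → bound (<⇒≤ʳ (⟨⟩-mono-< 0<q))
  (≤ʳ-trans (≤ʳ-reflexive e) (square-nonNeg ⟨ q ⟩))

-- From `¬ w ≃ 0ᶜ` no positive lower bound for |w| can be computed. Stability of `≃` allows arguing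
-- from `¬ z ≃ 0ᶜ` instead, and multiplicativity of `normSq` moves the question to the reals.
*ᶜ-cancel-0 : ∀ {z w} → z *ᶜ w ≃ 0ᶜ → ¬ w ≃ 0ᶜ → z ≃ 0ᶜ
*ᶜ-cancel-0 {z} {w} zw≃0 w≄0 = ≃-stable λ z≄0 → w≄0 (normSq-zero (≤ʳ-antisym
  (≮⇒≥ λ 0<w → z≄0 (normSq-zero (*ʳ-cancel-0
    (≃ʳ-trans (≃ʳ-sym (normSq-* z w)) (≃ʳ-trans (normSq-cong zw≃0)
      (≃ʳ-trans (normSq-fromℝ 0ʳ) (*ʳ-zeroˡ 0ʳ)))) 0<w)))
  (normSq-nonNeg w)))

-- Completeness of the complex numbers

module _ (u : ℕ → ℂ) (b : ℕ → ℝ)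
  (u-close : ∀ m n → m ℕ.≤ n → ∥ u n +ᶜ -ᶜ u m ∥≤ b m)
  (b→0 : ∀ q → 0ℚ ℚ.< q → ∃[ M ] (∀ m → M ℕ.≤ m → b m ≤ʳ ⟨ q ⟩))
  where

  private
    module Part (part : ℂ → ℝ) (part-bound : ∀ {z a} → ∥ z ∥≤ a → part z ≤ʳ a)
      (part-diff : ∀ z w → part (z +ᶜ -ᶜ w) ≃ʳ part z +ʳ -ʳ part w) where
      open ℝ-Solver

      move : ∀ {z w c} → ∥ z +ᶜ -ᶜ w ∥≤ c → part z ≤ʳ part w +ʳ c
      move {z} {w} {c} h = ≤ʳ-trans (≤ʳ-reflexive (solve 2 (λ z w → z := w :+ (z :- w)) ≃ʳ-refl (part z) (part w)))
        (+ʳ-monoʳ-≤ (part w) (≤ʳ-trans (≤ʳ-reflexive (≃ʳ-sym (part-diff z w))) (part-bound h)))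

      part-cauchy : ∀ q → 0ℚ ℚ.< q → ∃[ N ] (∀ m n → N ℕ.≤ m → N ℕ.≤ n → part (u m) ≤ʳ part (u n) +ʳ ⟨ q ⟩)
      part-cauchy q 0<q = let N , h = b→0 q 0<q in N , λ m n N≤m N≤n →
        move ([ (λ m≤n → norm-diff-sym (norm-weaken (h m N≤m) (u-close m n m≤n)))
              , (λ n≤m → norm-weaken (h n N≤n) (u-close n m n≤m)) ]′ (ℕ.≤-total m n))

      part-limit : ℝ
      part-limit = limit (λ m → part (u m)) part-cauchy

      close : ∀ m → part-limit ≤ʳ part (u m) +ʳ b m × part (u m) ≤ʳ part-limit +ʳ b m
      close m = ≤ʳ-limit (λ q 0<q → let N , h = limit-close (λ m → part (u m)) part-cauchy q 0<q
                                        n = m ℕ.⊔ N in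
                  ≤ʳ-trans (proj₂ (h n (ℕ.m≤n⊔m m N))) (+ʳ-monoˡ-≤ ⟨ q ⟩ (move (u-close m n (ℕ.m≤m⊔n m N)))))
              , ≤ʳ-limit (λ q 0<q → let N , h = limit-close (λ m → part (u m)) part-cauchy q 0<q
                                        n = m ℕ.⊔ N in
                  ≤ʳ-trans (move (norm-diff-sym (u-close m n (ℕ.m≤m⊔n m N))))
                    (≤ʳ-trans (+ʳ-monoˡ-≤ (b m) (proj₁ (h n (ℕ.m≤n⊔m m N))))
                      (≤ʳ-reflexive (solve 3 (λ x y z → x :+ y :+ z := x :+ z :+ y) ≃ʳ-refl part-limit ⟨ q ⟩ (b m)))))

      close-norm : ∀ m → ∥ fromℝ (part-limit +ʳ -ʳ part (u m)) ∥≤ b m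
      close-norm m = abs-bound (shift (proj₁ (close m)))
        (≤ʳ-trans (≤ʳ-reflexive (solve 2 (λ x y → :- (x :- y) := y :- x) ≃ʳ-refl part-limit (part (u m)))) (shift (proj₂ (close m))))
        where
        shift : ∀ {x y c} → x ≤ʳ y +ʳ c → x +ʳ -ʳ y ≤ʳ c
        shift {x} {y} {c} h = ≤ʳ-trans (+ʳ-monoˡ-≤ (-ʳ y) h)
          (≤ʳ-reflexive (solve 2 (λ y c → y :+ c :- y := c) ≃ʳ-refl y c))

    module Re = Part re re-bound (λ z w → ≃ʳ-trans (re-+ z (-ᶜ w)) (+ʳ-cong ≃ʳ-refl (re-neg w)))
    module Im = Part im im-bound (λ z w → ≃ʳ-trans (im-+ z (-ᶜ w)) (+ʳ-cong ≃ʳ-refl (im-neg w)))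

  limitᶜ : ℂ
  limitᶜ = Re.part-limit +i Im.part-limit

  limitᶜ-close : ∀ m → ∥ limitᶜ +ᶜ -ᶜ u m ∥≤ (b m +ʳ b m)
  limitᶜ-close m = norm-cartesian
    (norm-resp (fromℝ-cong (≃ʳ-sym (≃ʳ-trans (re-+ _ _) (+ʳ-cong ≃ʳ-refl (re-neg (u m)))))) (Re.close-norm m))
    (norm-resp (fromℝ-cong (≃ʳ-sym (≃ʳ-trans (im-+ _ _) (+ʳ-cong ≃ʳ-refl (im-neg (u m)))))) (Im.close-norm m))

-- Finite sums and convergence

open SemiringExp (CommutativeRing.semiring ℂ-commutativeRing) using ()
  renaming (_^_ to _^ᶜ_; ^-homo-* to ^ᶜ-homo-*; ^-assocʳ to ^ᶜ-assocʳ; ^-congˡ to ^ᶜ-congˡ)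

sum : (ℕ → ℂ) → ℕ → ℂ
sum f zero    = 0ᶜ
sum f (suc n) = sum f n +ᶜ f n

sum-cong : ∀ {f g} n → (∀ k → k ℕ.< n → f k ≃ g k) → sum f n ≃ sum g n
sum-cong zero    h = ≃-refl
sum-cong (suc n) h = +ᶜ-cong (sum-cong n λ k k<n → h k (ℕ.m<n⇒m<1+n k<n)) (h n (ℕ.n<1+n n))

sum-+ : ∀ f g n → sum (λ k → f k +ᶜ g k) n ≃ sum f n +ᶜ sum g n
sum-+ f g zero    = ≃-sym (+ᶜ-identityˡ 0ᶜ)
sum-+ f g (suc n) = ≃-trans (+ᶜ-cong (sum-+ f g n) ≃-refl)
  (solve 4 (λ a b c d → (a :+ b) :+ (c :+ d) := (a :+ c) :+ (b :+ d)) ≃-refl (sum f n) (sum g n) (f n) (g n))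
  where open ℂ-Solver

sum-*ˡ : ∀ c f n → sum (λ k → c *ᶜ f k) n ≃ c *ᶜ sum f n
sum-*ˡ c f zero    = ≃-sym (*ᶜ-zeroʳ c)
sum-*ˡ c f (suc n) = ≃-trans (+ᶜ-cong (sum-*ˡ c f n) ≃-refl) (≃-sym (*ᶜ-distribˡ-+ᶜ c (sum f n) (f n)))

sum-0 : ∀ n → sum (λ _ → 0ᶜ) n ≃ 0ᶜ
sum-0 zero    = ≃-refl
sum-0 (suc n) = ≃-trans (+ᶜ-cong (sum-0 n) ≃-refl) (+ᶜ-identityˡ 0ᶜ)

sum-swap : ∀ (f : ℕ → ℕ → ℂ) m n → sum (λ j → sum (f j) n) m ≃ sum (λ k → sum (λ j → f j k) m) n
sum-swap f zero    n = ≃-sym (sum-0 n)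
sum-swap f (suc m) n = ≃-trans (+ᶜ-cong (sum-swap f m n) ≃-refl) (≃-sym (sum-+ (λ k → sum (λ j → f j k) m) (f m) n))

sum-head : ∀ f n → sum f (suc n) ≃ f 0 +ᶜ sum (λ k → f (suc k)) n
sum-head f zero    = +ᶜ-comm 0ᶜ (f 0)
sum-head f (suc n) = ≃-trans (+ᶜ-cong (sum-head f n) ≃-refl) (+ᶜ-assoc (f 0) _ (f (suc n)))

norm-sum : ∀ {f a} → 0ʳ ≤ʳ a → ∀ n → (∀ k → k ℕ.< n → ∥ f k ∥≤ a) → ∥ sum f n ∥≤ (⟨ nat n ⟩ *ʳ a)
norm-sum {a = a} 0≤a zero    h = norm-0 (*ʳ-nonNeg (⟨⟩-mono-≤ (nat-nonNeg 0)) 0≤a)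
norm-sum {a = a} 0≤a (suc n) h = norm-weaken (≤ʳ-reflexive eq)
  (norm-+ (norm-sum 0≤a n λ k k<n → h k (ℕ.m<n⇒m<1+n k<n)) (h n (ℕ.n<1+n n)))
  where
  open ℝ-Solver
  eq : ⟨ nat n ⟩ *ʳ a +ʳ a ≃ʳ ⟨ nat (suc n) ⟩ *ʳ a
  eq = ≃ʳ-trans (solve 2 (λ n a → n :* a :+ a := (con 1ℚ :+ n) :* a) ≃ʳ-refl ⟨ nat n ⟩ a)
    (*ʳ-cong (≃ʳ-sym (≃ʳ-trans (⟨⟩-cong (nat-+ 1 n)) (⟨⟩-+ 1ℚ (nat n)))) ≃ʳ-refl)

-- Telescoping: each term is paid for by a drop of b, and the drops from m on add up to at most
-- `b m`. Geometric tails are estimated this way without summing a series.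
norm-sum-tail : ∀ {f} {b : ℕ → ℝ} m → (∀ k → 0ʳ ≤ʳ b k) → (∀ k → m ℕ.≤ k → ∥ f k ∥≤ (b k +ʳ -ʳ b (suc k))) →
  ∀ n → m ℕ.≤ n → ∥ sum f n +ᶜ -ᶜ sum f m ∥≤ b m
norm-sum-tail {f} {b} m 0≤b h n m≤n = subst (λ n → ∥ sum f n +ᶜ -ᶜ sum f m ∥≤ b m) (ℕ.m∸n+n≡m m≤n)
  (norm-weaken (≤-by (0≤b (n ℕ.∸ m ℕ.+ m)) (solveʳ 2 (λ x y → x :- y :+ y := x) ≃ʳ-refl (b m) (b (n ℕ.∸ m ℕ.+ m))))
    (go (n ℕ.∸ m)))
  where
  open ℝ-Solver renaming (solve to solveʳ)
  go : ∀ j → ∥ sum f (j ℕ.+ m) +ᶜ -ᶜ sum f m ∥≤ (b m +ʳ -ʳ b (j ℕ.+ m))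
  go zero = norm-weaken (≤ʳ-reflexive (solveʳ 1 (λ x → con 0ℚ := x :- x) ≃ʳ-refl (b m)))
    (norm-resp (≃-sym (-ᶜ-inverseʳ (sum f m))) (norm-0 ≤ʳ-refl))
  go (suc j) = norm-weaken (≤ʳ-reflexive (solveʳ 3 (λ x y z → x :- y :+ (y :- z) := x :- z) ≃ʳ-refl (b m) (b (j ℕ.+ m)) (b (suc j ℕ.+ m))))
    (norm-resp (ℂ-Solver.solve 3 (λ s t u → (s ℂ-Solver.:- t) ℂ-Solver.:+ u ℂ-Solver.:= (s ℂ-Solver.:+ u) ℂ-Solver.:- t) ≃-refl _ _ _)
      (norm-+ (go j) (h (j ℕ.+ m) (ℕ.m≤n+m m j))))

halves : ∀ q → q ℚ.* ℚ.½ ℚ.+ q ℚ.* ℚ.½ ≡ q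
halves q = trans (sym (ℚ.*-distribˡ-+ q ℚ.½ ℚ.½)) (ℚ.*-identityʳ q)

infix 4 _⇝_
_⇝_ : (ℕ → ℂ) → ℂ → Set
u ⇝ z = ∀ q → 0ℚ ℚ.< q → ∃[ M ] (∀ m → M ℕ.≤ m → ∥ u m +ᶜ -ᶜ z ∥≤ ⟨ q ⟩)

⇝-unique : ∀ {u z w} → u ⇝ z → u ⇝ w → z ≃ w
⇝-unique {u} {z} {w} h k = ≃-trans (solve 2 (λ z w → z := (z :- w) :+ w) ≃-refl z w)
  (≃-trans (+ᶜ-cong (norm-infinitesimal λ q 0<q →
    let 0<½q = *-pos 0<q (ℚ.positive⁻¹ ℚ.½)
        M , hM = h (q ℚ.* ℚ.½) 0<½q
        N , kN = k (q ℚ.* ℚ.½) 0<½q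
        n = M ℕ.⊔ N
    in norm-weaken (≤ʳ-reflexive (≃ʳ-trans (≃ʳ-sym (⟨⟩-+ _ _)) (⟨⟩-cong (halves q))))
         (norm-triangle (norm-diff-sym (hM n (ℕ.m≤m⊔n M N))) (kN n (ℕ.m≤n⊔m M N)))) ≃-refl) (+ᶜ-identityˡ w))
  where
  open ℂ-Solver

⇝-cong : ∀ {u v z w} → (∀ m → u m ≃ v m) → z ≃ w → u ⇝ z → v ⇝ w
⇝-cong u≃v z≃w h q 0<q = let M , k = h q 0<q in M , λ m M≤m →
  norm-resp (+ᶜ-cong (u≃v m) (-ᶜ-cong z≃w)) (k m M≤m)

⇝-const : ∀ {z} → (λ _ → z) ⇝ z
⇝-const {z} q 0<q = 0 , λ _ _ →
  norm-resp (≃-sym (-ᶜ-inverseʳ z)) (norm-0 (<⇒≤ʳ (⟨⟩-mono-< 0<q)))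

⇝-+ : ∀ {u v z w} → u ⇝ z → v ⇝ w → (λ m → u m +ᶜ v m) ⇝ z +ᶜ w
⇝-+ {u} {v} {z} {w} h k q 0<q =
  let 0<½q = *-pos 0<q (ℚ.positive⁻¹ ℚ.½)
      M , hM = h (q ℚ.* ℚ.½) 0<½q
      N , kN = k (q ℚ.* ℚ.½) 0<½q
  in M ℕ.⊔ N , λ n n≥ → norm-resp (solve 4 (λ a b c d → (a :- b) :+ (c :- d) := (a :+ c) :- (b :+ d)) ≃-refl (u n) z (v n) w)
       (norm-weaken (≤ʳ-reflexive (≃ʳ-trans (≃ʳ-sym (⟨⟩-+ _ _)) (⟨⟩-cong (halves q))))
         (norm-+ (hM n (ℕ.≤-trans (ℕ.m≤m⊔n M N) n≥)) (kN n (ℕ.≤-trans (ℕ.m≤n⊔m M N) n≥))))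
  where
  open ℂ-Solver

⇝-neg : ∀ {u z} → u ⇝ z → (λ m → -ᶜ u m) ⇝ -ᶜ z
⇝-neg {u} {z} h q 0<q = let M , k = h q 0<q in M , λ m M≤m →
  norm-resp (solve 2 (λ a b → :- (a :- b) := (:- a) :- (:- b)) ≃-refl (u m) z) (norm-neg (k m M≤m))
  where open ℂ-Solver

⇝-* : ∀ {u v z w} → u ⇝ z → v ⇝ w → (λ m → u m *ᶜ v m) ⇝ z *ᶜ w
⇝-* {u} {v} {z} {w} h k q 0<q =
  let K , w≤K = norm-exists w
      L , z≤L = norm-exists z
      -- From uv - zw = u(v - w) + (u - z)w the error is at most (1 + L)δ + δK for δ ≤ 1, and
      -- `reciprocal (K + L)` is 1/(1 + K + L).
      n , small = reciprocal-small (*-pos 0<q (reciprocal-pos (K ℕ.+ L)))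
      δ = reciprocal n
      M , hM = h δ (reciprocal-pos n)
      N , kN = k δ (reciprocal-pos n)
  in M ℕ.⊔ N , λ m m≥ →
    let u-z = hM m (ℕ.≤-trans (ℕ.m≤m⊔n M N) m≥)
        v-w = kN m (ℕ.≤-trans (ℕ.m≤n⊔m M N) m≥)
        u≤ = norm-resp (solve 2 (λ a b → (a :- b) :+ b := a) ≃-refl (u m) z)
               (norm-+ (norm-weaken (⟨⟩-mono-≤ (reciprocal≤1 n)) u-z) z≤L)
    in norm-resp (solve 4 (λ a b c d → a :* (b :- d) :+ (a :- c) :* d := a :* b :- c :* d) ≃-refl (u m) (v m) z w)
         (norm-weaken (≤ʳ-trans (≤ʳ-reflexive (total K L δ))
             (⟨⟩-mono-≤ (subst (nat (suc (K ℕ.+ L)) ℚ.* δ ℚ.≤_) (scaled-reciprocal q (K ℕ.+ L))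
                (ℚ.*-monoˡ-≤-nonNeg (nat (suc (K ℕ.+ L))) {{ℚ.nonNegative (nat-nonNeg (suc (K ℕ.+ L)))}}
                  (ℚ.<⇒≤ (small n ℕ.≤-refl))))))
           (norm-+ (norm-* u≤ v-w) (norm-* u-z w≤K)))
  where
  open ℂ-Solver
  total : ∀ K L δ → (1ʳ +ʳ ⟨ nat L ⟩) *ʳ ⟨ δ ⟩ +ʳ ⟨ δ ⟩ *ʳ ⟨ nat K ⟩ ≃ʳ ⟨ nat (suc (K ℕ.+ L)) ℚ.* δ ⟩
  total K L δ = ≃ʳ-trans
    (ℝ-Solver.solve 3 (λ k l d → (con1 r+ l) r* d r+ d r* k r= (con1 r+ (k r+ l)) r* d) ≃ʳ-refl ⟨ nat K ⟩ ⟨ nat L ⟩ ⟨ δ ⟩)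
    (≃ʳ-trans (*ʳ-cong (≃ʳ-sym (≃ʳ-trans (⟨⟩-cong (trans (nat-+ 1 (K ℕ.+ L)) (cong (1ℚ ℚ.+_) (nat-+ K L))))
      (≃ʳ-trans (⟨⟩-+ _ _) (+ʳ-cong ≃ʳ-refl (⟨⟩-+ _ _))))) ≃ʳ-refl) (≃ʳ-sym (⟨⟩-* _ δ)))
    where
    open ℝ-Solver using () renaming (_:*_ to _r*_; _:+_ to _r+_; _:=_ to _r=_)
    con1 = ℝ-Solver.con 1ℚ

⇝-bound : ∀ {u z} (b : ℕ → ℝ) → (∀ m → ∥ u m +ᶜ -ᶜ z ∥≤ b m) →
  (∀ q → 0ℚ ℚ.< q → ∃[ M ] (∀ m → M ℕ.≤ m → b m ≤ʳ ⟨ q ⟩)) → u ⇝ z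
⇝-bound b h b→0 q 0<q = let M , k = b→0 q 0<q in M , λ m M≤m → norm-weaken (k m M≤m) (h m)

-- The exponential function

-- zᵏ/k!, built from the successive ratios z/(k + 1) so that estimates go by recursion; `expTerm-≃`
-- compares it with the factorial form.
term : ℂ → ℕ → ℂ
term z zero    = 1ᶜ
term z (suc k) = term z k *ᶜ (z *ᶜ ⟪ reciprocal k ⟫)

term-cong : ∀ {z w} → z ≃ w → ∀ k → term z k ≃ term w k
term-cong e zero    = ≃-refl
term-cong e (suc k) = *ᶜ-cong (term-cong e k) (*ᶜ-cong e ≃-refl)

term-suc : ∀ z k → ⟪ nat (suc k) ⟫ *ᶜ term z (suc k) ≃ z *ᶜ term z k
term-suc z k = begin
  ⟪ nat (suc k) ⟫ *ᶜ (term z k *ᶜ (z *ᶜ ⟪ reciprocal k ⟫))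
    ≈⟨ solve 4 (λ n t z r → n :* (t :* (z :* r)) := (n :* r) :* (z :* t)) ≃-refl _ _ _ _ ⟩
  ⟪ nat (suc k) ⟫ *ᶜ ⟪ reciprocal k ⟫ *ᶜ (z *ᶜ term z k)
    ≈⟨ *ᶜ-cong (≃-trans (≃-sym (⟪⟫-* _ _)) (⟪⟫-cong (reciprocal-inverse k))) ≃-refl ⟩
  1ᶜ *ᶜ (z *ᶜ term z k)
    ≈⟨ *ᶜ-identityˡ _ ⟩
  z *ᶜ term z k ∎
  where
  open ≃-Reasoning
  open ℂ-Solver

-- The bound is c 0 + ... + c M, which serves as well as a maximum and needs no comparison of reals.
bounded-of-eventually-decreasing : ∀ M (c : ℕ → ℝ) → (∀ k → 0ʳ ≤ʳ c k) → (∀ k → M ℕ.≤ k → c (suc k) ≤ʳ c k) →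
  ∃[ K ] 0ʳ ≤ʳ K × (∀ k → c k ≤ʳ K)
bounded-of-eventually-decreasing zero c 0≤c h = c 0 , 0≤c 0 , go
  where
  go : ∀ k → c k ≤ʳ c 0
  go zero    = ≤ʳ-refl
  go (suc k) = ≤ʳ-trans (h k ℕ.z≤n) (go k)
bounded-of-eventually-decreasing (suc M) c 0≤c h =
  let K , 0≤K , c≤K = bounded-of-eventually-decreasing M (λ k → c (suc k)) (λ k → 0≤c (suc k)) (λ k M≤k → h (suc k) (ℕ.s≤s M≤k))
  in c 0 +ʳ K , ≤ʳ-trans (0≤c 0) (≤-by 0≤K ≃ʳ-refl) , λ where
    zero    → ≤-by 0≤K ≃ʳ-refl
    (suc k) → ≤ʳ-trans (c≤K k) (≤-by (0≤c 0) (+ʳ-comm K (c 0)))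

θ : ℝ
θ = ⟨ ℚ.½ ⟩

0≤θ : 0ʳ ≤ʳ θ
0≤θ = ⟨⟩-mono-≤ (ℚ.<⇒≤ (ℚ.positive⁻¹ ℚ.½))

θ[1+1]≤1 : θ *ʳ (1ʳ +ʳ 1ʳ) ≤ʳ 1ʳ
θ[1+1]≤1 = ≤ʳ-reflexive (solve 0 (con ℚ.½ :* (con 1ℚ :+ con 1ℚ) := con 1ℚ) ≃ʳ-refl)
  where open ℝ-Solver

-- ρ k = 4⁻ᵏ is kept as a square: in the Cauchy product one factor 2⁻ᵐ absorbs the number m of terms.
ρ : ℕ → ℝ
ρ k = θ ^ʳ k *ʳ θ ^ʳ k

0≤ρ : ∀ k → 0ʳ ≤ʳ ρ k
0≤ρ k = square-nonNeg (θ ^ʳ k)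

Dominated : (ℕ → ℂ) → ℝ → Set
Dominated f K = 0ʳ ≤ʳ K × (∀ k → ∥ f k ∥≤ (K *ʳ ρ k))

reciprocal-nonNeg : ∀ k → 0ʳ ≤ʳ ⟨ reciprocal k ⟩
reciprocal-nonNeg k = ⟨⟩-mono-≤ (ℚ.<⇒≤ (reciprocal-pos k))

-- `c k` bounds 4ᵏ|zᵏ/k!|. With R a natural number bounding |z|, its ratios 4R/(k + 1) are at most 1
-- from k = 4R on.
term-dominated : ∀ z → ∃[ K ] Dominated (term z) K
term-dominated z = let K , 0≤K , c≤K = bounded-of-eventually-decreasing (4 ℕ.* R) c 0≤c decreasing in
  K , 0≤K , λ k → norm-weaken (*ʳ-monoˡ-≤ (ρ k) (0≤ρ k) (c≤K k)) (bounds k)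
  where
  R = proj₁ (norm-exists z)
  z≤R = proj₂ (norm-exists z)
  factor : ℕ → ℝ
  factor k = ⟨ nat 4 ⟩ *ʳ ⟨ nat R ⟩ *ʳ ⟨ reciprocal k ⟩
  0≤factor : ∀ k → 0ʳ ≤ʳ factor k
  0≤factor k = *ʳ-nonNeg (*ʳ-nonNeg (⟨⟩-mono-≤ (nat-nonNeg 4)) (⟨⟩-mono-≤ (nat-nonNeg R))) (reciprocal-nonNeg k)
  c : ℕ → ℝ
  c zero    = 1ʳ
  c (suc k) = c k *ʳ factor k
  0≤c : ∀ k → 0ʳ ≤ʳ c k
  0≤c zero    = <⇒≤ʳ 0<1ʳ
  0≤c (suc k) = *ʳ-nonNeg (0≤c k) (0≤factor k)
  factor≤1 : ∀ k → 4 ℕ.* R ℕ.≤ k → factor k ≤ʳ 1ʳ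
  factor≤1 k 4R≤k = begin
    ⟨ nat 4 ⟩ *ʳ ⟨ nat R ⟩ *ʳ ⟨ reciprocal k ⟩
      ≈⟨ *ʳ-cong (≃ʳ-trans (≃ʳ-sym (⟨⟩-* _ _)) (⟨⟩-cong (sym (nat-* 4 R)))) ≃ʳ-refl ⟩
    ⟨ nat (4 ℕ.* R) ⟩ *ʳ ⟨ reciprocal k ⟩
      ≤⟨ *ʳ-monoˡ-≤ _ (reciprocal-nonNeg k) (⟨⟩-mono-≤ (nat-mono-≤ (ℕ.≤-trans 4R≤k (ℕ.n≤1+n k)))) ⟩
    ⟨ nat (suc k) ⟩ *ʳ ⟨ reciprocal k ⟩
      ≈⟨ ≃ʳ-trans (≃ʳ-sym (⟨⟩-* _ _)) (⟨⟩-cong (reciprocal-inverse k)) ⟩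
    1ʳ ∎
    where open ≤ʳ-Reasoning
  decreasing : ∀ k → 4 ℕ.* R ℕ.≤ k → c (suc k) ≤ʳ c k
  decreasing k h = ≤ʳ-trans (*ʳ-monoʳ-≤ (c k) (0≤c k) (factor≤1 k h))
    (≤ʳ-reflexive (*ʳ-identityʳ (c k)))
  open ℝ-Solver
  bounds : ∀ k → ∥ term z k ∥≤ (c k *ʳ ρ k)
  bounds zero = norm-weaken (≤ʳ-reflexive (solve 0 (con 1ℚ := con 1ℚ :* (con 1ℚ :* con 1ℚ)) ≃ʳ-refl)) (norm-fromℝ (<⇒≤ʳ 0<1ʳ))
  bounds (suc k) = norm-weaken (≤ʳ-reflexive
    (solve 4 (λ c t r s → c :* (t :* t) :* (r :* s)
        := c :* (con (nat 4) :* r :* s) :* (con ℚ.½ :* t :* (con ℚ.½ :* t)))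
      ≃ʳ-refl (c k) (θ ^ʳ k) ⟨ nat R ⟩ ⟨ reciprocal k ⟩))
    (norm-* (bounds k) (norm-* z≤R (norm-fromℝ (reciprocal-nonNeg k))))

-- The exact tail of Σ K 4⁻ᵏ has the constant 4/3. The constant 2 leaves room: 2K 4⁻ᵏ drops by
-- (3/2)K 4⁻ᵏ at each step, more than the term that has to be paid for.
tail : ℝ → ℕ → ℝ
tail K k = ⟨ nat 2 ⟩ *ʳ (K *ʳ ρ k)

Kρ-nonNeg : ∀ {K} → 0ʳ ≤ʳ K → ∀ k → 0ʳ ≤ʳ K *ʳ ρ k
Kρ-nonNeg 0≤K k = *ʳ-nonNeg 0≤K (0≤ρ k)

tail-nonNeg : ∀ {K} → 0ʳ ≤ʳ K → ∀ k → 0ʳ ≤ʳ tail K k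
tail-nonNeg 0≤K k = *ʳ-nonNeg (⟨⟩-mono-≤ (nat-nonNeg 2)) (Kρ-nonNeg 0≤K k)

sum-close : ∀ {f K} → Dominated f K → ∀ m n → m ℕ.≤ n → ∥ sum f n +ᶜ -ᶜ sum f m ∥≤ tail K m
sum-close {f} {K} (0≤K , h) m = norm-sum-tail m (tail-nonNeg 0≤K) λ k _ → norm-weaken
  (≤-by (*ʳ-nonNeg (⟨⟩-mono-≤ (ℚ.<⇒≤ (ℚ.positive⁻¹ ℚ.½))) (Kρ-nonNeg 0≤K k))
    (solve 2 (λ K t → K :* (t :* t) :+ con ℚ.½ :* (K :* (t :* t))
      := con (nat 2) :* (K :* (t :* t)) :- con (nat 2) :* (K :* (con ℚ.½ :* t :* (con ℚ.½ :* t)))) ≃ʳ-refl K (θ ^ʳ k)))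
  (h k)
  where open ℝ-Solver

m*ρ≤θ : ∀ m → ⟨ nat m ⟩ *ʳ ρ m ≤ʳ θ ^ʳ m
m*ρ≤θ m = ≤ʳ-trans (≤-by (0≤ρ m)
    (solve 2 (λ k t → k :* (t :* t) :+ t :* t := t :* (t :* (con 1ℚ :+ k :* con 1ℚ))) ≃ʳ-refl ⟨ nat m ⟩ (θ ^ʳ m)))
  (≤ʳ-trans (*ʳ-monoʳ-≤ (θ ^ʳ m) (^ʳ-nonNeg 0≤θ m) (bernoulli 0≤θ 0<1ʳ θ[1+1]≤1 m))
    (≤ʳ-reflexive (*ʳ-identityʳ _)))
  where open ℝ-Solver

θ→0 : ∀ K → 0ʳ ≤ʳ K → ∀ q → 0ℚ ℚ.< q → ∃[ M ] (∀ m → M ℕ.≤ m → K *ʳ θ ^ʳ m ≤ʳ ⟨ q ⟩)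
θ→0 K 0≤K q 0<q = power→0 0≤θ 0<1ʳ θ[1+1]≤1 K (⟨⟩-mono-< 0<q)

θ≤1 : ∀ k → θ ^ʳ k ≤ʳ 1ʳ
θ≤1 zero    = ≤ʳ-refl
θ≤1 (suc k) = ≤ʳ-trans (*ʳ-mono-≤ 0≤θ (<⇒≤ʳ 0<1ʳ) (⟨⟩-mono-≤ {ℚ.½} {1ℚ} (ℚ.<⇒≤ (diff>0⇒< refl))) (θ≤1 k))
  (≤ʳ-reflexive (*ʳ-identityˡ 1ʳ))
  where
  diff>0⇒< : ∀ {p q} → q ℚ.- p ≡ ℚ.½ → p ℚ.< q
  diff>0⇒< e = from-diff (ℚ.positive⁻¹ ℚ.½) (sym e)

tail→0 : ∀ {K} → 0ʳ ≤ʳ K → ∀ q → 0ℚ ℚ.< q → ∃[ M ] (∀ m → M ℕ.≤ m → tail K m ≤ʳ ⟨ q ⟩)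
tail→0 {K} 0≤K q 0<q = let M , h = θ→0 (⟨ nat 2 ⟩ *ʳ K) 0≤2K q 0<q in M , λ m M≤m →
  ≤ʳ-trans (≤-by (*ʳ-nonNeg (*ʳ-nonNeg 0≤2K (^ʳ-nonNeg 0≤θ m)) (diff-nonNegʳ (θ≤1 m)))
    (solve 3 (λ c K t → c :* (K :* (t :* t)) :+ c :* K :* t :* (con 1ℚ :- t) := c :* K :* t) ≃ʳ-refl ⟨ nat 2 ⟩ K (θ ^ʳ m)))
    (h m M≤m)
  where
  open ℝ-Solver
  0≤2K = *ʳ-nonNeg (⟨⟩-mono-≤ (nat-nonNeg 2)) 0≤K

opaque
  expᶜ : ℂ → ℂ
  expᶜ z = let K , dom = term-dominated z in
    limitᶜ (sum (term z)) (tail K) (sum-close dom) (tail→0 (proj₁ dom))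

  exp-limit : ∀ z → sum (term z) ⇝ expᶜ z
  exp-limit z q 0<q = let K , dom = term-dominated z
                          0<½q = *-pos 0<q (ℚ.positive⁻¹ ℚ.½)
                          M , h = tail→0 (proj₁ dom) (q ℚ.* ℚ.½) 0<½q
    in M , λ m M≤m → norm-diff-sym (norm-weaken
      (≤ʳ-trans (+ʳ-mono-≤ (h m M≤m) (h m M≤m)) (≤ʳ-reflexive (≃ʳ-trans (≃ʳ-sym (⟨⟩-+ _ _)) (⟨⟩-cong (halves q)))))
      (limitᶜ-close (sum (term z)) (tail K) (sum-close dom) (tail→0 (proj₁ dom)) m))

exp-cong : ∀ {z w} → z ≃ w → expᶜ z ≃ expᶜ w
exp-cong {z} {w} e = ⇝-unique (exp-limit z)
  (⇝-cong (λ m → sum-cong m λ k _ → term-cong (≃-sym e) k) ≃-refl (exp-limit w))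

convolution : (ℕ → ℂ) → (ℕ → ℂ) → ℕ → ℂ
convolution e f k = sum (λ i → e i *ᶜ f (k ℕ.∸ i)) (suc k)

-- The binomial theorem without binomial coefficients: splitting the weight k + 1 as i + (k + 1 - i)
-- shows that the convolution satisfies (k + 1) C(k + 1) = (z + w) C(k), the recursion of
-- `term (z +ᶜ w)`.
convolution-term : ∀ z w k → convolution (term z) (term w) k ≃ term (z +ᶜ w) k
convolution-term z w zero = solve 0 (con 0ℚ :+ con 1ℚ :* con 1ℚ := con 1ℚ) ≃-refl
  where open ℂ-Solver
convolution-term z w (suc k) = begin
  C
    ≈⟨ solve 3 (λ r n c → c := n :* r :* c :+ (con 1ℚ :- n :* r) :* c) ≃-refl ⟪ reciprocal k ⟫ ⟪ nat (suc k) ⟫ C ⟩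
  n *ᶜ r *ᶜ C +ᶜ (1ᶜ +ᶜ -ᶜ (n *ᶜ r)) *ᶜ C
    ≈⟨ +ᶜ-cong ≃-refl (*ᶜ-cong (+ᶜ-cong ≃-refl (-ᶜ-cong nr≃1)) ≃-refl) ⟩
  n *ᶜ r *ᶜ C +ᶜ (1ᶜ +ᶜ -ᶜ 1ᶜ) *ᶜ C
    ≈⟨ solve 3 (λ r n c → n :* r :* c :+ (con 1ℚ :- con 1ℚ) :* c := r :* (n :* c)) ≃-refl r n C ⟩
  r *ᶜ (n *ᶜ C)
    ≈⟨ *ᶜ-cong ≃-refl derivation ⟩
  r *ᶜ ((z +ᶜ w) *ᶜ convolution (term z) (term w) k)
    ≈⟨ *ᶜ-cong ≃-refl (*ᶜ-cong ≃-refl (convolution-term z w k)) ⟩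
  r *ᶜ ((z +ᶜ w) *ᶜ term (z +ᶜ w) k)
    ≈⟨ solve 3 (λ r s t → r :* (s :* t) := t :* (s :* r)) ≃-refl r (z +ᶜ w) (term (z +ᶜ w) k) ⟩
  term (z +ᶜ w) k *ᶜ ((z +ᶜ w) *ᶜ r) ∎
  where
  open ≃-Reasoning
  open ℂ-Solver
  C = convolution (term z) (term w) (suc k)
  r = ⟪ reciprocal k ⟫
  n = ⟪ nat (suc k) ⟫
  nr≃1 : n *ᶜ r ≃ 1ᶜ
  nr≃1 = ≃-trans (≃-sym (⟪⟫-* _ _)) (⟪⟫-cong (reciprocal-inverse k))
  e f a b : ℕ → ℂ
  e i = term z i
  f i = term w (suc k ℕ.∸ i)
  a i = ⟪ nat i ⟫ *ᶜ e i *ᶜ f i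
  b i = e i *ᶜ (⟪ nat (suc k ℕ.∸ i) ⟫ *ᶜ f i)
  weight : ∀ i → i ℕ.≤ suc k → n *ᶜ (e i *ᶜ f i) ≃ a i +ᶜ b i
  weight i i≤ = ≃-trans (*ᶜ-cong (≃-trans (⟪⟫-cong (trans (cong nat (sym (ℕ.m+[n∸m]≡n i≤))) (nat-+ i (suc k ℕ.∸ i)))) (⟪⟫-+ _ _)) ≃-refl)
    (solve 4 (λ p q s t → (p :+ q) :* (s :* t) := p :* s :* t :+ s :* (q :* t)) ≃-refl _ _ (e i) (f i))
  sum-a : sum a (suc (suc k)) ≃ z *ᶜ convolution (term z) (term w) k
  sum-a = begin
    sum a (suc (suc k))                 ≈⟨ sum-head a (suc k) ⟩
    a 0 +ᶜ sum (λ i → a (suc i)) (suc k) ≈⟨ +ᶜ-cong (solve 2 (λ s t → con 0ℚ :* s :* t := con 0ℚ) ≃-refl (e 0) (f 0))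
                                            (sum-cong (suc k) λ i _ → ≃-trans (*ᶜ-cong (term-suc z i) ≃-refl) (*ᶜ-assoc z (e i) _)) ⟩
    0ᶜ +ᶜ sum (λ i → z *ᶜ (e i *ᶜ term w (k ℕ.∸ i))) (suc k) ≈⟨ +ᶜ-identityˡ _ ⟩
    sum (λ i → z *ᶜ (e i *ᶜ term w (k ℕ.∸ i))) (suc k) ≈⟨ sum-*ˡ z _ (suc k) ⟩
    z *ᶜ convolution (term z) (term w) k ∎
  sum-b : sum b (suc (suc k)) ≃ w *ᶜ convolution (term z) (term w) k
  sum-b = begin
    sum b (suc k) +ᶜ b (suc k)
      ≈⟨ +ᶜ-cong (sum-cong (suc k) λ i i<1+k → let eq = ℕ.+-∸-assoc 1 (ℕ.≤-pred i<1+k) in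
            ≃-trans (*ᶜ-cong ≃-refl (subst (λ j → ⟪ nat j ⟫ *ᶜ term w j ≃ w *ᶜ term w (k ℕ.∸ i)) (sym eq) (term-suc w (k ℕ.∸ i))))
              (solve 3 (λ s t u → s :* (t :* u) := t :* (s :* u)) ≃-refl (e i) w (term w (k ℕ.∸ i))))
          (*ᶜ-cong ≃-refl (*ᶜ-cong (⟪⟫-cong (cong nat (ℕ.n∸n≡0 (suc k)))) ≃-refl)) ⟩
    sum (λ i → w *ᶜ (e i *ᶜ term w (k ℕ.∸ i))) (suc k) +ᶜ e (suc k) *ᶜ (0ᶜ *ᶜ f (suc k))
      ≈⟨ solve 3 (λ s t u → s :+ t :* (con 0ℚ :* u) := s) ≃-refl _ (e (suc k)) (f (suc k)) ⟩
    sum (λ i → w *ᶜ (e i *ᶜ term w (k ℕ.∸ i))) (suc k) ≈⟨ sum-*ˡ w _ (suc k) ⟩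
    w *ᶜ convolution (term z) (term w) k ∎
  derivation : n *ᶜ C ≃ (z +ᶜ w) *ᶜ convolution (term z) (term w) k
  derivation = begin
    n *ᶜ C                                        ≈⟨ sum-*ˡ n _ (suc (suc k)) ⟨
    sum (λ i → n *ᶜ (e i *ᶜ f i)) (suc (suc k))   ≈⟨ sum-cong (suc (suc k)) (λ i i< → weight i (ℕ.≤-pred i<)) ⟩
    sum (λ i → a i +ᶜ b i) (suc (suc k))          ≈⟨ sum-+ a b (suc (suc k)) ⟩
    sum a (suc (suc k)) +ᶜ sum b (suc (suc k))    ≈⟨ +ᶜ-cong sum-a sum-b ⟩
    z *ᶜ convolution (term z) (term w) k +ᶜ w *ᶜ convolution (term z) (term w) k
      ≈⟨ *ᶜ-distribʳ-+ᶜ _ z w ⟨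
    (z +ᶜ w) *ᶜ convolution (term z) (term w) k ∎

sum-convolution : ∀ e f m → sum (convolution e f) m ≃ sum (λ i → e i *ᶜ sum f (m ℕ.∸ i)) m
sum-convolution e f zero    = ≃-refl
sum-convolution e f (suc m) = begin
  sum (convolution e f) m +ᶜ (sum (λ i → e i *ᶜ f (m ℕ.∸ i)) m +ᶜ e m *ᶜ f (m ℕ.∸ m))
    ≈⟨ +ᶜ-cong (sum-convolution e f m) ≃-refl ⟩
  sum (λ i → e i *ᶜ sum f (m ℕ.∸ i)) m +ᶜ (sum (λ i → e i *ᶜ f (m ℕ.∸ i)) m +ᶜ e m *ᶜ f (m ℕ.∸ m))
    ≈⟨ +ᶜ-assoc _ _ _ ⟨
  sum (λ i → e i *ᶜ sum f (m ℕ.∸ i)) m +ᶜ sum (λ i → e i *ᶜ f (m ℕ.∸ i)) m +ᶜ e m *ᶜ f (m ℕ.∸ m)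
    ≈⟨ +ᶜ-cong (≃-trans (≃-sym (sum-+ _ _ m)) (sum-cong m λ i i<m →
          ≃-trans (≃-sym (*ᶜ-distribˡ-+ᶜ (e i) _ _)) (*ᶜ-cong ≃-refl (≡⇒≃ (cong (sum f) (sym (ℕ.+-∸-assoc 1 (ℕ.<⇒≤ i<m))))))))
        (*ᶜ-cong ≃-refl last) ⟩
  sum (λ i → e i *ᶜ sum f (suc m ℕ.∸ i)) m +ᶜ e m *ᶜ sum f (suc m ℕ.∸ m) ∎
  where
  open ≃-Reasoning
  last : f (m ℕ.∸ m) ≃ sum f (suc m ℕ.∸ m)
  last = ≃-trans (≡⇒≃ (cong f (ℕ.n∸n≡0 m))) (≃-trans (≃-sym (+ᶜ-identityˡ (f 0)))
    (≡⇒≃ (cong (sum f) {1} (sym (trans (ℕ.+-∸-assoc 1 {m} ℕ.≤-refl) (cong suc (ℕ.n∸n≡0 m)))))))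

module _ where
  open ℂ-Solver

  ℂ-eq : ∀ a b c → a *ᶜ (b +ᶜ -ᶜ c) ≃ b *ᶜ a +ᶜ -ᶜ 1ᶜ *ᶜ (a *ᶜ c)
  ℂ-eq = solve 3 (λ a b c → a :* (b :- c) := b :* a :+ (:- con 1ℚ) :* (a :* c)) ≃-refl

  ℂ-eq′ : ∀ a b c → a *ᶜ b +ᶜ -ᶜ 1ᶜ *ᶜ c ≃ b *ᶜ a +ᶜ -ᶜ c
  ℂ-eq′ = solve 3 (λ a b c → a :* b :+ (:- con 1ℚ) :* c := b :* a :- c) ≃-refl

-- Square minus triangle: what remains is Σ e(i) (sum f m - sum f (m - i)). Each of the m summands
-- is at most 2KL 4⁻ⁱ 4^(i-m) = 2KL 4⁻ᵐ, and m 4⁻ᵐ ≤ 2⁻ᵐ.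
product-close : ∀ {e f K L} → Dominated e K → Dominated f L → ∀ m →
  ∥ sum e m *ᶜ sum f m +ᶜ -ᶜ sum (convolution e f) m ∥≤ (⟨ nat 2 ⟩ *ʳ (K *ʳ L) *ʳ θ ^ʳ m)
product-close {e} {f} {K} {L} (0≤K , he) f-dom@(0≤L , hf) m = norm-resp rearranged
  (norm-weaken (≤ʳ-trans (≤ʳ-reflexive (solve 4 (λ n c k r → n :* (c :* k :* r) := c :* k :* (n :* r)) ≃ʳ-refl ⟨ nat m ⟩ ⟨ nat 2 ⟩ (K *ʳ L) (ρ m)))
      (*ʳ-monoʳ-≤ _ 0≤2KL (m*ρ≤θ m)))
    (norm-sum (*ʳ-nonNeg 0≤2KL (0≤ρ m)) m λ i i<m → norm-weaken (≤ʳ-reflexive (≃ʳ-trans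
        (solve 5 (λ K L a b c → K :* (a :* a) :* (c :* (L :* (b :* b))) := c :* (K :* L) :* (a :* b :* (a :* b)))
          ≃ʳ-refl K L (θ ^ʳ i) (θ ^ʳ (m ℕ.∸ i)) ⟨ nat 2 ⟩)
        (*ʳ-cong ≃ʳ-refl (*ʳ-cong (power i (ℕ.<⇒≤ i<m)) (power i (ℕ.<⇒≤ i<m))))))
      (norm-* (he i) (sum-close f-dom (m ℕ.∸ i) m (ℕ.m∸n≤m m i)))))
  where
  open ℝ-Solver
  0≤2KL = *ʳ-nonNeg (⟨⟩-mono-≤ (nat-nonNeg 2)) (*ʳ-nonNeg 0≤K 0≤L)
  power : ∀ i → i ℕ.≤ m → θ ^ʳ i *ʳ θ ^ʳ (m ℕ.∸ i) ≃ʳ θ ^ʳ m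
  power i i≤m = ≃ʳ-trans (≃ʳ-sym (^ʳ-homo-* θ i (m ℕ.∸ i)))
    (subst (λ j → θ ^ʳ j ≃ʳ θ ^ʳ m) (sym (ℕ.m+[n∸m]≡n i≤m)) ≃ʳ-refl)
  rearranged : sum (λ i → e i *ᶜ (sum f m +ᶜ -ᶜ sum f (m ℕ.∸ i))) m ≃ sum e m *ᶜ sum f m +ᶜ -ᶜ sum (convolution e f) m
  rearranged = ≃R.begin
    sum (λ i → e i *ᶜ (sum f m +ᶜ -ᶜ sum f (m ℕ.∸ i))) m
      ≃R.≈⟨ sum-cong m (λ i _ → ℂ-eq (e i) (sum f m) (sum f (m ℕ.∸ i))) ⟩
    sum (λ i → sum f m *ᶜ e i +ᶜ -ᶜ 1ᶜ *ᶜ (e i *ᶜ sum f (m ℕ.∸ i))) m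
      ≃R.≈⟨ sum-+ _ _ m ⟩
    sum (λ i → sum f m *ᶜ e i) m +ᶜ sum (λ i → -ᶜ 1ᶜ *ᶜ (e i *ᶜ sum f (m ℕ.∸ i))) m
      ≃R.≈⟨ +ᶜ-cong (sum-*ˡ (sum f m) e m) (sum-*ˡ (-ᶜ 1ᶜ) _ m) ⟩
    sum f m *ᶜ sum e m +ᶜ -ᶜ 1ᶜ *ᶜ sum (λ i → e i *ᶜ sum f (m ℕ.∸ i)) m
      ≃R.≈⟨ +ᶜ-cong ≃-refl (*ᶜ-cong ≃-refl (≃-sym (sum-convolution e f m))) ⟩
    sum f m *ᶜ sum e m +ᶜ -ᶜ 1ᶜ *ᶜ sum (convolution e f) m
      ≃R.≈⟨ ℂ-eq′ (sum f m) (sum e m) (sum (convolution e f) m) ⟩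
    sum e m *ᶜ sum f m +ᶜ -ᶜ sum (convolution e f) m ≃R.∎
    where
    module ≃R = ≃-Reasoning

exp-+ : ∀ z w → expᶜ (z +ᶜ w) ≃ expᶜ z *ᶜ expᶜ w
exp-+ z w = ≃-sym (≃-trans (solve 2 (λ a b → a := a :- b :+ b) ≃-refl (expᶜ z *ᶜ expᶜ w) (expᶜ (z +ᶜ w)))
  (≃-trans (+ᶜ-cong difference≃0 ≃-refl) (+ᶜ-identityˡ _)))
  where
  open ℂ-Solver
  difference : ℕ → ℂ
  difference m = sum (term z) m *ᶜ sum (term w) m +ᶜ -ᶜ sum (term (z +ᶜ w)) m
  K = proj₁ (term-dominated z)
  L = proj₁ (term-dominated w)
  z-dom = proj₂ (term-dominated z)
  w-dom = proj₂ (term-dominated w)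
  difference→0 : difference ⇝ 0ᶜ
  difference→0 = ⇝-bound (λ m → ⟨ nat 2 ⟩ *ʳ (K *ʳ L) *ʳ θ ^ʳ m)
    (λ m → norm-resp (≃-trans (+ᶜ-cong ≃-refl (-ᶜ-cong (sum-cong m λ k _ → convolution-term z w k)))
        (solve 1 (λ a → a := a :- con 0ℚ) ≃-refl (difference m)))
      (product-close z-dom w-dom m))
    (θ→0 _ (*ʳ-nonNeg (⟨⟩-mono-≤ (nat-nonNeg 2)) (*ʳ-nonNeg (proj₁ z-dom) (proj₁ w-dom))))
  difference≃0 : expᶜ z *ᶜ expᶜ w +ᶜ -ᶜ expᶜ (z +ᶜ w) ≃ 0ᶜ
  difference≃0 = ⇝-unique (⇝-+ (⇝-* (exp-limit z) (exp-limit w)) (⇝-neg (exp-limit (z +ᶜ w)))) difference→0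

-- Estimates for the exponential near 0

-- Bounds concern squares, so q has to be small relative to b: (b + q)² = b² + q(2b + q), and q(2B +
-- 1) ≤ e stays below the supposed excess |z|² - b².
norm-limit : ∀ {z b} → 0ʳ ≤ʳ b → (∀ q → 0ℚ ℚ.< q → ∥ z ∥≤ (b +ʳ ⟨ q ⟩)) → ∥ z ∥≤ b
norm-limit {z} {b} 0≤b h = bound 0≤b (≮⇒≥ λ bb<zz →
  let d = diff-posʳ bb<zz
      B , b<B = ℝ-archimedean b 0<1ʳ
      b≤B = <⇒≤ʳ (<ʳ-respʳ (*ʳ-identityʳ ⟨ nat B ⟩) b<B)
      e , 0<e , e<d = rational-below d
      q , 0<q , q≤1 , q[2B+1]≤e = small B e 0<e
  in ≤⇒≯ (bound-square (h q 0<q)) (<ʳ-respˡ (solve 2 (λ b q → b :* b :+ q :* (b :+ b :+ q) := (b :+ q) :* (b :+ q)) ≃ʳ-refl b ⟨ q ⟩)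
       (<ʳ-respʳ (solve 2 (λ x y → x :+ (y :- x) := y) ≃ʳ-refl (b *ʳ b) (normSq z))
       (<ʳ-respˡ (+ʳ-comm _ (b *ʳ b)) (<ʳ-respʳ (+ʳ-comm _ (b *ʳ b)) (+ʳ-monoˡ-< (b *ʳ b)
         (≤-<ʳ-trans (≤ʳ-trans (*ʳ-monoʳ-≤ ⟨ q ⟩ (<⇒≤ʳ (⟨⟩-mono-< 0<q)) (+ʳ-mono-≤ (+ʳ-mono-≤ b≤B b≤B) q≤1)) q[2B+1]≤e) e<d)))))))
  where
  open ℝ-Solver
  small : ∀ B e → 0ℚ ℚ.< e → ∃[ q ] 0ℚ ℚ.< q × ⟨ q ⟩ ≤ʳ 1ʳ × ⟨ q ⟩ *ʳ (⟨ nat B ⟩ +ʳ ⟨ nat B ⟩ +ʳ 1ʳ) ≤ʳ ⟨ e ⟩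
  small B e 0<e =
    let n , lt = reciprocal-small (*-pos 0<e (reciprocal-pos (B ℕ.+ B)))
    in reciprocal n , reciprocal-pos n , ⟨⟩-mono-≤ (reciprocal≤1 n) ,
       ≤ʳ-trans (≤ʳ-reflexive (≃ʳ-trans (*ʳ-comm _ _) (≃ʳ-trans (*ʳ-cong (≃ʳ-sym (≃ʳ-trans
           (⟨⟩-cong (trans (nat-+ 1 (B ℕ.+ B)) (trans (ℚ.+-comm 1ℚ (nat (B ℕ.+ B))) (cong (ℚ._+ 1ℚ) (nat-+ B B)))))
           (≃ʳ-trans (⟨⟩-+ _ _) (+ʳ-cong (⟨⟩-+ _ _) ≃ʳ-refl)))) ≃ʳ-refl) (≃ʳ-sym (⟨⟩-* _ _)))))
         (⟨⟩-mono-≤ (subst (nat (suc (B ℕ.+ B)) ℚ.* reciprocal n ℚ.≤_) (scaled-reciprocal e (B ℕ.+ B))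
                (ℚ.*-monoˡ-≤-nonNeg (nat (suc (B ℕ.+ B))) {{ℚ.nonNegative (nat-nonNeg (suc (B ℕ.+ B)))}}
                  (ℚ.<⇒≤ (lt n ℕ.≤-refl)))))

norm-⇝ : ∀ {u z w b} N → 0ʳ ≤ʳ b → u ⇝ z → (∀ n → N ℕ.≤ n → ∥ u n +ᶜ -ᶜ w ∥≤ b) → ∥ z +ᶜ -ᶜ w ∥≤ b
norm-⇝ {b = b} N 0≤b u⇝z h = norm-limit 0≤b λ q 0<q → let M , k = u⇝z q 0<q ; n = M ℕ.⊔ N in
  norm-weaken (≤ʳ-reflexive (+ʳ-comm ⟨ q ⟩ b))
    (norm-triangle (norm-diff-sym (k n (ℕ.m≤m⊔n M N))) (h n (ℕ.m≤n⊔m M N)))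

-- For |z| ≤ 1 every ratio z/(k + 1) with k ≥ N ≥ 1 is at most 1/2, so from the term bounded by c on
-- a geometric series with sum 2c dominates.
exp-tail : ∀ {z a c} N → 1 ℕ.≤ N → ∥ z ∥≤ a → a ≤ʳ 1ʳ → ∥ term z N ∥≤ c →
  ∥ expᶜ z +ᶜ -ᶜ sum (term z) N ∥≤ (⟨ nat 2 ⟩ *ʳ c)
exp-tail {z} {a} {c} N 1≤N z≤a a≤1 t≤c = norm-weaken (≤ʳ-reflexive b[N])
  (norm-⇝ N (0≤b N) (exp-limit z) (norm-sum-tail N 0≤b λ k N≤k → subst (λ k → ∥ term z k ∥≤ (b k +ʳ -ʳ b (suc k)))
    (ℕ.m∸n+n≡m N≤k) (norm-weaken (≤ʳ-reflexive (step (k ℕ.∸ N))) (terms (k ℕ.∸ N)))))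
  where
  open ℝ-Solver
  0≤c = bound-nonNeg t≤c
  b : ℕ → ℝ
  b k = ⟨ nat 2 ⟩ *ʳ c *ʳ θ ^ʳ (k ℕ.∸ N)
  0≤b : ∀ k → 0ʳ ≤ʳ b k
  0≤b k = *ʳ-nonNeg (*ʳ-nonNeg (⟨⟩-mono-≤ (nat-nonNeg 2)) 0≤c) (^ʳ-nonNeg 0≤θ (k ℕ.∸ N))
  b[N] : b N ≃ʳ ⟨ nat 2 ⟩ *ʳ c
  b[N] = subst (λ j → ⟨ nat 2 ⟩ *ʳ c *ʳ θ ^ʳ j ≃ʳ ⟨ nat 2 ⟩ *ʳ c) (sym (ℕ.n∸n≡0 N)) (*ʳ-identityʳ _)
  step : ∀ j → c *ʳ θ ^ʳ j ≃ʳ b (j ℕ.+ N) +ʳ -ʳ b (suc (j ℕ.+ N))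
  step j rewrite ℕ.m+n∸n≡m j N | ℕ.m+n∸n≡m (suc j) N =
    solve 2 (λ c t → c :* t := con (nat 2) :* c :* t :- con (nat 2) :* c :* (con ℚ.½ :* t)) ≃ʳ-refl c (θ ^ʳ j)
  reciprocal≤½ : ∀ k → 1 ℕ.≤ k → reciprocal k ℚ.≤ ℚ.½
  reciprocal≤½ k 1≤k = subst₂ ℚ._≤_ (cancel (reciprocal k)) (ℚ.*-identityʳ ℚ.½)
    (ℚ.*-monoˡ-≤-nonNeg ℚ.½ (subst (nat 2 ℚ.* reciprocal k ℚ.≤_) (reciprocal-inverse k)
      (ℚ.*-monoʳ-≤-nonNeg (reciprocal k) {{ℚ.nonNegative (ℚ.<⇒≤ (reciprocal-pos k))}} (nat-mono-≤ (ℕ.s≤s 1≤k)))))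
    where
    cancel : ∀ r → ℚ.½ ℚ.* (nat 2 ℚ.* r) ≡ r
    cancel r = trans (sym (ℚ.*-assoc ℚ.½ (nat 2) r)) (ℚ.*-identityˡ r)
  terms : ∀ j → ∥ term z (j ℕ.+ N) ∥≤ (c *ʳ θ ^ʳ j)
  terms zero    = norm-weaken (≤ʳ-reflexive (≃ʳ-sym (*ʳ-identityʳ c))) t≤c
  terms (suc j) = norm-weaken (≤ʳ-trans
      (*ʳ-monoʳ-≤ _ (*ʳ-nonNeg 0≤c (^ʳ-nonNeg 0≤θ j)) (*ʳ-mono-≤ (bound-nonNeg z≤a) 0≤θ a≤1
        (⟨⟩-mono-≤ (reciprocal≤½ (j ℕ.+ N) (ℕ.≤-trans 1≤N (ℕ.m≤n+m N j))))))
      (≤ʳ-reflexive (solve 2 (λ c t → c :* t :* (con 1ℚ :* con ℚ.½) := c :* (con ℚ.½ :* t)) ≃ʳ-refl c (θ ^ʳ j))))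
    (norm-* (terms j) (norm-* z≤a (norm-fromℝ (reciprocal-nonNeg (j ℕ.+ N)))))

exp-near-1 : ∀ {z a} → ∥ z ∥≤ a → a ≤ʳ 1ʳ → ∥ expᶜ z +ᶜ -ᶜ 1ᶜ ∥≤ (⟨ nat 2 ⟩ *ʳ a)
exp-near-1 {z} {a} z≤a a≤1 = norm-resp (+ᶜ-cong ≃-refl (-ᶜ-cong (+ᶜ-identityˡ 1ᶜ)))
  (exp-tail 1 ℕ.≤-refl z≤a a≤1 (norm-resp (solve 1 (λ z → z := con 1ℚ :* (z :* con 1ℚ)) ≃-refl z) z≤a))
  where open ℂ-Solver

exp-near-1+z : ∀ {z a} → ∥ z ∥≤ a → a ≤ʳ 1ʳ → ∥ expᶜ z +ᶜ -ᶜ (1ᶜ +ᶜ z) ∥≤ (a *ʳ a)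
exp-near-1+z {z} {a} z≤a a≤1 = norm-weaken (≤ʳ-reflexive (R.solve 1 (λ a → R.con (nat 2) R.:* (R.con ℚ.½ R.:* (a R.:* a)) R.:= a R.:* a) ≃ʳ-refl a))
  (norm-resp (+ᶜ-cong ≃-refl (-ᶜ-cong (solve 1 (λ z → con 0ℚ :+ con 1ℚ :+ con 1ℚ :* (z :* con 1ℚ) := con 1ℚ :+ z) ≃-refl z)))
    (exp-tail 2 (ℕ.s≤s ℕ.z≤n) z≤a a≤1
      (norm-resp (solve 1 (λ z → con ℚ.½ :* (z :* z) := con 1ℚ :* (z :* con 1ℚ) :* (z :* con ℚ.½)) ≃-refl z)
        (norm-* (norm-fromℝ (⟨⟩-mono-≤ (ℚ.<⇒≤ (ℚ.positive⁻¹ ℚ.½)))) (norm-* z≤a z≤a)))))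
  where
  open ℂ-Solver
  module R = ℝ-Solver

exp-0 : expᶜ 0ᶜ ≃ 1ᶜ
exp-0 = ≃-trans (solve 2 (λ e o → e := (e :- o) :+ o) ≃-refl (expᶜ 0ᶜ) 1ᶜ) (≃-trans (+ᶜ-cong
  (norm-infinitesimal λ q 0<q → norm-weaken (≤ʳ-trans (≤ʳ-reflexive (*ʳ-zeroʳ _)) (<⇒≤ʳ (⟨⟩-mono-< 0<q)))
    (exp-near-1 (norm-0 ≤ʳ-refl) (<⇒≤ʳ 0<1ʳ))) ≃-refl) (+ᶜ-identityˡ 1ᶜ))
  where open ℂ-Solver

-- Conjugation and the real exponential

conj : ℂ → ℂ
conj z = re z +i (-ʳ im z)

opaque
  unfolding _≃_

  conj-+ : ∀ z w → conj (z +ᶜ w) ≃ conj z +ᶜ conj w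
  conj-+ (a +i b) (c +i d) = ≃ʳ-refl , solve 2 (λ b d → :- (b :+ d) := (:- b) :+ (:- d)) ≃ʳ-refl b d
    where open ℝ-Solver

  conj-neg : ∀ z → conj (-ᶜ z) ≃ -ᶜ conj z
  conj-neg z = ≃ʳ-refl , ≃ʳ-refl

  conj-* : ∀ z w → conj (z *ᶜ w) ≃ conj z *ᶜ conj w
  conj-* (a +i b) (c +i d) =
      solve 4 (λ a b c d → a :* c :- b :* d := a :* c :- (:- b) :* (:- d)) ≃ʳ-refl a b c d
    , solve 4 (λ a b c d → :- (a :* d :+ b :* c) := a :* (:- d) :+ (:- b) :* c) ≃ʳ-refl a b c d
    where open ℝ-Solver

  conj-fromℝ : ∀ x → conj (fromℝ x) ≃ fromℝ x
  conj-fromℝ x = ≃ʳ-refl , solve 1 (λ x → :- con 0ℚ := con 0ℚ) ≃ʳ-refl x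
    where open ℝ-Solver

  conj-i : conj i ≃ -ᶜ i
  conj-i = solve 1 (λ x → con 0ℚ := :- con 0ℚ) ≃ʳ-refl 0ʳ , ≃ʳ-refl
    where open ℝ-Solver

  i*i : i *ᶜ i ≃ -ᶜ 1ᶜ
  i*i = solve 1 (λ x → con 0ℚ :* con 0ℚ :- con 1ℚ :* con 1ℚ := :- con 1ℚ) ≃ʳ-refl 0ʳ
    , solve 1 (λ x → con 0ℚ :* con 1ℚ :+ con 1ℚ :* con 0ℚ := :- con 0ℚ) ≃ʳ-refl 0ʳ
    where open ℝ-Solver

  z*conj : ∀ z → z *ᶜ conj z ≃ fromℝ (normSq z)
  z*conj (a +i b) = solve 2 (λ a b → a :* a :- b :* (:- b) := a :* a :+ b :* b) ≃ʳ-refl a b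
    , solve 2 (λ a b → a :* (:- b) :+ b :* a := con 0ℚ) ≃ʳ-refl a b
    where open ℝ-Solver

  z+conj : ∀ z → z +ᶜ conj z ≃ fromℝ (re z +ʳ re z)
  z+conj (a +i b) = ≃ʳ-refl , solve 1 (λ b → b :+ (:- b) := con 0ℚ) ≃ʳ-refl b
    where open ℝ-Solver

  fromℝ-injective : ∀ {x y} → fromℝ x ≃ fromℝ y → x ≃ʳ y
  fromℝ-injective = proj₁

  conj-fixed : ∀ {z} → conj z ≃ z → z ≃ fromℝ (re z)
  conj-fixed {a +i b} (_ , -b≃b) = ≃ʳ-refl , ≃ʳ-trans (solve 1 (λ b → b := con ℚ.½ :* (b :+ b)) ≃ʳ-refl b)
    (≃ʳ-trans (*ʳ-cong ≃ʳ-refl (+ʳ-cong ≃ʳ-refl (≃ʳ-sym -b≃b))) (solve 1 (λ b → con ℚ.½ :* (b :- b) := con 0ℚ) ≃ʳ-refl b))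
    where open ℝ-Solver

norm-conj : ∀ {z a} → ∥ z ∥≤ a → ∥ conj z ∥≤ a
norm-conj {z} (bound p q) = bound p (≤ʳ-trans (≤ʳ-reflexive
  (solve 2 (λ a b → a :* a :+ (:- b) :* (:- b) := a :* a :+ b :* b) ≃ʳ-refl (re z) (im z))) q)
  where open ℝ-Solver

conj-sum : ∀ f n → conj (sum f n) ≃ sum (λ k → conj (f k)) n
conj-sum f zero    = conj-fromℝ _
conj-sum f (suc n) = ≃-trans (conj-+ (sum f n) (f n)) (+ᶜ-cong (conj-sum f n) ≃-refl)

term-conj : ∀ z k → conj (term z k) ≃ term (conj z) k
term-conj z zero    = conj-fromℝ _
term-conj z (suc k) = ≃-trans (conj-* _ _) (*ᶜ-cong (term-conj z k) (≃-trans (conj-* _ _) (*ᶜ-cong ≃-refl (conj-fromℝ _))))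

exp-conj : ∀ z → conj (expᶜ z) ≃ expᶜ (conj z)
exp-conj z = ⇝-unique conj-limit (exp-limit (conj z))
  where
  conj-limit : sum (term (conj z)) ⇝ conj (expᶜ z)
  conj-limit q 0<q = let M , h = exp-limit z q 0<q in M , λ m M≤m →
    norm-resp (≃-trans (conj-+ _ _) (+ᶜ-cong (≃-trans (conj-sum (term z) m) (sum-cong m λ k _ → term-conj z k)) (conj-neg _)))
      (norm-conj (h m M≤m))

expʳ : ℝ → ℝ
expʳ x = re (expᶜ (fromℝ x))

exp-fromℝ : ∀ x → expᶜ (fromℝ x) ≃ fromℝ (expʳ x)
exp-fromℝ x = conj-fixed (≃-trans (exp-conj (fromℝ x)) (exp-cong (conj-fromℝ x)))

expʳ-cong : ∀ {x y} → x ≃ʳ y → expʳ x ≃ʳ expʳ y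
expʳ-cong e = re-cong (exp-cong (fromℝ-cong e))

expʳ-+ : ∀ x y → expʳ (x +ʳ y) ≃ʳ expʳ x *ʳ expʳ y
expʳ-+ x y = fromℝ-injective (begin
  fromℝ (expʳ (x +ʳ y))                 ≈⟨ exp-fromℝ (x +ʳ y) ⟨
  expᶜ (fromℝ (x +ʳ y))                 ≈⟨ exp-cong (fromℝ-+ x y) ⟩
  expᶜ (fromℝ x +ᶜ fromℝ y)             ≈⟨ exp-+ (fromℝ x) (fromℝ y) ⟩
  expᶜ (fromℝ x) *ᶜ expᶜ (fromℝ y)      ≈⟨ *ᶜ-cong (exp-fromℝ x) (exp-fromℝ y) ⟩
  fromℝ (expʳ x) *ᶜ fromℝ (expʳ y)      ≈⟨ fromℝ-* (expʳ x) (expʳ y) ⟨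
  fromℝ (expʳ x *ʳ expʳ y)              ∎)
  where open ≃-Reasoning

expʳ-0 : expʳ 0ʳ ≃ʳ 1ʳ
expʳ-0 = fromℝ-injective (≃-trans (≃-sym (exp-fromℝ 0ʳ)) exp-0)

expʳ-inverse : ∀ x → expʳ x *ʳ expʳ (-ʳ x) ≃ʳ 1ʳ
expʳ-inverse x = ≃ʳ-trans (≃ʳ-sym (expʳ-+ x (-ʳ x)))
  (≃ʳ-trans (expʳ-cong (-ʳ-inverseʳ x)) expʳ-0)

expʳ-nonNeg : ∀ x → 0ʳ ≤ʳ expʳ x
expʳ-nonNeg x = ≤ʳ-trans (square-nonNeg (expʳ (⟨ ℚ.½ ⟩ *ʳ x)))
  (≤ʳ-reflexive (≃ʳ-trans (≃ʳ-sym (expʳ-+ _ _)) (expʳ-cong (solve 1 (λ x → con ℚ.½ :* x :+ con ℚ.½ :* x := x) ≃ʳ-refl x))))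
  where open ℝ-Solver

-- exp z times its conjugate is exp (z + conj z), a real exponential. This puts `cis` on the unit
-- circle and computes |T₀| as p^(-t₀).
normSq-exp : ∀ z → normSq (expᶜ z) ≃ʳ expʳ (re z) *ʳ expʳ (re z)
normSq-exp z = fromℝ-injective (begin
  fromℝ (normSq (expᶜ z))               ≈⟨ z*conj (expᶜ z) ⟨
  expᶜ z *ᶜ conj (expᶜ z)               ≈⟨ *ᶜ-cong ≃-refl (exp-conj z) ⟩
  expᶜ z *ᶜ expᶜ (conj z)               ≈⟨ exp-+ z (conj z) ⟨
  expᶜ (z +ᶜ conj z)                    ≈⟨ exp-cong (z+conj z) ⟩
  expᶜ (fromℝ (re z +ʳ re z))           ≈⟨ exp-fromℝ _ ⟩
  fromℝ (expʳ (re z +ʳ re z))           ≈⟨ fromℝ-cong (expʳ-+ (re z) (re z)) ⟩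
  fromℝ (expʳ (re z) *ʳ expʳ (re z))    ∎)
  where open ≃-Reasoning

norm-exp : ∀ z → ∥ expᶜ z ∥≤ expʳ (re z)
norm-exp z = bound (expʳ-nonNeg (re z)) (≤ʳ-reflexive (normSq-exp z))

-- Partial sums with two or more terms are at least 1 + x, because the further terms are
-- nonnegative.
expʳ-≥ : ∀ {x} → 0ʳ ≤ʳ x → 1ʳ +ʳ x ≤ʳ expʳ x
expʳ-≥ {x} 0≤x = ≤ʳ-limit λ q 0<q → let M , h = exp-limit (fromℝ x) q 0<q ; m = 2 ℕ.+ M in begin
  1ʳ +ʳ x                                           ≤⟨ partial≥ M ⟩
  re (sum (term (fromℝ x)) m)                       ≈⟨ solve 2 (λ a b → a := b :+ (a :- b)) ≃ʳ-refl _ (expʳ x) ⟩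
  expʳ x +ʳ (re (sum (term (fromℝ x)) m) +ʳ -ʳ expʳ x)
    ≈⟨ +ʳ-cong ≃ʳ-refl (≃ʳ-sym (≃ʳ-trans (re-+ _ _) (+ʳ-cong ≃ʳ-refl (re-neg _)))) ⟩
  expʳ x +ʳ re (sum (term (fromℝ x)) m +ᶜ -ᶜ expᶜ (fromℝ x))
    ≤⟨ +ʳ-monoʳ-≤ (expʳ x) (re-bound (h m (ℕ.m≤n+m M 2))) ⟩
  expʳ x +ʳ ⟨ q ⟩                                   ∎
  where
  open ≤ʳ-Reasoning
  open ℝ-Solver
  t : ℕ → ℝ
  t zero    = 1ʳ
  t (suc k) = t k *ʳ (x *ʳ ⟨ reciprocal k ⟩)
  0≤t : ∀ k → 0ʳ ≤ʳ t k
  0≤t zero    = <⇒≤ʳ 0<1ʳ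
  0≤t (suc k) = *ʳ-nonNeg (0≤t k) (*ʳ-nonNeg 0≤x (reciprocal-nonNeg k))
  term≃t : ∀ k → term (fromℝ x) k ≃ fromℝ (t k)
  term≃t zero    = ≃-refl
  term≃t (suc k) = ≃-trans (*ᶜ-cong (term≃t k) (≃-sym (fromℝ-* _ _))) (≃-sym (fromℝ-* _ _))
  re-term : ∀ k → re (term (fromℝ x) k) ≃ʳ t k
  re-term k = ≃ʳ-trans (re-cong (term≃t k)) (re-fromℝ _)
  partial≥ : ∀ M → 1ʳ +ʳ x ≤ʳ re (sum (term (fromℝ x)) (2 ℕ.+ M))
  partial≥ zero = ≤ʳ-reflexive (≃ʳ-sym (≃ʳ-trans (re-+ _ _) (≃ʳ-trans (+ʳ-cong (≃ʳ-trans (re-+ _ _) (+ʳ-cong (re-fromℝ _) (re-term 0))) (re-term 1))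
    (solve 1 (λ x → con 0ℚ :+ con 1ℚ :+ con 1ℚ :* (x :* con 1ℚ) := con 1ℚ :+ x) ≃ʳ-refl x))))
  partial≥ (suc M) = ≤ʳ-trans (partial≥ M) (≤-by (0≤t (2 ℕ.+ M)) (≃ʳ-sym (≃ʳ-trans (re-+ _ _) (+ʳ-cong ≃ʳ-refl (re-term (2 ℕ.+ M))))))

0≄1 : ¬ 0ʳ ≃ʳ 1ʳ
0≄1 e = ≃ʳ⇒≮ e 0<1ʳ

-- If x < y, then exp x (exp (y - x) - 1) = 0 with exp (y - x) - 1 ≥ y - x > 0, which forces exp x =
-- 0 against exp x exp (-x) = 1. Real logarithms are therefore unique.
expʳ-injective : ∀ {x y} → expʳ x ≃ʳ expʳ y → x ≃ʳ y
expʳ-injective {x} {y} e = <ʳ-tight (impossible e) (impossible (≃ʳ-sym e))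
  where
  open ℝ-Solver
  impossible : ∀ {x y} → expʳ x ≃ʳ expʳ y → ¬ x <ʳ y
  impossible {x} {y} e x<y = 0≄1 (≃ʳ-trans (≃ʳ-sym (*ʳ-zeroˡ (expʳ (-ʳ x))))
    (≃ʳ-trans (*ʳ-cong (≃ʳ-sym exp≃0) ≃ʳ-refl) (expʳ-inverse x)))
    where
    d = y +ʳ -ʳ x
    0<d = diff-posʳ x<y
    0<exp[d]-1 : 0ʳ <ʳ expʳ d +ʳ -ʳ 1ʳ
    0<exp[d]-1 = diff-posʳ (<-≤ʳ-trans (<-by 0<d ≃ʳ-refl) (expʳ-≥ (<⇒≤ʳ 0<d)))
    exp≃0 : expʳ x ≃ʳ 0ʳ
    exp≃0 = *ʳ-cancel-0 (≃ʳ-trans (solve 2 (λ a b → a :* (b :- con 1ℚ) := a :* b :- a) ≃ʳ-refl (expʳ x) (expʳ d))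
      (≃ʳ-trans (+ʳ-cong (≃ʳ-trans (≃ʳ-sym (expʳ-+ x d)) (≃ʳ-trans (expʳ-cong (solve 2 (λ x y → x :+ (y :- x) := y) ≃ʳ-refl x y)) (≃ʳ-sym e))) ≃ʳ-refl)
        (-ʳ-inverseʳ (expʳ x)))) 0<exp[d]-1

-- Primitive roots of unity

module RootsOfUnity where
  open ℝ-Solver

  ½ʳ : ℝ
  ½ʳ = ⟨ ℚ.½ ⟩

  cis : ℝ → ℂ
  cis t = expᶜ (i *ᶜ fromℝ t)

  cos sin : ℝ → ℝ
  cos t = re (cis t)
  sin t = im (cis t)

  cis-cong : ∀ {s t} → s ≃ʳ t → cis s ≃ cis t
  cis-cong e = exp-cong (*ᶜ-cong ≃-refl (fromℝ-cong e))

  cis-+ : ∀ s t → cis (s +ʳ t) ≃ cis s *ᶜ cis t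
  cis-+ s t = ≃-trans (exp-cong (≃-trans (*ᶜ-cong ≃-refl (fromℝ-+ s t)) (*ᶜ-distribˡ-+ᶜ i (fromℝ s) (fromℝ t)))) (exp-+ _ _)

  cos-+ : ∀ s t → cos (s +ʳ t) ≃ʳ cos s *ʳ cos t +ʳ -ʳ (sin s *ʳ sin t)
  cos-+ s t = ≃ʳ-trans (re-cong (cis-+ s t)) (re-* (cis s) (cis t))

  sin-+ : ∀ s t → sin (s +ʳ t) ≃ʳ cos s *ʳ sin t +ʳ sin s *ʳ cos t
  sin-+ s t = ≃ʳ-trans (im-cong (cis-+ s t)) (im-* (cis s) (cis t))

  cis-neg : ∀ t → cis (-ʳ t) ≃ conj (cis t)
  cis-neg t = ≃-sym (≃-trans (exp-conj _) (exp-cong (≃-trans (conj-* i (fromℝ t)) (≃-trans (*ᶜ-cong conj-i (conj-fromℝ t))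
    (≃-trans (solveᶜ 2 (λ i t → :-ᶜ i :*ᶜ t :=ᶜ i :*ᶜ (:-ᶜ t)) ≃-refl i (fromℝ t)) (*ᶜ-cong ≃-refl (≃-sym (fromℝ-neg t))))))))
    where open ℂ-Solver using () renaming (solve to solveᶜ; _:*_ to _:*ᶜ_; :-_ to :-ᶜ_; _:=_ to _:=ᶜ_)

  re-it : ∀ t → re (i *ᶜ fromℝ t) ≃ʳ 0ʳ
  re-it t = ≃ʳ-trans (re-* i (fromℝ t)) (≃ʳ-trans
    (+ʳ-cong (*ʳ-cong re-i ≃ʳ-refl) (-ʳ-cong (*ʳ-cong ≃ʳ-refl (im-fromℝ t))))
    (solve 2 (λ a b → con 0ℚ :* a :- b :* con 0ℚ := con 0ℚ) ≃ʳ-refl (re (fromℝ t)) (im i)))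

  cos²+sin² : ∀ t → cos t *ʳ cos t +ʳ sin t *ʳ sin t ≃ʳ 1ʳ
  cos²+sin² t = ≃ʳ-trans (normSq-exp (i *ᶜ fromℝ t)) (≃ʳ-trans (*ʳ-cong e e) (*ʳ-identityˡ 1ʳ))
    where
    e : expʳ (re (i *ᶜ fromℝ t)) ≃ʳ 1ʳ
    e = ≃ʳ-trans (expʳ-cong (re-it t)) expʳ-0

  im-it : ∀ t → im (i *ᶜ fromℝ t) ≃ʳ t
  im-it t = ≃ʳ-trans (im-* i (fromℝ t)) (≃ʳ-trans
    (+ʳ-cong (*ʳ-cong re-i (im-fromℝ t)) (*ʳ-cong im-i (re-fromℝ t)))
    (solve 1 (λ t → con 0ℚ :* con 0ℚ :+ con 1ℚ :* t := t) ≃ʳ-refl t))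

  norm-it : ∀ {t a} → ∥ fromℝ t ∥≤ a → ∥ i *ᶜ fromℝ t ∥≤ a
  norm-it {a = a} h = norm-weaken (≤ʳ-reflexive (*ʳ-identityˡ a)) (norm-* norm-i h)

  re-diff : ∀ z w → re (z +ᶜ -ᶜ w) ≃ʳ re z +ʳ -ʳ re w
  re-diff z w = ≃ʳ-trans (re-+ z (-ᶜ w)) (+ʳ-cong ≃ʳ-refl (re-neg w))

  im-diff : ∀ z w → im (z +ᶜ -ᶜ w) ≃ʳ im z +ʳ -ʳ im w
  im-diff z w = ≃ʳ-trans (im-+ z (-ᶜ w)) (+ʳ-cong ≃ʳ-refl (im-neg w))

  diff-upper : ∀ {x y c} → x +ʳ -ʳ y ≤ʳ c → x ≤ʳ y +ʳ c
  diff-upper {x} {y} {c} h = ≤ʳ-trans (≤ʳ-reflexive (solve 2 (λ x y → x := x :- y :+ y) ≃ʳ-refl x y))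
    (≤ʳ-trans (+ʳ-monoˡ-≤ y h) (≤ʳ-reflexive (+ʳ-comm c y)))

  re-close : ∀ {z w c} → ∥ z +ᶜ -ᶜ w ∥≤ c → re z ≤ʳ re w +ʳ c
  re-close {z} {w} h = diff-upper (≤ʳ-trans (≤ʳ-reflexive (≃ʳ-sym (re-diff z w))) (re-bound h))

  im-close : ∀ {z w c} → ∥ z +ᶜ -ᶜ w ∥≤ c → im z ≤ʳ im w +ʳ c
  im-close {z} {w} h = diff-upper (≤ʳ-trans (≤ʳ-reflexive (≃ʳ-sym (im-diff z w))) (im-bound h))

  module _ {t} (0<t : 0ʳ <ʳ t) (t<1 : t <ʳ 1ʳ) where

    private
      0≤t = <⇒≤ʳ 0<t
      close : ∥ cis t +ᶜ -ᶜ (1ᶜ +ᶜ i *ᶜ fromℝ t) ∥≤ (t *ʳ t)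
      close = exp-near-1+z (norm-it (norm-fromℝ 0≤t)) (<⇒≤ʳ t<1)
      0<1-t = diff-posʳ t<1

    -- The estimate |cis t - (1 + it)| ≤ t² gives sin t ≥ t(1 - t) here and cos t ≥ 1 - t² in the
    -- next lemma.
    sin-pos-small : 0ʳ <ʳ sin t
    sin-pos-small = <-≤ʳ-trans (*ʳ-pos 0<t 0<1-t) (≤-by (diff-nonNegʳ bound₁) eq)
      where
      bound₁ : t ≤ʳ sin t +ʳ t *ʳ t
      bound₁ = ≤ʳ-trans (≤ʳ-reflexive (≃ʳ-sym (≃ʳ-trans (im-+ _ _) (≃ʳ-trans (+ʳ-cong (im-fromℝ _) (im-it t)) (+ʳ-identityˡ t)))))
        (im-close (norm-diff-sym close))
      eq : t *ʳ (1ʳ +ʳ -ʳ t) +ʳ (sin t +ʳ t *ʳ t +ʳ -ʳ t) ≃ʳ sin t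
      eq = solve 2 (λ t s → t :* (con 1ℚ :- t) :+ (s :+ t :* t :- t) := s) ≃ʳ-refl t (sin t)

    cos-pos-small : 0ʳ <ʳ cos t
    cos-pos-small = <-≤ʳ-trans (*ʳ-pos 0<1-t 0<1-t) (≤-by (+ʳ-nonNeg (diff-nonNegʳ bound₁) (*ʳ-nonNeg (⟨⟩-mono-≤ (nat-nonNeg 2)) (*ʳ-nonNeg 0≤t (<⇒≤ʳ 0<1-t)))) eq)
      where
      bound₁ : 1ʳ ≤ʳ cos t +ʳ t *ʳ t
      bound₁ = ≤ʳ-trans (≤ʳ-reflexive (≃ʳ-sym (≃ʳ-trans (re-+ _ _) (≃ʳ-trans (+ʳ-cong (re-fromℝ _) (re-it t)) (+ʳ-identityʳ _)))))
        (re-close (norm-diff-sym close))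
      eq : (1ʳ +ʳ -ʳ t) *ʳ (1ʳ +ʳ -ʳ t) +ʳ (cos t +ʳ t *ʳ t +ʳ -ʳ 1ʳ +ʳ ⟨ nat 2 ⟩ *ʳ (t *ʳ (1ʳ +ʳ -ʳ t))) ≃ʳ cos t
      eq = solve 2 (λ t c → (con 1ℚ :- t) :* (con 1ℚ :- t) :+ (c :+ t :* t :- con 1ℚ :+ con (nat 2) :* (t :* (con 1ℚ :- t))) := c) ≃ʳ-refl t (cos t)

  0<½ʳ : 0ʳ <ʳ ½ʳ
  0<½ʳ = ⟨⟩-mono-< (ℚ.positive⁻¹ ℚ.½)

  half+half : ∀ t → ½ʳ *ʳ t +ʳ ½ʳ *ʳ t ≃ʳ t
  half+half = solve 1 (λ t → con ℚ.½ :* t :+ con ℚ.½ :* t := t) ≃ʳ-refl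

  2ʳ : ℝ
  2ʳ = ⟨ nat 2 ⟩

  half-<1 : ∀ {t} → t <ʳ 2ʳ → ½ʳ *ʳ t <ʳ 1ʳ
  half-<1 t<2 = <ʳ-respʳ (solve 1 (λ x → con ℚ.½ :* con (nat 2) := con 1ℚ) ≃ʳ-refl 0ʳ) (*ʳ-monoʳ-< ½ʳ 0<½ʳ t<2)

  -- Doubling, sin 2u = 2 sin u cos u, extends positivity from (0, 1) to (0, 2).
  sin-pos : ∀ {t} → 0ʳ <ʳ t → t <ʳ 2ʳ → 0ʳ <ʳ sin t
  sin-pos {t} 0<t t<2 = <ʳ-respʳ (≃ʳ-sym (≃ʳ-trans (im-cong (cis-cong (≃ʳ-sym (half+half t)))) (sin-+ u u)))
    (+-pos (*ʳ-pos c s) (*ʳ-pos s c))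
    where
    u = ½ʳ *ʳ t
    0<u = *ʳ-pos 0<½ʳ 0<t
    s = sin-pos-small 0<u (half-<1 t<2)
    c = cos-pos-small 0<u (half-<1 t<2)
    +-pos : ∀ {x y} → 0ʳ <ʳ x → 0ʳ <ʳ y → 0ʳ <ʳ x +ʳ y
    +-pos p q = <ʳ-respˡ (+ʳ-identityˡ 0ʳ) (+ʳ-mono-< p q)

  -- cos x - cos y = 2 sin m sin h with m = (x + y)/2 and h = (y - x)/2, both in (0, 2).
  cos-decreasing : ∀ {x y} → 0ʳ ≤ʳ x → x <ʳ y → y ≤ʳ 2ʳ → cos y <ʳ cos x
  cos-decreasing {x} {y} 0≤x x<y y≤2 = <-by (*ʳ-pos (⟨⟩-mono-< (nat-mono-< {0} {2} (ℕ.s≤s ℕ.z≤n))) (*ʳ-pos sm sh))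
    (begin
      cos y +ʳ 2ʳ *ʳ (sin m *ʳ sin h)
        ≈⟨ +ʳ-cong (≃ʳ-trans (re-cong (cis-cong (solve 2 (λ x y → y := con ℚ.½ :* (x :+ y) :+ con ℚ.½ :* (y :- x)) ≃ʳ-refl x y))) (cos-+ m h)) ≃ʳ-refl ⟩
      cos m *ʳ cos h +ʳ -ʳ (sin m *ʳ sin h) +ʳ 2ʳ *ʳ (sin m *ʳ sin h)
        ≈⟨ solve 3 (λ a b s → a :* b :- s :+ con (nat 2) :* s := a :* b :+ s) ≃ʳ-refl (cos m) (cos h) (sin m *ʳ sin h) ⟩
      cos m *ʳ cos h +ʳ sin m *ʳ sin h
        ≈⟨ solve 4 (λ a b s t → a :* b :+ s :* t := a :* b :- s :* (:- t)) ≃ʳ-refl (cos m) (cos h) (sin m) (sin h) ⟩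
      cos m *ʳ cos h +ʳ -ʳ (sin m *ʳ -ʳ sin h)
        ≈⟨ +ʳ-cong (*ʳ-cong ≃ʳ-refl (re-cong (cis-neg h))) (-ʳ-cong (*ʳ-cong ≃ʳ-refl (im-cong (cis-neg h)))) ⟨
      cos m *ʳ cos (-ʳ h) +ʳ -ʳ (sin m *ʳ sin (-ʳ h))
        ≈⟨ cos-+ m (-ʳ h) ⟨
      cos (m +ʳ -ʳ h)
        ≈⟨ re-cong (cis-cong (solve 2 (λ x y → con ℚ.½ :* (x :+ y) :- con ℚ.½ :* (y :- x) := x) ≃ʳ-refl x y)) ⟩
      cos x ∎)
    where
    open ≃ʳ-Reasoning
    m = ½ʳ *ʳ (x +ʳ y)
    h = ½ʳ *ʳ (y +ʳ -ʳ x)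
    0<y-x = diff-posʳ x<y
    0<y = ≤-<ʳ-trans 0≤x x<y
    sm : 0ʳ <ʳ sin m
    sm = sin-pos (*ʳ-pos 0<½ʳ (<-≤ʳ-trans 0<y (≤-by 0≤x (+ʳ-comm y x))))
      (<-≤ʳ-trans (*ʳ-monoʳ-< ½ʳ 0<½ʳ (+ʳ-monoˡ-< y x<y)) (≤ʳ-trans (≤ʳ-reflexive (solve 1 (λ y → con ℚ.½ :* (y :+ y) := y) ≃ʳ-refl y)) y≤2))
    sh : 0ʳ <ʳ sin h
    sh = sin-pos (*ʳ-pos 0<½ʳ 0<y-x) (<-≤ʳ-trans (<-by (*ʳ-pos 0<½ʳ 0<y)
        (solve 2 (λ x y → con ℚ.½ :* (y :- x) :+ con ℚ.½ :* y := y :- con ℚ.½ :* x) ≃ʳ-refl x y))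
      (≤ʳ-trans (≤-by (*ʳ-nonNeg (<⇒≤ʳ 0<½ʳ) 0≤x) (solve 2 (λ x y → y :- con ℚ.½ :* x :+ con ℚ.½ :* x := y) ≃ʳ-refl x y)) y≤2))

  -- cos 1 = 1 - 1/2 up to 2/4!.
  cos-1-bounds : cos 1ʳ ≤ʳ ⟨ + 7 ℚ./ 12 ⟩ × -ʳ cos 1ʳ ≤ʳ 0ʳ
  cos-1-bounds =
      ≤ʳ-trans (re-close close) (≤ʳ-reflexive (≃ʳ-trans (+ʳ-cong re-partial ≃ʳ-refl) (solve 1 (λ x → con ℚ.½ :+ con (+ 1 ℚ./ 12) := con (+ 7 ℚ./ 12)) ≃ʳ-refl 0ʳ)))
    , ≤-by (≤ʳ-trans (⟨⟩-mono-≤ (ℚ.<⇒≤ (ℚ.positive⁻¹ (+ 5 ℚ./ 12)))) (≤-by (diff-nonNegʳ lower)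
          (solve 1 (λ c → con (+ 5 ℚ./ 12) :+ (c :+ con (+ 1 ℚ./ 12) :- con ℚ.½) := c) ≃ʳ-refl (cos 1ʳ))))
        (solve 1 (λ c → :- c :+ c := con 0ℚ) ≃ʳ-refl (cos 1ʳ))
    where
    z = i *ᶜ fromℝ 1ʳ
    z≃i : z ≃ i
    z≃i = *ᶜ-identityʳ i
    ∥z∥ : ∥ z ∥≤ 1ʳ
    ∥z∥ = norm-it (norm-fromℝ (<⇒≤ʳ 0<1ʳ))
    module ᶜ = ℂ-Solver
    term4 : ∥ term z 4 ∥≤ ⟨ + 1 ℚ./ 24 ⟩
    term4 = norm-resp (
        (ᶜ.solve 1 (λ z → z ᶜ.:* z ᶜ.:* (z ᶜ.:* z) ᶜ.:* ᶜ.con (+ 1 ℚ./ 24) ᶜ.:=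
          ᶜ.con 1ℚ ᶜ.:* (z ᶜ.:* ᶜ.con (reciprocal 0)) ᶜ.:* (z ᶜ.:* ᶜ.con (reciprocal 1)) ᶜ.:* (z ᶜ.:* ᶜ.con (reciprocal 2)) ᶜ.:* (z ᶜ.:* ᶜ.con (reciprocal 3))) ≃-refl z))
      (norm-weaken (≤ʳ-reflexive (solve 1 (λ x → con 1ℚ :* con 1ℚ :* (con 1ℚ :* con 1ℚ) :* con (+ 1 ℚ./ 24) := con (+ 1 ℚ./ 24)) ≃ʳ-refl 0ʳ))
        (norm-* (norm-* (norm-* ∥z∥ ∥z∥) (norm-* ∥z∥ ∥z∥)) (norm-fromℝ (⟨⟩-mono-≤ (ℚ.<⇒≤ (ℚ.positive⁻¹ (+ 1 ℚ./ 24)))))))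
    close : ∥ cis 1ʳ +ᶜ -ᶜ sum (term z) 4 ∥≤ ⟨ + 1 ℚ./ 12 ⟩
    close = norm-weaken (≤ʳ-reflexive (solve 1 (λ x → con (nat 2) :* con (+ 1 ℚ./ 24) := con (+ 1 ℚ./ 12)) ≃ʳ-refl 0ʳ))
      (exp-tail 4 (ℕ.s≤s ℕ.z≤n) ∥z∥ ≤ʳ-refl term4)
    partial : sum (term z) 4 ≃ fromℝ ½ʳ +ᶜ i *ᶜ fromℝ ⟨ + 5 ℚ./ 6 ⟩
    partial = begin
      sum (term z) 4
        ≈⟨ ᶜ.solve 1 (λ z → ᶜ.con 0ℚ ᶜ.:+ ᶜ.con 1ℚ ᶜ.:+ ᶜ.con 1ℚ ᶜ.:* (z ᶜ.:* ᶜ.con (reciprocal 0))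
              ᶜ.:+ ᶜ.con 1ℚ ᶜ.:* (z ᶜ.:* ᶜ.con (reciprocal 0)) ᶜ.:* (z ᶜ.:* ᶜ.con (reciprocal 1))
              ᶜ.:+ ᶜ.con 1ℚ ᶜ.:* (z ᶜ.:* ᶜ.con (reciprocal 0)) ᶜ.:* (z ᶜ.:* ᶜ.con (reciprocal 1)) ᶜ.:* (z ᶜ.:* ᶜ.con (reciprocal 2))
              ᶜ.:= ᶜ.con 1ℚ ᶜ.:+ z ᶜ.:+ z ᶜ.:* z ᶜ.:* ᶜ.con ℚ.½ ᶜ.:+ z ᶜ.:* (z ᶜ.:* z) ᶜ.:* ᶜ.con (+ 1 ℚ./ 6)) ≃-refl z ⟩
      1ᶜ +ᶜ z +ᶜ z *ᶜ z *ᶜ ⟪ ℚ.½ ⟫ +ᶜ z *ᶜ (z *ᶜ z) *ᶜ ⟪ + 1 ℚ./ 6 ⟫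
        ≈⟨ +ᶜ-cong (+ᶜ-cong (+ᶜ-cong ≃-refl z≃i) (*ᶜ-cong z² ≃-refl)) (*ᶜ-cong (*ᶜ-cong z≃i z²) ≃-refl) ⟩
      1ᶜ +ᶜ i +ᶜ -ᶜ 1ᶜ *ᶜ ⟪ ℚ.½ ⟫ +ᶜ i *ᶜ -ᶜ 1ᶜ *ᶜ ⟪ + 1 ℚ./ 6 ⟫
        ≈⟨ ᶜ.solve 1 (λ i → ᶜ.con 1ℚ ᶜ.:+ i ᶜ.:+ (ᶜ.:- ᶜ.con 1ℚ) ᶜ.:* ᶜ.con ℚ.½ ᶜ.:+ i ᶜ.:* (ᶜ.:- ᶜ.con 1ℚ) ᶜ.:* ᶜ.con (+ 1 ℚ./ 6)
              ᶜ.:= ᶜ.con ℚ.½ ᶜ.:+ i ᶜ.:* ᶜ.con (+ 5 ℚ./ 6)) ≃-refl i ⟩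
      fromℝ ½ʳ +ᶜ i *ᶜ fromℝ ⟨ + 5 ℚ./ 6 ⟩ ∎
      where
      open ≃-Reasoning
      z² : z *ᶜ z ≃ -ᶜ 1ᶜ
      z² = ≃-trans (*ᶜ-cong z≃i z≃i) i*i
    re-partial : re (sum (term z) 4) ≃ʳ ½ʳ
    re-partial = ≃ʳ-trans (re-cong partial) (≃ʳ-trans (re-+ _ _) (≃ʳ-trans (+ʳ-cong (re-fromℝ _) (re-it _))
      (+ʳ-identityʳ ½ʳ)))
    lower : ½ʳ ≤ʳ cos 1ʳ +ʳ ⟨ + 1 ℚ./ 12 ⟩
    lower = ≤ʳ-trans (≤ʳ-reflexive (≃ʳ-sym re-partial)) (re-close (norm-diff-sym close))

  -- cos 2 = 2 cos² 1 - 1 ≤ 2 (7/12)² - 1 = -23/72.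
  cos-2<0 : cos 2ʳ <ʳ 0ʳ
  cos-2<0 = ≤-<ʳ-trans (begin
      cos 2ʳ                                        ≈⟨ re-cong (cis-cong (solve 1 (λ x → con (nat 2) := con 1ℚ :+ con 1ℚ) ≃ʳ-refl 0ʳ)) ⟩
      cos (1ʳ +ʳ 1ʳ)                                ≈⟨ cos-+ 1ʳ 1ʳ ⟩
      c *ʳ c +ʳ -ʳ (sin 1ʳ *ʳ sin 1ʳ)               ≈⟨ solve 2 (λ c s → c :* c :- s :* s := con (nat 2) :* (c :* c) :- (c :* c :+ s :* s)) ≃ʳ-refl c (sin 1ʳ) ⟩
      2ʳ *ʳ (c *ʳ c) +ʳ -ʳ (c *ʳ c +ʳ sin 1ʳ *ʳ sin 1ʳ) ≈⟨ +ʳ-cong ≃ʳ-refl (-ʳ-cong (cos²+sin² 1ʳ)) ⟩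
      2ʳ *ʳ (c *ʳ c) +ʳ -ʳ 1ʳ                       ≤⟨ +ʳ-monoˡ-≤ _ (*ʳ-monoʳ-≤ 2ʳ (⟨⟩-mono-≤ (nat-nonNeg 2)) (*ʳ-mono-≤ 0≤c 0≤7/12 c≤ c≤)) ⟩
      2ʳ *ʳ (⟨ + 7 ℚ./ 12 ⟩ *ʳ ⟨ + 7 ℚ./ 12 ⟩) +ʳ -ʳ 1ʳ
        ≈⟨ solve 1 (λ x → con (nat 2) :* (con (+ 7 ℚ./ 12) :* con (+ 7 ℚ./ 12)) :- con 1ℚ := :- con (+ 23 ℚ./ 72)) ≃ʳ-refl 0ʳ ⟩
      -ʳ ⟨ + 23 ℚ./ 72 ⟩                            ∎)
    (<-by (⟨⟩-mono-< (ℚ.positive⁻¹ (+ 23 ℚ./ 72))) (CommutativeRing.-‿inverseˡ ℝ-commutativeRing _))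
    where
    open ≤ʳ-Reasoning
    c = cos 1ʳ
    c≤ = proj₁ cos-1-bounds
    0≤7/12 = ⟨⟩-mono-≤ (ℚ.<⇒≤ (ℚ.positive⁻¹ (+ 7 ℚ./ 12)))
    0≤c : 0ʳ ≤ʳ c
    0≤c = ≤ʳ-trans (diff-nonNegʳ (proj₂ cos-1-bounds)) (≤ʳ-reflexive (solve 1 (λ c → con 0ℚ :- (:- c) := c) ≃ʳ-refl c))

  -- The zero of the cosine

  ⅓ ⅔ : ℚ
  ⅓ = + 1 ℚ./ 3
  ⅔ = + 2 ℚ./ 3

  record Bracket (w : ℚ) : Set where
    field
      left  : ℚ
      0≤l   : 0ℚ ℚ.≤ left
      r≤2   : left ℚ.+ w ℚ.≤ nat 2
      cos-l : 0ʳ <ʳ cos ⟨ left ⟩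
      cos-r : cos ⟨ left ℚ.+ w ⟩ <ʳ 0ʳ

  open Bracket

  width : ℕ → ℚ
  width zero    = nat 2
  width (suc j) = width j ℚ.* ⅔

  width-pos : ∀ j → 0ℚ ℚ.< width j
  width-pos zero    = ℚ.positive⁻¹ (nat 2)
  width-pos (suc j) = *-pos (width-pos j) (ℚ.positive⁻¹ ⅔)

  -- Bisection would need the sign of the cosine at the midpoint. With two inner points m₁ < m₂ one
  -- has cos m₂ < cos m₁, and cotransitivity at 0 yields cos m₂ < 0 or 0 < cos m₁. The bracket
  -- [l, m₂] or [m₁, r] keeps two thirds of the width.
  trisect : ∀ {w} → 0ℚ ℚ.< w → (b : Bracket w) →
    Σ (Bracket (w ℚ.* ⅔)) λ b′ → left b ℚ.≤ left b′ × left b′ ℚ.+ w ℚ.* ⅔ ℚ.≤ left b ℚ.+ w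
  trisect {w} 0<w b = choose (<ʳ-cotrans (cos-decreasing 0≤m₁ (⟨⟩-mono-< m₁<m₂) m₂≤2) 0ʳ)
    where
    l = left b
    0<⅓w : 0ℚ ℚ.< w ℚ.* ⅓
    0<⅓w = *-pos 0<w (ℚ.positive⁻¹ ⅓)
    l<m₁ : l ℚ.< l ℚ.+ w ℚ.* ⅓
    l<m₁ = from-diff 0<⅓w (eq l (w ℚ.* ⅓))
      where
      eq : ∀ l u → u ≡ l ℚ.+ u ℚ.- l
      eq = +-*-Solver.solve 2 (λ l u → u S.:= l S.:+ u S.:- l) refl
        where module S = +-*-Solver
    m₁<m₂ : l ℚ.+ w ℚ.* ⅓ ℚ.< l ℚ.+ w ℚ.* ⅔
    m₁<m₂ = from-diff 0<⅓w (eq l w)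
      where
      eq : ∀ l w → w ℚ.* ⅓ ≡ l ℚ.+ w ℚ.* ⅔ ℚ.- (l ℚ.+ w ℚ.* ⅓)
      eq = +-*-Solver.solve 2 (λ l w → w S.:* S.con ⅓ S.:= l S.:+ w S.:* S.con ⅔ S.:- (l S.:+ w S.:* S.con ⅓)) refl
        where module S = +-*-Solver
    m₂<r : l ℚ.+ w ℚ.* ⅔ ℚ.< l ℚ.+ w
    m₂<r = from-diff 0<⅓w (eq l w)
      where
      eq : ∀ l w → w ℚ.* ⅓ ≡ l ℚ.+ w ℚ.- (l ℚ.+ w ℚ.* ⅔)
      eq = +-*-Solver.solve 2 (λ l w → w S.:* S.con ⅓ S.:= l S.:+ w S.:- (l S.:+ w S.:* S.con ⅔)) refl
        where module S = +-*-Solver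
    thirds : l ℚ.+ w ℚ.* ⅓ ℚ.+ w ℚ.* ⅔ ≡ l ℚ.+ w
    thirds = eq l w
      where
      eq : ∀ l w → l ℚ.+ w ℚ.* ⅓ ℚ.+ w ℚ.* ⅔ ≡ l ℚ.+ w
      eq = +-*-Solver.solve 2 (λ l w → l S.:+ w S.:* S.con ⅓ S.:+ w S.:* S.con ⅔ S.:= l S.:+ w) refl
        where module S = +-*-Solver
    0≤m₁ : 0ʳ ≤ʳ ⟨ l ℚ.+ w ℚ.* ⅓ ⟩
    0≤m₁ = ⟨⟩-mono-≤ (ℚ.≤-trans (0≤l b) (ℚ.<⇒≤ l<m₁))
    m₂≤2 : ⟨ l ℚ.+ w ℚ.* ⅔ ⟩ ≤ʳ 2ʳ
    m₂≤2 = ⟨⟩-mono-≤ (ℚ.≤-trans (ℚ.<⇒≤ m₂<r) (r≤2 b))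
    choose : cos ⟨ l ℚ.+ w ℚ.* ⅔ ⟩ <ʳ 0ʳ ⊎ 0ʳ <ʳ cos ⟨ l ℚ.+ w ℚ.* ⅓ ⟩ →
      Σ (Bracket (w ℚ.* ⅔)) λ b′ → l ℚ.≤ left b′ × left b′ ℚ.+ w ℚ.* ⅔ ℚ.≤ l ℚ.+ w
    choose (inj₁ c) = record { left = l ; 0≤l = 0≤l b ; r≤2 = ℚ.≤-trans (ℚ.<⇒≤ m₂<r) (r≤2 b) ; cos-l = cos-l b ; cos-r = c }
      , ℚ.≤-refl , ℚ.<⇒≤ m₂<r
    choose (inj₂ c) = record
      { left = l ℚ.+ w ℚ.* ⅓
      ; 0≤l = ℚ.≤-trans (0≤l b) (ℚ.<⇒≤ l<m₁)
      ; r≤2 = subst (ℚ._≤ nat 2) (sym thirds) (r≤2 b)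
      ; cos-l = c
      ; cos-r = subst (λ r → cos ⟨ r ⟩ <ʳ 0ʳ) (sym thirds) (cos-r b) }
      , ℚ.<⇒≤ l<m₁ , ℚ.≤-reflexive thirds

  cos-0 : cos 0ʳ ≃ʳ 1ʳ
  cos-0 = ≃ʳ-trans (re-cong (≃-trans (exp-cong (*ᶜ-zeroʳ i)) exp-0)) (re-fromℝ 1ʳ)

  bracket : ∀ j → Bracket (width j)
  bracket zero = record
    { left = 0ℚ ; 0≤l = ℚ.≤-refl ; r≤2 = ℚ.≤-reflexive (ℚ.+-identityˡ (nat 2))
    ; cos-l = <ʳ-respʳ (≃ʳ-sym cos-0) 0<1ʳ
    ; cos-r = subst (λ r → cos ⟨ r ⟩ <ʳ 0ʳ) (sym (ℚ.+-identityˡ (nat 2))) cos-2<0 }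
  bracket (suc j) = proj₁ (trisect (width-pos j) (bracket j))

  nested : ∀ m j → left (bracket m) ℚ.≤ left (bracket (j ℕ.+ m)) ×
    left (bracket (j ℕ.+ m)) ℚ.+ width (j ℕ.+ m) ℚ.≤ left (bracket m) ℚ.+ width m
  nested m zero    = ℚ.≤-refl , ℚ.≤-refl
  nested m (suc j) = let a , b = nested m j
                         c , d = proj₂ (trisect (width-pos (j ℕ.+ m)) (bracket (j ℕ.+ m)))
                     in ℚ.≤-trans a c , ℚ.≤-trans d b

  nested-≤ : ∀ {m n} → m ℕ.≤ n → left (bracket m) ℚ.≤ left (bracket n) × left (bracket n) ℚ.≤ left (bracket m) ℚ.+ width m
  nested-≤ {m} {n} m≤n = subst (λ n → left (bracket m) ℚ.≤ left (bracket n) × left (bracket n) ℚ.≤ left (bracket m) ℚ.+ width m)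
    (ℕ.m∸n+n≡m m≤n) (let a , b = nested m (n ℕ.∸ m) ; k = n ℕ.∸ m ℕ.+ m in a , ℚ.≤-trans
      (subst (ℚ._≤ left (bracket k) ℚ.+ width k) (ℚ.+-identityʳ _) (ℚ.+-monoʳ-≤ (left (bracket k)) (ℚ.<⇒≤ (width-pos k)))) b)

  width→0 : ∀ q → 0ℚ ℚ.< q → ∃[ M ] (∀ m → M ℕ.≤ m → ⟨ width m ⟩ ≤ʳ ⟨ q ⟩)
  width→0 q 0<q = let M , h = power→0 (⟨⟩-mono-≤ (ℚ.<⇒≤ (ℚ.positive⁻¹ ⅔))) 0<½ʳ
                          (≤ʳ-reflexive (solve 1 (λ x → con ⅔ :* (con 1ℚ :+ con ℚ.½) := con 1ℚ) ≃ʳ-refl 0ʳ)) 2ʳ (⟨⟩-mono-< 0<q)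
    in M , λ m M≤m → ≤ʳ-trans (≤ʳ-reflexive (width-power m)) (h m M≤m)
    where
    width-power : ∀ m → ⟨ width m ⟩ ≃ʳ 2ʳ *ʳ ⟨ ⅔ ⟩ ^ʳ m
    width-power zero    = ≃ʳ-sym (*ʳ-identityʳ 2ʳ)
    width-power (suc m) = ≃ʳ-trans (⟨⟩-* (width m) ⅔) (≃ʳ-trans (*ʳ-cong (width-power m) ≃ʳ-refl)
      (solve 3 (λ a p t → a :* p :* t := a :* (t :* p)) ≃ʳ-refl 2ʳ (⟨ ⅔ ⟩ ^ʳ m) ⟨ ⅔ ⟩))

  lefts : ℕ → ℝ
  lefts j = ⟨ left (bracket j) ⟩

  lefts-cauchy : ∀ q → 0ℚ ℚ.< q → ∃[ N ] (∀ m n → N ℕ.≤ m → N ℕ.≤ n → lefts m ≤ʳ lefts n +ʳ ⟨ q ⟩)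
  lefts-cauchy q 0<q = let N , h = width→0 q 0<q in N , λ m n N≤m N≤n →
    [ (λ m≤n → ≤ʳ-trans (⟨⟩-mono-≤ (proj₁ (nested-≤ m≤n))) (≤-by (⟨⟩-mono-≤ (ℚ.<⇒≤ 0<q)) ≃ʳ-refl))
    , (λ n≤m → ≤ʳ-trans (⟨⟩-mono-≤ (proj₂ (nested-≤ n≤m))) (≤ʳ-trans (≤ʳ-reflexive (⟨⟩-+ _ _)) (+ʳ-monoʳ-≤ (lefts n) (h n N≤n))))
    ]′ (ℕ.≤-total m n)

  opaque
    -- π/2
    τ : ℝ
    τ = limit lefts lefts-cauchy

    τ-near : ∀ q → 0ℚ ℚ.< q → ∃[ N ] (∀ n → N ℕ.≤ n → lefts n ≤ʳ τ +ʳ ⟨ q ⟩ × τ ≤ʳ lefts n +ʳ ⟨ q ⟩)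
    τ-near = limit-close lefts lefts-cauchy

  left≤τ : ∀ m → lefts m ≤ʳ τ
  left≤τ m = ≤ʳ-limit λ q 0<q → let N , h = τ-near q 0<q ; n = m ℕ.⊔ N in
    ≤ʳ-trans (⟨⟩-mono-≤ (proj₁ (nested-≤ (ℕ.m≤m⊔n m N)))) (proj₁ (h n (ℕ.m≤n⊔m m N)))

  τ≤right : ∀ m → τ ≤ʳ ⟨ left (bracket m) ℚ.+ width m ⟩
  τ≤right m = ≤ʳ-limit λ q 0<q → let N , h = τ-near q 0<q ; n = m ℕ.⊔ N in
    ≤ʳ-trans (proj₂ (h n (ℕ.m≤n⊔m m N))) (+ʳ-monoˡ-≤ ⟨ q ⟩ (⟨⟩-mono-≤ (proj₂ (nested-≤ (ℕ.m≤m⊔n m N)))))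

  τ≤2 : τ ≤ʳ 2ʳ
  τ≤2 = ≤ʳ-trans (τ≤right 0) (⟨⟩-mono-≤ (r≤2 (bracket 0)))

  norm-cis : ∀ t → ∥ cis t ∥≤ 1ʳ
  norm-cis t = norm-weaken (≤ʳ-reflexive (≃ʳ-trans (expʳ-cong (re-it t)) expʳ-0)) (norm-exp (i *ᶜ fromℝ t))

  -- cis t - cis s = cis s (cis (t - s) - 1), where |cis s| ≤ 1 and the second factor is at most 2a.
  cos-lipschitz : ∀ {s t a} → ∥ fromℝ (t +ʳ -ʳ s) ∥≤ a → a ≤ʳ 1ʳ → cos t ≤ʳ cos s +ʳ 2ʳ *ʳ a
  cos-lipschitz {s} {t} {a} h a≤1 = re-close (norm-resp eq (norm-weaken (≤ʳ-reflexive (*ʳ-identityˡ (2ʳ *ʳ a)))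
    (norm-* (norm-cis s) (exp-near-1 (norm-it h) a≤1))))
    where
    eq : cis s *ᶜ (cis (t +ʳ -ʳ s) +ᶜ -ᶜ 1ᶜ) ≃ cis t +ᶜ -ᶜ cis s
    eq = ≃-trans (ℂ-Solver.solve 2 (λ a b → a C.:* (b C.:- C.con 1ℚ) C.:= a C.:* b C.:- a) ≃-refl (cis s) (cis (t +ʳ -ʳ s)))
      (+ᶜ-cong (≃-trans (≃-sym (cis-+ s (t +ʳ -ʳ s))) (cis-cong (solve 2 (λ s t → s :+ (t :- s) := t) ≃ʳ-refl s t))) ≃-refl)
      where module C = ℂ-Solver

  between : ∀ {x y l w} → l ≤ʳ x → x ≤ʳ l +ʳ w → l ≤ʳ y → y ≤ʳ l +ʳ w → ∥ fromℝ (x +ʳ -ʳ y) ∥≤ w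
  between {x} {y} {l} {w} l≤x x≤r l≤y y≤r = abs-bound (half x≤r l≤y)
    (≤ʳ-trans (≤ʳ-reflexive (solve 2 (λ x y → :- (x :- y) := y :- x) ≃ʳ-refl x y)) (half y≤r l≤x))
    where
    half : ∀ {x y} → x ≤ʳ l +ʳ w → l ≤ʳ y → x +ʳ -ʳ y ≤ʳ w
    half {x} {y} x≤ l≤ = ≤-by (+ʳ-nonNeg (diff-nonNegʳ x≤) (diff-nonNegʳ l≤))
      (solve 4 (λ x y l w → x :- y :+ ((l :+ w :- x) :+ (y :- l)) := w) ≃ʳ-refl x y l w)

  -- In a bracket of width w, cos τ is within 2w of the values at both ends, which have opposite
  -- signs.
  cos-τ : cos τ ≃ʳ 0ʳ
  cos-τ = ≤ʳ-antisym
    (≤ʳ-limit λ q 0<q → let m , w≤1 , 2w≤q = small q 0<q ; l≤τ = left≤τ m ; τ≤r = ≤ʳ-trans (τ≤right m) (≤ʳ-reflexive (⟨⟩-+ _ _)) in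
      ≤ʳ-trans (cos-lipschitz {⟨ left (bracket m) ℚ.+ width m ⟩} (between l≤τ τ≤r (l≤r m) (≤ʳ-reflexive (⟨⟩-+ _ _))) w≤1)
        (+ʳ-mono-≤ (<⇒≤ʳ (cos-r (bracket m))) 2w≤q))
    (≤ʳ-limit λ q 0<q → let m , w≤1 , 2w≤q = small q 0<q ; l≤τ = left≤τ m ; τ≤r = ≤ʳ-trans (τ≤right m) (≤ʳ-reflexive (⟨⟩-+ _ _)) in
      ≤ʳ-trans (<⇒≤ʳ (cos-l (bracket m))) (≤ʳ-trans (cos-lipschitz {τ} (between ≤ʳ-refl (≤-by (⟨⟩-mono-≤ (ℚ.<⇒≤ (width-pos m))) ≃ʳ-refl) l≤τ τ≤r) w≤1)
        (+ʳ-monoʳ-≤ (cos τ) 2w≤q)))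
    where
    l≤r : ∀ m → lefts m ≤ʳ ⟨ left (bracket m) ℚ.+ width m ⟩
    l≤r m = ≤-by (⟨⟩-mono-≤ (ℚ.<⇒≤ (width-pos m))) (≃ʳ-sym (⟨⟩-+ _ _))
    small : ∀ q → 0ℚ ℚ.< q → ∃[ m ] ⟨ width m ⟩ ≤ʳ 1ʳ × 2ʳ *ʳ ⟨ width m ⟩ ≤ʳ ⟨ q ⟩
    small q 0<q = let M , h = width→0 1ℚ (ℚ.positive⁻¹ 1ℚ)
                      N , k = width→0 (q ℚ.* ℚ.½) (*-pos 0<q (ℚ.positive⁻¹ ℚ.½))
                  in M ℕ.⊔ N , h _ (ℕ.m≤m⊔n M N) , ≤ʳ-trans (*ʳ-monoʳ-≤ 2ʳ (⟨⟩-mono-≤ (nat-nonNeg 2)) (k _ (ℕ.m≤n⊔m M N)))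
                       (≤ʳ-reflexive (≃ʳ-trans (*ʳ-cong ≃ʳ-refl (⟨⟩-* q ℚ.½)) (solve 1 (λ q → con (nat 2) :* (q :* con ℚ.½) := q) ≃ʳ-refl ⟨ q ⟩)))

  0<τ : 0ʳ <ʳ τ
  0<τ with <ʳ-cotrans (⟨⟩-mono-< (ℚ.positive⁻¹ (+ 1 ℚ./ 4))) τ
  ... | inj₁ 0<τ = 0<τ
  -- The Lipschitz bound would give 1 = cos 0 ≤ cos τ + 2/4 = 1/2.
  ... | inj₂ τ<¼ = ⊥-elim (≤⇒≯ (≤ʳ-trans (≤ʳ-reflexive (≃ʳ-sym cos-0))
          (≤ʳ-trans (cos-lipschitz {τ} {0ʳ} (between ≤ʳ-refl (≤ʳ-trans 0≤¼ (≤ʳ-reflexive (≃ʳ-sym (+ʳ-identityˡ _)))) (left≤τ 0)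
              (≤ʳ-trans (<⇒≤ʳ τ<¼) (≤ʳ-reflexive (≃ʳ-sym (+ʳ-identityˡ _))))) (≤-by (⟨⟩-mono-≤ (ℚ.<⇒≤ (ℚ.positive⁻¹ (+ 3 ℚ./ 4))))
                (solve 1 (λ x → con (+ 1 ℚ./ 4) :+ con (+ 3 ℚ./ 4) := con 1ℚ) ≃ʳ-refl 0ʳ)))
            (≤ʳ-reflexive (≃ʳ-trans (+ʳ-cong cos-τ ≃ʳ-refl) (solve 1 (λ x → con 0ℚ :+ con (nat 2) :* con (+ 1 ℚ./ 4) := con ℚ.½) ≃ʳ-refl 0ʳ)))))
        (<-by 0<½ʳ (solve 1 (λ x → con ℚ.½ :+ con ℚ.½ := con 1ℚ) ≃ʳ-refl 0ʳ)))
    where 0≤¼ = ⟨⟩-mono-≤ (ℚ.<⇒≤ (ℚ.positive⁻¹ (+ 1 ℚ./ 4)))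

  cis-nat* : ∀ k t → cis t ^ᶜ k ≃ cis (⟨ nat k ⟩ *ʳ t)
  cis-nat* zero    t = ≃-sym (≃-trans (exp-cong (≃-trans (*ᶜ-cong ≃-refl (fromℝ-cong (*ʳ-zeroˡ t))) (*ᶜ-zeroʳ i))) exp-0)
  cis-nat* (suc k) t = ≃-trans (*ᶜ-cong ≃-refl (cis-nat* k t)) (≃-trans (≃-sym (cis-+ t _))
    (cis-cong (≃ʳ-trans (solve 2 (λ t n → t :+ n :* t := (con 1ℚ :+ n) :* t) ≃ʳ-refl t ⟨ nat k ⟩)
      (*ʳ-cong (≃ʳ-sym (≃ʳ-trans (⟨⟩-cong (nat-+ 1 k)) (⟨⟩-+ 1ℚ (nat k)))) ≃ʳ-refl))))

  cis-2τ : cis (τ +ʳ τ) ≃ -ᶜ 1ᶜ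
  cis-2τ = ≃-intro
    (≃ʳ-trans (cos-+ τ τ) (≃ʳ-trans (solve 2 (λ c s → c :* c :- s :* s := con (nat 2) :* (c :* c) :- (c :* c :+ s :* s)) ≃ʳ-refl (cos τ) (sin τ))
      (≃ʳ-trans (+ʳ-cong (*ʳ-cong ≃ʳ-refl (*ʳ-cong cos-τ cos-τ)) (-ʳ-cong (cos²+sin² τ)))
        (≃ʳ-trans (solve 1 (λ x → con (nat 2) :* (con 0ℚ :* con 0ℚ) :- con 1ℚ := :- con 1ℚ) ≃ʳ-refl 0ʳ)
          (≃ʳ-sym (≃ʳ-trans (re-neg 1ᶜ) (-ʳ-cong (re-fromℝ 1ʳ))))))))
    (≃ʳ-trans (sin-+ τ τ) (≃ʳ-trans (+ʳ-cong (*ʳ-cong cos-τ ≃ʳ-refl) (*ʳ-cong ≃ʳ-refl cos-τ))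
      (≃ʳ-trans (solve 1 (λ s → con 0ℚ :* s :+ s :* con 0ℚ := :- con 0ℚ) ≃ʳ-refl (sin τ))
        (≃ʳ-sym (≃ʳ-trans (im-neg 1ᶜ) (-ʳ-cong (im-fromℝ 1ʳ)))))))

  -- 2π
  4τ : ℝ
  4τ = τ +ʳ τ +ʳ (τ +ʳ τ)

  cis-4τ : cis 4τ ≃ 1ᶜ
  cis-4τ = ≃-trans (cis-+ (τ +ʳ τ) (τ +ʳ τ)) (≃-trans (*ᶜ-cong cis-2τ cis-2τ)
    (ℂ-Solver.solve 1 (λ x → (C.:- C.con 1ℚ) C.:* (C.:- C.con 1ℚ) C.:= C.con 1ℚ) ≃-refl 0ᶜ))
    where module C = ℂ-Solver

  -- Since cos u and sin u are positive, cis (2u) lies in the open upper half plane, so its square is not 1.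
  cis-4u≄1 : ∀ {u} → 0ʳ <ʳ u → u <ʳ τ → ¬ cis (u +ʳ u +ʳ (u +ʳ u)) ≃ 1ᶜ
  cis-4u≄1 {u} 0<u u<τ e = <ʳ-asym 0<1ʳ (<ʳ-respˡ (≃ʳ-trans (≃ʳ-sym re≃) (≃ʳ-trans (re-cong e) (re-fromℝ 1ʳ)))
      (<-by (*ʳ-pos 0<B 0<B) (≃ʳ-trans (+ʳ-cong (+ʳ-cong (*ʳ-cong A≃0 ≃ʳ-refl) ≃ʳ-refl) ≃ʳ-refl)
        (solve 2 (λ a b → con 0ℚ :* a :- b :* b :+ b :* b := con 0ℚ) ≃ʳ-refl A B))))
    where
    A = cos (u +ʳ u)
    B = sin (u +ʳ u)
    0<cos : 0ʳ <ʳ cos u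
    0<cos = <ʳ-respˡ cos-τ (cos-decreasing (<⇒≤ʳ 0<u) u<τ τ≤2)
    0<sin : 0ʳ <ʳ sin u
    0<sin = sin-pos 0<u (<-≤ʳ-trans u<τ τ≤2)
    0<B : 0ʳ <ʳ B
    0<B = <ʳ-respˡ (+ʳ-identityˡ 0ʳ) (<ʳ-respʳ (≃ʳ-sym (sin-+ u u)) (+ʳ-mono-< (*ʳ-pos 0<cos 0<sin) (*ʳ-pos 0<sin 0<cos)))
    re≃ : cos (u +ʳ u +ʳ (u +ʳ u)) ≃ʳ A *ʳ A +ʳ -ʳ (B *ʳ B)
    re≃ = cos-+ (u +ʳ u) (u +ʳ u)
    A≃0 : A ≃ʳ 0ʳ
    A≃0 = *ʳ-cancel-0 (≃ʳ-trans (solve 2 (λ a b → a :* b := con ℚ.½ :* (a :* b :+ b :* a)) ≃ʳ-refl A B)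
      (≃ʳ-trans (*ʳ-cong ≃ʳ-refl (≃ʳ-trans (≃ʳ-sym (sin-+ (u +ʳ u) (u +ʳ u))) (≃ʳ-trans (im-cong e) (im-fromℝ 1ʳ)))) (*ʳ-zeroʳ ½ʳ))) 0<B

  Primitive : ℕ → ℂ → Set
  Primitive N ξ = ξ ^ᶜ N ≃ 1ᶜ × (∀ k → 0 ℕ.< k → k ℕ.< N → ¬ ξ ^ᶜ k ≃ 1ᶜ)

  primitive-root : ∀ N → ∃[ ξ ] Primitive (suc N) ξ
  primitive-root N = cis (4τ *ʳ r) ,
      ≃-trans (cis-nat* (suc N) (4τ *ʳ r)) (≃-trans (cis-cong (≃ʳ-trans (solve 3 (λ n t r → n :* (t :* r) := n :* r :* t) ≃ʳ-refl ⟨ nat (suc N) ⟩ 4τ r)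
        (≃ʳ-trans (*ʳ-cong nr≃1 ≃ʳ-refl) (*ʳ-identityˡ 4τ)))) cis-4τ)
    -- The k-th power is `cis` of 4u with u = (k/(N + 1)) τ, strictly between 0 and τ.
    , λ k 0<k k<N h → cis-4u≄1 {⟨ nat k ⟩ *ʳ r *ʳ τ} (*ʳ-pos (*ʳ-pos (⟨⟩-mono-< (nat-mono-< 0<k)) 0<r) 0<τ)
        (<ʳ-respʳ (≃ʳ-trans (*ʳ-cong nr≃1 ≃ʳ-refl) (*ʳ-identityˡ τ))
          (<ʳ-respˡ (solve 3 (λ k r t → t :* r :* k := k :* r :* t) ≃ʳ-refl ⟨ nat k ⟩ r τ)
          (<ʳ-respʳ (solve 3 (λ k r t → t :* r :* k := k :* r :* t) ≃ʳ-refl ⟨ nat (suc N) ⟩ r τ)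
            (*ʳ-monoʳ-< (τ *ʳ r) (*ʳ-pos 0<τ 0<r) (⟨⟩-mono-< (nat-mono-< k<N))))))
        (≃-trans (cis-cong (solve 3 (λ k r t → (let u = k :* r :* t in u :+ u :+ (u :+ u)) := k :* ((t :+ t :+ (t :+ t)) :* r)) ≃ʳ-refl ⟨ nat k ⟩ r τ))
          (≃-trans (≃-sym (cis-nat* k (4τ *ʳ r))) h))
    where
    r = ⟨ reciprocal N ⟩
    0<r = ⟨⟩-mono-< (reciprocal-pos N)
    nr≃1 : ⟨ nat (suc N) ⟩ *ʳ r ≃ʳ 1ʳ
    nr≃1 = ≃ʳ-trans (≃ʳ-sym (⟨⟩-* _ _)) (⟨⟩-cong (reciprocal-inverse N))

open RootsOfUnity using (Primitive; primitive-root)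

-- Exponential sums and numbers of solutions

sum-split : ∀ f m n → sum f (n ℕ.+ m) ≃ sum f m +ᶜ sum (λ j → f (j ℕ.+ m)) n
sum-split f m zero    = ≃-sym (+ᶜ-identityʳ _)
sum-split f m (suc n) = ≃-trans (+ᶜ-cong (sum-split f m n) ≃-refl) (+ᶜ-assoc _ _ _)

sum-blocks : ∀ f a b → sum f (a ℕ.* b) ≃ sum (λ v → sum (λ j → f (j ℕ.+ v ℕ.* b)) b) a
sum-blocks f zero    b = ≃-refl
sum-blocks f (suc a) b = ≃-trans (sum-split f (a ℕ.* b) b) (+ᶜ-cong (sum-blocks f a b) ≃-refl)

sum-const : ∀ c n → sum (λ _ → c) n ≃ ⟪ nat n ⟫ *ᶜ c
sum-const c zero    = ≃-sym (*ᶜ-zeroˡ c)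
sum-const c (suc n) = ≃-trans (+ᶜ-cong (sum-const c n) ≃-refl)
  (≃-trans (solve 2 (λ n c → n :* c :+ c := (con 1ℚ :+ n) :* c) ≃-refl ⟪ nat n ⟫ c)
    (*ᶜ-cong (≃-sym (≃-trans (⟪⟫-cong (nat-+ 1 n)) (⟪⟫-+ 1ℚ (nat n)))) ≃-refl))
  where open ℂ-Solver

boxSum : ∀ N n → (Vec ℕ n → ℂ) → ℂ
boxSum N zero    G = G []
boxSum N (suc n) G = sum (λ a → boxSum N n λ v → G (a ∷ v)) N

boxSum-cong : ∀ {N} n {G H} → (∀ v → G v ≃ H v) → boxSum N n G ≃ boxSum N n H
boxSum-cong zero    h = h []
boxSum-cong {N} (suc n) h = sum-cong N λ a _ → boxSum-cong n λ v → h (a ∷ v)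

boxSum-*ˡ : ∀ {N} n c G → boxSum N n (λ v → c *ᶜ G v) ≃ c *ᶜ boxSum N n G
boxSum-*ˡ zero    c G = ≃-refl
boxSum-*ˡ {N} (suc n) c G = ≃-trans (sum-cong N λ a _ → boxSum-*ˡ n c λ v → G (a ∷ v)) (sum-*ˡ c _ N)

sum-boxSum-swap : ∀ {N} n (G : ℕ → Vec ℕ n → ℂ) K →
  sum (λ u → boxSum N n (G u)) K ≃ boxSum N n (λ v → sum (λ u → G u v) K)
sum-boxSum-swap zero    G K = ≃-refl
sum-boxSum-swap {N} (suc n) G K = ≃-trans (sum-swap _ K N)
  (sum-cong N λ a _ → sum-boxSum-swap n (λ u v → G u (a ∷ v)) K)

_≡_[mod_] : ℤ → ℤ → ℕ → Set
x ≡ y [mod M ] = + M ℤ∣.∣ x ℤ.- y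

Congruent : ∀ {n} → ℕ → Vec ℕ n → Vec ℕ n → Set
Congruent M = Pointwise λ a b → (+ a) ≡ + b [mod M ]

mod-refl : ∀ {M} x → x ≡ x [mod M ]
mod-refl {M} x = subst (+ M ℤ∣.∣_) (sym (ℤ.+-inverseʳ x)) (ℤ∣.divides (+ 0) refl)

Congruent-refl : ∀ {n M} (v : Vec ℕ n) → Congruent M v v
Congruent-refl []      = []
Congruent-refl (a ∷ v) = mod-refl (+ a) ∷ Congruent-refl v

mod-+* : ∀ M a j → (+ (a ℕ.+ j ℕ.* M)) ≡ + a [mod M ]
mod-+* M a j = ℤ∣.divides (+ j) (trans (cong (ℤ._- + a) (trans (ℤ.pos-+ a (j ℕ.* M)) (ℤ.+-comm (+ a) (+ (j ℕ.* M)))))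
  (trans (ℤ.+-assoc (+ (j ℕ.* M)) (+ a) (ℤ.- + a)) (trans (cong (ℤ._+_ (+ (j ℕ.* M))) (ℤ.+-inverseʳ (+ a)))
    (trans (ℤ.+-identityʳ _) (ℤ.pos-* j M)))))

-- Numbers below pM are a + jM with a < M and j < p, so each coordinate of a point modulo M has p
-- lifts.
boxSum-periodic : ∀ p M n {G : Vec ℕ n → ℂ} → (∀ {v w} → Congruent M v w → G v ≃ G w) →
  boxSum (p ℕ.* M) n G ≃ ⟪ nat (p ℕ.^ n) ⟫ *ᶜ boxSum M n G
boxSum-periodic p M zero    per = ≃-sym (*ᶜ-identityˡ _)
boxSum-periodic p M (suc n) {G} per = begin
  sum (λ a → boxSum (p ℕ.* M) n λ v → G (a ∷ v)) (p ℕ.* M)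
    ≈⟨ sum-cong (p ℕ.* M) (λ a _ → boxSum-periodic p M n λ v≡w → per (mod-refl (+ a) ∷ v≡w)) ⟩
  sum (λ a → ⟪ nat (p ℕ.^ n) ⟫ *ᶜ H a) (p ℕ.* M)
    ≈⟨ sum-*ˡ _ H (p ℕ.* M) ⟩
  ⟪ nat (p ℕ.^ n) ⟫ *ᶜ sum H (p ℕ.* M)
    ≈⟨ *ᶜ-cong ≃-refl (sum-blocks H p M) ⟩
  ⟪ nat (p ℕ.^ n) ⟫ *ᶜ sum (λ j → sum (λ a → H (a ℕ.+ j ℕ.* M)) M) p
    ≈⟨ *ᶜ-cong ≃-refl (sum-cong p λ j _ → sum-cong M λ a _ → boxSum-cong n λ v → per (mod-+* M a j ∷ Congruent-refl v)) ⟩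
  ⟪ nat (p ℕ.^ n) ⟫ *ᶜ sum (λ j → sum H M) p
    ≈⟨ *ᶜ-cong ≃-refl (sum-const (sum H M) p) ⟩
  ⟪ nat (p ℕ.^ n) ⟫ *ᶜ (⟪ nat p ⟫ *ᶜ sum H M)
    ≈⟨ ℂ-Solver.solve 3 (λ a b c → a C.:* (b C.:* c) C.:= b C.:* a C.:* c) ≃-refl _ _ _ ⟩
  ⟪ nat p ⟫ *ᶜ ⟪ nat (p ℕ.^ n) ⟫ *ᶜ sum H M
    ≈⟨ *ᶜ-cong (≃-trans (≃-sym (⟪⟫-* _ _)) (⟪⟫-cong (sym (nat-* p (p ℕ.^ n))))) ≃-refl ⟩
  ⟪ nat (p ℕ.^ suc n) ⟫ *ᶜ sum H M ∎
  where
  open ≃-Reasoning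
  module C = ℂ-Solver
  H : ℕ → ℂ
  H a = boxSum M n λ v → G (a ∷ v)

indicator : ∀ {A : Set} → Dec A → ℂ
indicator d = if does d then 1ᶜ else 0ᶜ

indicator-yes : ∀ {A : Set} (d : Dec A) → A → indicator d ≃ 1ᶜ
indicator-yes (yes _) a = ≃-refl
indicator-yes (no ¬a) a = ⊥-elim (¬a a)

indicator-no : ∀ {A : Set} (d : Dec A) → ¬ A → indicator d ≃ 0ᶜ
indicator-no (yes a) ¬a = ⊥-elim (¬a a)
indicator-no (no _)  ¬a = ≃-refl

indicator-⇔ : ∀ {A B : Set} (d : Dec A) (e : Dec B) → (A → B) → (B → A) → indicator d ≃ indicator e
indicator-⇔ (yes a) e f g = ≃-sym (indicator-yes e (f a))
indicator-⇔ (no ¬a) e f g = ≃-sym (indicator-no e λ b → ¬a (g b))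

χ : ℕ → ℤ → ℂ
χ M x = indicator (+ M ℤ∣.∣? x)

χ-mod : ∀ {M x y} → x ≡ y [mod M ] → χ M x ≃ χ M y
χ-mod {M} {x} {y} h = indicator-⇔ (+ M ℤ∣.∣? x) (+ M ℤ∣.∣? y) (λ k → ℤ∣.∣m+n∣m⇒∣n (subst (+ M ℤ∣.∣_) (eq x y) k) h)
  (λ k → subst (+ M ℤ∣.∣_) (sym (eq x y)) (ℤ∣.∣m∣n⇒∣m+n h k))
  where
  eq : ∀ x y → x ≡ x ℤ.- y ℤ.+ y
  eq x y = sym (trans (ℤ.+-assoc x (ℤ.- y) y) (trans (cong (ℤ._+_ x) (ℤ.+-inverseˡ y)) (ℤ.+-identityʳ x)))

1^ : ∀ k → 1ᶜ ^ᶜ k ≃ 1ᶜ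
1^ zero    = ≃-refl
1^ (suc k) = ≃-trans (*ᶜ-identityˡ _) (1^ k)

module _ {N} .{{_ : NonZero N}} {ξ} (prim : Primitive N ξ) where

  primitive-mod : ∀ e → ξ ^ᶜ e ≃ ξ ^ᶜ (e ℕ.% N)
  primitive-mod e = begin
    ξ ^ᶜ e                                    ≈⟨ ≡⇒≃ (cong (ξ ^ᶜ_) (ℕ.m≡m%n+[m/n]*n e N)) ⟩
    ξ ^ᶜ (e ℕ.% N ℕ.+ e ℕ./ N ℕ.* N)          ≈⟨ ^ᶜ-homo-* ξ (e ℕ.% N) _ ⟩
    ξ ^ᶜ (e ℕ.% N) *ᶜ ξ ^ᶜ (e ℕ./ N ℕ.* N)    ≈⟨ *ᶜ-cong ≃-refl (≃-trans (≡⇒≃ (cong (ξ ^ᶜ_) (ℕ.*-comm (e ℕ./ N) N)))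
                                                  (≃-trans (≃-sym (^ᶜ-assocʳ ξ N (e ℕ./ N))) (≃-trans (^ᶜ-congˡ (e ℕ./ N) (proj₁ prim)) (1^ (e ℕ./ N))))) ⟩
    ξ ^ᶜ (e ℕ.% N) *ᶜ 1ᶜ                      ≈⟨ *ᶜ-identityʳ _ ⟩
    ξ ^ᶜ (e ℕ.% N)                            ∎
    where open ≃-Reasoning

  primitive-∣ : ∀ e → ξ ^ᶜ e ≃ 1ᶜ → N ℕ∣.∣ e
  primitive-∣ e h with e ℕ.% N in eq
  ... | zero  = ℕ∣.m%n≡0⇒n∣m e N eq
  ... | suc r = ⊥-elim (proj₂ prim (suc r) (ℕ.s≤s ℕ.z≤n) (subst (ℕ._< N) eq (ℕ.m%n<n e N))
    (≃-trans (≃-sym (≃-trans (primitive-mod e) (≡⇒≃ (cong (ξ ^ᶜ_) eq)))) h))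

  ∣-primitive : ∀ e → N ℕ∣.∣ e → ξ ^ᶜ e ≃ 1ᶜ
  ∣-primitive e N∣e = ≃-trans (primitive-mod e) (≡⇒≃ (cong (ξ ^ᶜ_) (ℕ∣.n∣m⇒m%n≡0 e N N∣e)))

  -- Multiplied by ζ - 1 with ζ = ξᵉ, the geometric sum becomes ξ^(Ne) - 1 = 0. If N does not divide
  -- e, primitivity gives ζ ≠ 1 and that factor cancels.
  orthogonality : ∀ e → sum (λ u → ξ ^ᶜ (u ℕ.* e)) N ≃ ⟪ nat N ⟫ *ᶜ χ N (+ e)
  orthogonality e = go (+ N ℤ∣.∣? + e)
    where
    open ℂ-Solver
    ζ = ξ ^ᶜ e
    geometric : ∀ n → sum (λ u → ξ ^ᶜ (u ℕ.* e)) n *ᶜ (ζ +ᶜ -ᶜ 1ᶜ) ≃ ξ ^ᶜ (n ℕ.* e) +ᶜ -ᶜ 1ᶜ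
    geometric zero    = solve 1 (λ z → con 0ℚ :* (z :- con 1ℚ) := con 1ℚ :- con 1ℚ) ≃-refl ζ
    geometric (suc n) = begin
      (sum (λ u → ξ ^ᶜ (u ℕ.* e)) n +ᶜ ξ ^ᶜ (n ℕ.* e)) *ᶜ (ζ +ᶜ -ᶜ 1ᶜ)
        ≈⟨ solve 3 (λ s x z → (s :+ x) :* (z :- con 1ℚ) := s :* (z :- con 1ℚ) :+ (z :* x :- x)) ≃-refl _ _ ζ ⟩
      sum (λ u → ξ ^ᶜ (u ℕ.* e)) n *ᶜ (ζ +ᶜ -ᶜ 1ᶜ) +ᶜ (ζ *ᶜ ξ ^ᶜ (n ℕ.* e) +ᶜ -ᶜ (ξ ^ᶜ (n ℕ.* e)))
        ≈⟨ +ᶜ-cong (geometric n) (+ᶜ-cong (≃-sym (^ᶜ-homo-* ξ e (n ℕ.* e))) ≃-refl) ⟩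
      ξ ^ᶜ (n ℕ.* e) +ᶜ -ᶜ 1ᶜ +ᶜ (ξ ^ᶜ (suc n ℕ.* e) +ᶜ -ᶜ (ξ ^ᶜ (n ℕ.* e)))
        ≈⟨ solve 2 (λ x y → x :- con 1ℚ :+ (y :- x) := y :- con 1ℚ) ≃-refl _ _ ⟩
      ξ ^ᶜ (suc n ℕ.* e) +ᶜ -ᶜ 1ᶜ ∎
      where open ≃-Reasoning
    vanishing : sum (λ u → ξ ^ᶜ (u ℕ.* e)) N *ᶜ (ζ +ᶜ -ᶜ 1ᶜ) ≃ 0ᶜ
    vanishing = ≃-trans (geometric N) (≃-trans (+ᶜ-cong (∣-primitive (N ℕ.* e) (ℕ∣.m∣m*n e)) ≃-refl)
      (-ᶜ-inverseʳ 1ᶜ))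
    minus-one : ζ +ᶜ -ᶜ 1ᶜ ≃ 0ᶜ → ζ ≃ 1ᶜ
    minus-one h = ≃-trans (solve 1 (λ z → z := z :- con 1ℚ :+ con 1ℚ) ≃-refl ζ) (≃-trans (+ᶜ-cong h ≃-refl) (+ᶜ-identityˡ 1ᶜ))
    go : (d : Dec (+ N ℤ∣.∣ + e)) → sum (λ u → ξ ^ᶜ (u ℕ.* e)) N ≃ ⟪ nat N ⟫ *ᶜ indicator d
    go (yes h) = ≃-trans (sum-cong N λ u _ → ∣-primitive (u ℕ.* e) (ℕ∣.∣n⇒∣m*n u (ℤ∣.∣⇒∣ᵤ h))) (sum-const 1ᶜ N)
    go (no ¬h) = ≃-trans (*ᶜ-cancel-0 vanishing λ ζ-1≃0 → ¬h (ℤ∣.∣ᵤ⇒∣ (primitive-∣ e (minus-one ζ-1≃0))))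
                   (≃-sym (*ᶜ-zeroʳ _))

primitive-power : ∀ {p M ξ} .{{_ : NonZero p}} → Primitive (p ℕ.* M) ξ → Primitive M (ξ ^ᶜ p)
primitive-power {p} {M} {ξ} (one , other) = ≃-trans (^ᶜ-assocʳ ξ p M) one , λ k 0<k k<M h →
  other (p ℕ.* k) (subst (ℕ._< p ℕ.* k) (ℕ.*-zeroʳ p) (ℕ.*-monoʳ-< p 0<k)) (ℕ.*-monoʳ-< p k<M) (≃-trans (≃-sym (^ᶜ-assocʳ ξ p k)) h)

prime-power-cancel : ∀ {p} → ℕ.Prime p → ∀ m u k → ¬ p ℕ∣.∣ u → p ℕ.^ m ℕ∣.∣ u ℕ.* k → p ℕ.^ m ℕ∣.∣ k
prime-power-cancel pr zero    u k p∤u h = ℕ∣.1∣ k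
prime-power-cancel {p} pr (suc m) u k p∤u h with ℕ.euclidsLemma u k pr (ℕ∣.∣-trans (ℕ∣.m∣m*n (p ℕ.^ m)) h)
... | inj₁ p∣u = ⊥-elim (p∤u p∣u)
... | inj₂ (ℕ∣.divides k′ refl) = subst (p ℕ.* p ℕ.^ m ℕ∣.∣_) (ℕ.*-comm p k′) (ℕ∣.*-monoʳ-∣ p
  (prime-power-cancel pr m u k′ p∤u (ℕ∣.*-cancelˡ-∣ p {{ℕ.prime⇒nonZero pr}} (subst (p ℕ.* p ℕ.^ m ℕ∣.∣_) eq h))))
  where
  eq : u ℕ.* (k′ ℕ.* p) ≡ p ℕ.* (u ℕ.* k′)
  eq = trans (sym (ℕ.*-assoc u k′ p)) (ℕ.*-comm (u ℕ.* k′) p)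

-- The recursion between solution densities modulo pᵐ and pᵐ⁺¹

module _ {n p′ : ℕ} (pr : ℕ.Prime (suc p′)) (m : ℕ) (F : Vec ℕ n → ℤ)
  (F-periodic : ∀ M {v w} → Congruent M v w → F v ≡ F w [mod M ]) where

  private
    p M N : ℕ
    p = suc p′
    M = p ℕ.^ m
    N = p ℕ.* M
    instance
      M≢0 : NonZero M
      M≢0 = ℕ.m^n≢0 p m
      N≢0 : NonZero N
      N≢0 = ℕ.m*n≢0 p M

  -- Exponents of ξ are natural numbers. Reduction modulo N = pM preserves divisibility of `F v` by
  -- N as well as by M.
  residue : Vec ℕ n → ℕ
  residue v = F v ℤ.%ℕ N

  private
    residue-mod : ∀ K → K ℕ∣.∣ N → ∀ v → χ K (+ residue v) ≃ χ K (F v)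
    residue-mod K K∣N v = ≃-sym (χ-mod {K} {F v} {+ residue v} (subst (+ K ℤ∣.∣_) (sym eq) (ℤ∣.∣n⇒∣m*n (F v ℤ./ℕ N) (ℤ∣.∣ᵤ⇒∣ K∣N))))
      where
      eq : F v ℤ.- + residue v ≡ (F v ℤ./ℕ N) ℤ.* + N
      eq = trans (cong (ℤ._- + residue v) (trans (ℤ.a≡a%ℕn+[a/ℕn]*n (F v) N) (ℤ.+-comm (+ residue v) ((F v ℤ./ℕ N) ℤ.* + N))))
        (trans (ℤ.+-assoc ((F v ℤ./ℕ N) ℤ.* + N) (+ residue v) (ℤ.- + residue v))
          (trans (cong (ℤ._+_ ((F v ℤ./ℕ N) ℤ.* + N)) (ℤ.+-inverseʳ (+ residue v))) (ℤ.+-identityʳ _)))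

  exponentialSum : ℂ → ℂ
  exponentialSum ζ = boxSum N n λ v → ζ ^ᶜ residue v

  private
    p∤unit : ∀ v j → j ℕ.< p′ → ¬ p ℕ∣.∣ suc j ℕ.+ v ℕ.* p
    p∤unit v j j<p′ h = ℕ.<⇒≱ (ℕ.s≤s j<p′) (ℕ∣.∣⇒≤ (ℕ∣.∣m+n∣m⇒∣n (subst (p ℕ∣.∣_) (ℕ.+-comm (suc j) (v ℕ.* p)) h) (ℕ∣.∣n⇒∣m*n v ℕ∣.∣-refl)))

    unit-power : ∀ {ξ} → Primitive N ξ → ∀ u → ¬ p ℕ∣.∣ u → Primitive N (ξ ^ᶜ u)
    unit-power {ξ} prim u p∤u =
        ≃-trans (^ᶜ-assocʳ ξ u N) (∣-primitive prim (u ℕ.* N) (ℕ∣.∣n⇒∣m*n u ℕ∣.∣-refl))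
      , λ k 0<k k<N h → ℕ.<⇒≱ k<N (ℕ∣.∣⇒≤ {{ℕ.>-nonZero 0<k}}
          (prime-power-cancel pr (suc m) u k p∤u (primitive-∣ prim (u ℕ.* k) (≃-trans (≃-sym (^ᶜ-assocʳ ξ u k)) h))))

  -- Side of the box and modulus are separate, because the multiples of p count solutions modulo M
  -- among the points modulo N.
  solutions : ℕ → ℕ → ℂ
  solutions L K = boxSum L n λ v → χ K (F v)

  module _ {ξ} (prim : Primitive N ξ) where
    private
      g : ℕ → ℂ
      g u = boxSum N n λ v → ξ ^ᶜ (u ℕ.* residue v)

      sum-all : sum g N ≃ ⟪ nat N ⟫ *ᶜ solutions N N
      sum-all = ≃-trans (sum-boxSum-swap n _ N) (≃-trans
        (boxSum-cong n λ v → ≃-trans (orthogonality prim (residue v)) (*ᶜ-cong ≃-refl (residue-mod N ℕ∣.∣-refl v)))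
        (boxSum-*ˡ n _ _))

      sum-multiples : sum (λ v → g (v ℕ.* p)) M ≃ ⟪ nat M ⟫ *ᶜ solutions N M
      sum-multiples = ≃-trans (sum-boxSum-swap n _ M) (≃-trans
        (boxSum-cong n λ v → ≃-trans
          (sum-cong M λ u _ → ≃-trans (≡⇒≃ (cong (ξ ^ᶜ_) (trans (cong (ℕ._* residue v) (ℕ.*-comm u p)) (ℕ.*-assoc p u (residue v)))))
            (≃-sym (^ᶜ-assocʳ ξ p (u ℕ.* residue v))))
          (≃-trans (orthogonality {M} (primitive-power {p} {M} prim) (residue v)) (*ᶜ-cong ≃-refl (residue-mod M (ℕ∣.∣n⇒∣m*n p ℕ∣.∣-refl) v))))
        (boxSum-*ˡ n _ _))

      -- The numbers u = (j + 1) + vp with j < p - 1 run through the residues modulo N prime to p,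
      -- for which ξᵘ is again a primitive N-th root.
      units : ℂ
      units = sum (λ v → sum (λ j → g (suc j ℕ.+ v ℕ.* p)) p′) M

      sum-units : sum (λ v → g (v ℕ.* p)) M +ᶜ units ≃ sum g N
      sum-units = ≃-sym (≃-trans (≡⇒≃ (cong (sum g) (ℕ.*-comm p M))) (≃-trans (sum-blocks g M p)
        (≃-trans (sum-cong M λ v _ → sum-head _ p′) (sum-+ _ _ M))))

    -- Summed over all u modulo N, orthogonality counts solutions modulo N. The multiples of p
    -- involve only ξᵖ, a primitive M-th root, and count solutions modulo M, each with pⁿ lifts. The
    -- units are the difference.
    solutions-recursion : units ≃ ⟪ nat N ⟫ *ᶜ solutions N N +ᶜ -ᶜ (⟪ nat M ⟫ *ᶜ (⟪ nat (p ℕ.^ n) ⟫ *ᶜ solutions M M))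
    solutions-recursion = ≃-trans (solve 2 (λ a b → b := (a :+ b) :- a) ≃-refl _ units)
      (+ᶜ-cong (≃-trans sum-units sum-all) (-ᶜ-cong (≃-trans sum-multiples
        (*ᶜ-cong ≃-refl (boxSum-periodic p M n λ {v} {w} v≡w → χ-mod {M} {F v} {F w} (F-periodic M v≡w))))))
      where open ℂ-Solver

    units-bound : ∀ {c B} → 0ʳ ≤ʳ B → (∀ ζ → Primitive N ζ → ∥ c *ᶜ exponentialSum ζ ∥≤ B) →
      ∥ c *ᶜ units ∥≤ (⟨ nat N ⟩ *ʳ B)
    units-bound {c} {B} 0≤B h = norm-resp (≃-trans (sum-cong M λ v _ → sum-*ˡ c _ p′) (sum-*ˡ c _ M))
      (norm-weaken weaken (norm-sum 0≤p′B M λ v _ → norm-sum 0≤B p′ λ j j<p′ →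
        norm-resp (*ᶜ-cong ≃-refl (boxSum-cong n λ w → ^ᶜ-assocʳ ξ (suc j ℕ.+ v ℕ.* p) (residue w)))
          (h _ (unit-power prim _ (p∤unit v j j<p′)))))
      where
      0≤p′B = *ʳ-nonNeg (⟨⟩-mono-≤ (nat-nonNeg p′)) 0≤B
      weaken : ⟨ nat M ⟩ *ʳ (⟨ nat p′ ⟩ *ʳ B) ≤ʳ ⟨ nat N ⟩ *ʳ B
      weaken = ≤ʳ-trans (≤ʳ-reflexive (≃ʳ-trans (≃ʳ-sym (*ʳ-assoc _ _ _))
          (*ʳ-cong (≃ʳ-trans (≃ʳ-sym (⟨⟩-* _ _)) (⟨⟩-cong (sym (nat-* M p′)))) ≃ʳ-refl)))
        (*ʳ-monoˡ-≤ B 0≤B (⟨⟩-mono-≤ (nat-mono-≤ (ℕ.≤-trans (ℕ.≤-reflexive (ℕ.*-comm M p′)) (ℕ.*-monoˡ-≤ M (ℕ.n≤1+n p′))))))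

    -- Dividing by N averages over the units, of which there are at most N, so the bound B for a
    -- single normalised sum passes to the densities without loss.
    density-recursion : ∀ {a b r B} → nat (N ℕ.^ n) ℚ.* a ≡ 1ℚ → nat (M ℕ.^ n) ℚ.* b ≡ 1ℚ → nat p ℚ.* r ≡ 1ℚ →
      0ʳ ≤ʳ B → (∀ ζ → Primitive N ζ → ∥ ⟪ a ⟫ *ᶜ exponentialSum ζ ∥≤ B) →
      ∥ ⟪ a ⟫ *ᶜ solutions N N +ᶜ -ᶜ (⟪ r ⟫ *ᶜ (⟪ b ⟫ *ᶜ solutions M M)) ∥≤ B
    density-recursion {a} {b} {r} {B} a-inv b-inv r-inv 0≤B h =
      norm-resp eq (norm-weaken (≤ʳ-reflexive (≃ʳ-trans (≃ʳ-sym (*ʳ-assoc _ _ _)) (≃ʳ-trans (*ʳ-cong (≃ʳ-trans (≃ʳ-sym (⟨⟩-* _ _)) (⟨⟩-cong N⁻¹N)) ≃ʳ-refl) (*ʳ-identityˡ B))))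
        (norm-* (norm-fromℝ (⟨⟩-mono-≤ 0≤N⁻¹)) (units-bound {⟪ a ⟫} 0≤B h)))
      where
      instance
        natN≢0 : ℚ.Positive (nat N)
        natN≢0 = ℚ.positive (nat-mono-< {0} (ℕ.>-nonZero⁻¹ N))
        natN≢0′ : ℚ.NonZero (nat N)
        natN≢0′ = ℚ.pos⇒nonZero (nat N)
      N⁻¹ = ℚ.1/ nat N
      N⁻¹N : N⁻¹ ℚ.* nat N ≡ 1ℚ
      N⁻¹N = ℚ.*-inverseˡ (nat N)
      0≤N⁻¹ : 0ℚ ℚ.≤ N⁻¹
      0≤N⁻¹ = ℚ.<⇒≤ (ℚ.positive⁻¹ N⁻¹ {{ℚ.1/pos⇒pos (nat N)}})
      unique-inverse : ∀ {x y z} → x ℚ.* z ≡ 1ℚ → y ℚ.* z ≡ 1ℚ → x ≡ y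
      unique-inverse {x} {y} {z} xz yz = trans (sym (ℚ.*-identityʳ x)) (trans (cong (x ℚ.*_) (trans (sym yz) (ℚ.*-comm y z)))
        (trans (sym (ℚ.*-assoc x z y)) (trans (cong (ℚ._* y) xz) (ℚ.*-identityˡ y))))
      natM≡ : nat p ℚ.* nat M ≡ nat N
      natM≡ = sym (nat-* p M)
      ^-distribʳ-* : ∀ n → N ℕ.^ n ≡ p ℕ.^ n ℕ.* M ℕ.^ n
      ^-distribʳ-* zero    = refl
      ^-distribʳ-* (suc n) = trans (cong (N ℕ.*_) (^-distribʳ-* n)) (ℕ.[m*n]*[o*p]≡[m*o]*[n*p] p M (p ℕ.^ n) (M ℕ.^ n))
      pⁿMⁿ : nat (p ℕ.^ n) ℚ.* nat (M ℕ.^ n) ≡ nat (N ℕ.^ n)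
      pⁿMⁿ = trans (sym (nat-* (p ℕ.^ n) (M ℕ.^ n))) (cong nat (sym (^-distribʳ-* n)))
      rational : N⁻¹ ℚ.* (a ℚ.* (nat M ℚ.* nat (p ℕ.^ n))) ≡ r ℚ.* b
      -- Both sides are inverse to p Mⁿ.
      rational = unique-inverse {z = nat p ℚ.* nat (M ℕ.^ n)}
        (trans (solve 6 (λ i a m q l k → i :* (a :* (m :* q)) :* (l :* k) := i :* (l :* m) :* (q :* k :* a)) refl
            N⁻¹ a (nat M) (nat (p ℕ.^ n)) (nat p) (nat (M ℕ.^ n)))
          (cong₂ ℚ._*_ (trans (cong (N⁻¹ ℚ.*_) natM≡) N⁻¹N) (trans (cong (ℚ._* a) pⁿMⁿ) a-inv)))
        (trans (solve 4 (λ r b l k → r :* b :* (l :* k) := l :* r :* (k :* b)) refl r b (nat p) (nat (M ℕ.^ n)))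
          (cong₂ ℚ._*_ r-inv b-inv))
        where open +-*-Solver
      eq : ⟪ N⁻¹ ⟫ *ᶜ (⟪ a ⟫ *ᶜ units) ≃ ⟪ a ⟫ *ᶜ solutions N N +ᶜ -ᶜ (⟪ r ⟫ *ᶜ (⟪ b ⟫ *ᶜ solutions M M))
      eq = begin
        ⟪ N⁻¹ ⟫ *ᶜ (⟪ a ⟫ *ᶜ units)
          ≈⟨ *ᶜ-cong ≃-refl (*ᶜ-cong ≃-refl solutions-recursion) ⟩
        ⟪ N⁻¹ ⟫ *ᶜ (⟪ a ⟫ *ᶜ (⟪ nat N ⟫ *ᶜ solutions N N +ᶜ -ᶜ (⟪ nat M ⟫ *ᶜ (⟪ nat (p ℕ.^ n) ⟫ *ᶜ solutions M M))))
          ≈⟨ solve 7 (λ i a k s m q t → i :* (a :* (k :* s :- m :* (q :* t))) := i :* k :* (a :* s) :- i :* (a :* (m :* q)) :* t)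
               ≃-refl ⟪ N⁻¹ ⟫ ⟪ a ⟫ ⟪ nat N ⟫ (solutions N N) ⟪ nat M ⟫ ⟪ nat (p ℕ.^ n) ⟫ (solutions M M) ⟩
        ⟪ N⁻¹ ⟫ *ᶜ ⟪ nat N ⟫ *ᶜ (⟪ a ⟫ *ᶜ solutions N N) +ᶜ -ᶜ (⟪ N⁻¹ ⟫ *ᶜ (⟪ a ⟫ *ᶜ (⟪ nat M ⟫ *ᶜ ⟪ nat (p ℕ.^ n) ⟫)) *ᶜ solutions M M)
          ≈⟨ +ᶜ-cong (*ᶜ-cong (≃-trans (≃-sym (⟪⟫-* _ _)) (⟪⟫-cong N⁻¹N)) ≃-refl)
               (-ᶜ-cong (*ᶜ-cong (≃-trans (*ᶜ-cong ≃-refl (≃-trans (*ᶜ-cong ≃-refl (≃-sym (⟪⟫-* _ _))) (≃-sym (⟪⟫-* _ _))))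
                 (≃-trans (≃-sym (⟪⟫-* _ _)) (≃-trans (⟪⟫-cong rational) (⟪⟫-* r b)))) ≃-refl)) ⟩
        1ᶜ *ᶜ (⟪ a ⟫ *ᶜ solutions N N) +ᶜ -ᶜ (⟪ r ⟫ *ᶜ ⟪ b ⟫ *ᶜ solutions M M)
          ≈⟨ +ᶜ-cong (*ᶜ-identityˡ _) (-ᶜ-cong (*ᶜ-assoc _ _ _)) ⟩
        ⟪ a ⟫ *ᶜ solutions N N +ᶜ -ᶜ (⟪ r ⟫ *ᶜ (⟪ b ⟫ *ᶜ solutions M M)) ∎
        where
        open ≃-Reasoning
        open ℂ-Solver

-- Poles

⇝-shift : ∀ {u z} → (λ m → u (suc m)) ⇝ z → u ⇝ z
⇝-shift h q 0<q = let M , k = h q 0<q in suc M , λ { (suc m) (ℕ.s≤s M≤m) → k m M≤m }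

seriesᶜ : List ℂ → ℕ → ℂ
seriesᶜ []       _       = 0ᶜ
seriesᶜ (a ∷ as) zero    = a
seriesᶜ (a ∷ as) (suc m) = seriesᶜ as m

infixl 7 _·ᶜ_
_·ᶜ_ : List ℂ → (ℕ → ℂ) → ℕ → ℂ
([]       ·ᶜ P) _       = 0ᶜ
((a ∷ as) ·ᶜ P) zero    = a *ᶜ P zero
((a ∷ as) ·ᶜ P) (suc m) = a *ᶜ P (suc m) +ᶜ (as ·ᶜ P) m

evalᶜ : List ℂ → ℂ → ℂ
evalᶜ []       z = 0ᶜ
evalᶜ (a ∷ as) z = a +ᶜ z *ᶜ evalᶜ as z

shift : (ℕ → ℂ) → ℕ → ℂ
shift U zero    = 0ᶜ
shift U (suc m) = U m

module _ (T : ℂ) where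
  open ℂ-Solver
  open ≃-Reasoning

  partial : (ℕ → ℂ) → ℕ → ℂ
  partial U = sum λ k → U k *ᶜ T ^ᶜ k

  partial-cong : ∀ {U V} → (∀ k → U k ≃ V k) → ∀ m → partial U m ≃ partial V m
  partial-cong h m = sum-cong m λ k _ → *ᶜ-cong (h k) ≃-refl

  partial-head : ∀ U m → partial U (suc m) ≃ U 0 +ᶜ T *ᶜ partial (λ k → U (suc k)) m
  partial-head U m = ≃-trans (sum-head _ m) (+ᶜ-cong (*ᶜ-identityʳ (U 0))
    (≃-trans (sum-cong m λ k _ → solve 3 (λ u t p → u :* (t :* p) := t :* (u :* p)) ≃-refl (U (suc k)) T (T ^ᶜ k)) (sum-*ˡ T _ m)))

  partial-series : ∀ B m → length B ℕ.≤ m → partial (seriesᶜ B) m ≃ evalᶜ B T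
  partial-series []       m       _           = ≃-trans (sum-cong m λ k _ → *ᶜ-zeroˡ _) (sum-0 m)
  partial-series (b ∷ bs) (suc m) (ℕ.s≤s len) = ≃-trans (partial-head (seriesᶜ (b ∷ bs)) m)
    (+ᶜ-cong ≃-refl (*ᶜ-cong ≃-refl (partial-series bs m len)))

  partial-+* : ∀ c U V m → partial (λ k → c *ᶜ U k +ᶜ V k) m ≃ c *ᶜ partial U m +ᶜ partial V m
  partial-+* c U V m = ≃-trans (sum-cong m λ k _ → solve 4 (λ c u v p → (c :* u :+ v) :* p := c :* (u :* p) :+ v :* p) ≃-refl c (U k) (V k) (T ^ᶜ k))
    (≃-trans (sum-+ _ _ m) (+ᶜ-cong (sum-*ˡ c _ m) ≃-refl))

  partial-· : ∀ a as P m → partial ((a ∷ as) ·ᶜ P) (suc m) ≃ a *ᶜ partial P (suc m) +ᶜ T *ᶜ partial (as ·ᶜ P) m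
  partial-· a as P m = begin
    partial ((a ∷ as) ·ᶜ P) (suc m)
      ≈⟨ partial-head _ m ⟩
    a *ᶜ P 0 +ᶜ T *ᶜ partial (λ k → a *ᶜ P (suc k) +ᶜ (as ·ᶜ P) k) m
      ≈⟨ +ᶜ-cong ≃-refl (*ᶜ-cong ≃-refl (partial-+* a _ _ m)) ⟩
    a *ᶜ P 0 +ᶜ T *ᶜ (a *ᶜ partial (λ k → P (suc k)) m +ᶜ partial (as ·ᶜ P) m)
      ≈⟨ solve 5 (λ a p t x y → a :* p :+ t :* (a :* x :+ y) := a :* (p :+ t :* x) :+ t :* y) ≃-refl a (P 0) T _ _ ⟩
    a *ᶜ (P 0 +ᶜ T *ᶜ partial (λ k → P (suc k)) m) +ᶜ T *ᶜ partial (as ·ᶜ P) m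
      ≈⟨ +ᶜ-cong (*ᶜ-cong ≃-refl (≃-sym (partial-head P m))) ≃-refl ⟩
    a *ᶜ partial P (suc m) +ᶜ T *ᶜ partial (as ·ᶜ P) m ∎

  -- Prepending a coefficient to A shifts the partial sums of Q by one index. The mismatch is a
  -- fixed multiple of the term Q m Tᵐ, so it is enough that the terms tend to 0.
  partial-product : ∀ A {Q} → (λ m → Q m *ᶜ T ^ᶜ m) ⇝ 0ᶜ →
    (λ m → partial (A ·ᶜ Q) m +ᶜ -ᶜ (evalᶜ A T *ᶜ partial Q m)) ⇝ 0ᶜ
  partial-product [] {Q} Q→0 = ⇝-cong (λ m → ≃-sym (≃-trans
      (+ᶜ-cong (≃-trans (sum-cong m λ k _ → *ᶜ-zeroˡ _) (sum-0 m)) ≃-refl)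
      (solve 1 (λ x → con 0ℚ :- con 0ℚ :* x := con 0ℚ) ≃-refl (partial Q m)))) ≃-refl ⇝-const
  partial-product (a ∷ as) {Q} Q→0 = ⇝-shift (⇝-cong
    (λ m → ≃-sym (≃-trans (+ᶜ-cong (partial-· a as Q m) ≃-refl)
      (solve 6 (λ a q t u e p → a :* (p :+ q) :+ t :* u :- (a :+ t :* e) :* (p :+ q) := t :* ((u :- e :* p) :+ :- (e :* q)))
        ≃-refl a (Q m *ᶜ T ^ᶜ m) T (partial (as ·ᶜ Q) m) (evalᶜ as T) (partial Q m))))
    (solve 2 (λ t e → t :* (con 0ℚ :+ :- (e :* con 0ℚ)) := con 0ℚ) ≃-refl T (evalᶜ as T))
    (⇝-* (⇝-const {T}) (⇝-+ (partial-product as Q→0) (⇝-neg (⇝-* (⇝-const {evalᶜ as T}) Q→0)))))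

  partial-shift : ∀ U m → partial (shift U) (suc m) ≃ T *ᶜ partial U m
  partial-shift U m = ≃-trans (partial-head (shift U) m) (+ᶜ-identityˡ _)

·ᶜ-shift : ∀ A P m → (A ·ᶜ shift P) m ≃ shift (A ·ᶜ P) m
·ᶜ-shift []       P zero          = ≃-refl
·ᶜ-shift []       P (suc m)       = ≃-refl
·ᶜ-shift (a ∷ as) P zero          = *ᶜ-zeroʳ a
·ᶜ-shift (a ∷ as) P (suc zero)    = ≃-trans (+ᶜ-cong ≃-refl (·ᶜ-shift as P 0)) (+ᶜ-identityʳ _)
·ᶜ-shift (a ∷ as) P (suc (suc m)) = +ᶜ-cong ≃-refl (·ᶜ-shift as P (suc m))

·ᶜ-linear : ∀ A c P R m → (A ·ᶜ (λ k → c *ᶜ P k +ᶜ R k)) m ≃ c *ᶜ (A ·ᶜ P) m +ᶜ (A ·ᶜ R) m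
·ᶜ-linear []       c P R m       = solve 1 (λ c → con 0ℚ := c :* con 0ℚ :+ con 0ℚ) ≃-refl c
  where open ℂ-Solver
·ᶜ-linear (a ∷ as) c P R zero    = solve 4 (λ a c p r → a :* (c :* p :+ r) := c :* (a :* p) :+ a :* r) ≃-refl a c (P 0) (R 0)
  where open ℂ-Solver
·ᶜ-linear (a ∷ as) c P R (suc m) = ≃-trans (+ᶜ-cong ≃-refl (·ᶜ-linear as c P R m))
  (solve 6 (λ a c p r x y → a :* (c :* p :+ r) :+ (c :* x :+ y) := c :* (a :* p :+ x) :+ (a :* r :+ y)) ≃-refl a c (P (suc m)) (R (suc m)) _ _)
  where open ℂ-Solver

-- With Q = (1 - r T) P, the partial sums of A Q at T₀ end up at (1 - r T₀) B(T₀), and they differ from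
-- A(T₀) times those of Q by finitely many terms q T₀ᵐ.
pole-location : ∀ {P A B T₀ r} → (∀ m → (A ·ᶜ P) m ≃ seriesᶜ B m) → evalᶜ A T₀ ≃ 0ᶜ → ¬ evalᶜ B T₀ ≃ 0ᶜ →
  (λ m → (-ᶜ r *ᶜ shift P m +ᶜ P m) *ᶜ T₀ ^ᶜ m) ⇝ 0ᶜ → 1ᶜ +ᶜ -ᶜ (r *ᶜ T₀) ≃ 0ᶜ
pole-location {P} {A} {B} {T₀} {r} AP≃B A≃0 B≄0 Q→0 = *ᶜ-cancel-0 (≃-sym (⇝-unique zero-limit value-limit)) B≄0
  where
  open ℂ-Solver
  open ≃-Reasoning
  Q : ℕ → ℂ
  Q m = -ᶜ r *ᶜ shift P m +ᶜ P m
  zero-limit : partial T₀ (A ·ᶜ Q) ⇝ 0ᶜ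
  zero-limit = ⇝-cong (λ m → ≃-trans (+ᶜ-cong ≃-refl (-ᶜ-cong (*ᶜ-cong A≃0 ≃-refl)))
      (solve 2 (λ x y → x :- con 0ℚ :* y := x) ≃-refl _ (partial T₀ Q m))) ≃-refl (partial-product T₀ A Q→0)
  AQ : ∀ m → (A ·ᶜ Q) m ≃ -ᶜ r *ᶜ shift (seriesᶜ B) m +ᶜ seriesᶜ B m
  AQ m = ≃-trans (·ᶜ-linear A (-ᶜ r) (shift P) P m) (+ᶜ-cong (*ᶜ-cong ≃-refl (≃-trans (·ᶜ-shift A P m) (shift-cong m))) (AP≃B m))
    where
    shift-cong : ∀ m → shift (A ·ᶜ P) m ≃ shift (seriesᶜ B) m
    shift-cong zero    = ≃-refl
    shift-cong (suc m) = AP≃B m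
  value : ∀ m → length B ℕ.≤ m → partial T₀ (A ·ᶜ Q) (suc m) ≃ (1ᶜ +ᶜ -ᶜ (r *ᶜ T₀)) *ᶜ evalᶜ B T₀
  value m len = begin
    partial T₀ (A ·ᶜ Q) (suc m)
      ≈⟨ partial-cong T₀ AQ (suc m) ⟩
    partial T₀ (λ k → -ᶜ r *ᶜ shift (seriesᶜ B) k +ᶜ seriesᶜ B k) (suc m)
      ≈⟨ partial-+* T₀ (-ᶜ r) _ _ (suc m) ⟩
    -ᶜ r *ᶜ partial T₀ (shift (seriesᶜ B)) (suc m) +ᶜ partial T₀ (seriesᶜ B) (suc m)
      ≈⟨ +ᶜ-cong (*ᶜ-cong ≃-refl (≃-trans (partial-shift T₀ _ m) (*ᶜ-cong ≃-refl (partial-series T₀ B m len))))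
           (partial-series T₀ B (suc m) (ℕ.≤-trans len (ℕ.n≤1+n m))) ⟩
    -ᶜ r *ᶜ (T₀ *ᶜ evalᶜ B T₀) +ᶜ evalᶜ B T₀
      ≈⟨ solve 3 (λ r t b → (:- r) :* (t :* b) :+ b := (con 1ℚ :- r :* t) :* b) ≃-refl r T₀ _ ⟩
    (1ᶜ +ᶜ -ᶜ (r *ᶜ T₀)) *ᶜ evalᶜ B T₀ ∎
  value-limit : partial T₀ (A ·ᶜ Q) ⇝ (1ᶜ +ᶜ -ᶜ (r *ᶜ T₀)) *ᶜ evalᶜ B T₀
  value-limit = ⇝-shift λ q 0<q → length B , λ m len →
    norm-resp (≃-trans (≃-sym (-ᶜ-inverseʳ _)) (+ᶜ-cong (≃-sym (value m len)) ≃-refl))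
      (norm-0 (<⇒≤ʳ (⟨⟩-mono-< 0<q)))

-- Polynomials and the Bernstein-Sato polynomial

opaque
  unfolding _≃_ _≃ʳ_

  -- The opaque operations are by definition those of the statement. Exporting this as propositional
  -- equations keeps terms folded everywhere else.
  +-≡ : ∀ z w → Defs._+_ z w ≡ z +ᶜ w
  +-≡ z w = refl

  *-≡ : ∀ z w → Defs._*_ z w ≡ z *ᶜ w
  *-≡ z w = refl

  neg-≡ : ∀ z → Defs.-_ z ≡ -ᶜ z
  neg-≡ z = refl

  ℚ⇒ℂ-≡ : ∀ q → ℚ⇒ℂ q ≡ ⟪ q ⟫
  ℚ⇒ℂ-≡ q = refl

  ≈⇒≃ : ∀ {z w} → z ≈ w → z ≃ w
  ≈⇒≃ h = h

  ≃⇒≈ : ∀ {z w} → z ≃ w → z ≈ w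
  ≃⇒≈ h = h

Poly : ℕ → Set
Poly n = List (ℂ × Vec ℕ n)

-- Polynomials are compared through the linear functionals x^α ↦ w(α): products and derivatives act on the
-- weight w, so ring laws and congruences need no coefficient computation.
L : ∀ {n} → (Vec ℕ n → ℂ) → Poly n → ℂ
L w []            = 0ᶜ
L w ((c , α) ∷ f) = c *ᶜ w α +ᶜ L w f

L-cong : ∀ {n} {w w′ : Vec ℕ n → ℂ} f → (∀ α → w α ≃ w′ α) → L w f ≃ L w′ f
L-cong []            h = ≃-refl
L-cong ((c , α) ∷ f) h = +ᶜ-cong (*ᶜ-cong ≃-refl (h α)) (L-cong f h)

L-++ : ∀ {n} (w : Vec ℕ n → ℂ) f g → L w (f ++ g) ≃ L w f +ᶜ L w g
L-++ w []      g = ≃-sym (+ᶜ-identityˡ _)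
L-++ w (t ∷ f) g = ≃-trans (+ᶜ-cong ≃-refl (L-++ w f g)) (≃-sym (+ᶜ-assoc _ _ _))

L-+ : ∀ {n} (w w′ : Vec ℕ n → ℂ) f → L (λ α → w α +ᶜ w′ α) f ≃ L w f +ᶜ L w′ f
L-+ w w′ []            = ≃-sym (+ᶜ-identityˡ _)
L-+ w w′ ((c , α) ∷ f) = ≃-trans (+ᶜ-cong ≃-refl (L-+ w w′ f))
  (solve 5 (λ c x y s t → c :* (x :+ y) :+ (s :+ t) := (c :* x :+ s) :+ (c :* y :+ t)) ≃-refl c (w α) (w′ α) _ _)
  where open ℂ-Solver

L-* : ∀ {n} c (w : Vec ℕ n → ℂ) f → L (λ α → c *ᶜ w α) f ≃ c *ᶜ L w f
L-* c w []            = ≃-sym (*ᶜ-zeroʳ c)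
L-* c w ((d , α) ∷ f) = ≃-trans (+ᶜ-cong ≃-refl (L-* c w f))
  (solve 4 (λ c d x s → d :* (c :* x) :+ c :* s := c :* (d :* x :+ s)) ≃-refl c d (w α) _)
  where open ℂ-Solver

L-0 : ∀ {n} (f : Poly n) → L (λ _ → 0ᶜ) f ≃ 0ᶜ
L-0 []            = ≃-refl
L-0 ((c , α) ∷ f) = ≃-trans (+ᶜ-cong (*ᶜ-zeroʳ c) (L-0 f)) (+ᶜ-identityˡ 0ᶜ)

L-swap : ∀ {m n} (w : Vec ℕ m → Vec ℕ n → ℂ) f g → L (λ α → L (w α) g) f ≃ L (λ β → L (λ α → w α β) f) g
L-swap w []            g = ≃-sym (L-0 g)
L-swap w ((c , α) ∷ f) g = ≃-trans (+ᶜ-cong (≃-sym (L-* c (w α) g)) (L-swap w f g)) (≃-sym (L-+ (λ β → c *ᶜ w α β) _ g))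

δ : ∀ {n} → Vec ℕ n → Vec ℕ n → ℂ
δ α β = if does (Vec.≡-dec ℕ._≟_ β α) then 1ᶜ else 0ᶜ

δ-≡ : ∀ {n} (α : Vec ℕ n) → δ α α ≃ 1ᶜ
δ-≡ α with Vec.≡-dec ℕ._≟_ α α
... | yes _ = ≃-refl
... | no ¬e = ⊥-elim (¬e refl)

δ-≢ : ∀ {n} {α β : Vec ℕ n} → ¬ β ≡ α → δ α β ≃ 0ᶜ
δ-≢ {α = α} {β} β≢α with Vec.≡-dec ℕ._≟_ β α
... | yes e = ⊥-elim (β≢α e)
... | no _  = ≃-refl

infixl 6 _∖_
-- Exponents may repeat in a polynomial. Deleting all occurrences of α at once leaves the whole
-- coefficient of α as the complement, see `L-∖`.
_∖_ : ∀ {n} → Poly n → Vec ℕ n → Poly n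
[]            ∖ α = []
((c , β) ∷ f) ∖ α = if does (Vec.≡-dec ℕ._≟_ β α) then f ∖ α else (c , β) ∷ (f ∖ α)

length-∖ : ∀ {n} (f : Poly n) α → length (f ∖ α) ℕ.≤ length f
length-∖ []            α = ℕ.z≤n
length-∖ ((c , β) ∷ f) α with Vec.≡-dec ℕ._≟_ β α
... | yes _ = ℕ.≤-trans (length-∖ f α) (ℕ.n≤1+n _)
... | no _  = ℕ.s≤s (length-∖ f α)

length-∖-head : ∀ {n} c α (f : Poly n) → length (((c , α) ∷ f) ∖ α) ℕ.≤ length f
length-∖-head c α f with Vec.≡-dec ℕ._≟_ α α
... | yes _ = length-∖ f α
... | no ¬e = ⊥-elim (¬e refl)

L-∖ : ∀ {n} (w : Vec ℕ n → ℂ) f α → L w f ≃ w α *ᶜ L (δ α) f +ᶜ L w (f ∖ α)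
L-∖ w []            α = solve 1 (λ x → con 0ℚ := x :* con 0ℚ :+ con 0ℚ) ≃-refl (w α)
  where open ℂ-Solver
L-∖ w ((c , β) ∷ f) α with Vec.≡-dec ℕ._≟_ β α
... | yes refl = ≃-trans (+ᶜ-cong ≃-refl (L-∖ w f α))
  (solve 4 (λ c w s t → c :* w :+ (w :* s :+ t) := w :* (c :* con 1ℚ :+ s) :+ t) ≃-refl c (w α) _ _)
  where open ℂ-Solver
... | no _ = ≃-trans (+ᶜ-cong ≃-refl (L-∖ w f α))
  (solve 5 (λ c v w s t → c :* v :+ (w :* s :+ t) := w :* (c :* con 0ℚ :+ s) :+ (c :* v :+ t)) ≃-refl c (w β) (w α) _ _)
  where open ℂ-Solver

coeff-∖ : ∀ {n} (f : Poly n) α → L (δ α) (f ∖ α) ≃ 0ᶜ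
coeff-∖ f α = begin
  L (δ α) (f ∖ α)
    ≈⟨ solve 2 (λ x y → x := con 1ℚ :* y :+ x :- y) ≃-refl _ (L (δ α) f) ⟩
  1ᶜ *ᶜ L (δ α) f +ᶜ L (δ α) (f ∖ α) +ᶜ -ᶜ L (δ α) f
    ≈⟨ +ᶜ-cong (≃-trans (+ᶜ-cong (*ᶜ-cong (≃-sym (δ-≡ α)) ≃-refl) ≃-refl) (≃-sym (L-∖ (δ α) f α))) ≃-refl ⟩
  L (δ α) f +ᶜ -ᶜ L (δ α) f
    ≈⟨ -ᶜ-inverseʳ _ ⟩
  0ᶜ ∎
  where
  open ≃-Reasoning
  open ℂ-Solver

coeff-∖-≢ : ∀ {n} (f : Poly n) {α β} → ¬ α ≡ β → L (δ β) f ≃ L (δ β) (f ∖ α)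
coeff-∖-≢ f {α} {β} α≢β = ≃-trans (L-∖ (δ β) f α) (≃-trans (+ᶜ-cong (≃-trans (*ᶜ-cong (δ-≢ α≢β) ≃-refl) (*ᶜ-zeroˡ _)) ≃-refl)
  (+ᶜ-identityˡ _))

-- Splits off all terms with the exponent of the head. What is left is no subterm of f, hence the
-- recursion on a bound for the length. The alternative `w α ≃ 0ᶜ` serves the triangular elimination
-- in `⊗-cancel`.
L-vanishes : ∀ {n} (w : Vec ℕ n → ℂ) f → (∀ α → L (δ α) f ≃ 0ᶜ ⊎ w α ≃ 0ᶜ) → L w f ≃ 0ᶜ
L-vanishes w f h = go (length f) f ℕ.≤-refl h
  where
  go : ∀ k f → length f ℕ.≤ k → (∀ α → L (δ α) f ≃ 0ᶜ ⊎ w α ≃ 0ᶜ) → L w f ≃ 0ᶜ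
  go k       []                _         h = ≃-refl
  go (suc k) f@((c , α) ∷ f′) (ℕ.s≤s le) h = ≃-trans (L-∖ w f α) (≃-trans
    (+ᶜ-cong (product-zero (h α)) (go k (f ∖ α) (ℕ.≤-trans (length-∖-head c α f′) le) h′)) (+ᶜ-identityˡ 0ᶜ))
    where
    product-zero : L (δ α) f ≃ 0ᶜ ⊎ w α ≃ 0ᶜ → w α *ᶜ L (δ α) f ≃ 0ᶜ
    product-zero (inj₁ e) = ≃-trans (*ᶜ-cong ≃-refl e) (*ᶜ-zeroʳ _)
    product-zero (inj₂ e) = ≃-trans (*ᶜ-cong e ≃-refl) (*ᶜ-zeroˡ _)
    h′ : ∀ β → L (δ β) (f ∖ α) ≃ 0ᶜ ⊎ w β ≃ 0ᶜ
    h′ β with Vec.≡-dec ℕ._≟_ α β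
    ... | yes refl = inj₁ (coeff-∖ f α)
    ... | no α≢β   = [ (λ e → inj₁ (≃-trans (≃-sym (coeff-∖-≢ f α≢β)) e)) , inj₂ ]′ (h β)

infix 4 _~_
record _~_ {n} (f g : Poly n) : Set where
  constructor mk~
  field
    at : ∀ w → L w f ≃ L w g

open _~_ public

infixl 6 _⊕ᵖ_
infixl 7 _⊗ᵖ_
infix  8 -ᵖ_

opaque
  _⊕ᵖ_ _⊗ᵖ_ : ∀ {n} → Poly n → Poly n → Poly n
  _⊕ᵖ_ = ℂX._⊕_
  _⊗ᵖ_ = ℂX._⊗_

  -ᵖ_ : ∀ {n} → Poly n → Poly n
  -ᵖ_ = List.map λ (c , α) → -ᶜ c , α

  constᵖ : ∀ {n} → ℂ → Poly n
  constᵖ = ℂX.const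

  ∂ᵖ : ∀ {n} → Fin n → Poly n → Poly n
  ∂ᵖ = ℂX.∂

0ᵖ 1ᵖ : ∀ {n} → Poly n
0ᵖ = []
1ᵖ = constᵖ 1ᶜ

opaque
  unfolding _⊕ᵖ_

  L-⊕ : ∀ {n} (w : Vec ℕ n → ℂ) f g → L w (f ⊕ᵖ g) ≃ L w f +ᶜ L w g
  L-⊕ = L-++

  L-⊗-row : ∀ {n} (w : Vec ℕ n → ℂ) c α (g : Poly n) →
    L w (List.map (λ (d , β) → Defs._*_ c d , zipWith ℕ._+_ α β) g) ≃ c *ᶜ L (λ β → w (zipWith ℕ._+_ α β)) g
  L-⊗-row w c α []            = ≃-sym (*ᶜ-zeroʳ c)
  L-⊗-row w c α ((d , β) ∷ g) = ≃-trans (+ᶜ-cong (*ᶜ-cong (≡⇒≃ (*-≡ c d)) ≃-refl) (L-⊗-row w c α g))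
    (solve 4 (λ c d x s → c :* d :* x :+ c :* s := c :* (d :* x :+ s)) ≃-refl c d (w (zipWith ℕ._+_ α β)) (L (λ β → w (zipWith ℕ._+_ α β)) g))
    where open ℂ-Solver

  L-⊗ : ∀ {n} (w : Vec ℕ n → ℂ) f g → L w (f ⊗ᵖ g) ≃ L (λ α → L (λ β → w (zipWith ℕ._+_ α β)) g) f
  L-⊗ w []            g = ≃-refl
  L-⊗ w ((c , α) ∷ f) g = ≃-trans (L-++ w (List.map _ g) _) (+ᶜ-cong (L-⊗-row w c α g) (L-⊗ w f g))

  L-neg : ∀ {n} (w : Vec ℕ n → ℂ) f → L w (-ᵖ f) ≃ -ᶜ L w f
  L-neg w []            = solve 1 (λ x → con 0ℚ := :- con 0ℚ) ≃-refl 0ᶜ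
    where open ℂ-Solver
  L-neg w ((c , α) ∷ f) = ≃-trans (+ᶜ-cong ≃-refl (L-neg w f))
    (solve 3 (λ c x s → (:- c) :* x :+ (:- s) := :- (c :* x :+ s)) ≃-refl c (w α) (L w f))
    where open ℂ-Solver

  L-const : ∀ {n} (w : Vec ℕ n → ℂ) c → L w (constᵖ c) ≃ c *ᶜ w (replicate n 0)
  L-const w c = +ᶜ-identityʳ _

  multiple : ∀ k c → RawSemiringDefs._×_ (RawRing.rawSemiring ℂ-rawRing) k c ≃ ⟪ nat k ⟫ *ᶜ c
  multiple zero    c = ≃-trans (≡⇒≃ (ℚ⇒ℂ-≡ 0ℚ)) (≃-sym (*ᶜ-zeroˡ c))
  multiple (suc k) c = ≃-trans (≡⇒≃ (+-≡ c _)) (≃-trans (+ᶜ-cong ≃-refl (multiple k c))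
    (≃-trans (solve 2 (λ c k → c :+ k :* c := (con 1ℚ :+ k) :* c) ≃-refl c ⟪ nat k ⟫)
      (*ᶜ-cong (≃-sym (≃-trans (⟪⟫-cong (nat-+ 1 k)) (⟪⟫-+ 1ℚ (nat k)))) ≃-refl)))
    where open ℂ-Solver

  L-∂ : ∀ {n} (w : Vec ℕ n → ℂ) i f → L w (∂ᵖ i f) ≃ L (λ α → ⟪ nat (lookup α i) ⟫ *ᶜ w (updateAt α i ℕ.pred)) f
  L-∂ w i []            = ≃-refl
  L-∂ w i ((c , α) ∷ f) = +ᶜ-cong (≃-trans (*ᶜ-cong (multiple (lookup α i) c) ≃-refl)
    (solve 3 (λ n c x → n :* c :* x := c :* (n :* x)) ≃-refl ⟪ nat (lookup α i) ⟫ c (w (updateAt α i ℕ.pred)))) (L-∂ w i f)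
    where open ℂ-Solver

  ~-of-≋ : ∀ {n} {f g : Poly n} → f ℂX.≋ g → f ~ g
  ~-of-≋ {n} {f} {g} f≋g = mk~ λ w → ≃-trans (solve 2 (λ x y → x := (x :+ :- y) :+ y) ≃-refl (L w f) (L w g))
    (≃-trans (+ᶜ-cong (≃-trans (≃-sym (≃-trans (L-⊕ w f (-ᵖ g)) (+ᶜ-cong ≃-refl (L-neg w g))))
      (L-vanishes w (f ⊕ᵖ (-ᵖ g)) λ α → inj₁ (≃-trans (L-⊕ (δ α) f (-ᵖ g)) (≃-trans (+ᶜ-cong (coeff≃ α) (L-neg (δ α) g))
        (-ᶜ-inverseʳ _))))) ≃-refl) (+ᶜ-identityˡ _))
    where
    open ℂ-Solver
    coeff-L : ∀ (f : Poly n) α → ℂX.coeff f α ≃ L (δ α) f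
    coeff-L []            α = ≡⇒≃ (ℚ⇒ℂ-≡ 0ℚ)
    coeff-L ((c , β) ∷ f) α with does (Vec.≡-dec ℕ._≟_ β α)
    ... | true  = ≃-trans (≡⇒≃ (+-≡ c _)) (+ᶜ-cong (≃-sym (*ᶜ-identityʳ c)) (coeff-L f α))
    ... | false = ≃-trans (coeff-L f α) (≃-sym (≃-trans (+ᶜ-cong (*ᶜ-zeroʳ c) ≃-refl) (+ᶜ-identityˡ _)))
    coeff≃ : ∀ α → L (δ α) f ≃ L (δ α) g
    coeff≃ α = ≃-trans (≃-sym (coeff-L f α)) (≃-trans (≈⇒≃ (f≋g α)) (coeff-L g α))

-- The ring of polynomials and its derivations

~-refl : ∀ {n} {f : Poly n} → f ~ f
~-refl = mk~ λ w → ≃-refl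

~-sym : ∀ {n} {f g : Poly n} → f ~ g → g ~ f
~-sym e = mk~ λ w → ≃-sym (at e w)

~-trans : ∀ {n} {f g h : Poly n} → f ~ g → g ~ h → f ~ h
~-trans e e′ = mk~ λ w → ≃-trans (at e w) (at e′ w)

⊕-cong : ∀ {n} {f f′ g g′ : Poly n} → f ~ f′ → g ~ g′ → f ⊕ᵖ g ~ f′ ⊕ᵖ g′
⊕-cong e e′ = mk~ λ w → ≃-trans (L-⊕ w _ _) (≃-trans (+ᶜ-cong (at e w) (at e′ w)) (≃-sym (L-⊕ w _ _)))

neg-cong : ∀ {n} {f g : Poly n} → f ~ g → -ᵖ f ~ -ᵖ g
neg-cong e = mk~ λ w → ≃-trans (L-neg w _) (≃-trans (-ᶜ-cong (at e w)) (≃-sym (L-neg w _)))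

⊗-cong : ∀ {n} {f f′ g g′ : Poly n} → f ~ f′ → g ~ g′ → f ⊗ᵖ g ~ f′ ⊗ᵖ g′
⊗-cong {f = f} {f′} {g} {g′} e e′ = mk~ λ w → ≃-trans (L-⊗ w f g) (≃-trans (L-cong f λ α → at e′ _)
  (≃-trans (at e _) (≃-sym (L-⊗ w f′ g′))))

∂-cong : ∀ {n} i {f g : Poly n} → f ~ g → ∂ᵖ i f ~ ∂ᵖ i g
∂-cong i {f} {g} e = mk~ λ w → ≃-trans (L-∂ w i f) (≃-trans (at e _) (≃-sym (L-∂ w i g)))

const-cong : ∀ {n c d} → c ≃ d → constᵖ {n} c ~ constᵖ d
const-cong e = mk~ λ w → ≃-trans (L-const w _) (≃-trans (*ᶜ-cong e ≃-refl) (≃-sym (L-const w _)))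

⊗-comm : ∀ {n} (f g : Poly n) → f ⊗ᵖ g ~ g ⊗ᵖ f
⊗-comm f g = mk~ λ w → ≃-trans (L-⊗ w f g) (≃-trans (L-swap _ f g)
  (≃-trans (L-cong g λ β → L-cong f λ α → ≡⇒≃ (cong w (Vec.zipWith-comm ℕ.+-comm α β))) (≃-sym (L-⊗ w g f))))

⊗-assoc : ∀ {n} (f g h : Poly n) → f ⊗ᵖ g ⊗ᵖ h ~ f ⊗ᵖ (g ⊗ᵖ h)
⊗-assoc f g h = mk~ λ w → ≃-trans (L-⊗ w (f ⊗ᵖ g) h) (≃-trans (L-⊗ _ f g) (≃-sym (≃-trans (L-⊗ w f (g ⊗ᵖ h))
  (L-cong f λ α → ≃-trans (L-⊗ _ g h) (L-cong g λ β → L-cong h λ γ → ≡⇒≃ (cong w (sym (Vec.zipWith-assoc ℕ.+-assoc α β γ))))))))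

const-⊗ : ∀ {n} (w : Vec ℕ n → ℂ) c f → L w (constᵖ c ⊗ᵖ f) ≃ c *ᶜ L w f
const-⊗ w c f = ≃-trans (L-⊗ w (constᵖ c) f) (≃-trans (L-const _ c)
  (*ᶜ-cong ≃-refl (L-cong f λ β → ≡⇒≃ (cong w (Vec.zipWith-identityˡ ℕ.+-identityˡ β)))))

Poly-commutativeRing : ℕ → CommutativeRing 0ℓ 0ℓ
Poly-commutativeRing n = record
  { Carrier = Poly n ; _≈_ = _~_ ; _+_ = _⊕ᵖ_ ; _*_ = _⊗ᵖ_ ; -_ = -ᵖ_ ; 0# = 0ᵖ ; 1# = 1ᵖ
  ; isCommutativeRing = record
    { isRing = record
      { +-isAbelianGroup = record
        { isGroup = record
          { isMonoid = record
            { isSemigroup = record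
              { isMagma = record
                { isEquivalence = record { refl = ~-refl ; sym = ~-sym ; trans = ~-trans }
                ; ∙-cong = ⊕-cong }
              ; assoc = λ f g h → mk~ λ w → ≃-trans (L-⊕ w _ h) (≃-trans (+ᶜ-cong (L-⊕ w f g) ≃-refl) (≃-trans (+ᶜ-assoc _ _ _)
                  (≃-sym (≃-trans (L-⊕ w f _) (+ᶜ-cong ≃-refl (L-⊕ w g h)))))) }
            ; identity = comm∧idˡ⇒id ⊕-comm ⊕-identityˡ }
          ; inverse = inverseˡ , λ f → ~-trans (⊕-comm f (-ᵖ f)) (inverseˡ f)
          ; ⁻¹-cong = neg-cong }
        ; comm = ⊕-comm }
      ; *-cong = ⊗-cong
      ; *-assoc = ⊗-assoc
      ; *-identity = comm∧idˡ⇒id ⊗-comm (λ f → mk~ λ w → ≃-trans (const-⊗ w 1ᶜ f) (*ᶜ-identityˡ _))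
      ; distrib = distribˡ , λ h f g → ~-trans (⊗-comm (f ⊕ᵖ g) h) (~-trans (distribˡ h f g) (⊕-cong (⊗-comm h f) (⊗-comm h g))) }
    ; *-comm = ⊗-comm } }
  where
  comm∧idˡ⇒id : ∀ {_∙_ : Poly n → Poly n → Poly n} {e} → (∀ x y → (x ∙ y) ~ (y ∙ x)) → (∀ x → (e ∙ x) ~ x) →
    (∀ x → (e ∙ x) ~ x) × (∀ x → (x ∙ e) ~ x)
  comm∧idˡ⇒id {e = e} comm idˡ = idˡ , λ x → ~-trans (comm x e) (idˡ x)
  ⊕-comm : ∀ (f g : Poly n) → f ⊕ᵖ g ~ g ⊕ᵖ f
  ⊕-comm f g = mk~ λ w → ≃-trans (L-⊕ w f g) (≃-trans (+ᶜ-comm _ _) (≃-sym (L-⊕ w g f)))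
  ⊕-identityˡ : ∀ (f : Poly n) → 0ᵖ ⊕ᵖ f ~ f
  ⊕-identityˡ f = mk~ λ w → ≃-trans (L-⊕ w 0ᵖ f) (+ᶜ-identityˡ _)
  inverseˡ : ∀ (f : Poly n) → -ᵖ f ⊕ᵖ f ~ 0ᵖ
  inverseˡ f = mk~ λ w → ≃-trans (L-⊕ w (-ᵖ f) f) (≃-trans (+ᶜ-cong (L-neg w f) ≃-refl) (-ᶜ-inverseˡ _))
  distribˡ : ∀ (h f g : Poly n) → h ⊗ᵖ (f ⊕ᵖ g) ~ h ⊗ᵖ f ⊕ᵖ h ⊗ᵖ g
  distribˡ h f g = mk~ λ w → ≃-trans (L-⊗ w h (f ⊕ᵖ g)) (≃-trans (L-cong h λ α → L-⊕ _ f g) (≃-trans (L-+ _ _ h)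
    (≃-sym (≃-trans (L-⊕ w _ _) (+ᶜ-cong (L-⊗ w h f) (L-⊗ w h g))))))

const-+ : ∀ {n} c d → constᵖ {n} (c +ᶜ d) ~ constᵖ c ⊕ᵖ constᵖ d
const-+ c d = mk~ λ w → ≃-trans (L-const w _) (≃-trans (*ᶜ-distribʳ-+ᶜ _ c d)
  (≃-sym (≃-trans (L-⊕ w _ _) (+ᶜ-cong (L-const w c) (L-const w d)))))

const-* : ∀ {n} c d → constᵖ {n} (c *ᶜ d) ~ constᵖ c ⊗ᵖ constᵖ d
const-* c d = mk~ λ w → ≃-trans (L-const w _) (≃-trans (*ᶜ-assoc c d _)
  (≃-sym (≃-trans (const-⊗ w c _) (*ᶜ-cong ≃-refl (L-const w d)))))

const-neg : ∀ {n} c → constᵖ {n} (-ᶜ c) ~ -ᵖ constᵖ c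
const-neg c = mk~ λ w → ≃-trans (L-const w _) (≃-trans (solve 2 (λ c x → (:- c) :* x := :- (c :* x)) ≃-refl c _)
  (≃-sym (≃-trans (L-neg w _) (-ᶜ-cong (L-const w c)))))
  where open ℂ-Solver

const-0 : ∀ {n} → constᵖ {n} 0ᶜ ~ 0ᵖ
const-0 = mk~ λ w → ≃-trans (L-const w 0ᶜ) (*ᶜ-zeroˡ _)

ℚ⟶Poly : ∀ n → ℚ-rawRing ACR.-Raw-AlmostCommutative⟶ ACR.fromCommutativeRing (Poly-commutativeRing n)
ℚ⟶Poly n = record
  { ⟦_⟧ = λ q → constᵖ ⟪ q ⟫
  ; +-homo = λ p q → ~-trans (const-cong (⟪⟫-+ p q)) (const-+ _ _)
  ; *-homo = λ p q → ~-trans (const-cong (⟪⟫-* p q)) (const-* _ _)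
  ; -‿homo = λ p → ~-trans (const-cong (⟪⟫-neg p)) (const-neg _)
  ; 0-homo = const-0
  ; 1-homo = ~-refl }

const⟪⟫-cong : ∀ {n p q} → p ≡ q → constᵖ {n} ⟪ p ⟫ ~ constᵖ ⟪ q ⟫
const⟪⟫-cong e = const-cong (⟪⟫-cong e)

module Poly-Solver (n : ℕ) =
  RingSolver ℚ-rawRing (ACR.fromCommutativeRing (Poly-commutativeRing n)) (ℚ⟶Poly n) (≟-coeff const⟪⟫-cong)

module ~-Reasoning {n : ℕ} = SetoidReasoning (CommutativeRing.setoid (Poly-commutativeRing n))

leibniz : ∀ {n} i (f g : Poly n) → ∂ᵖ i (f ⊗ᵖ g) ~ ∂ᵖ i f ⊗ᵖ g ⊕ᵖ f ⊗ᵖ ∂ᵖ i g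
leibniz i f g = mk~ λ w → begin
  L w (∂ᵖ i (f ⊗ᵖ g))
    ≈⟨ ≃-trans (L-∂ w i (f ⊗ᵖ g)) (L-⊗ _ f g) ⟩
  L (λ α → L (λ β → ⟪ nat (lookup (zipWith ℕ._+_ α β) i) ⟫ *ᶜ w (updateAt (zipWith ℕ._+_ α β) i ℕ.pred)) g) f
    ≈⟨ L-cong f (λ α → L-cong g λ β → split w α β i) ⟩
  L (λ α → L (λ β → ⟪ nat (lookup α i) ⟫ *ᶜ w (zipWith ℕ._+_ (updateAt α i ℕ.pred) β)
                    +ᶜ ⟪ nat (lookup β i) ⟫ *ᶜ w (zipWith ℕ._+_ α (updateAt β i ℕ.pred))) g) f
    ≈⟨ L-cong f (λ α → ≃-trans (L-+ _ _ g) (+ᶜ-cong (L-* _ _ g) ≃-refl)) ⟩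
  L (λ α → ⟪ nat (lookup α i) ⟫ *ᶜ L (λ β → w (zipWith ℕ._+_ (updateAt α i ℕ.pred) β)) g
           +ᶜ L (λ β → ⟪ nat (lookup β i) ⟫ *ᶜ w (zipWith ℕ._+_ α (updateAt β i ℕ.pred))) g) f
    ≈⟨ L-+ _ _ f ⟩
  L (λ α → ⟪ nat (lookup α i) ⟫ *ᶜ L (λ β → w (zipWith ℕ._+_ (updateAt α i ℕ.pred) β)) g) f
    +ᶜ L (λ α → L (λ β → ⟪ nat (lookup β i) ⟫ *ᶜ w (zipWith ℕ._+_ α (updateAt β i ℕ.pred))) g) f
    ≈⟨ +ᶜ-cong (≃-trans (L-⊗ w (∂ᵖ i f) g) (L-∂ _ i f)) (≃-trans (L-⊗ w f (∂ᵖ i g)) (L-cong f λ α → L-∂ _ i g)) ⟨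
  L w (∂ᵖ i f ⊗ᵖ g) +ᶜ L w (f ⊗ᵖ ∂ᵖ i g)
    ≈⟨ L-⊕ w _ _ ⟨
  L w (∂ᵖ i f ⊗ᵖ g ⊕ᵖ f ⊗ᵖ ∂ᵖ i g) ∎
  where
  open ≃-Reasoning
  -- At exponent 0 the truncated `ℕ.pred` produces the wrong monomial, but its coefficient is 0.
  nat-zero : ∀ {k} (x y : ℂ) → k ≡ 0 → ⟪ nat k ⟫ *ᶜ x ≃ ⟪ nat k ⟫ *ᶜ y
  nat-zero x y refl = ≃-trans (*ᶜ-zeroˡ x) (≃-sym (*ᶜ-zeroˡ y))
  pred-left : ∀ {m} (w : Vec ℕ m → ℂ) α β (i : Fin m) → ⟪ nat (lookup α i) ⟫ *ᶜ w (updateAt (zipWith ℕ._+_ α β) i ℕ.pred)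
    ≃ ⟪ nat (lookup α i) ⟫ *ᶜ w (zipWith ℕ._+_ (updateAt α i ℕ.pred) β)
  pred-left w (zero  ∷ α) (b ∷ β) zero    = nat-zero _ _ refl
  pred-left w (suc a ∷ α) (b ∷ β) zero    = ≃-refl
  pred-left w (a ∷ α)     (b ∷ β) (suc i) = pred-left (λ γ → w (a ℕ.+ b ∷ γ)) α β i
  split : ∀ {m} (w : Vec ℕ m → ℂ) α β (i : Fin m) →
    ⟪ nat (lookup (zipWith ℕ._+_ α β) i) ⟫ *ᶜ w (updateAt (zipWith ℕ._+_ α β) i ℕ.pred)
      ≃ ⟪ nat (lookup α i) ⟫ *ᶜ w (zipWith ℕ._+_ (updateAt α i ℕ.pred) β)
        +ᶜ ⟪ nat (lookup β i) ⟫ *ᶜ w (zipWith ℕ._+_ α (updateAt β i ℕ.pred))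
  split w α β i = ≃-trans (*ᶜ-cong (≃-trans (⟪⟫-cong (trans (cong nat (Vec.lookup-zipWith ℕ._+_ i α β)) (nat-+ (lookup α i) (lookup β i)))) (⟪⟫-+ _ _)) ≃-refl)
    (≃-trans (*ᶜ-distribʳ-+ᶜ _ _ _) (+ᶜ-cong (pred-left w α β i)
      (≃-trans (*ᶜ-cong ≃-refl (≡⇒≃ (cong (λ γ → w (updateAt γ i ℕ.pred)) (Vec.zipWith-comm ℕ.+-comm α β))))
        (≃-trans (pred-left w β α i) (*ᶜ-cong ≃-refl (≡⇒≃ (cong w (Vec.zipWith-comm ℕ.+-comm (updateAt β i ℕ.pred) α))))))))

infixr 8 _↑ᵖ_
_↑ᵖ_ : ∀ {n} → Poly n → ℕ → Poly n
f ↑ᵖ zero  = 1ᵖ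
f ↑ᵖ suc k = f ⊗ᵖ f ↑ᵖ k

↑-+ : ∀ {n} (f : Poly n) j k → f ↑ᵖ (j ℕ.+ k) ~ f ↑ᵖ j ⊗ᵖ f ↑ᵖ k
↑-+ {n} f zero    k = ~-sym (CommutativeRing.*-identityˡ (Poly-commutativeRing n) _)
↑-+ {n} f (suc j) k = ~-trans (⊗-cong ~-refl (↑-+ f j k)) (~-sym (⊗-assoc f _ _))

↑-cong : ∀ {n} {f g : Poly n} k → f ~ g → f ↑ᵖ k ~ g ↑ᵖ k
↑-cong zero    e = ~-refl
↑-cong (suc k) e = ⊗-cong e (↑-cong k e)

∂-const : ∀ {n} i c → ∂ᵖ {n} i (constᵖ c) ~ 0ᵖ
∂-const i c = mk~ λ w → ≃-trans (L-∂ w i (constᵖ c)) (≃-trans (L-const _ c)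
  (≃-trans (*ᶜ-cong ≃-refl (≃-trans (*ᶜ-cong (⟪⟫-cong (cong nat (Vec.lookup-replicate i 0))) ≃-refl) (*ᶜ-zeroˡ _)))
    (*ᶜ-zeroʳ c)))

power-rule : ∀ {n} i (f : Poly n) k → ∂ᵖ i (f ↑ᵖ suc k) ~ constᵖ ⟪ nat (suc k) ⟫ ⊗ᵖ (f ↑ᵖ k ⊗ᵖ ∂ᵖ i f)
power-rule {n} i f zero = ~-trans (leibniz i f 1ᵖ) (~-trans (⊕-cong ~-refl (⊗-cong ~-refl (~-trans (∂-const i 1ᶜ) (~-sym const-0))))
  (solve 2 (λ d f → d :* con 1ℚ :+ f :* con 0ℚ := con 1ℚ :* (con 1ℚ :* d)) ~-refl′ (∂ᵖ i f) f))
  where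
  open Poly-Solver n
  ~-refl′ : ∀ {f : Poly n} → f ~ f
  ~-refl′ = ~-refl
power-rule {n} i f (suc k) = ~-trans (leibniz i f (f ↑ᵖ suc k)) (~-trans (⊕-cong ~-refl (⊗-cong ~-refl (power-rule i f k)))
  (~-trans (solve 4 (λ d f p c → d :* (f :* p) :+ f :* (c :* (p :* d)) := (con 1ℚ :+ c) :* (f :* p :* d)) ~-refl (∂ᵖ i f) f (f ↑ᵖ k) (constᵖ ⟪ nat (suc k) ⟫))
    (⊗-cong (~-sym (~-trans (const-cong (≃-trans (⟪⟫-cong (nat-+ 1 (suc k))) (⟪⟫-+ 1ℚ (nat (suc k))))) (const-+ _ _))) ~-refl)))
  where open Poly-Solver n

-- Specialisation of the first variable σ to -1.
sub : ∀ {n} → (Vec ℕ n → ℂ) → Vec ℕ (suc n) → ℂ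
sub w (k ∷ α) = (-ᶜ 1ᶜ) ^ᶜ k *ᶜ w α

spec : ∀ {n} → Poly (suc n) → Poly n
spec = List.map λ { (c , k ∷ α) → c *ᶜ (-ᶜ 1ᶜ) ^ᶜ k , α }

L-spec : ∀ {n} (w : Vec ℕ n → ℂ) f → L w (spec f) ≃ L (sub w) f
L-spec w []                = ≃-refl
L-spec w ((c , k ∷ α) ∷ f) = +ᶜ-cong (*ᶜ-assoc c _ (w α)) (L-spec w f)

spec-cong : ∀ {n} {f g : Poly (suc n)} → f ~ g → spec f ~ spec g
spec-cong {f = f} {g} e = mk~ λ w → ≃-trans (L-spec w f) (≃-trans (at e _) (≃-sym (L-spec w g)))

opaque
  unfolding _⊕ᵖ_

  spec-⊕ : ∀ {n} (f g : Poly (suc n)) → spec (f ℂX.⊕ g) ~ spec f ⊕ᵖ spec g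
  spec-⊕ f g = mk~ λ w → ≃-trans (L-spec w (f ++ g)) (≃-trans (L-⊕ (sub w) f g)
    (≃-sym (≃-trans (L-⊕ w (spec f) (spec g)) (+ᶜ-cong (L-spec w f) (L-spec w g)))))

  spec-⊗ : ∀ {n} (f g : Poly (suc n)) → spec (f ℂX.⊗ g) ~ spec f ⊗ᵖ spec g
  spec-⊗ {n} f g = mk~ λ w → ≃-trans (L-spec w (f ℂX.⊗ g)) (≃-trans (L-⊗ (sub w) f g)
    (≃-sym (≃-trans (L-⊗ w (spec f) (spec g)) (≃-trans (L-spec _ f) (L-cong f (row w))))))
    where
    row : ∀ (w : Vec ℕ n → ℂ) α → sub (λ α → L (λ β → w (zipWith ℕ._+_ α β)) (spec g)) α ≃ L (λ β → sub w (zipWith ℕ._+_ α β)) g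
    row w (k ∷ α) = ≃-trans (*ᶜ-cong ≃-refl (L-spec _ g)) (≃-trans (≃-sym (L-* _ _ g)) (L-cong g λ { (l ∷ β) →
      ≃-trans (≃-sym (*ᶜ-assoc _ _ _)) (*ᶜ-cong (≃-sym (^ᶜ-homo-* (-ᶜ 1ᶜ) k l)) ≃-refl) }))

  spec-∂ : ∀ {n} i (f : Poly (suc n)) → spec (ℂX.∂ (suc i) f) ~ ∂ᵖ i (spec f)
  spec-∂ i f = mk~ λ w → ≃-trans (L-spec w (ℂX.∂ (suc i) f)) (≃-trans (L-∂ (sub w) (suc i) f)
    (≃-sym (≃-trans (L-∂ w i (spec f)) (≃-trans (L-spec _ f) (L-cong f λ { (k ∷ α) →
      solve 3 (λ a b c → a :* (b :* c) := b :* (a :* c)) ≃-refl ((-ᶜ 1ᶜ) ^ᶜ k) ⟪ nat (lookup α i) ⟫ (w (updateAt α i ℕ.pred)) })))))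
    where open ℂ-Solver

  spec-const : ∀ {n} c → spec {n} (ℂX.const c) ~ constᵖ c
  spec-const c = mk~ λ w → ≃-trans (L-spec w (ℂX.const c)) (≃-trans (L-const (sub w) c)
    (≃-trans (*ᶜ-cong ≃-refl (*ᶜ-identityˡ _)) (≃-sym (L-const w c))))

  spec-σ : ∀ {n} (f : ℤX.Poly n) → spec (BernsteinSato.σ f) ~ constᵖ (-ᶜ 1ᶜ)
  spec-σ f = mk~ λ w → ≃-trans (+ᶜ-cong (*ᶜ-cong (*ᶜ-cong (≡⇒≃ (ℚ⇒ℂ-≡ 1ℚ)) ≃-refl) ≃-refl) ≃-refl)
    (≃-trans (solve 2 (λ m x → con 1ℚ :* (m :* con 1ℚ) :* x :+ con 0ℚ := m :* x) ≃-refl (-ᶜ 1ᶜ) (w (replicate _ 0))) (≃-sym (L-const w _)))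
    where open ℂ-Solver

spec-1 : ∀ {n} → spec {n} (ℂX.const 1ℂ) ~ 1ᵖ
spec-1 = ~-trans (spec-const 1ℂ) (const-cong (≡⇒≃ (ℚ⇒ℂ-≡ 1ℚ)))

spec-↑ : ∀ {n} (f : Poly (suc n)) k → spec (f ℂX.↑ k) ~ spec f ↑ᵖ k
spec-↑ f zero    = spec-1
spec-↑ f (suc k) = ~-trans (spec-⊗ f (f ℂX.↑ k)) (⊗-cong ~-refl (spec-↑ f k))

ℕ⇒ℂ-≃ : ∀ k → ℕ⇒ℂ k ≃ ⟪ nat k ⟫
ℕ⇒ℂ-≃ k = ≡⇒≃ (ℚ⇒ℂ-≡ (nat k))

module _ {n} (f : ℤX.Poly n) where
  open BernsteinSato f

  Φ : Poly n
  Φ = toℂX f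

  spec-fσ : spec fσ ~ Φ
  spec-fσ = mk~ λ w → go w (toℂX f)
    where
    go : ∀ w f → L w (spec (List.map (λ (c , α) → c , 0 ∷ α) f)) ≃ L w f
    go w []            = ≃-refl
    go w ((c , α) ∷ f) = +ᶜ-cong (*ᶜ-cong (*ᶜ-identityʳ c) ≃-refl) (go w f)

  -- At σ = -1 the element (g / f^k) f^σ is the polynomial h.
  Polynomial-at-−1 : Element → Set
  Polynomial-at-−1 (g /f^ k) = ∃[ h ] spec g ~ h ⊗ᵖ Φ ↑ᵖ suc k

  private module S = Poly-Solver n
  open S using (solve; _:+_; _:*_; _:-_; :-_; _:=_; con)
  open ~-Reasoning

  +ₑ-polynomial : ∀ u v → Polynomial-at-−1 u → Polynomial-at-−1 v → Polynomial-at-−1 (u +ₑ v)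
  +ₑ-polynomial (g /f^ k) (g′ /f^ l) (h , e) (h′ , e′) = h ⊕ᵖ h′ , (begin
    spec (g ℂX.⊗ fσ ℂX.↑ l ℂX.⊕ g′ ℂX.⊗ fσ ℂX.↑ k)
      ≈⟨ ~-trans (spec-⊕ _ _) (⊕-cong (~-trans (spec-⊗ g _) (⊗-cong e (~-trans (spec-↑ fσ l) (↑-cong l spec-fσ))))
           (~-trans (spec-⊗ g′ _) (⊗-cong e′ (~-trans (spec-↑ fσ k) (↑-cong k spec-fσ))))) ⟩
    h ⊗ᵖ (Φ ⊗ᵖ Φ ↑ᵖ k) ⊗ᵖ Φ ↑ᵖ l ⊕ᵖ h′ ⊗ᵖ (Φ ⊗ᵖ Φ ↑ᵖ l) ⊗ᵖ Φ ↑ᵖ k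
      ≈⟨ solve 5 (λ h h′ f p q → h :* (f :* p) :* q :+ h′ :* (f :* q) :* p := (h :+ h′) :* (f :* (p :* q))) ~-refl h h′ Φ (Φ ↑ᵖ k) (Φ ↑ᵖ l) ⟩
    (h ⊕ᵖ h′) ⊗ᵖ (Φ ⊗ᵖ (Φ ↑ᵖ k ⊗ᵖ Φ ↑ᵖ l))
      ≈⟨ ⊗-cong ~-refl (⊗-cong ~-refl (↑-+ Φ k l)) ⟨
    (h ⊕ᵖ h′) ⊗ᵖ Φ ↑ᵖ suc (k ℕ.+ l) ∎)

  *ₑ-polynomial : ∀ p u → Polynomial-at-−1 u → Polynomial-at-−1 (p *ₑ u)
  *ₑ-polynomial p (g /f^ k) (h , e) = spec p ⊗ᵖ h , ~-trans (spec-⊗ p g) (~-trans (⊗-cong ~-refl e) (~-sym (⊗-assoc _ _ _)))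

  -- For g = h f^(k+1) the factor σ - k = -(1 + k) cancels the 1 + k of the power rule, and only ∂h
  -- remains: at σ = -1 the operators act on polynomials as usual.
  ∂ₑ-polynomial : ∀ i u → Polynomial-at-−1 u → Polynomial-at-−1 (∂ₑ i u)
  ∂ₑ-polynomial i (g /f^ k) (h , e) = ∂ᵖ i h , (begin
    spec (fσ ℂX.⊗ ℂX.∂ (suc i) g ℂX.⊕ (σ ℂX.⊕ ℂX.const (Defs.-_ (ℕ⇒ℂ k))) ℂX.⊗ (g ℂX.⊗ ℂX.∂ (suc i) fσ))
      ≈⟨ ~-trans (spec-⊕ _ _) (⊕-cong
           (~-trans (spec-⊗ fσ _) (⊗-cong spec-fσ (~-trans (spec-∂ i g) (∂-cong i e))))
           (~-trans (spec-⊗ _ _) (⊗-cong (~-trans (spec-⊕ σ (ℂX.const (Defs.-_ (ℕ⇒ℂ k)))) (⊕-cong (~-trans (spec-σ f) (const-neg 1ᶜ))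
               (~-trans (spec-const (Defs.-_ (ℕ⇒ℂ k))) (~-trans (const-cong (≃-trans (≡⇒≃ (neg-≡ (ℕ⇒ℂ k))) (-ᶜ-cong (ℕ⇒ℂ-≃ k)))) (const-neg ⟪ nat k ⟫)))))
             (~-trans (spec-⊗ g _) (⊗-cong e (~-trans (spec-∂ i fσ) (∂-cong i spec-fσ))))))) ⟩
    Φ ⊗ᵖ ∂ᵖ i (h ⊗ᵖ Φ ↑ᵖ suc k) ⊕ᵖ (-ᵖ 1ᵖ ⊕ᵖ -ᵖ K) ⊗ᵖ (h ⊗ᵖ (Φ ⊗ᵖ P) ⊗ᵖ ∂ᵖ i Φ)
      ≈⟨ ⊕-cong (⊗-cong ~-refl (~-trans (leibniz i h _) (⊕-cong ~-refl (⊗-cong ~-refl (~-trans (power-rule i Φ k)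
           (⊗-cong (~-trans (const-cong (≃-trans (⟪⟫-cong (nat-+ 1 k)) (⟪⟫-+ 1ℚ (nat k)))) (const-+ _ _)) ~-refl)))))) ~-refl ⟩
    Φ ⊗ᵖ (∂ᵖ i h ⊗ᵖ (Φ ⊗ᵖ P) ⊕ᵖ h ⊗ᵖ ((1ᵖ ⊕ᵖ K) ⊗ᵖ (P ⊗ᵖ ∂ᵖ i Φ))) ⊕ᵖ (-ᵖ 1ᵖ ⊕ᵖ -ᵖ K) ⊗ᵖ (h ⊗ᵖ (Φ ⊗ᵖ P) ⊗ᵖ ∂ᵖ i Φ)
      ≈⟨ solve 6 (λ f d h p k e → f :* (d :* (f :* p) :+ h :* ((con 1ℚ :+ k) :* (p :* e))) :+ (:- con 1ℚ :+ :- k) :* (h :* (f :* p) :* e)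
             := d :* (f :* (f :* p))) ~-refl Φ (∂ᵖ i h) h P K (∂ᵖ i Φ) ⟩
    ∂ᵖ i h ⊗ᵖ Φ ↑ᵖ suc (suc k) ∎)
    where
    P K : Poly n
    P = Φ ↑ᵖ k
    K = constᵖ ⟪ nat k ⟫

  ∂ₑ^-polynomial : ∀ β u → Polynomial-at-−1 u → Polynomial-at-−1 (∂ₑ^ β u)
  ∂ₑ^-polynomial β u inv = go (allFin n)
    where
    iterate : ∀ i k v → Polynomial-at-−1 v → Polynomial-at-−1 (fold v (∂ₑ i) k)
    iterate i zero    v h = h
    iterate i (suc k) v h = ∂ₑ-polynomial i (fold v (∂ₑ i) k) (iterate i k v h)
    go : ∀ is → Polynomial-at-−1 (List.foldr (λ i v → fold v (∂ₑ i) (lookup β i)) u is)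
    go []       = inv
    go (i ∷ is) = iterate i (lookup β i) (List.foldr (λ i v → fold v (∂ₑ i) (lookup β i)) u is) (go is)

  apply-polynomial : ∀ D u → Polynomial-at-−1 u → Polynomial-at-−1 (apply D u)
  apply-polynomial []            u inv = 0ᵖ , ~-sym (CommutativeRing.zeroˡ (Poly-commutativeRing n) (Φ ↑ᵖ 1))
  apply-polynomial ((p , β) ∷ D) u inv =
    +ₑ-polynomial (p *ₑ ∂ₑ^ β u) (apply D u) (*ₑ-polynomial p (∂ₑ^ β u) (∂ₑ^-polynomial β u inv)) (apply-polynomial D u inv)

  spec-inσ : ∀ b → spec (inσ b) ~ constᵖ (evalᶜ b (-ᶜ 1ᶜ))
  spec-inσ b = mk~ λ w → ≃-trans (L-spec w (inσ b)) (≃-trans (go w b 0 (λ j → j) (λ j → sym (ℕ.+-identityʳ j))) (≃-trans (≃-sym (*ᶜ-assoc _ _ _))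
    (≃-trans (*ᶜ-cong (*ᶜ-identityˡ _) ≃-refl) (≃-sym (L-const w _)))))
    where
    open ℂ-Solver using () renaming (solve to solveᶜ; _:+_ to _c+_; _:*_ to _c*_; _:=_ to _c=_)
    go : ∀ w b s (g : ℕ → ℕ) → (∀ j → g j ≡ j ℕ.+ s) →
      L (sub w) (List.zipWith (λ c k → c , k ∷ replicate n 0) b (applyUpTo g (length b)))
        ≃ (-ᶜ 1ᶜ) ^ᶜ s *ᶜ (evalᶜ b (-ᶜ 1ᶜ) *ᶜ w (replicate n 0))
    go w []      s g h = ≃-sym (≃-trans (*ᶜ-cong ≃-refl (*ᶜ-zeroˡ _)) (*ᶜ-zeroʳ _))
    go w (c ∷ b) s g h = ≃-trans (+ᶜ-cong (*ᶜ-cong ≃-refl (*ᶜ-cong (≡⇒≃ (cong ((-ᶜ 1ᶜ) ^ᶜ_) (h 0))) ≃-refl))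
        (go w b (suc s) (λ j → g (suc j)) (λ j → trans (h (suc j)) (sym (ℕ.+-suc j s)))))
      (solveᶜ 5 (λ c m p e x → c c* (p c* x) c+ (m c* p) c* (e c* x) c= p c* ((c c+ m c* e) c* x))
        ≃-refl c (-ᶜ 1ᶜ) ((-ᶜ 1ᶜ) ^ᶜ s) (evalᶜ b (-ᶜ 1ᶜ)) (w (replicate n 0)))

  ≅-at-−1 : ∀ b u → Polynomial-at-−1 u → u ≅ (inσ b /f^ 0) →
    ∃[ h ] ∃[ K ] constᵖ (evalᶜ b (-ᶜ 1ᶜ)) ⊗ᵖ Φ ↑ᵖ K ~ h ⊗ᵖ Φ ↑ᵖ suc K
  ≅-at-−1 b (g /f^ K) (h , e) eq = h , K , (begin
    constᵖ (evalᶜ b (-ᶜ 1ᶜ)) ⊗ᵖ Φ ↑ᵖ K  ≈⟨ ⊗-cong (spec-inσ b) (~-trans (spec-↑ fσ K) (↑-cong K spec-fσ)) ⟨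
    spec (inσ b) ⊗ᵖ spec (fσ ℂX.↑ K)    ≈⟨ spec-⊗ (inσ b) _ ⟨
    spec (inσ b ℂX.⊗ fσ ℂX.↑ K)         ≈⟨ spec-cong (~-of-≋ eq) ⟨
    spec (g ℂX.⊗ ℂX.const 1ℂ)           ≈⟨ ~-trans (spec-⊗ g _) (⊗-cong e spec-1) ⟩
    h ⊗ᵖ Φ ↑ᵖ suc K ⊗ᵖ 1ᵖ               ≈⟨ CommutativeRing.*-identityʳ (Poly-commutativeRing n) _ ⟩
    h ⊗ᵖ Φ ↑ᵖ suc K                     ∎)

  -- At σ = -1 the element f · f^σ is the polynomial 1, so D turns it into a polynomial h.
  -- Cross-multiplication of fractions leaves the power f^K on both sides.
  functional-equation-at-−1 : ∀ b → FunctionalEquation b →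
    ∃[ h ] ∃[ K ] constᵖ (evalᶜ b (-ᶜ 1ᶜ)) ⊗ᵖ Φ ↑ᵖ K ~ h ⊗ᵖ Φ ↑ᵖ suc K
  functional-equation-at-−1 b (D , eq) = ≅-at-−1 b (apply D (fσ /f^ 0)) (apply-polynomial D (fσ /f^ 0) (1ᵖ , base)) eq
    where
    base : spec fσ ~ 1ᵖ ⊗ᵖ Φ ↑ᵖ 1
    base = ~-trans spec-fσ (solve 1 (λ f → f := con 1ℚ :* (f :* con 1ℚ)) ~-refl Φ)

-- Cancellation for polynomials in one variable

[_] : ℕ → Vec ℕ 1
[ k ] = k ∷ []

[]-injective : ∀ {j k} → [ j ] ≡ [ k ] → j ≡ k
[]-injective refl = refl

coefficient : ℕ → Poly 1 → ℂ
coefficient k = L (δ [ k ])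

δ-translate : ∀ i x k → δ [ i ℕ.+ x ] [ i ℕ.+ k ] ≃ δ [ x ] [ k ]
δ-translate i x k with k ℕ.≟ x
... | yes refl = ≃-trans (δ-≡ [ i ℕ.+ k ]) (≃-sym (δ-≡ [ k ]))
... | no k≢x   = ≃-trans (δ-≢ λ e → k≢x (ℕ.+-cancelˡ-≡ i k x ([]-injective e))) (≃-sym (δ-≢ λ e → k≢x ([]-injective e)))

degreeBound : Poly 1 → ℕ
degreeBound []                 = 0
degreeBound ((c , k ∷ []) ∷ u) = suc k ℕ.+ degreeBound u

coefficient-above : ∀ u j → degreeBound u ℕ.≤ j → coefficient j u ≃ 0ᶜ
coefficient-above []                 j le = ≃-refl
coefficient-above ((c , k ∷ []) ∷ u) j le = ≃-trans (+ᶜ-cong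
    (≃-trans (*ᶜ-cong ≃-refl (δ-≢ λ e → ℕ.<⇒≢ (ℕ.≤-trans (ℕ.m≤m+n (suc k) _) le) ([]-injective e))) (*ᶜ-zeroʳ c))
    (coefficient-above u j (ℕ.≤-trans (ℕ.m≤n+m _ (suc k)) le))) (+ᶜ-identityˡ 0ᶜ)

module _ {F : Poly 1} {D : ℕ} (lead : ¬ coefficient D F ≃ 0ᶜ) (above : ∀ l → D ℕ.< l → coefficient l F ≃ 0ᶜ) where

  -- Descending induction on j: once the coefficients of u above j vanish, the coefficient of uF at
  -- j + D is the product of those of u at j and of F at D. Only the coefficients from D on are
  -- assumed to vanish, since `no-unit-multiple` applies this to a constant product.
  ⊗-cancel : ∀ u → (∀ j → coefficient (j ℕ.+ D) (u ⊗ᵖ F) ≃ 0ᶜ) → u ~ 0ᵖ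
  ⊗-cancel u h = mk~ λ w → L-vanishes w u λ { (j ∷ []) → inj₁ (down (degreeBound u) j (ℕ.m≤n+m _ j)) }
    where
    step : ∀ j → (∀ i → j ℕ.< i → coefficient i u ≃ 0ᶜ) → coefficient j u ≃ 0ᶜ
    step j higher = *ᶜ-cancel-0 (≃-trans (*ᶜ-comm _ _) (≃-trans (*ᶜ-cong (≃-sym v[j]) ≃-refl) (≃-trans (≃-sym Lv) (≃-trans (≃-sym (L-⊗ _ u F)) (h j))))) lead
      where
      v : Vec ℕ 1 → ℂ
      v α = L (λ β → δ [ j ℕ.+ D ] (zipWith ℕ._+_ α β)) F
      v[j] : v [ j ] ≃ coefficient D F
      v[j] = L-cong F λ { (k ∷ []) → δ-translate j D k }
      v-below : ∀ i → i ℕ.< j → v [ i ] ≃ 0ᶜ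
      v-below i i<j = ≃-trans (L-cong F λ { (k ∷ []) → ≃-trans (≡⇒≃ (cong (λ m → δ [ m ] [ i ℕ.+ k ]) eq)) (δ-translate i (j ℕ.∸ i ℕ.+ D) k) })
        (above (j ℕ.∸ i ℕ.+ D) (ℕ.+-monoˡ-≤ D (ℕ.m<n⇒0<n∸m i<j)))
        where
        eq : j ℕ.+ D ≡ i ℕ.+ (j ℕ.∸ i ℕ.+ D)
        eq = trans (cong (ℕ._+ D) (sym (ℕ.m+[n∸m]≡n (ℕ.<⇒≤ i<j)))) (ℕ.+-assoc i (j ℕ.∸ i) D)
      Lv : L v u ≃ v [ j ] *ᶜ coefficient j u
      Lv = ≃-trans (L-∖ v u [ j ]) (≃-trans (+ᶜ-cong ≃-refl (L-vanishes v (u ∖ [ j ]) λ { (i ∷ []) → cases i (ℕ.<-cmp i j) }))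
        (+ᶜ-identityʳ _))
        where
        open import Relation.Binary.Definitions using (Tri; tri<; tri≈; tri>)
        cases : ∀ i → Tri (i ℕ.< j) (i ≡ j) (j ℕ.< i) → L (δ [ i ]) (u ∖ [ j ]) ≃ 0ᶜ ⊎ v [ i ] ≃ 0ᶜ
        cases i (tri< i<j _ _)  = inj₂ (v-below i i<j)
        cases i (tri≈ _ refl _) = inj₁ (coeff-∖ u [ j ])
        cases i (tri> _ i≢j j<i) = inj₁ (≃-trans (≃-sym (coeff-∖-≢ u λ e → i≢j (sym ([]-injective e)))) (higher i j<i))
    down : ∀ t j → degreeBound u ℕ.≤ j ℕ.+ t → coefficient j u ≃ 0ᶜ
    down zero    j le = coefficient-above u j (ℕ.≤-trans le (ℕ.≤-reflexive (ℕ.+-identityʳ j)))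
    down (suc t) j le = step j λ i j<i → down t i (ℕ.≤-trans le (ℕ.≤-trans (ℕ.≤-reflexive (ℕ.+-suc j t)) (ℕ.+-monoˡ-≤ t j<i)))

  power-cancel : ∀ K u → u ⊗ᵖ F ↑ᵖ K ~ 0ᵖ → u ~ 0ᵖ
  power-cancel zero    u e = ~-trans (~-sym (CommutativeRing.*-identityʳ (Poly-commutativeRing 1) u)) e
  power-cancel (suc K) u e = power-cancel K u (⊗-cancel (u ⊗ᵖ F ↑ᵖ K) λ j → at (~-trans
    (solve 3 (λ u p f → u :* p :* f := u :* (f :* p)) ~-refl u (F ↑ᵖ K) F) e) _)
    where open Poly-Solver 1

  -- Cancelling F^K gives β = hF. As D > 0, the coefficients of hF from D on vanish, so h is zero
  -- and β with it.
  no-unit-multiple : 0 ℕ.< D → ∀ {β h K} → constᵖ β ⊗ᵖ F ↑ᵖ K ~ h ⊗ᵖ F ↑ᵖ suc K → β ≃ 0ᶜ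
  no-unit-multiple 0<D {β} {h} {K} e = ≃-trans (≃-sym (≃-trans (L-const (δ [ 0 ]) β) (≃-trans (*ᶜ-cong ≃-refl (δ-≡ [ 0 ])) (*ᶜ-identityʳ β))))
      (at (~-trans const~hF (~-trans (⊗-cong h~0 ~-refl) (CommutativeRing.zeroˡ (Poly-commutativeRing 1) F))) (δ [ 0 ]))
    where
    open Poly-Solver 1
    difference~0 : constᵖ β ⊕ᵖ -ᵖ (h ⊗ᵖ F) ~ 0ᵖ
    difference~0 = power-cancel K _ (~-trans (solve 4 (λ b h f p → (b :- h :* f) :* p := b :* p :- h :* (f :* p)) ~-refl (constᵖ β) h F (F ↑ᵖ K))
      (~-trans (⊕-cong e ~-refl) (CommutativeRing.-‿inverseʳ (Poly-commutativeRing 1) _)))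
    const~hF : constᵖ β ~ h ⊗ᵖ F
    const~hF = ~-trans (solve 2 (λ b x → b := (b :- x) :+ x) ~-refl (constᵖ β) (h ⊗ᵖ F))
      (~-trans (⊕-cong difference~0 ~-refl) (CommutativeRing.+-identityˡ (Poly-commutativeRing 1) _))
    h~0 : h ~ 0ᵖ
    h~0 = ⊗-cancel h λ j → ≃-trans (≃-sym (at const~hF _)) (≃-trans (L-const _ β)
      (≃-trans (*ᶜ-cong ≃-refl (δ-≢ λ e → ℕ.<⇒≢ (ℕ.<-≤-trans 0<D (ℕ.m≤n+m D j)) ([]-injective e))) (*ᶜ-zeroʳ β)))

-- If no coefficient from l on were a leading one, stability would make them all vanish, from the
-- degree bound downwards. The existence of a leading coefficient is thus obtained in doubly negated
-- form.
has-lead : ∀ {F : Poly 1} {l} → ¬ coefficient l F ≃ 0ᶜ →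
  ¬ (∀ D → l ℕ.≤ D → ¬ coefficient D F ≃ 0ᶜ → (∀ j → D ℕ.< j → coefficient j F ≃ 0ᶜ) → ⊥)
has-lead {F} {l} F[l]≄0 none = F[l]≄0 (down (degreeBound F) l ℕ.≤-refl (ℕ.m≤n+m _ l))
  where
  down : ∀ t j → l ℕ.≤ j → degreeBound F ℕ.≤ j ℕ.+ t → coefficient j F ≃ 0ᶜ
  down zero    j l≤j le = coefficient-above F j (ℕ.≤-trans le (ℕ.≤-reflexive (ℕ.+-identityʳ j)))
  down (suc t) j l≤j le = ≃-stable λ F[j]≄0 → none j l≤j F[j]≄0 λ i j<i →
    down t i (ℕ.≤-trans l≤j (ℕ.<⇒≤ j<i)) (ℕ.≤-trans le (ℕ.≤-trans (ℕ.≤-reflexive (ℕ.+-suc j t)) (ℕ.+-monoˡ-≤ t j<i)))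

-- Kronecker's substitution xᵢ = t^(Mⁱ), which separates the monomials with exponents below M.
module Kronecker (M : ℕ) where

  weight : ∀ {n} → Vec ℕ n → ℕ
  weight []      = 0
  weight (a ∷ α) = a ℕ.+ weight α ℕ.* M

  weight-+ : ∀ {n} (α β : Vec ℕ n) → weight (zipWith ℕ._+_ α β) ≡ weight α ℕ.+ weight β
  weight-+ []      []      = refl
  weight-+ (a ∷ α) (b ∷ β) rewrite weight-+ α β | ℕ.*-distribʳ-+ M (weight α) (weight β) = interchange a b (weight α ℕ.* M) (weight β ℕ.* M)
    where
    interchange : ∀ a b c d → a ℕ.+ b ℕ.+ (c ℕ.+ d) ≡ a ℕ.+ c ℕ.+ (b ℕ.+ d)
    interchange a b c d = trans (ℕ.+-assoc a b (c ℕ.+ d)) (trans (cong (a ℕ.+_)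
      (trans (sym (ℕ.+-assoc b c d)) (trans (cong (ℕ._+ d) (ℕ.+-comm b c)) (ℕ.+-assoc c b d)))) (sym (ℕ.+-assoc a c (b ℕ.+ d))))

  weight-0 : ∀ n → weight (replicate n 0) ≡ 0
  weight-0 zero    = refl
  weight-0 (suc n) = cong (ℕ._* M) (weight-0 n)

  -- Keeps the substituted polynomial nonconstant: it supplies the 0 < D that `no-unit-multiple`
  -- asks for.
  sum≤weight : ∀ {n} .{{_ : ℕ.NonZero M}} (α : Vec ℕ n) → Vec.sum α ℕ.≤ weight α
  sum≤weight []      = ℕ.z≤n
  sum≤weight (a ∷ α) = ℕ.+-monoʳ-≤ a (ℕ.≤-trans (sum≤weight α) (ℕ.m≤m*n (weight α) M))

  -- The exponents are the base-M digits of the weight; the first one is the remainder modulo M.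
  weight-injective : ∀ {n} .{{_ : ℕ.NonZero M}} (α β : Vec ℕ n) → Vec.sum α ℕ.< M → Vec.sum β ℕ.< M → weight α ≡ weight β → α ≡ β
  weight-injective []      []      _   _   _ = refl
  weight-injective (a ∷ α) (b ∷ β) sα< sβ< e = cong₂ _∷_ a≡b (weight-injective α β (below a α sα<) (below b β sβ<)
      (ℕ.*-cancelʳ-≡ (weight α) (weight β) M (ℕ.+-cancelˡ-≡ a _ _ (trans e (cong (ℕ._+ weight β ℕ.* M) (sym a≡b))))))
    where
    below : ∀ {n} a (α : Vec ℕ n) → Vec.sum (a ∷ α) ℕ.< M → Vec.sum α ℕ.< M
    below a α h = ℕ.≤-<-trans (ℕ.m≤n+m (Vec.sum α) a) h
    head-mod : ∀ {n} a (α : Vec ℕ n) → Vec.sum (a ∷ α) ℕ.< M → weight (a ∷ α) ℕ.% M ≡ a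
    head-mod a α h = trans (ℕ.[m+kn]%n≡m%n a (weight α) M) (ℕ.m<n⇒m%n≡m (ℕ.≤-<-trans (ℕ.m≤m+n a (Vec.sum α)) h))
    a≡b : a ≡ b
    a≡b = trans (sym (head-mod a α sα<)) (trans (cong (ℕ._% M) e) (head-mod b β sβ<))

  substitute : ∀ {n} → Poly n → Poly 1
  substitute = List.map λ (c , α) → c , [ weight α ]

  L-substitute : ∀ {n} w (f : Poly n) → L w (substitute f) ≃ L (λ α → w [ weight α ]) f
  L-substitute w []            = ≃-refl
  L-substitute w ((c , α) ∷ f) = +ᶜ-cong ≃-refl (L-substitute w f)

  substitute-cong : ∀ {n} {f g : Poly n} → f ~ g → substitute f ~ substitute g
  substitute-cong {f = f} {g} e = mk~ λ w → ≃-trans (L-substitute w f) (≃-trans (at e _) (≃-sym (L-substitute w g)))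

  substitute-⊗ : ∀ {n} (f g : Poly n) → substitute (f ⊗ᵖ g) ~ substitute f ⊗ᵖ substitute g
  substitute-⊗ f g = mk~ λ w → ≃-trans (L-substitute w (f ⊗ᵖ g)) (≃-trans (L-⊗ _ f g) (≃-sym (≃-trans (L-⊗ w (substitute f) (substitute g))
    (≃-trans (L-substitute _ f) (L-cong f λ α → ≃-trans (L-substitute _ g) (L-cong g λ β → ≡⇒≃ (cong (λ k → w [ k ]) (sym (weight-+ α β)))))))))

  substitute-const : ∀ {n} c → substitute (constᵖ {n} c) ~ constᵖ c
  substitute-const {n} c = mk~ λ w → ≃-trans (L-substitute w (constᵖ c)) (≃-trans (L-const _ c)
    (≃-trans (*ᶜ-cong ≃-refl (≡⇒≃ (cong (λ k → w [ k ]) (weight-0 n)))) (≃-sym (L-const w c))))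

  substitute-↑ : ∀ {n} (f : Poly n) k → substitute (f ↑ᵖ k) ~ substitute f ↑ᵖ k
  substitute-↑ f zero    = substitute-const 1ᶜ
  substitute-↑ f (suc k) = ~-trans (substitute-⊗ f (f ↑ᵖ k)) (⊗-cong ~-refl (substitute-↑ f k))

int : ℤ → ℚ
int z = z ℚ./ 1

toℚᵘ-int : ∀ z → ℚ.toℚᵘ (int z) ℚᵘ.≃ ℚᵘ.mkℚᵘ z 0
toℚᵘ-int z = ℚ.toℚᵘ-fromℚᵘ (ℚᵘ.mkℚᵘ z 0)

int-+ : ∀ y z → int (y ℤ.+ z) ≡ int y ℚ.+ int z
int-+ y z = ℚ.toℚᵘ-injective (begin
  ℚ.toℚᵘ (int (y ℤ.+ z))              ≈⟨ toℚᵘ-int (y ℤ.+ z) ⟩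
  ℚᵘ.mkℚᵘ (y ℤ.+ z) 0                 ≈⟨ ℚᵘ.*≡* (cong (ℤ._* + 1) (sym (cong₂ ℤ._+_ (ℤ.*-identityʳ y) (ℤ.*-identityʳ z)))) ⟩
  ℚᵘ.mkℚᵘ y 0 ℚᵘ.+ ℚᵘ.mkℚᵘ z 0        ≈⟨ ℚᵘ.+-cong (toℚᵘ-int y) (toℚᵘ-int z) ⟨
  ℚ.toℚᵘ (int y) ℚᵘ.+ ℚ.toℚᵘ (int z)  ≈⟨ ℚ.toℚᵘ-homo-+ (int y) (int z) ⟨
  ℚ.toℚᵘ (int y ℚ.+ int z)            ∎)
  where open ℚᵘ.≃-Reasoning

⟪int⟫≄0 : ∀ {z} → ¬ z ≡ + 0 → ¬ ⟪ int z ⟫ ≃ 0ᶜ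
⟪int⟫≄0 {z} z≢0 e = z≢0 (trans (sym (ℤ.*-identityʳ z)) (drop (begin
  ℚᵘ.mkℚᵘ z 0        ≈⟨ toℚᵘ-int z ⟨
  ℚ.toℚᵘ (int z)     ≡⟨ cong ℚ.toℚᵘ int≡0 ⟩
  ℚᵘ.mkℚᵘ (+ 0) 0    ∎)))
  where
  open ℚᵘ.≃-Reasoning
  drop : ∀ {z} → ℚᵘ.mkℚᵘ z 0 ℚᵘ.≃ ℚᵘ.mkℚᵘ (+ 0) 0 → z ℤ.* + 1 ≡ + 0
  drop (ℚᵘ.*≡* h) = h
  ⟨int⟩≃0 : ⟨ int z ⟩ ≃ʳ ⟨ 0ℚ ⟩
  ⟨int⟩≃0 = ≃ʳ-trans (≃ʳ-sym (re-fromℝ _)) (≃ʳ-trans (re-cong e) (re-fromℝ _))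
  int≡0 : int z ≡ 0ℚ
  int≡0 = ℚ.≤-antisym (ℚ.≮⇒≥ λ 0<z → ≃ʳ⇒≮ (≃ʳ-sym ⟨int⟩≃0) (⟨⟩-mono-< 0<z)) (ℚ.≮⇒≥ λ z<0 → ≃ʳ⇒≮ ⟨int⟩≃0 (⟨⟩-mono-< z<0))

coeff-toℂX : ∀ {n} (f : ℤX.Poly n) α → L (δ α) (toℂX f) ≃ ⟪ int (ℤX.coeff f α) ⟫
coeff-toℂX []            α = ≃-refl
coeff-toℂX ((c , β) ∷ f) α with does (Vec.≡-dec ℕ._≟_ β α)
... | true  = ≃-trans (+ᶜ-cong (≃-trans (*ᶜ-identityʳ _) (≡⇒≃ (ℚ⇒ℂ-≡ (int c)))) (coeff-toℂX f α))
  (≃-sym (≃-trans (⟪⟫-cong (int-+ c (ℤX.coeff f α))) (⟪⟫-+ _ _)))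
... | false = ≃-trans (+ᶜ-cong (*ᶜ-zeroʳ _) (coeff-toℂX f α)) (+ᶜ-identityˡ _)

functional-equation-root : ∀ {n} (f : ℤX.Poly n) α → 0 ℕ.< totalDegree α → ¬ ℤX.coeff f α ≡ + 0 →
  ∀ b → BernsteinSato.FunctionalEquation f b → evalᶜ b (-ᶜ 1ᶜ) ≃ 0ᶜ
functional-equation-root {n} f α 0<d f[α]≢0 b equation =
  let h , K , e = functional-equation-at-−1 f b equation in
  ≃-stable λ β≄0 → has-lead {substitute Φf} lead≄0 λ D l≤D F[D]≄0 above → β≄0 (no-unit-multiple {substitute Φf} F[D]≄0 above
    (ℕ.<-≤-trans 0<d (ℕ.≤-trans (sum≤weight α) l≤D)) {h = substitute h} {K}
    (~-trans (⊗-cong (~-sym (substitute-const {n} (evalᶜ b (-ᶜ 1ᶜ)))) (~-sym (substitute-↑ Φf K))) (~-trans (~-sym (substitute-⊗ _ _)) (~-trans (substitute-cong e)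
      (~-trans (substitute-⊗ _ _) (⊗-cong ~-refl (substitute-↑ Φf (suc K))))))))
  where
  Φf : Poly n
  Φf = toℂX f
  exponentBound : ∀ {n} → ℤX.Poly n → ℕ
  exponentBound []            = 0
  exponentBound ((c , β) ∷ f) = Vec.sum β ℕ.+ exponentBound f
  M : ℕ
  -- Larger than the total degree of α and of every exponent listed in f, so no other exponent of f
  -- has the weight of α.
  M = suc (exponentBound f ℕ.+ Vec.sum α)
  open Kronecker M
  agree : ∀ β → Vec.sum β ℕ.< M → δ [ weight α ] [ weight β ] ≃ δ α β
  agree β β<M with Vec.≡-dec ℕ._≟_ β α
  ... | yes refl = δ-≡ [ weight α ]
  ... | no β≢α   = δ-≢ λ e → β≢α (weight-injective β α β<M (ℕ.s≤s (ℕ.m≤n+m _ (exponentBound f))) ([]-injective e))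
  agree-on : ∀ g → exponentBound g ℕ.< M → L (λ β → δ [ weight α ] [ weight β ]) (toℂX g) ≃ L (δ α) (toℂX g)
  agree-on []            _  = ≃-refl
  agree-on ((c , β) ∷ g) g< = +ᶜ-cong (*ᶜ-cong ≃-refl (agree β (ℕ.≤-<-trans (ℕ.m≤m+n _ (exponentBound g)) g<)))
    (agree-on g (ℕ.≤-<-trans (ℕ.m≤n+m _ (Vec.sum β)) g<))
  lead≄0 : ¬ coefficient (weight α) (substitute Φf) ≃ 0ᶜ
  lead≄0 e = ⟪int⟫≄0 f[α]≢0 (≃-trans (≃-sym (coeff-toℂX f α)) (≃-trans (≃-sym (agree-on f (ℕ.s≤s (ℕ.m≤m+n _ (Vec.sum α)))))
    (≃-trans (≃-sym (L-substitute _ Φf)) e)))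

-- Translation of the definitions

^-≡ : ∀ z k → z Defs.^ k ≡ z ^ᶜ k
^-≡ z zero    = ℚ⇒ℂ-≡ 1ℚ
^-≡ z (suc k) = trans (*-≡ z (z Defs.^ k)) (cong (z *ᶜ_) (^-≡ z k))

∑-cong-≡ : ∀ (xs : List ℂ) → ∑ xs ≡ List.foldr _+ᶜ_ 0ᶜ xs
∑-cong-≡ []       = ℚ⇒ℂ-≡ 0ℚ
∑-cong-≡ (x ∷ xs) = trans (+-≡ x (∑ xs)) (cong (x +ᶜ_) (∑-cong-≡ xs))

∑-applyUpTo : ∀ (h : ℕ → ℂ) g m → List.foldr _+ᶜ_ 0ᶜ (List.map h (applyUpTo g m)) ≃ sum (λ k → h (g k)) m
∑-applyUpTo h g zero    = ≃-refl
∑-applyUpTo h g (suc m) = ≃-trans (+ᶜ-cong ≃-refl (∑-applyUpTo h (λ k → g (suc k)) m)) (≃-sym (sum-head _ m))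

inverse : ∀ k .{{_ : NonZero k}} → nat k ℚ.* (+ 1 ℚ./ k) ≡ 1ℚ
inverse k@(suc k′) = ℚ.toℚᵘ-injective (begin
  ℚ.toℚᵘ (nat k ℚ.* (+ 1 ℚ./ k))                ≈⟨ ℚ.toℚᵘ-homo-* (nat k) (+ 1 ℚ./ k) ⟩
  ℚ.toℚᵘ (nat k) ℚᵘ.* ℚ.toℚᵘ (+ 1 ℚ./ k)        ≈⟨ ℚᵘ.*-cong (ℚ.toℚᵘ-fromℚᵘ (ℚᵘ.mkℚᵘ (+ k) 0)) (ℚ.toℚᵘ-fromℚᵘ (ℚᵘ.mkℚᵘ (+ 1) k′)) ⟩
  ℚᵘ.mkℚᵘ (+ k) 0 ℚᵘ.* ℚᵘ.mkℚᵘ (+ 1) k′         ≈⟨ ℚᵘ.*≡* (trans (ℤ.*-identityʳ _) (trans (ℤ.*-identityʳ (+ k))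
                                                     (sym (trans (ℤ.*-identityˡ (+ (1 ℕ.* k))) (cong +_ (ℕ.*-identityˡ k)))))) ⟩
  ℚᵘ.mkℚᵘ (+ 1) 0                               ∎)
  where open ℚᵘ.≃-Reasoning

inverse-unique : ∀ k {x y} → k ℚ.* x ≡ 1ℚ → k ℚ.* y ≡ 1ℚ → x ≡ y
inverse-unique k {x} {y} kx ky = trans (sym (ℚ.*-identityˡ x)) (trans (cong (ℚ._* x) (trans (sym ky) (ℚ.*-comm k y)))
  (trans (ℚ.*-assoc y k x) (trans (cong (y ℚ.*_) kx) (ℚ.*-identityʳ y))))

expTerm-≃ : ∀ z k → expTerm z k ≃ term z k
expTerm-≃ z k = ≃-trans (≡⇒≃ (trans (*-≡ (z Defs.^ k) (ℚ⇒ℂ (invFactorial k))) (cong₂ _*ᶜ_ (^-≡ z k) (ℚ⇒ℂ-≡ (invFactorial k))))) (go k)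
  where
  invFactorial : ℕ → ℚ
  invFactorial k = ℚ._/_ (+ 1) (k !) {{k ℕ.!≢0}}
  invFactorial-suc : ∀ k → invFactorial (suc k) ≡ invFactorial k ℚ.* reciprocal k
  invFactorial-suc k = inverse-unique (nat (suc k !)) (inverse (suc k !) {{suc k ℕ.!≢0}})
    (trans (cong (ℚ._* (invFactorial k ℚ.* reciprocal k)) (nat-* (suc k) (k !)))
      (trans (eq (nat (suc k)) (nat (k !)) (invFactorial k) (reciprocal k))
        (cong₂ ℚ._*_ (reciprocal-inverse k) (inverse (k !) {{k ℕ.!≢0}}))))
    where
    eq : ∀ a b c d → a ℚ.* b ℚ.* (c ℚ.* d) ≡ a ℚ.* d ℚ.* (b ℚ.* c)
    eq = solve 4 (λ a b c d → a :* b :* (c :* d) := a :* d :* (b :* c)) refl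
      where open +-*-Solver
  go : ∀ k → z ^ᶜ k *ᶜ ⟪ invFactorial k ⟫ ≃ term z k
  go zero    = *ᶜ-identityˡ 1ᶜ
  go (suc k) = ≃-trans (*ᶜ-cong ≃-refl (≃-trans (⟪⟫-cong (invFactorial-suc k)) (⟪⟫-* _ _)))
    (≃-trans (solve 4 (λ z p f r → z :* p :* (f :* r) := p :* f :* (z :* r)) ≃-refl z (z ^ᶜ k) _ _) (*ᶜ-cong (go k) ≃-refl))
    where open ℂ-Solver

opaque
  unfolding _≃_ _≃ʳ_

  ∣∣²⇒norm : ∀ {z w x} → 0ᵣ ≤ᵣ x → Defs.∣ Defs._+_ z (Defs.-_ w) ∣² <ᵣ x *ᵣ x → ∥ z +ᶜ -ᶜ w ∥≤ x
  ∣∣²⇒norm {z} {w} {x} 0≤x h = bound 0≤x (<⇒≤ʳ {normSq (z +ᶜ -ᶜ w)} {x *ʳ x} h)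

  norm-of-∣∣≈ : ∀ {z e} → Defs.∣ z ∣≈ e → ∥ z ∥≤ e
  norm-of-∣∣≈ {z} {e} (0≤e , h) = bound 0≤e (≤ʳ-reflexive {normSq z} {e *ʳ e} (≃ʳ-sym {e *ʳ e} {normSq z} h))

  0<⟨_⟩ : ∀ {q} → 0ℚ ℚ.< q → 0ᵣ <ᵣ ⟨ q ⟩
  0<⟨_⟩ {q} 0<q = ⟨⟩-mono-< {0ℚ} {q} 0<q

  0≤⟨_⟩ : ∀ {q} → 0ℚ ℚ.< q → 0ᵣ ≤ᵣ ⟨ q ⟩
  0≤⟨_⟩ {q} 0<q = ⟨⟩-mono-≤ {0ℚ} {q} (ℚ.<⇒≤ 0<q)

  <ᵣ⇒<ʳ : ∀ {x y} → x <ᵣ y → x <ʳ y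
  <ᵣ⇒<ʳ h = h

  0<ʳ⇒0<ᵣ : ∀ {x} → 0ʳ <ʳ x → 0ᵣ <ᵣ x
  0<ʳ⇒0<ᵣ h = h

  ≤ᵣ⇒≤ʳ : ∀ {x c y} → x ≤ᵣ c *ᵣ y → x ≤ʳ c *ʳ y
  ≤ᵣ⇒≤ʳ h = h

  ≃ʳ⇒≈ᵣ-1 : ∀ {x} → x ≃ʳ -ʳ 1ʳ → x ≈ᵣ -ᵣ 1ᵣ
  ≃ʳ⇒≈ᵣ-1 h = h

  ℝ⇒ℂ-≡ : ∀ x → ℝ⇒ℂ x ≡ fromℝ x
  ℝ⇒ℂ-≡ x = refl

  +ᵣ-≡ : ∀ x y → x +ᵣ y ≡ x +ʳ y
  +ᵣ-≡ x y = refl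

-- The statement knows exp only as a graph; uniqueness of limits identifies each of its values with
-- `expᶜ z`.
exp-≃ : ∀ {z w} → exp z ≈ w → expᶜ z ≃ w
exp-≃ {z} {w} h = ⇝-unique (exp-limit z) (⇝-cong partialSum≃ ≃-refl converges)
  where
  partialSum≃ : ∀ m → ∑ (List.map (expTerm z) (upTo m)) ≃ sum (term z) m
  partialSum≃ m = ≃-trans (≡⇒≃ (∑-cong-≡ (List.map (expTerm z) (upTo m)))) (≃-trans (∑-applyUpTo (expTerm z) (λ k → k) m) (sum-cong m λ k _ → expTerm-≃ z k))
  converges : (λ m → ∑ (List.map (expTerm z) (upTo m))) ⇝ w
  converges q 0<q = let M , k = h ⟨ q ⟩ 0<⟨ 0<q ⟩ in M , λ m M≤m → ∣∣²⇒norm {w = w} 0≤⟨ 0<q ⟩ (k m M≤m)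

isPrimitiveRoot : ∀ {N ξ} → Primitive N ξ → IsPrimitiveRoot N ξ
isPrimitiveRoot {N} {ξ} (one , other) =
    ≃⇒≈ (≃-trans (≡⇒≃ (^-≡ ξ N)) (≃-trans one (≡⇒≃ (sym (ℚ⇒ℂ-≡ 1ℚ)))))
  , λ k 0<k k<N h → other k 0<k k<N (≃-trans (≡⇒≃ (sym (^-≡ ξ k))) (≃-trans (≈⇒≃ h) (≡⇒≃ (ℚ⇒ℂ-≡ 1ℚ))))

-- The sums and counts of the statement as box sums

lsum : List ℂ → ℂ
lsum = List.foldr _+ᶜ_ 0ᶜ

lsum-++ : ∀ xs ys → lsum (xs ++ ys) ≃ lsum xs +ᶜ lsum ys
lsum-++ []       ys = ≃-sym (+ᶜ-identityˡ _)
lsum-++ (x ∷ xs) ys = ≃-trans (+ᶜ-cong ≃-refl (lsum-++ xs ys)) (≃-sym (+ᶜ-assoc x _ _))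

lsum-tabulate : ∀ N (g : ℕ → ℂ) → lsum (List.tabulate {n = N} λ i → g (toℕ i)) ≃ sum g N
lsum-tabulate zero    g = ≃-refl
lsum-tabulate (suc N) g = ≃-trans (+ᶜ-cong ≃-refl (lsum-tabulate N λ k → g (suc k))) (≃-sym (sum-head g N))

lsum-product : ∀ {A B C : Set} (h : C → ℂ) (f : A → B → C) xs ys →
  lsum (List.map h (List.cartesianProductWith f xs ys)) ≃ lsum (List.map (λ x → lsum (List.map (λ y → h (f x y)) ys)) xs)
lsum-product h f []       ys = ≃-refl
lsum-product h f (x ∷ xs) ys = ≃-trans (≡⇒≃ (cong lsum (List.map-++ h (List.map (f x) ys) _)))
  (≃-trans (lsum-++ (List.map h (List.map (f x) ys)) _) (+ᶜ-cong (≡⇒≃ (cong lsum (sym (List.map-∘ ys)))) (lsum-product h f xs ys)))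

lsum-points : ∀ N n (G : Vec ℕ n → ℂ) → lsum (List.map (λ x → G (Vec.map toℕ x)) (points N n)) ≃ boxSum N n G
lsum-points N zero    G = +ᶜ-identityʳ _
lsum-points N (suc n) G = ≃-trans (lsum-product _ _∷_ (allFin N) (points N n))
  (≃-trans (≡⇒≃ (cong lsum (List.map-tabulate {n = N} (λ i → i) _)))
    (≃-trans (lsum-tabulate N λ a → lsum (List.map (λ y → G (a ∷ Vec.map toℕ y)) (points N n)))
      (sum-cong N λ a _ → lsum-points N n λ v → G (a ∷ v))))

length-filter : ∀ {A : Set} {P : Pred A 0ℓ} (P? : Decidable P) xs →
  ⟪ nat (length (List.filter P? xs)) ⟫ ≃ lsum (List.map (λ x → indicator (P? x)) xs)
length-filter P? []       = ≃-refl
length-filter P? (x ∷ xs) with does (P? x)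
... | true  = ≃-trans (≃-trans (⟪⟫-cong (nat-+ 1 (length (List.filter P? xs)))) (⟪⟫-+ 1ℚ _)) (+ᶜ-cong ≃-refl (length-filter P? xs))
... | false = ≃-trans (length-filter P? xs) (≃-sym (+ᶜ-identityˡ _))

module _ {n} (f : ℤX.Poly n) where

  F : Vec ℕ n → ℤ
  F v = ℤX.eval f (Vec.map +_ v)

  evalAt-F : ∀ {N} (x : Vec (Fin N) n) → evalAt f x ≡ F (Vec.map toℕ x)
  evalAt-F x = cong (ℤX.eval f) (Vec.map-∘ +_ toℕ x)

  normalisedSum-≃ : ∀ N .{{_ : NonZero N}} ξ → normalisedSum f N ξ ≃ ⟪ 1/[ N ^ n ] ⟫ *ᶜ boxSum N n (λ v → ξ ^ᶜ (F v ℤ.%ℕ N))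
  normalisedSum-≃ N ξ = ≃-trans (≡⇒≃ (trans (*-≡ (ℚ⇒ℂ 1/[ N ^ n ]) (∑ terms)) (cong₂ _*ᶜ_ (ℚ⇒ℂ-≡ 1/[ N ^ n ]) (∑-cong-≡ terms))))
    (*ᶜ-cong ≃-refl (≃-trans (≡⇒≃ (cong lsum (List.map-cong terms-≡ (points N n)))) (lsum-points N n λ v → ξ ^ᶜ (F v ℤ.%ℕ N))))
    where
    terms : List ℂ
    terms = List.map (λ x → ξ Defs.^ (evalAt f x ℤ.%ℕ N)) (points N n)
    terms-≡ : ∀ x → ξ Defs.^ (evalAt f x ℤ.%ℕ N) ≡ ξ ^ᶜ (F (Vec.map toℕ x) ℤ.%ℕ N)
    terms-≡ x = trans (^-≡ ξ (evalAt f x ℤ.%ℕ N)) (cong (λ z → ξ ^ᶜ (z ℤ.%ℕ N)) (evalAt-F x))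

  solutionCount-≃ : ∀ p m → ⟪ nat (solutionCount f p m) ⟫ ≃ boxSum (p ℕ.^ m) n (λ v → χ (p ℕ.^ m) (F v))
  solutionCount-≃ p m = ≃-trans (length-filter (λ x → + (p ℕ.^ m) ℤ∣.∣? evalAt f x) (points (p ℕ.^ m) n))
    (≃-trans (≡⇒≃ (cong lsum (List.map-cong (λ x → cong (χ (p ℕ.^ m)) (evalAt-F x)) (points (p ℕ.^ m) n)))) (lsum-points (p ℕ.^ m) n λ v → χ (p ℕ.^ m) (F v)))

  density : ∀ p .{{_ : NonZero p}} → ℕ → ℚ
  density p m = ℚ._/_ (+ 1) ((p ℕ.^ m) ℕ.^ n) {{ℕ.m^n≢0 (p ℕ.^ m) n {{ℕ.m^n≢0 p m}}}}

  density-inverse : ∀ p .{{_ : NonZero p}} m → nat ((p ℕ.^ m) ℕ.^ n) ℚ.* density p m ≡ 1ℚ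
  density-inverse p m = inverse ((p ℕ.^ m) ℕ.^ n) {{ℕ.m^n≢0 (p ℕ.^ m) n {{ℕ.m^n≢0 p m}}}}

  1/[^]-≡ : ∀ p .{{_ : NonZero p}} m → 1/[ p ^ m ℕ.* n ] ≡ density p m
  1/[^]-≡ p m = inverse-unique (nat (p ℕ.^ (m ℕ.* n))) (inverse (p ℕ.^ (m ℕ.* n)) {{ℕ.m^n≢0 p (m ℕ.* n)}})
    (trans (cong (λ k → nat k ℚ.* density p m) (sym (ℕ.^-*-assoc p m n))) (density-inverse p m))

  poincaré-≃ : ∀ p .{{_ : NonZero p}} m → poincaré f p m ≃ ⟪ density p m ⟫ *ᶜ boxSum (p ℕ.^ m) n (λ v → χ (p ℕ.^ m) (F v))
  poincaré-≃ p m = ≃-trans (≡⇒≃ (ℚ⇒ℂ-≡ (nat (solutionCount f p m) ℚ.* 1/[ p ^ m ℕ.* n ])))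
    (≃-trans (⟪⟫-* (nat (solutionCount f p m)) 1/[ p ^ m ℕ.* n ]) (≃-trans (*ᶜ-comm _ _)
      (*ᶜ-cong (⟪⟫-cong (1/[^]-≡ p m)) (solutionCount-≃ p m))))

module _ (M : ℕ) where

  private
    Mod : ℤ → ℤ → Set
    Mod x y = x ≡ y [mod M ]

    _^ᶻ_ : ℤ → ℕ → ℤ
    _^ᶻ_ = RawSemiringDefs._^_ (RawRing.rawSemiring ℤ.+-*-rawRing)

    mod-+ : ∀ {x x′ y y′} → Mod x x′ → Mod y y′ → Mod (x ℤ.+ y) (x′ ℤ.+ y′)
    mod-+ {x} {x′} {y} {y′} h k = subst (+ M ℤ∣.∣_) (eq x x′ y y′) (ℤ∣.∣m∣n⇒∣m+n h k)
      where
      open ℤSolver.+-*-Solver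
      eq : ∀ x x′ y y′ → (x ℤ.- x′) ℤ.+ (y ℤ.- y′) ≡ (x ℤ.+ y) ℤ.- (x′ ℤ.+ y′)
      eq = solve 4 (λ x x′ y y′ → (x :- x′) :+ (y :- y′) := (x :+ y) :- (x′ :+ y′)) refl

    mod-* : ∀ {x x′ y y′} → Mod x x′ → Mod y y′ → Mod (x ℤ.* y) (x′ ℤ.* y′)
    mod-* {x} {x′} {y} {y′} h k = subst (+ M ℤ∣.∣_) (eq x x′ y y′) (ℤ∣.∣m∣n⇒∣m+n (ℤ∣.∣m⇒∣m*n y h) (ℤ∣.∣n⇒∣m*n x′ k))
      where
      open ℤSolver.+-*-Solver
      eq : ∀ x x′ y y′ → (x ℤ.- x′) ℤ.* y ℤ.+ x′ ℤ.* (y ℤ.- y′) ≡ x ℤ.* y ℤ.- x′ ℤ.* y′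
      eq = solve 4 (λ x x′ y y′ → (x :- x′) :* y :+ x′ :* (y :- y′) := x :* y :- x′ :* y′) refl

    mod-^ : ∀ {x y} k → Mod x y → Mod (x ^ᶻ k) (y ^ᶻ k)
    mod-^ zero    h = mod-refl {M} (+ 1)
    mod-^ {x} {y} (suc k) h = mod-* {x} {y} {x ^ᶻ k} {y ^ᶻ k} h (mod-^ {x} {y} k h)

    monomial : ∀ {n} → Vec ℤ n → Vec ℕ n → ℤ
    monomial x α = Vec.foldr _ ℤ._*_ (+ 1) (Vec.zipWith _^ᶻ_ x α)

    mod-monomial : ∀ {n} {v w : Vec ℕ n} → Congruent M v w → ∀ α → Mod (monomial (Vec.map +_ v) α) (monomial (Vec.map +_ w) α)
    mod-monomial []      []      = mod-refl {M} (+ 1)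
    mod-monomial {v = a ∷ v} {b ∷ w} (h ∷ hs) (k ∷ α) =
      mod-* {(+ a) ^ᶻ k} {(+ b) ^ᶻ k} {monomial (Vec.map +_ v) α} {monomial (Vec.map +_ w) α} (mod-^ {+ a} {+ b} k h) (mod-monomial hs α)

  F-periodic : ∀ {n} (f : ℤX.Poly n) {v w} → Congruent M v w → F f v ≡ F f w [mod M ]
  F-periodic []            h = mod-refl {M} (+ 0)
  F-periodic ((c , α) ∷ f) {v} {w} h =
    mod-+ {c ℤ.* monomial (Vec.map +_ v) α} {c ℤ.* monomial (Vec.map +_ w) α} {F f v} {F f w}
      (mod-* {c} {c} {monomial (Vec.map +_ v) α} {monomial (Vec.map +_ w) α} (mod-refl {M} c) (mod-monomial h α)) (F-periodic f h)

·-≡ : ∀ A P m → (A · P) m ≡ (A ·ᶜ P) m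
·-≡ []       P m       = ℚ⇒ℂ-≡ 0ℚ
·-≡ (a ∷ as) P zero    = *-≡ a (P 0)
·-≡ (a ∷ as) P (suc m) = trans (+-≡ (Defs._*_ a (P (suc m))) ((as · P) m)) (cong₂ _+ᶜ_ (*-≡ a (P (suc m))) (·-≡ as P m))

series-≡ : ∀ B m → series B m ≡ seriesᶜ B m
series-≡ []       m       = ℚ⇒ℂ-≡ 0ℚ
series-≡ (b ∷ bs) zero    = refl
series-≡ (b ∷ bs) (suc m) = series-≡ bs m

evalAtℂ-≡ : ∀ A z → evalAtℂ A z ≡ evalᶜ A z
evalAtℂ-≡ []       z = ℚ⇒ℂ-≡ 0ℚ
evalAtℂ-≡ (a ∷ as) z = trans (+-≡ a (Defs._*_ z (evalAtℂ as z))) (cong (a +ᶜ_) (trans (*-≡ z (evalAtℂ as z)) (cong (z *ᶜ_) (evalAtℂ-≡ as z))))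

evalᶜ-cong : ∀ A {z w} → z ≃ w → evalᶜ A z ≃ evalᶜ A w
evalᶜ-cong []       e = ≃-refl
evalᶜ-cong (a ∷ as) e = +ᶜ-cong ≃-refl (*ᶜ-cong e (evalᶜ-cong as e))

·ᶜ-cong : ∀ A {P Q} → (∀ m → P m ≃ Q m) → ∀ m → (A ·ᶜ P) m ≃ (A ·ᶜ Q) m
·ᶜ-cong List.[]       h m       = ≃-refl
·ᶜ-cong (a List.∷ as) h zero    = *ᶜ-cong ≃-refl (h 0)
·ᶜ-cong (a List.∷ as) h (suc m) = +ᶜ-cong (*ᶜ-cong ≃-refl (h (suc m))) (·ᶜ-cong as h m)

-- The real part of a pole

norm-^ : ∀ {z a} → ∥ z ∥≤ a → ∀ m → ∥ z ^ᶜ m ∥≤ (a ^ʳ m)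
norm-^ h zero    = norm-fromℝ (<⇒≤ʳ 0<1ʳ)
norm-^ h (suc m) = norm-* h (norm-^ h m)

expʳ-nat* : ∀ m x → expʳ (⟨ nat m ⟩ *ʳ x) ≃ʳ expʳ x ^ʳ m
expʳ-nat* zero    x = ≃ʳ-trans (expʳ-cong (*ʳ-zeroˡ x)) expʳ-0
expʳ-nat* (suc m) x = ≃ʳ-trans (expʳ-cong (≃ʳ-trans (*ʳ-cong (≃ʳ-trans (⟨⟩-cong (nat-+ 1 m)) (⟨⟩-+ 1ℚ (nat m))) ≃ʳ-refl)
    (solve 2 (λ m x → (con 1ℚ :+ m) :* x := x :+ m :* x) ≃ʳ-refl ⟨ nat m ⟩ x)))
  (≃ʳ-trans (expʳ-+ x _) (*ʳ-cong ≃ʳ-refl (expʳ-nat* m x)))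
  where open ℝ-Solver

nat-^ : ∀ p m → ⟨ nat (p ℕ.^ m) ⟩ ≃ʳ ⟨ nat p ⟩ ^ʳ m
nat-^ p zero    = ≃ʳ-refl
nat-^ p (suc m) = ≃ʳ-trans (⟨⟩-cong (nat-* p (p ℕ.^ m))) (≃ʳ-trans (⟨⟩-* _ _) (*ʳ-cong ≃ʳ-refl (nat-^ p m)))

^ʳ-cong : ∀ {x y} m → x ≃ʳ y → x ^ʳ m ≃ʳ y ^ʳ m
^ʳ-cong zero    e = ≃ʳ-refl
^ʳ-cong (suc m) e = *ʳ-cong e (^ʳ-cong m e)

^ʳ-distrib : ∀ x y m → x ^ʳ m *ʳ y ^ʳ m ≃ʳ (x *ʳ y) ^ʳ m
^ʳ-distrib x y zero    = *ʳ-identityˡ 1ʳ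
^ʳ-distrib x y (suc m) = ≃ʳ-trans (solve 4 (λ x y p q → x :* p :* (y :* q) := x :* y :* (p :* q)) ≃ʳ-refl x y (x ^ʳ m) (y ^ʳ m))
  (*ʳ-cong ≃ʳ-refl (^ʳ-distrib x y m))
  where open ℝ-Solver

primitive-root-exists : ∀ N .{{_ : NonZero N}} → ∃[ ξ ] Primitive N ξ
primitive-root-exists (suc N) = primitive-root N

-- If ℓ ≤ 0, then p ≤ p(1 - ℓ) ≤ p exp (-ℓ) = 1.
log-positive : ∀ {ℓ p} → 1 ℕ.< p → expʳ ℓ ≃ʳ ⟨ nat p ⟩ → ¬ ¬ 0ʳ <ʳ ℓ
log-positive {ℓ} {p} 1<p e ℓ≯0 = ≤⇒≯ p≤1 (⟨⟩-mono-< (nat-mono-< 1<p))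
  where
  open ≤ʳ-Reasoning
  open ℝ-Solver
  0≤-ℓ : 0ʳ ≤ʳ -ʳ ℓ
  0≤-ℓ = ≤-by (diff-nonNegʳ (≮⇒≥ ℓ≯0)) (solve 1 (λ ℓ → con 0ℚ :+ (con 0ℚ :- ℓ) := :- ℓ) ≃ʳ-refl ℓ)
  p≤1 : ⟨ nat p ⟩ ≤ʳ 1ʳ
  p≤1 = begin
    ⟨ nat p ⟩              ≈⟨ *ʳ-identityʳ _ ⟨
    ⟨ nat p ⟩ *ʳ 1ʳ        ≤⟨ *ʳ-monoʳ-≤ _ (⟨⟩-mono-≤ (nat-nonNeg p)) (≤ʳ-trans (≤-by 0≤-ℓ ≃ʳ-refl) (expʳ-≥ 0≤-ℓ)) ⟩
    ⟨ nat p ⟩ *ʳ expʳ (-ʳ ℓ) ≈⟨ *ʳ-cong e ≃ʳ-refl ⟨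
    expʳ ℓ *ʳ expʳ (-ʳ ℓ)  ≈⟨ expʳ-inverse ℓ ⟩
    1ʳ                     ∎

exponentialSumᶠ : ∀ {n} → ℤX.Poly n → (N : ℕ) .{{_ : NonZero N}} → ℂ → ℂ
exponentialSumᶠ {n} f N ξ = ⟪ 1/[ N ^ n ] ⟫ *ᶜ boxSum N n (λ v → ξ ^ᶜ (F f v ℤ.%ℕ N))

-- The power Nᵃ is spelled out as exp (aℓ), with a logarithm ℓ that may vary with N and ξ as in the
-- graph of the power function; `log-power` identifies it for powers of p.
UniformBound : ∀ {n} → ℤX.Poly n → ℝ → Set
UniformBound f a = ∃[ c ] (∀ N .{{_ : NonZero N}} ξ → Primitive N ξ →
  ∃[ ℓ ] expʳ ℓ ≃ʳ ⟨ nat N ⟩ × ∥ exponentialSumᶠ f N ξ ∥≤ (c *ʳ expʳ (a *ʳ ℓ)))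

module _ {n} (f : ℤX.Poly n) {p′} (pr : Prime (suc p′)) {ℓ} (exp-ℓ : expʳ ℓ ≃ʳ ⟨ nat (suc p′) ⟩) where

  private
    p : ℕ
    p = suc p′
    instance
      p^m≢0 : ∀ {m} → NonZero (p ℕ.^ m)
      p^m≢0 {m} = ℕ.m^n≢0 p m

  log-power : ∀ {ℓ′} m → expʳ ℓ′ ≃ʳ ⟨ nat (p ℕ.^ m) ⟩ → ℓ′ ≃ʳ ⟨ nat m ⟩ *ʳ ℓ
  log-power m e = expʳ-injective (≃ʳ-trans e (≃ʳ-trans (nat-^ p m) (≃ʳ-trans (^ʳ-cong m (≃ʳ-sym exp-ℓ)) (≃ʳ-sym (expʳ-nat* m ℓ)))))

  coefficients : ℕ → ℂ
  coefficients m = ⟪ density f p m ⟫ *ᶜ boxSum (p ℕ.^ m) n (λ v → χ (p ℕ.^ m) (F f v))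

  quotient-bound : ∀ {a} ((c , _) : UniformBound f a) → ∀ m →
    ∥ -ᶜ ⟪ reciprocal p′ ⟫ *ᶜ shift coefficients (suc m) +ᶜ coefficients (suc m) ∥≤ (c *ʳ expʳ (a *ʳ ℓ) ^ʳ suc m)
  quotient-bound {a} (c , h) m = norm-resp
    (solve 3 (λ r x y → x :- r :* y := (:- r) :* y :+ x) ≃-refl ⟪ reciprocal p′ ⟫ (coefficients (suc m)) (coefficients m))
    (density-recursion pr m (F f) (λ M → F-periodic M f) (proj₂ root) (density-inverse f p (suc m)) (density-inverse f p m) (reciprocal-inverse p′)
      (bound-nonNeg (bounds (proj₁ root) (proj₂ root))) bounds)
    where
    open ℂ-Solver
    root : ∃[ ξ ] Primitive (p ℕ.^ suc m) ξ
    root = primitive-root-exists (p ℕ.^ suc m) {{p^m≢0 {suc m}}}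
    bounds : ∀ ζ → Primitive (p ℕ.^ suc m) ζ → ∥ exponentialSumᶠ f (p ℕ.^ suc m) {{p^m≢0 {suc m}}} ζ ∥≤ (c *ʳ expʳ (a *ʳ ℓ) ^ʳ suc m)
    bounds ζ prim = let ℓ′ , e , b = h (p ℕ.^ suc m) {{p^m≢0 {suc m}}} ζ prim in
      norm-weaken (≤ʳ-reflexive (*ʳ-cong ≃ʳ-refl (≃ʳ-trans (expʳ-cong (≃ʳ-trans (*ʳ-cong ≃ʳ-refl (log-power (suc m) e))
        (ℝ-Solver.solve 3 (λ a m ℓ → a R.:* (m R.:* ℓ) R.:= m R.:* (a R.:* ℓ)) ≃ʳ-refl a ⟨ nat (suc m) ⟩ ℓ))) (expʳ-nat* (suc m) (a *ʳ ℓ))))) b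
      where module R = ℝ-Solver

  pole-real-part : (r : ℝ) → (∀ ε → 0ʳ <ʳ ε → UniformBound f (r +ʳ ε)) →
    ∀ {A B T₀ s₀} → (∀ m → (A ·ᶜ coefficients) m ≃ seriesᶜ B m) → evalᶜ A T₀ ≃ 0ᶜ → ¬ evalᶜ B T₀ ≃ 0ᶜ →
    expᶜ (-ᶜ s₀ *ᶜ fromℝ ℓ) ≃ T₀ → r <ʳ re s₀ → re s₀ ≃ʳ -ʳ 1ʳ
  -- Positivity of log p is available only up to double negation, hence the detour through stability
  -- of the conclusion.
  pole-real-part r bounds {A} {B} {T₀} {s₀} AP≃B A≃0 B≄0 exp-T₀ r<t = ≃ʳ-stable λ t≄-1 →
    log-positive {ℓ} {p} 1<p exp-ℓ λ 0<ℓ → t≄-1 (conclusion 0<ℓ)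
    where
    open ℝ-Solver
    1<p : 1 ℕ.< p
    1<p = ℕ.nonTrivial⇒n>1 p {{ℕ.prime⇒nonTrivial pr}}
    t ε a θ′ : ℝ
    t = re s₀
    -- With half the gap, a - t = -ε, and the ratio θ′ of the bound for the terms at T₀ is exp
    -- (-εℓ).
    ε = ⟨ ℚ.½ ⟩ *ʳ (t +ʳ -ʳ r)
    a = r +ʳ ε
    θ′ = expʳ (a *ʳ ℓ) *ʳ expʳ (-ʳ (t *ʳ ℓ))
    0<ε : 0ʳ <ʳ ε
    0<ε = *ʳ-pos (⟨⟩-mono-< (ℚ.positive⁻¹ ℚ.½)) (diff-posʳ r<t)
    c : ℝ
    c = proj₁ (bounds ε 0<ε)
    re-exponent : re (-ᶜ s₀ *ᶜ fromℝ ℓ) ≃ʳ -ʳ (t *ʳ ℓ)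
    re-exponent = ≃ʳ-trans (re-* (-ᶜ s₀) (fromℝ ℓ)) (≃ʳ-trans
      (+ʳ-cong (*ʳ-cong (re-neg s₀) (re-fromℝ ℓ)) (-ʳ-cong (*ʳ-cong ≃ʳ-refl (im-fromℝ ℓ))))
      (solve 3 (λ t ℓ y → (:- t) :* ℓ :- y :* con 0ℚ := :- (t :* ℓ)) ≃ʳ-refl t ℓ (im (-ᶜ s₀))))
    norm-T₀ : ∥ T₀ ∥≤ expʳ (-ʳ (t *ʳ ℓ))
    norm-T₀ = norm-resp exp-T₀ (norm-weaken (≤ʳ-reflexive (expʳ-cong re-exponent)) (norm-exp _))
    θ′≃ : θ′ ≃ʳ expʳ (-ʳ (ε *ʳ ℓ))
    θ′≃ = ≃ʳ-trans (≃ʳ-sym (expʳ-+ _ _)) (expʳ-cong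
      (solve 3 (λ r t ℓ → (let ε = con ℚ.½ :* (t :- r) in (r :+ ε) :* ℓ :+ (:- (t :* ℓ)) := :- (ε :* ℓ))) ≃ʳ-refl r t ℓ))
    conclusion : 0ʳ <ʳ ℓ → t ≃ʳ -ʳ 1ʳ
    conclusion 0<ℓ = ≃ʳ-trans (solve 1 (λ t → t := (t :+ con 1ℚ) :- con 1ℚ) ≃ʳ-refl t)
      (≃ʳ-trans (+ʳ-cong (*ʳ-cancel-0 [t+1]ℓ≃0 0<ℓ) ≃ʳ-refl) (+ʳ-identityˡ _))
      where
      0<εℓ = *ʳ-pos 0<ε 0<ℓ
      -- From exp (-εℓ)(1 + εℓ) ≤ exp (-εℓ) exp (εℓ) = 1, in the form that `power→0` takes.
      contraction : θ′ *ʳ (1ʳ +ʳ ε *ʳ ℓ) ≤ʳ 1ʳ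
      contraction = ≤ʳ-trans (*ʳ-mono-≤ (*ʳ-nonNeg (expʳ-nonNeg _) (expʳ-nonNeg _)) (expʳ-nonNeg (ε *ʳ ℓ))
          (≤ʳ-reflexive θ′≃) (expʳ-≥ (<⇒≤ʳ 0<εℓ)))
        (≤ʳ-reflexive (≃ʳ-trans (*ʳ-comm _ _) (expʳ-inverse (ε *ʳ ℓ))))
      small : (λ m → (-ᶜ ⟪ reciprocal p′ ⟫ *ᶜ shift coefficients m +ᶜ coefficients m) *ᶜ T₀ ^ᶜ m) ⇝ 0ᶜ
      small = ⇝-shift λ q 0<q →
        let M , h = power→0 (*ʳ-nonNeg (expʳ-nonNeg _) (expʳ-nonNeg _)) 0<εℓ contraction c (⟨⟩-mono-< 0<q) in
        M , λ m M≤m → norm-resp (ℂ-Solver.solve 1 (λ z → z C.:= z C.:- C.con 0ℚ) ≃-refl _)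
          (norm-weaken (≤ʳ-trans (≤ʳ-reflexive (≃ʳ-trans (*ʳ-assoc c _ _) (*ʳ-cong ≃ʳ-refl (^ʳ-distrib _ _ (suc m)))))
              (h (suc m) (ℕ.≤-trans M≤m (ℕ.n≤1+n m))))
            (norm-* (quotient-bound (bounds ε 0<ε) m) (norm-^ norm-T₀ (suc m))))
        where module C = ℂ-Solver
      T₀≃p : T₀ ≃ fromℝ ⟨ nat p ⟩
      T₀≃p = begin
        T₀
          ≈⟨ ℂ-Solver.solve 1 (λ t → t C.:= C.con 1ℚ C.:* t) ≃-refl T₀ ⟩
        1ᶜ *ᶜ T₀
          ≈⟨ *ᶜ-cong (≃-trans (≃-sym (⟪⟫-cong (reciprocal-inverse p′))) (⟪⟫-* _ _)) ≃-refl ⟩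
        ⟪ nat p ⟫ *ᶜ ⟪ reciprocal p′ ⟫ *ᶜ T₀
          ≈⟨ ℂ-Solver.solve 3 (λ p r t → p C.:* r C.:* t C.:= p C.:- p C.:* (C.con 1ℚ C.:- r C.:* t)) ≃-refl _ _ T₀ ⟩
        ⟪ nat p ⟫ +ᶜ -ᶜ (⟪ nat p ⟫ *ᶜ (1ᶜ +ᶜ -ᶜ (⟪ reciprocal p′ ⟫ *ᶜ T₀)))
          ≈⟨ +ᶜ-cong ≃-refl (-ᶜ-cong (*ᶜ-cong ≃-refl (pole-location {coefficients} {A} {B} AP≃B A≃0 B≄0 small))) ⟩
        ⟪ nat p ⟫ +ᶜ -ᶜ (⟪ nat p ⟫ *ᶜ 0ᶜ)
          ≈⟨ ℂ-Solver.solve 1 (λ p → p C.:- p C.:* C.con 0ℚ C.:= p) ≃-refl ⟪ nat p ⟫ ⟩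
        ⟪ nat p ⟫ ∎
        where
        open ≃-Reasoning
        module C = ℂ-Solver
      -- Two computations of |T₀|²: from T₀ = exp (-s₀ℓ), and from T₀ = p = exp ℓ. The imaginary
      -- part of s₀ drops out.
      squares : expʳ (-ʳ (t *ʳ ℓ)) *ʳ expʳ (-ʳ (t *ʳ ℓ)) ≃ʳ expʳ ℓ *ʳ expʳ ℓ
      squares = ≃ʳ-trans (*ʳ-cong e e) (≃ʳ-trans (≃ʳ-sym (normSq-exp _)) (≃ʳ-trans (normSq-cong (≃-trans exp-T₀ T₀≃p))
        (≃ʳ-trans (normSq-fromℝ _) (*ʳ-cong (≃ʳ-sym exp-ℓ) (≃ʳ-sym exp-ℓ)))))
        where e = expʳ-cong (≃ʳ-sym re-exponent)
      [t+1]ℓ≃0 : (t +ʳ 1ʳ) *ʳ ℓ ≃ʳ 0ʳ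
      [t+1]ℓ≃0 = ≃ʳ-trans (solve 2 (λ t ℓ → (t :+ con 1ℚ) :* ℓ := ℓ :- (:- (t :* ℓ))) ≃ʳ-refl t ℓ)
        (≃ʳ-trans (+ʳ-cong (≃ʳ-sym (expʳ-injective (≤ʳ-antisym
            (square-cancel-≤ (expʳ-nonNeg ℓ) (≤ʳ-reflexive squares))
            (square-cancel-≤ (expʳ-nonNeg (-ʳ (t *ʳ ℓ))) (≤ʳ-reflexive (≃ʳ-sym squares)))))) ≃ʳ-refl)
          (-ʳ-inverseʳ (-ʳ (t *ʳ ℓ))))

log-≃ : ∀ ℓ k → exp ℝ⇒ℂ ℓ ≈ ℕ⇒ℂ k → expʳ ℓ ≃ʳ ⟨ nat k ⟩
log-≃ ℓ k h = fromℝ-injective (≃-trans (≃-sym (exp-fromℝ ℓ)) (≃-trans (exp-cong (≡⇒≃ (sym (ℝ⇒ℂ-≡ ℓ))))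
  (≃-trans (exp-≃ h) (ℕ⇒ℂ-≃ k))))

uniformBound : ∀ {n} (f : ℤX.Poly n) r ε →
  ∃[ c ] (∀ (N : ℕ) .{{_ : NonZero N}} (ξ : ℂ) → IsPrimitiveRoot N ξ →
    ∃[ e ] ∃[ y ] (E[ f , N , ξ ]≈ e) × (N ^ℝ (r +ᵣ ε) ≈ y) × (e ≤ᵣ c *ᵣ y)) →
  UniformBound f (r +ʳ ε)
uniformBound f r ε (c , h) = c , λ N ξ prim →
  let e , y , E≈e , (ℓ , exp-ℓ , exp-rℓ) , e≤cy = h N ξ (isPrimitiveRoot prim) in
  ℓ , log-≃ ℓ N exp-ℓ , norm-weaken (≤ʳ-trans (≤ᵣ⇒≤ʳ {e} {c} {y} e≤cy) (≤ʳ-reflexive (*ʳ-cong ≃ʳ-refl (y≃ ℓ y exp-rℓ))))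
    (norm-resp (normalisedSum-≃ f N ξ) (norm-of-∣∣≈ E≈e))
  where
  y≃ : ∀ ℓ y → exp (Defs._*_ (ℝ⇒ℂ (r +ᵣ ε)) (ℝ⇒ℂ ℓ)) ≈ ℝ⇒ℂ y → y ≃ʳ expʳ ((r +ʳ ε) *ʳ ℓ)
  y≃ ℓ y h = fromℝ-injective (≃-trans (≃-sym (≡⇒≃ (ℝ⇒ℂ-≡ y))) (≃-trans (≃-sym (exp-≃ h)) (≃-trans (exp-cong (≃-trans
    (≡⇒≃ (trans (*-≡ (ℝ⇒ℂ (r +ᵣ ε)) (ℝ⇒ℂ ℓ)) (cong₂ _*ᶜ_ (trans (ℝ⇒ℂ-≡ (r +ᵣ ε)) (cong fromℝ (+ᵣ-≡ r ε))) (ℝ⇒ℂ-≡ ℓ))))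
    (≃-sym (fromℝ-* _ _)))) (exp-fromℝ _))))

proposition2p3 : (n d s : ℕ) → 1 ≤ n → .{{_ : NonTrivial d}} →
    (f : ℤX.Poly n) → HasDegree f d →
    HasDimension (criticalLocus (toℂX (homogeneousPart d f))) s →
    (∀ (ε : ℝ) → 0ᵣ <ᵣ ε →
    ∃[ c ] (∀ (N : ℕ) .{{_ : NonZero N}} (ξ : ℂ) → IsPrimitiveRoot N ξ →
    ∃[ e ] ∃[ y ] (E[ f , N , ξ ]≈ e) × (N ^ℝ (exponent n s d +ᵣ ε) ≈ y) × (e ≤ᵣ c *ᵣ y))) →
    (p : ℕ) (p-prime : Prime p) →
    (T₀ : ℂ) → IsPole (poincaré f p {{prime⇒nonZero p-prime}}) T₀ →
    (s₀ : ℂ) → (p ^ℂ (- s₀) ≈ T₀) →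
    exponent n s d <ᵣ re s₀ →
    (re s₀ ≈ᵣ -ᵣ 1ᵣ) × (∀ (b : List ℂ) → IsBernsteinSato f b → evalAtℂ b (ℝ⇒ℂ (re s₀)) ≈ 0ℂ)
proposition2p3 n d s _ f ((α , deg-α , f[α]≢0) , _) _ bounds zero p-prime = ⊥-elim (ℕ.¬prime[0] p-prime)
proposition2p3 n d s _ f ((α , deg-α , f[α]≢0) , _) _ bounds p@(suc p′) p-prime T₀ (A , B , AP≈B , A≈0 , B≉0) s₀ (ℓ , exp-ℓ , exp-T₀) r<t =
  ≃ʳ⇒≈ᵣ-1 t≃-1 , λ b bs → ≃⇒≈ (≃-trans (≡⇒≃ (trans (evalAtℂ-≡ b (ℝ⇒ℂ (re s₀))) (cong (evalᶜ b) (ℝ⇒ℂ-≡ (re s₀)))))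
    (≃-trans (evalᶜ-cong b (≃-trans (fromℝ-cong t≃-1) (fromℝ-neg 1ʳ)))
      (≃-trans (functional-equation-root f α 0<deg f[α]≢0 b (IsBernsteinSato.equation bs)) (≡⇒≃ (sym (ℚ⇒ℂ-≡ 0ℚ))))))
  where
  0<deg : 0 ℕ.< totalDegree α
  0<deg = subst (0 ℕ.<_) (sym deg-α) (ℕ.<-trans (ℕ.s≤s ℕ.z≤n) (ℕ.nonTrivial⇒n>1 d))
  coefficients-≃ : ∀ m → poincaré f p {{prime⇒nonZero p-prime}} m ≃ coefficients f p-prime (log-≃ ℓ p exp-ℓ) m
  coefficients-≃ m = poincaré-≃ f p m
  eval-≃0 : ∀ A → evalAtℂ A T₀ ≈ 0ℂ → evalᶜ A T₀ ≃ 0ᶜ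
  eval-≃0 A e = ≃-trans (≡⇒≃ (sym (evalAtℂ-≡ A T₀))) (≃-trans (≈⇒≃ e) (≡⇒≃ (ℚ⇒ℂ-≡ 0ℚ)))
  t≃-1 : re s₀ ≃ʳ -ʳ 1ʳ
  t≃-1 = pole-real-part f p-prime (log-≃ ℓ p exp-ℓ) (exponent n s d)
    (λ ε 0<ε → uniformBound f (exponent n s d) ε (bounds ε (0<ʳ⇒0<ᵣ 0<ε)))
    {A} {B} {T₀} {s₀}
    (λ m → ≃-trans (·ᶜ-cong A (λ k → ≃-sym (coefficients-≃ k)) m) (≃-trans (≡⇒≃ (sym (·-≡ A _ m))) (≃-trans (≈⇒≃ (AP≈B m)) (≡⇒≃ (series-≡ B m)))))
    (eval-≃0 A A≈0)
    (λ e → B≉0 (≃⇒≈ (≃-trans (≡⇒≃ (evalAtℂ-≡ B T₀)) (≃-trans e (≡⇒≃ (sym (ℚ⇒ℂ-≡ 0ℚ)))))))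
    (≃-trans (exp-cong (≃-sym (≡⇒≃ (trans (*-≡ (Defs.-_ s₀) (ℝ⇒ℂ ℓ)) (cong₂ _*ᶜ_ (neg-≡ s₀) (ℝ⇒ℂ-≡ ℓ)))))) (exp-≃ exp-T₀))
    (<ᵣ⇒<ʳ r<t)
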